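{- Let $\rho = \sqrt{\sqrt{2}+1}$. The Generalized Multiway Cut on Trees (GMWCT) problem is solvable in time $O^{*}(\rho^{k})$; that is, there is an algorithm that, given an instance $(T,\{S_1,\ldots,S_r\},k)$ of GMWCT, correctly decides whether it is a yes-instance in time $\rho^{k}\cdot p(N)$, up to a constant factor, where $N$ is the size of the input instance and $p$ is a fixed polynomial.
   Context: Generalized Multiway Cut on Trees (GMWCT). Given: a tree $T$ (a finite connected acyclic undirected graph), a collection of vertex subsets (terminal sets) $S_1,\ldots,S_r\subseteq V(T)$, where the number $r$ of terminal sets is part of the input, and a non-negative integer $k$ (the parameter). Question: is there a set $E'\subseteq E(T)$ with $|E'|\le k$ such that for every $i=1,\ldots,r$ and every pair of distinct vertices $u,v\in S_i$ there is no path between $u$ and $v$ in the graph $T-E'=(V(T),E(T)\setminus E')$? An instance is a yes-instance if the answer is yes. The notation $O^{*}(f(k))$ suppresses any factor polynomial in the input length. -}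

module Defs where

open import Data.Bool.Base using (Bool; true; false)
open import Data.Fin.Base using (Fin; toℕ)
open import Data.Fin.Subset using (Subset; _∈_; ⊤; ∁; ∣_∣)
open import Data.Fin.Subset.Properties using (_∈?_)
import Data.Integer.Base as ℤ
open import Data.List.Base using (List; []; _∷_; foldr; filter; allFin; drop)
open import Data.List.Relation.Unary.All using (All)
open import Data.List.Relation.Unary.Unique.Propositional using (Unique)
open import Data.Nat.Base as ℕ using (ℕ; zero; suc)
open import Data.Nat.Binary.Base using (ℕᵇ; zero; 2[1+_]; 1+[2_]; fromℕ)
open import Data.Product.Base using (Σ; ∃₂; _×_; _,_; proj₁; proj₂)
open import Data.Rational.Base as ℚ using (ℚ; 0ℚ; _/_)
open import Data.Sum.Base using (_⊎_)
open import Data.Vec.Base as Vec using (Vec; []; _∷_; lookup; toList)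
open import Level using (0ℓ)
open import Relation.Binary.PropositionalEquality.Core using (_≡_; _≢_)
open import Relation.Nullary.Negation.Core using (¬_)
open import Relation.Unary using (Pred)
import Relation.Unary as Unary

------------------------------------------------------------------------
-- Non-negative reals

-- A real number x ≥ 0 is represented by its upper Dedekind cut, the set of
-- rationals q with x < q.  The operations below are the exact arithmetic
-- operations on cuts of non-negative reals, the only cuts used.

ℝ⁺ : Set₁
ℝ⁺ = Pred ℚ 0ℓ

infix  4 _≤ʳ_
infixl 6 _+ʳ_
infixl 7 _*ʳ_
infixr 8 _^ʳ_

ℕ→ℝ⁺ : ℕ → ℝ⁺
ℕ→ℝ⁺ n q = (ℤ.+ n / 1) ℚ.< q

_≤ʳ_ : ℝ⁺ → ℝ⁺ → Set
x ≤ʳ y = y Unary.⊆ x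

_+ʳ_ : ℝ⁺ → ℝ⁺ → ℝ⁺
(x +ʳ y) q = ∃₂ λ a b → x a × y b × q ≡ a ℚ.+ b

_*ʳ_ : ℝ⁺ → ℝ⁺ → ℝ⁺
(x *ʳ y) q = ∃₂ λ a b → x a × y b × q ≡ a ℚ.* b

_^ʳ_ : ℝ⁺ → ℕ → ℝ⁺
x ^ʳ zero  = ℕ→ℝ⁺ 1
x ^ʳ suc k = x *ʳ (x ^ʳ k)

√_ : ℝ⁺ → ℝ⁺
(√ x) q = 0ℚ ℚ.< q × x (q ℚ.* q)

ρ : ℝ⁺
ρ = √ (√ (ℕ→ℝ⁺ 2) +ʳ ℕ→ℝ⁺ 1)

-- Polynomials over ℕ as coefficient lists, constant term first.

Polynomial : Set
Polynomial = List ℕ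

⟦_⟧ : Polynomial → ℕ → ℕ
⟦ p ⟧ x = foldr (λ a s → a ℕ.+ x ℕ.* s) 0 p

------------------------------------------------------------------------
-- Model of computation

-- Algorithms are programs of the untyped call-by-value λ-calculus with
-- recursive functions and binary trees (Lisp's nil and cons).  Running time
-- is the number of rule applications in the evaluation.  With environments
-- and trees shared through pointers, each application takes constant time
-- on a RAM (the constant depending on the program only).

data Datum : Set where
  nil  : Datum
  cons : Datum → Datum → Datum

size : Datum → ℕ
size nil        = 1
size (cons a b) = suc (size a ℕ.+ size b)

-- Terms with n free variables, as de Bruijn indices.
data Tm (n : ℕ) : Set where
  var  : Fin n → Tm n
  -- A recursive function: in the body, 0 is the argument, 1 the function.
  fun  : Tm (2 ℕ.+ n) → Tm n
  app  : Tm n → Tm n → Tm n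
  nil  : Tm n
  cons : Tm n → Tm n → Tm n
  -- In the second branch, 0 is the left subtree, 1 the right subtree.
  case : Tm n → Tm n → Tm (2 ℕ.+ n) → Tm n

data Value : Set where
  nil     : Value
  cons    : Value → Value → Value
  closure : ∀ {n} → Vec Value n → Tm (2 ℕ.+ n) → Value

Env : ℕ → Set
Env = Vec Value

⌜_⌝ : Datum → Value
⌜ nil ⌝      = nil
⌜ cons a b ⌝ = cons ⌜ a ⌝ ⌜ b ⌝

infix 4 _⊢_⇓_⟨_⟩

-- γ ⊢ e ⇓ v ⟨ t ⟩ : in environment γ, e evaluates to v in time t.
data _⊢_⇓_⟨_⟩ {n} (γ : Env n) : Tm n → Value → ℕ → Set where
  var  : ∀ x → γ ⊢ var x ⇓ lookup γ x ⟨ 1 ⟩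
  fun  : ∀ e → γ ⊢ fun e ⇓ closure γ e ⟨ 1 ⟩
  app  : ∀ {m f a v w s t u} {δ : Env m} {e : Tm (2 ℕ.+ m)} →
         γ ⊢ f ⇓ closure δ e ⟨ s ⟩ →
         γ ⊢ a ⇓ v ⟨ t ⟩ →
         v ∷ closure δ e ∷ δ ⊢ e ⇓ w ⟨ u ⟩ →
         γ ⊢ app f a ⇓ w ⟨ suc (s ℕ.+ t ℕ.+ u) ⟩
  nil  : γ ⊢ nil ⇓ nil ⟨ 1 ⟩
  cons : ∀ {a b v w s t} →
         γ ⊢ a ⇓ v ⟨ s ⟩ →
         γ ⊢ b ⇓ w ⟨ t ⟩ →
         γ ⊢ cons a b ⇓ cons v w ⟨ suc (s ℕ.+ t) ⟩
  case-nil  : ∀ {a b c w s t} →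
              γ ⊢ a ⇓ nil ⟨ s ⟩ →
              γ ⊢ b ⇓ w ⟨ t ⟩ →
              γ ⊢ case a b c ⇓ w ⟨ suc (s ℕ.+ t) ⟩
  case-cons : ∀ {a b c v v′ w s t} →
              γ ⊢ a ⇓ cons v v′ ⟨ s ⟩ →
              v ∷ v′ ∷ γ ⊢ c ⇓ w ⟨ t ⟩ →
              γ ⊢ case a b c ⇓ w ⟨ suc (s ℕ.+ t) ⟩

-- The input is the value of the only free variable.
Algorithm : Set
Algorithm = Tm 1

encodeBool : Bool → Datum
encodeBool false = nil
encodeBool true  = cons nil nil

_On_Outputs_InTime_ : Algorithm → Datum → Bool → ℕ → Set
A On x Outputs b InTime t = ⌜ x ⌝ ∷ [] ⊢ A ⇓ ⌜ encodeBool b ⌝ ⟨ t ⟩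

------------------------------------------------------------------------
-- Graphs

record Graph : Set where
  field
    #V   : ℕ
    #E   : ℕ
    ends : Vec (Fin #V × Fin #V) #E

  V : Set
  V = Fin #V

  E : Set
  E = Fin #E

  Joins : E → V → V → Set
  Joins e u v = lookup ends e ≡ (u , v) ⊎ lookup ends e ≡ (v , u)

  -- Walks in the spanning subgraph (V , A).
  data Walk (A : Subset #E) : V → V → Set where
    []   : ∀ {u} → Walk A u u
    step : ∀ {u v w} (e : E) → e ∈ A → Joins e u v → Walk A v w → Walk A u w

  edges : ∀ {A u v} → Walk A u v → List E
  edges []             = []
  edges (step e _ _ p) = e ∷ edges p

  vertices : ∀ {A u v} → Walk A u v → List V
  vertices {u = u} []             = u ∷ []
  vertices {u = u} (step _ _ _ p) = u ∷ vertices p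

  Path : Subset #E → V → V → Set
  Path A u v = Σ (Walk A u v) λ p → Unique (vertices p)

  Connected : Set
  Connected = ∀ u v → Path ⊤ u v

  -- Loops and pairs of parallel edges count as cycles, so an acyclic graph
  -- is simple.
  Cycle : Set
  Cycle = Σ V λ v → Σ (Walk ⊤ v v) λ p →
    edges p ≢ [] × Unique (edges p) × Unique (drop 1 (vertices p))

  IsTree : Set
  IsTree = Connected × ¬ Cycle

------------------------------------------------------------------------
-- Generalized Multiway Cut on Trees

record GMWCT : Set where
  field
    graph : Graph
  open Graph graph public
  field
    isTree    : IsTree
    terminals : List (Subset #V)
    k         : ℕ

YesInstance : GMWCT → Set
YesInstance I = Σ (Subset #E) λ E′ → ∣ E′ ∣ ℕ.≤ k ×
  All (λ S → ∀ u v → u ∈ S → v ∈ S → u ≢ v → ¬ Path (∁ E′) u v) terminals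
  where open GMWCT I

-- An instance is presented as the list of vertices, the list of edges, the
-- list of terminal sets (each as the list of its elements) and k, where
-- all numbers are written in binary.

encodeℕᵇ : ℕᵇ → Datum
encodeℕᵇ zero     = nil
encodeℕᵇ 2[1+ x ] = cons nil (encodeℕᵇ x)
encodeℕᵇ 1+[2 x ] = cons (cons nil nil) (encodeℕᵇ x)

encodeℕ : ℕ → Datum
encodeℕ n = encodeℕᵇ (fromℕ n)

encodeFin : ∀ {n} → Fin n → Datum
encodeFin i = encodeℕ (toℕ i)

encodeList : {A : Set} → (A → Datum) → List A → Datum
encodeList f = foldr (λ x → cons (f x)) nil

encodeSubset : ∀ {n} → Subset n → Datum
encodeSubset {n} S = encodeList encodeFin (filter (_∈? S) (allFin n))

encode : GMWCT → Datum
encode I =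
  cons (encodeList encodeFin (allFin #V))
  (cons (encodeList (λ e → cons (encodeFin (proj₁ e)) (encodeFin (proj₂ e)))
                    (toList ends))
  (cons (encodeList encodeSubset terminals)
        (encodeℕ k)))
  where open GMWCT I

{-# OPTIONS --safe #-}
module Submission where

-- Rooting the tree, a vertex stands for the edge to its parent, and two vertices that a terminal
-- set demands to be separated (a request) for the edges above exactly one of the two: the problem
-- is to hit these sets.  A search tree contracts edges, replaces the requests through a fork by
-- requests of its two branches, or branches on lists of edges one of which is contained in some
-- optimal solution.  A step is sound if an exchange argument on at most 40 edges shows it, which
-- the algorithm finds by brute force in polynomial time; and branching on lists of lengths
-- b₁,…,bₛ with Σ ρ^(-bᵢ) ≤ 1 gives O(ρᵏ) leaves, where ρ⁴ = 2ρ² + 1.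
--
-- The point is that some step applies as long as there is a request.  Otherwise, going up the tree,
-- below each edge h there are only leaves, joined by requests to disjoint pairs, paths on four
-- vertices and cycles of length at most five, or members of one kind of gadget: a request that
-- leaves such a structure, longer paths and cycles, and all other ways in which pairs below
-- different children of h are linked admit a branching.  At the root no request is left then.
--
-- The algorithm is written in a small language of list comprehensions, which compiles to the
-- λ-calculus with polynomial bounds on the running time and in which first-order formulas about
-- an instance and bounded lists of its edges can be evaluated.

open import Defs
open import Data.Bool.Base using (Bool; true; false; T; not; _∧_; _∨_; if_then_else_)
open import Data.Bool.Properties using (T?; T-≡; T-∧; T-∨; ∨-assoc; ∨-identityʳ; ∧-zeroʳ; ∧-identityʳ; ∧-comm)
open import Data.Empty using (⊥; ⊥-elim)
open import Data.Fin.Base using (Fin; zero; suc; toℕ)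
open import Data.Fin.Patterns
open import Data.Fin.Properties using (any?; all?; toℕ-injective; suc-injective) renaming (_≟_ to _≟ᶠ_)
open import Data.List.Base using (List; []; _∷_; _++_; length)
import Data.List.Base as List
open import Data.Bool.ListAction using (any; all)
open import Data.List.Membership.Propositional using (_∈_; _∉_; find; lose)
open import Data.List.Membership.Propositional.Properties using (∈-++⁺ˡ; ∈-++⁺ʳ; ∈-++⁻; ∈-map⁺; ∈-map⁻; ∈-allFin; ∈-cartesianProduct⁺; ∈-filter⁺; ∈-filter⁻)
open import Data.List.Properties using (length-++; length-map; ++-identityʳ; map-∘; length-tabulate)
open import Data.List.Relation.Unary.All as All using (All; []; _∷_)
open import Data.List.Relation.Unary.All.Properties as Allₚ using (all⁺; all⁻)
open import Data.List.Relation.Unary.Unique.Propositional using (Unique)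
open import Data.List.Relation.Binary.Subset.Propositional using (_⊆_)
open import Data.List.Relation.Unary.AllPairs using ([]; _∷_)
open import Data.List.Relation.Unary.Any as Any using (Any; here; there)
open import Data.List.Relation.Unary.Any.Properties as Anyₚ using (any⁺; any⁻)
open import Data.Nat.Base using (ℕ; zero; suc; _+_; _*_; _∸_; _⊓_; _/_; _%_; _≤_; _<_; _≡ᵇ_; _≤ᵇ_; _<ᵇ_; z≤n; s≤s)
open import Data.Nat.Properties hiding (suc-injective) renaming (_≟_ to _≟ⁿ_)
open import Data.Product.Base using (Σ; ∃; ∃₂; _×_; _,_; proj₁; proj₂)
open import Data.Sum.Base as Sum using (_⊎_; inj₁; inj₂; [_,_]′)
open import Data.Unit.Base using (⊤; tt)
open import Data.Vec.Base as Vec using (Vec; []; _∷_; lookup)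
open import Function.Base using (_∘_; id; flip)
open import Function.Bundles using (Equivalence; _⇔_; mk⇔)
open import Relation.Binary.PropositionalEquality
 using (_≡_; _≢_; refl; sym; trans; cong; cong₂; subst; module ≡-Reasoning)
open import Relation.Nullary.Decidable
 using (Dec; yes; no; does; _×-dec_; _⊎-dec_; _→-dec_; ¬?; decidable-stable; proof)
open import Relation.Nullary.Negation.Core using (¬_; contradiction)
open import Data.Nat.Solver using (module +-*-Solver)
open +-*-Solver using (solve; _:+_; _:*_; _:=_; con)
open import Relation.Nullary.Reflects using (Reflects; ofʸ; ofⁿ; T-reflects; fromEquivalence; ¬-reflects; _×-reflects_; _⊎-reflects_; _→-reflects_)
open import Data.Nat.Binary.Base as ℕᵇ using (ℕᵇ; 2[1+_]; 1+[2_])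
open import Data.Nat.Binary.Properties using (fromℕ-injective)
open import Data.Maybe.Base using (Maybe; just; nothing; maybe′)
open import Data.Fin.Subset using (Subset; ∣_∣; ∁) renaming (_∈_ to _∈ˢ_; ⊤ to allEdges; ⊥ to noEdges)
open import Data.Fin.Subset.Properties using (∈⊤; ∣⊥∣≡0; x∈∁p⇒x∉p; x∉p⇒x∈∁p; _∈?_)
open import Data.List.Relation.Unary.Unique.Propositional.Properties using (map⁺)
open import Data.Maybe.Properties using (≡-dec; just-injective)
open import Data.Vec.Membership.Propositional.Properties using (∈-toList⁺; ∈-lookup)
open import Data.Vec.Properties using (lookup-map; lookup⇒[]=; []=⇒lookup; lookup∘tabulate)

-- The base comes from the branchings with sets of sizes 2, 2 and 4: ρ solves 2ρ^(-2) + ρ^(-4) = 1,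
-- and every other list in `sizes` leaves slack. What shapes the case analysis is that the obvious
-- branchings are too slow at two kinds of ends. A request between two leaves gives the sizes 1 and
-- 1. One that ends at `a` in a pair `a`, `b` joined only to each other gives 1 and 2 (`a`, or else
-- `b` with something at the other end), and ρ^(-1) + ρ^(-2) > 1. At such ends several requests have
-- to be combined, and gadgets are what remains after that. The exchanges rest on one trade: where
-- too much is chosen below `h`, the vertex `h` itself can be bought with the surplus, and then it
-- hits every request that leaves, so that the elements below can be rearranged. The structure
-- theory is no part of the algorithm, which just tries all steps of a few bounded shapes. It serves
-- to derive from the absence of steps that no request with an edge to hit it is left.

private variable
 n m i j : ℕ

-- Booleans and sizes of finite sets

∧⁻ : ∀ {a b} → T (a ∧ b) → T a × T b
∧⁻ = Equivalence.to T-∧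

∧⁺ : ∀ {a b} → T a × T b → T (a ∧ b)
∧⁺ = Equivalence.from T-∧

∨⁻ : ∀ {a b} → T (a ∨ b) → T a ⊎ T b
∨⁻ = Equivalence.to T-∨

∨⁺ : ∀ {a b} → T a ⊎ T b → T (a ∨ b)
∨⁺ = Equivalence.from T-∨

T⇒≡ : ∀ {b} → T b → b ≡ true
T⇒≡ = Equivalence.to T-≡

≡⇒T : ∀ {b} → b ≡ true → T b
≡⇒T = Equivalence.from T-≡

pattern [_] x = x ∷ []

pattern here₁ p = there (here p)
pattern here₂ p = there (here₁ p)
pattern here₃ p = there (here₂ p)
pattern here₄ p = there (here₃ p)
pattern here₅ p = there (here₄ p)
pattern here₆ p = there (here₅ p)
pattern here₇ p = there (here₆ p)

pattern ∈₀ = here refl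
pattern ∈₁ = here₁ refl
pattern ∈₂ = here₂ refl
pattern ∈₃ = here₃ refl
pattern ∈₄ = here₄ refl
pattern ∈₅ = here₅ refl
pattern ∈₆ = here₆ refl
pattern ∈₇ = here₇ refl

weight : Bool → ℕ
weight true = 1
weight false = 0

count : (Fin n → Bool) → ℕ
count {zero} C = 0
count {suc n} C = weight (C zero) + count (C ∘ suc)

count-cong : {C D : Fin n → Bool} → (∀ e → C e ≡ D e) → count C ≡ count D
count-cong {zero} eq = refl
count-cong {suc n} eq = cong₂ _+_ (cong weight (eq zero)) (count-cong (eq ∘ suc))

count-mono : {C D : Fin n → Bool} → (∀ e → T (C e) → T (D e)) → count C ≤ count D
count-mono {zero} C⊆D = z≤n
count-mono {suc n} {C} {D} C⊆D = +-mono-≤ (weight-mono (C⊆D zero)) (count-mono (C⊆D ∘ suc))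
 where
 weight-mono : ∀ {a b} → (T a → T b) → weight a ≤ weight b
 weight-mono {false} f = z≤n
 weight-mono {true} {true} f = ≤-refl
 weight-mono {true} {false} f = ⊥-elim (f tt)

infixl 8 _[_≔_]
_[_≔_] : (Fin n → Bool) → Fin n → Bool → Fin n → Bool
(C [ x ≔ b ]) e = if does (e ≟ᶠ x) then b else C e

≔-same : (C : Fin n → Bool) (x : Fin n) (b : Bool) → (C [ x ≔ b ]) x ≡ b
≔-same C x b with x ≟ᶠ x
... | yes _ = refl
... | no x≢x = contradiction refl x≢x

≔-other : (C : Fin n → Bool) {x e : Fin n} (b : Bool) → e ≢ x → (C [ x ≔ b ]) e ≡ C e
≔-other C {x} {e} b e≢x with e ≟ᶠ x
... | yes e≡x = contradiction e≡x e≢x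
... | no _ = refl

-- The old value is added on the left and the new one on the right because subtraction in ℕ is
-- truncated.
count-≔ : (C : Fin n → Bool) (x : Fin n) (b : Bool) →
 count (C [ x ≔ b ]) + weight (C x) ≡ count C + weight b
count-≔ {suc n} C zero b = begin
 weight b + count (C ∘ suc) + weight (C zero) ≡⟨ +-comm _ (weight (C zero)) ⟩
 weight (C zero) + (weight b + count (C ∘ suc)) ≡⟨ cong (weight (C zero) +_) (+-comm (weight b) _) ⟩
 weight (C zero) + (count (C ∘ suc) + weight b) ≡⟨ +-assoc (weight (C zero)) _ _ ⟨
 weight (C zero) + count (C ∘ suc) + weight b ∎
 where open ≡-Reasoning
count-≔ {suc n} C (suc x) b = begin
 weight (C zero) + count ((C ∘ suc) [ x ≔ b ]) + weight (C (suc x))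
 ≡⟨ +-assoc (weight (C zero)) _ _ ⟩
 weight (C zero) + (count ((C ∘ suc) [ x ≔ b ]) + weight (C (suc x)))
 ≡⟨ cong (weight (C zero) +_) (count-≔ (C ∘ suc) x b) ⟩
 weight (C zero) + (count (C ∘ suc) + weight b)
 ≡⟨ +-assoc (weight (C zero)) _ _ ⟨
 weight (C zero) + count (C ∘ suc) + weight b ∎
 where open ≡-Reasoning

override : Vec (Fin n) m → Vec Bool m → (Fin n → Bool) → Fin n → Bool
override [] [] C = C
override (x ∷ xs) (b ∷ bs) C = override xs bs C [ x ≔ b ]

weights : Vec Bool m → ℕ
weights [] = 0
weights (b ∷ bs) = weight b + weights bs

override-∉ : (xs : Vec (Fin n) m) (bs : Vec Bool m) (C : Fin n → Bool) {e : Fin n} →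
 (∀ i → e ≢ lookup xs i) → override xs bs C e ≡ C e
override-∉ [] [] C e∉ = refl
override-∉ (x ∷ xs) (b ∷ bs) C e∉ =
 trans (≔-other (override xs bs C) b (e∉ zero)) (override-∉ xs bs C (e∉ ∘ suc))

-- Nested products instead of a quantifier over pairs of positions: for an explicit vector a proof
-- is a tuple of inequalities.
Apart : Fin n → Vec (Fin n) m → Set
Apart x [] = ⊤
Apart x (y ∷ ys) = x ≢ y × Apart x ys

Distinct : Vec (Fin n) m → Set
Distinct [] = ⊤
Distinct (x ∷ xs) = Apart x xs × Distinct xs

apart-lookup : {x : Fin n} (xs : Vec (Fin n) m) → Apart x xs → ∀ i → x ≢ lookup xs i
apart-lookup (y ∷ xs) (p , ps) zero = p
apart-lookup (y ∷ xs) (p , ps) (suc i) = apart-lookup xs ps i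

override-lookup : (xs : Vec (Fin n) m) (bs : Vec Bool m) (C : Fin n → Bool) → Distinct xs →
 ∀ i → override xs bs C (lookup xs i) ≡ lookup bs i
override-lookup (x ∷ xs) (b ∷ bs) C (x∉ , d) zero = ≔-same (override xs bs C) x b
override-lookup (x ∷ xs) (b ∷ bs) C (x∉ , d) (suc i) =
 trans (≔-other (override xs bs C) b (apart-lookup xs x∉ i ∘ sym)) (override-lookup xs bs C d i)

count-override : (xs : Vec (Fin n) m) (bs : Vec Bool m) (C : Fin n → Bool) → Distinct xs →
 count (override xs bs C) + weights (Vec.map C xs) ≡ count C + weights bs
count-override [] [] C d = refl
count-override (x ∷ xs) (b ∷ bs) C (x∉ , d) = begin
 count (D [ x ≔ b ]) + (weight (C x) + weights (Vec.map C xs))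
 ≡⟨ +-assoc (count (D [ x ≔ b ])) _ _ ⟨
 count (D [ x ≔ b ]) + weight (C x) + weights (Vec.map C xs)
 ≡⟨ cong (λ c → count (D [ x ≔ b ]) + weight c + weights (Vec.map C xs)) (override-∉ xs bs C (apart-lookup xs x∉)) ⟨
 count (D [ x ≔ b ]) + weight (D x) + weights (Vec.map C xs)
 ≡⟨ cong (_+ weights (Vec.map C xs)) (count-≔ D x b) ⟩
 count D + weight b + weights (Vec.map C xs)
 ≡⟨ swap-last (count D) (weight b) (weights (Vec.map C xs)) ⟩
 count D + weights (Vec.map C xs) + weight b
 ≡⟨ cong (_+ weight b) (count-override xs bs C d) ⟩
 count C + weights bs + weight b
 ≡⟨ +-assoc (count C) _ _ ⟩
 count C + (weights bs + weight b)
 ≡⟨ cong (count C +_) (+-comm (weights bs) _) ⟩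
 count C + (weight b + weights bs) ∎
 where
 open ≡-Reasoning
 D = override xs bs C
 swap-last : ∀ a b c → a + b + c ≡ a + c + b
 swap-last a b c = trans (+-assoc a b c) (trans (cong (a +_) (+-comm b c)) (sym (+-assoc a c b)))

count-override-≤ : (xs : Vec (Fin n) m) (bs : Vec Bool m) (C : Fin n → Bool) → Distinct xs →
 weights bs ≤ weights (Vec.map C xs) → count (override xs bs C) ≤ count C
count-override-≤ xs bs C d le = +-cancelʳ-≤ (weights (Vec.map C xs)) _ _ (begin
 count (override xs bs C) + weights (Vec.map C xs) ≡⟨ count-override xs bs C d ⟩
 count C + weights bs ≤⟨ +-monoʳ-≤ (count C) le ⟩
 count C + weights (Vec.map C xs) ∎)
 where open ≤-Reasoning

-- Hitting set on the paths of a rooted tree, and exchanges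

-- An instance of hitting set on the paths of a rooted tree.  A vertex e stands
-- also for the edge from e to its parent, and le u e says that e is u or an
-- ancestor of u.  Dead vertices are those whose edge has been contracted.
record Instance (n : ℕ) : Set where
 field
  le : Fin n → Fin n → Bool
  al : Fin n → Bool
  rq : Fin n → Fin n → Bool

 infix 4 _≼_
 _≼_ : Fin n → Fin n → Set
 u ≼ e = T (le u e)

 Alive : Fin n → Set
 Alive e = T (al e)

 Sep : Fin n → Fin n → Fin n → Set
 Sep e u v = Alive e × ((u ≼ e × ¬ v ≼ e) ⊎ (v ≼ e × ¬ u ≼ e))

 Req : Fin n → Fin n → Set
 Req u v = T (rq u v) ⊎ T (rq v u)

 -- In P, S x says that the request, which is one through e, passes x.
 Via : Fin n → ((Fin n → Set) → Set) → Set
 Via e P = ∀ u v → Req u v → Sep e u v → P (λ x → Sep x u v)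

 Hit : (Fin n → Bool) → Fin n → Fin n → Set
 Hit C u v = ∃ λ e → Sep e u v × T (C e)

 sep-sym : ∀ {e u v} → Sep e u v → Sep e v u
 sep-sym (a , inj₁ p) = a , inj₂ p
 sep-sym (a , inj₂ p) = a , inj₁ p

 req-sym : ∀ {u v} → Req u v → Req v u
 req-sym = Sum.swap

 hit-sym : ∀ {C u v} → Hit C u v → Hit C v u
 hit-sym (e , s , c) = e , sep-sym s , c

 sep? : ∀ e u v → Dec (Sep e u v)
 sep? e u v = T? _ ×-dec ((T? _ ×-dec ¬? (T? _)) ⊎-dec (T? _ ×-dec ¬? (T? _)))

 req? : ∀ u v → Dec (Req u v)
 req? u v = T? _ ⊎-dec T? _

record IsRooted {n} (le : Fin n → Fin n → Bool) (root : Fin n) : Set where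
 private
  _≼_ : Fin n → Fin n → Set
  u ≼ e = T (le u e)
 field
  ≼-refl : ∀ u → u ≼ u
  ≼-trans : ∀ {u v w} → u ≼ v → v ≼ w → u ≼ w
  ≼-antisym : ∀ {u v} → u ≼ v → v ≼ u → u ≡ v
  ≼-chain : ∀ {u v w} → u ≼ v → u ≼ w → v ≼ w ⊎ w ≼ v
  ≼-root : ∀ u → u ≼ root

-- The requests that lie in X see of a solution only its trace on X, and an
-- exchange changes a solution on X only, without losing requests.
module Exchange {n} (I : Instance n) where
 open Instance I

 LocalHit : List (Fin n) → (Fin n → Bool) → Set
 LocalHit X C = ∀ u v → Req u v → (∀ e → Sep e u v → e ∈ X) → Hit C u v

 record Exch (X : List (Fin n)) (C Y : Fin n → Bool) : Set where
  constructor exch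
  field
   off : ∀ e → e ∉ X → Y e ≡ C e
   cnt : count Y ≤ count C
   hits : ∀ u v → Req u v → Hit C u v → Hit Y u v

 open Exch public

 exch-refl : ∀ {X C} → Exch X C C
 exch-refl = exch (λ _ _ → refl) ≤-refl (λ _ _ _ h → h)

 exch-trans : ∀ {X X′ C D E} → (X ⊆ X′) → Exch X C D → Exch X′ D E → Exch X′ C E
 exch-trans X⊆X′ p q = exch (λ e e∉ → trans (off q e e∉) (off p e (e∉ ∘ X⊆X′)))
  (≤-trans (cnt q) (cnt p))
  (λ u v r → hits q u v r ∘ hits p u v r)

 exch-mono : ∀ {X X′ C D} → (X ⊆ X′) → Exch X C D → Exch X′ C D
 exch-mono X⊆X′ p = exch (λ e e∉ → off p e (e∉ ∘ X⊆X′)) (cnt p) (hits p)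

 keep : ∀ {X C D e} → Exch X C D → e ∉ X → T (C e) → T (D e)
 keep p e∉ = subst T (sym (off p _ e∉))

 local-exch : ∀ {X Z C D} → Exch Z C D → LocalHit X C → LocalHit X D
 local-exch p l u v r S⊆X = hits p u v r (l u v r S⊆X)

 local-mono : ∀ {X X′ C} → (X ⊆ X′) → LocalHit X′ C → LocalHit X C
 local-mono X⊆X′ l u v r S⊆X = l u v r (λ e s → X⊆X′ (S⊆X e s))

-- Exchange arguments decided by evaluation

-- A pattern is a finite abstraction of some elements xs of an instance, given
-- by requests that are known to be hit and, for every element, a list of
-- kernels one of which is contained in each request through that element.
-- check runs through all traces on xs of a solution and looks for a move
-- (elements to remove and elements to add) that leads to one of the goals
-- (elements to be contained and elements to be avoided).
allTraces : (m : ℕ) → (Vec Bool m → Bool) → Bool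
allTraces zero p = p []
allTraces (suc m) p = allTraces m (p ∘ (true ∷_)) ∧ allTraces m (p ∘ (false ∷_))

allTraces-sound : (p : Vec Bool m → Bool) → T (allTraces m p) → ∀ A → T (p A)
allTraces-sound p t [] = t
allTraces-sound p t (true ∷ A) =
 allTraces-sound (p ∘ (true ∷_)) (proj₁ (∧⁻ t)) A
allTraces-sound p t (false ∷ A) =
 allTraces-sound (p ∘ (false ∷_))
 (proj₂ (∧⁻ {allTraces _ (p ∘ (true ∷_))} t)) A

T-not⁻ : ∀ {b} → T (not b) → ¬ T b
T-not⁻ {false} _ ()

T-not⁺ : ∀ {b} → ¬ T b → T (not b)
T-not⁺ {false} _ = tt
T-not⁺ {true} f = f tt

put : Bool → List (Fin m) → Vec Bool m → Vec Bool m
put b [] A = A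
put b (i ∷ is) A = put b is (A Vec.[ i ]≔ b)

record Pattern (m : ℕ) : Set where
 constructor pattern′
 field
  musts : List (List (Fin m))
  kernels : Vec (List (List (Fin m))) m
  moves : List (List (Fin m) × List (Fin m))
  goals : List (List (Fin m) × List (Fin m))

 meets : Vec Bool m → List (Fin m) → Bool
 meets A = any (lookup A)

 reaches : Vec Bool m → List (Fin m) × List (Fin m) → Bool
 reaches A (pos , neg) = all (lookup A) pos ∧ all (not ∘ lookup A) neg

 -- Losing an element is harmless if the new trace meets all kernels of the element, because each
 -- request through it contains one of them whole.
 safe : ∀ {l} → Vec Bool l → Vec Bool l → Vec (List (List (Fin m))) l → Vec Bool m → Bool
 safe [] [] [] Y = true
 safe (a ∷ A) (b ∷ B) (K ∷ Ks) Y = (not a ∨ b ∨ all (meets Y) K) ∧ safe A B Ks Y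

 good : Vec Bool m → Vec Bool m → Bool
 good A Y = (weights Y ≤ᵇ weights A) ∧ safe A Y kernels Y ∧ any (reaches Y) goals

 apply : Vec Bool m → List (Fin m) × List (Fin m) → Vec Bool m
 apply A (rem , add) = put true add (put false rem A)

 check : Bool
 check = allTraces m λ A → not (all (meets A) musts) ∨
  (good A A ∨ any (λ mv → good A (apply A mv)) moves)

record Checked (m : ℕ) : Set where
 constructor checked
 field
  pattern-of : Pattern m
  ok : T (Pattern.check pattern-of)
 open Pattern pattern-of public using (musts; kernels)

module PatternMatch {n} (I : Instance n) where
 open Instance I
 open Exchange I

 Kernels : ∀ {m l} → Vec (Fin n) m → Vec (Fin n) l → Vec (List (List (Fin m))) l → Set
 Kernels ys [] [] = ⊤
 Kernels ys (x ∷ xs) (K ∷ Ks) =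
  (∀ u v → Req u v → Sep x u v → Any (All (λ j → Sep (lookup ys j) u v)) K) × Kernels ys xs Ks

 Reached : ∀ {m} → Vec (Fin n) m → (Fin n → Bool) → List (Fin m) × List (Fin m) → Set
 Reached xs Y (pos , neg) =
  All (λ i → T (Y (lookup xs i))) pos × All (λ i → ¬ T (Y (lookup xs i))) neg

 Match : ∀ {m} → Pattern m → Set
 Match {m} P = let open Pattern P in
  (xs : Vec (Fin n) m) → Distinct xs → Kernels xs xs kernels →
  (C : Fin n → Bool) → All (Any (λ i → T (C (lookup xs i)))) musts →
  ∃ λ Y → Exch (Vec.toList xs) C Y × Any (Reached xs Y) goals

 private
  match′ : ∀ {m} (P : Checked m) → Match (Checked.pattern-of P)
  match′ {m} (checked P ok) xs d ks C mu = Y , ex , goal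
   where
   open Pattern P
   A = Vec.map C xs

   lookup-A : ∀ i → lookup A i ≡ C (lookup xs i)
   lookup-A i = lookup-map i C xs

   musts-ok : T (all (meets A) musts)
   musts-ok = all⁻ _ (All.map (λ a → any⁺ (lookup A)
    (Any.map (λ {i} → subst T (sym (lookup-A i))) a)) mu)

   found : T (good A A ∨ any (λ mv → good A (apply A mv)) moves)
   found with ∨⁻ {not (all (meets A) musts)} (allTraces-sound _ ok A)
   ... | inj₁ q = ⊥-elim (T-not⁻ q musts-ok)
   ... | inj₂ q = q

   target : ∃ λ B → T (good A B)
   target with ∨⁻ {good A A} found
   ... | inj₁ q = A , q
   ... | inj₂ q with Any.satisfied (any⁻ (λ mv → good A (apply A mv)) moves q)
   ... | mv , t = apply A mv , t

   B = proj₁ target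
   Y = override xs B C

   parts = ∧⁻ {weights B ≤ᵇ weights A} (proj₂ target)
   parts′ = ∧⁻ {safe A B kernels B} (proj₂ parts)

   lookup-Y : ∀ i → Y (lookup xs i) ≡ lookup B i
   lookup-Y = override-lookup xs B C d

   hit-kernel : ∀ {u v} → (K : List (List (Fin m))) → T (all (meets B) K) →
    Any (All (λ j → Sep (lookup xs j) u v)) K → Hit Y u v
   hit-kernel (J ∷ K) t (here s) = go J s (any⁻ (lookup B) J (proj₁ (∧⁻ {meets B J} t)))
    where
    go : ∀ {u v} J → All (λ j → Sep (lookup xs j) u v) J → Any (T ∘ lookup B) J → Hit Y u v
    go (j ∷ J) (s ∷ _) (here b) = lookup xs j , s , subst T (sym (lookup-Y j)) b
    go (j ∷ J) (_ ∷ ss) (there b) = go J ss b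
   hit-kernel (J ∷ K) t (there s) = hit-kernel K (proj₂ (∧⁻ {meets B J} t)) s

   safe-hit : ∀ {l} (zs : Vec (Fin n) l) (D E : Vec Bool l) (Ks : Vec (List (List (Fin m))) l) →
    T (safe D E Ks B) → Kernels xs zs Ks →
    ∀ i u v → Req u v → Sep (lookup zs i) u v → T (lookup D i) → T (lookup E i) ⊎ Hit Y u v
   safe-hit (z ∷ zs) (a ∷ D) (b ∷ E) (K ∷ Ks) t (k , _) zero u v r s a′
    with ∨⁻ {not a} (proj₁ (∧⁻ {not a ∨ b ∨ all (meets B) K} t))
   ... | inj₁ na = ⊥-elim (T-not⁻ na a′)
   ... | inj₂ q with ∨⁻ {b} q
   ... | inj₁ b′ = inj₁ b′
   ... | inj₂ c = inj₂ (hit-kernel K c (k u v r s))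
   safe-hit (z ∷ zs) (a ∷ D) (b ∷ E) (K ∷ Ks) t (_ , k) (suc i) u v r s a′ =
    safe-hit zs D E Ks (proj₂ (∧⁻ {not a ∨ b ∨ all (meets B) K} t)) k i u v r s a′

   preserve : ∀ u v → Req u v → Hit C u v → Hit Y u v
   preserve u v r (e , s , c) with any? (λ i → e ≟ᶠ lookup xs i)
   ... | no e∉ = e , s , subst T (sym (override-∉ xs B C λ i p → e∉ (i , p))) c
   ... | yes (i , refl) with safe-hit xs A B kernels (proj₁ parts′) ks i u v r s
    (subst T (sym (lookup-A i)) c)
   ... | inj₁ b = e , s , subst T (sym (lookup-Y i)) b
   ... | inj₂ h = h

   ex : Exch (Vec.toList xs) C Y
   ex = exch (λ e e∉ → override-∉ xs B C λ { i refl → e∉ (∈-toList⁺ (∈-lookup i xs)) })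
    (count-override-≤ xs B C d (≤ᵇ⇒≤ (weights B) (weights A) (proj₁ parts)))
    preserve

   reached : ∀ g → T (reaches B g) → Reached xs Y g
   reached (pos , neg) t =
    All.map (λ {i} → subst T (sym (lookup-Y i))) (all⁺ (lookup B) pos (proj₁ q)) ,
    All.map (λ {i} nb y → T-not⁻ nb (subst T (lookup-Y i) y)) (all⁺ (not ∘ lookup B) neg (proj₂ q))
    where q = ∧⁻ {all (lookup B) pos} t

   goal : Any (Reached xs Y) goals
   goal = Any.map (λ {g} → reached g) (any⁻ (reaches B) goals (proj₂ parts′))

 -- Abstract because with-abstraction over its applications would unfold it.
 abstract
  match : ∀ {m} (P : Checked m) → Match (Checked.pattern-of P)
  match = match′

-- The steps of the search tree

-- The sizes of the sets of a branching; each list b₁,…,bₛ satisfies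
-- Σ ρ^(-bᵢ) ≤ 1.
sizes : List (List ℕ)
sizes = [ 1 ] ∷ (1 ∷ [ 3 ]) ∷ (3 ∷ [ 1 ]) ∷ (2 ∷ [ 2 ]) ∷ (2 ∷ 3 ∷ [ 3 ]) ∷
 (3 ∷ 3 ∷ [ 3 ]) ∷ (2 ∷ 2 ∷ [ 4 ]) ∷ [ 1 ∷ 4 ∷ [ 4 ] ]

window : ℕ
window = 40

module Rules {n} (I : Instance n) (root : Fin n) where
 open Instance I
 open Exchange I

 Valid : List (Fin n) → List (List (Fin n)) → Set
 Valid X Bs = ∀ C → LocalHit X C → ∃ λ Y → Exch X C Y × Any (All (T ∘ Y)) Bs

 record Branching : Set where
  field
   X : List (Fin n)
   Bs : List (List (Fin n))
   size-∈ : List.map length Bs ∈ sizes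
   unique : All Unique Bs
   small : length X ≤ window
   valid : Valid X Bs

 Pair : Fin n → Fin n → Set
 Pair a b = ∃₂ λ u v → Req u v × (∀ e → Sep e u v → e ≡ a ⊎ e ≡ b)

 -- If f is in a solution then a may be put there in place of its partner b.
 Good : Fin n → Fin n → Fin n → Set
 Good f g a = a ≢ f × ∃ λ b → b ≢ a × b ≢ f × Pair a b ×
  (Via b λ S → S a ⊎ (S f × S g))

 -- The plan is to trade `f` for `g`. A request through `f` that avoids `g` has to be hit elsewhere
 -- first, namely by an `a` bought with its partner `b`. A request that loses `b` passes `a`, or
 -- else both `f` and `g`, and so it survives the trade as well.
 record Deletable (f g : Fin n) : Set where
  field
   alive : Alive f
   ≢root : f ≢ root
   ≢g : f ≢ g
   replaced : Via f λ S → S g ⊎ ∃ λ a → S a × Good f g a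

 record Splittable (f a b : Fin n) : Set where
  field
   alive-f : Alive f
   ≢root : f ≢ root
   alive-a : Alive a
   alive-b : Alive b
   a≼f : a ≼ f
   b≼f : b ≼ f
   a≢f : a ≢ f
   b≢f : b ≢ f
   a⋠b : ¬ a ≼ b
   b⋠a : ¬ b ≼ a
   only : ∀ e → Alive e → e ≼ f → e ≡ f ⊎ e ≡ a ⊎ e ≡ b
   pair : Pair a b
   via-a : Via a λ S → S b ⊎ S f
   via-b : Via b λ S → S a ⊎ S f

 data Step : Set where
  delete : ∀ f g → Deletable f g → Step
  split : ∀ f a b → Splittable f a b → Step
  branch : Branching → Step

-- Branching on a request that leaves a subtree

-- Branchings on a request with one end below h: Zero holds the sets that make
-- the end harmless whatever the rest, Neg those sets that come with a
-- solution hitting the request outside of h only.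
module Sides {n} (I : Instance n) {root : Fin n} (tree : IsRooted (Instance.le I) root) where
 open Instance I
 open Exchange I
 open Rules I root
 open IsRooted tree

 Missed : (Fin n → Bool) → Fin n → Fin n → Set
 Missed Y h u = ∀ e → Alive e → u ≼ e → e ≼ h → ¬ T (Y e)

 record Closed (h u : Fin n) : Set where
  field
   X : List (Fin n)
   small : length X ≤ 13
   below : All (_≼ h) X
   covers : ∀ e → Alive e → u ≼ e → e ≼ h → e ∈ X
   Zero Neg : List (List (Fin n))
   size-∈ : List.map length Zero ++ List.map suc (List.map length Neg) ∈ sizes
   unique₀ : All Unique Zero
   unique₋ : All Unique Neg
   below₀ : All (All (_≼ h)) Zero
   below₋ : All (All (_≼ h)) Neg
   h∉ : All (All (h ≢_)) Neg
   valid : ∀ C → LocalHit X C → ∃ λ Y → Exch X C Y ×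
    (Any (All (T ∘ Y)) Zero ⊎ (Any (All (T ∘ Y)) Neg × Missed Y h u))

 -- After an exchange the part of the request below `h` is hit by `y` or not at all, so `y` can
 -- stand for this whole part. The last clause is for the root: there `h` may be added to a solution
 -- for free, and it brings `y` along.
 record Commit (h u : Fin n) : Set where
  field
   X : List (Fin n)
   small : length X ≤ 12
   below : All (_≼ h) X
   covers : ∀ e → Alive e → u ≼ e → e ≼ h → e ∈ X
   y : Fin n
   y≼h : y ≼ h
   valid : ∀ C → LocalHit X C → ∃ λ Y → Exch X C Y ×
    (T (Y y) ⊎ Missed Y h u) × (T (C h) → T (Y h) × T (Y y))

 Incomparable : Fin n → Fin n → Set
 Incomparable h k = ¬ h ≼ k × ¬ k ≼ h

 no-common : ∀ {e h k} → Incomparable h k → e ≼ h → ¬ e ≼ k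
 no-common (p , q) e≼h e≼k with ≼-chain e≼h e≼k
 ... | inj₁ h≼k = p h≼k
 ... | inj₂ k≼h = q k≼h

 private
  sizes-∷ : ∀ (z : Fin n) Neg → List.map length (List.map (z ∷_) Neg) ≡ List.map suc (List.map length Neg)
  sizes-∷ z [] = refl
  sizes-∷ z (B ∷ Neg) = cong (_ ∷_) (sizes-∷ z Neg)

  sizes-++ : ∀ (Zero Neg : List (List (Fin n))) z →
   List.map length (Zero ++ List.map (z ∷_) Neg) ≡
   List.map length Zero ++ List.map suc (List.map length Neg)
  sizes-++ [] Neg z = sizes-∷ z Neg
  sizes-++ (B ∷ Zero) Neg z = cong (_ ∷_) (sizes-++ Zero Neg z)

 missed-hit : ∀ {Y h u v} → ¬ v ≼ h → Missed Y h u → ∀ e → Sep e u v → e ≼ h → ¬ T (Y e)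
 missed-hit v⋠h m e (a , inj₁ (u≼e , _)) e≼h = m e a u≼e e≼h
 missed-hit v⋠h m e (a , inj₂ (v≼e , _)) e≼h = ⊥-elim (v⋠h (≼-trans v≼e e≼h))

 covers-sep : ∀ {X : List (Fin n)} {h u v} → (∀ e → Alive e → u ≼ e → e ≼ h → e ∈ X) → ¬ v ≼ h →
  ∀ e → Sep e u v → e ≼ h → e ∈ X
 covers-sep c v⋠h e (a , inj₁ (u≼e , _)) e≼h = c e a u≼e e≼h
 covers-sep c v⋠h e (a , inj₂ (v≼e , _)) e≼h = ⊥-elim (v⋠h (≼-trans v≼e e≼h))

 -- If the part below `h` is missed then the request is hit below `k`, hence by `y`: each set of
 -- `Neg` grows by `y`, which accounts for the `suc` in `size-∈`. The exchanges on the two sides do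
 -- not interfere, as nothing lies below both `h` and `k`.
 closed-commit : ∀ {u v h k} → Req u v → ¬ v ≼ h → ¬ u ≼ k → Incomparable h k →
  (∀ e → Sep e u v → e ≼ h ⊎ e ≼ k) → Closed h u → Commit k v → Step
 closed-commit {u} {v} {h} {k} r v⋠h u⋠k inc sides c d = branch record
  { X = c.X ++ d.X
  ; Bs = c.Zero ++ List.map (d.y ∷_) c.Neg
  ; size-∈ = subst (_∈ sizes) (sym (sizes-++ c.Zero c.Neg d.y)) c.size-∈
  ; unique = Allₚ.++⁺ c.unique₀ (Allₚ.map⁺ (All.zipWith (λ (p , q) → p ∷ q) (y∉ , c.unique₋)))
  ; small = ≤-trans (≤-reflexive (length-++ c.X)) (≤-trans (+-mono-≤ c.small d.small) (≤ᵇ⇒≤ 25 window tt))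
  ; valid = valid
  }
  where
  module c = Closed c
  module d = Commit d
  y∉ : All (All (d.y ≢_)) c.Neg
  y∉ = All.map (All.map λ { e≼h refl → no-common inc e≼h d.y≼h }) c.below₋

  valid : Valid (c.X ++ d.X) (c.Zero ++ List.map (d.y ∷_) c.Neg)
  valid C loc with c.valid C (local-mono ∈-++⁺ˡ loc)
  ... | Y₁ , x₁ , r₁ with d.valid Y₁ (local-mono (∈-++⁺ʳ c.X) (local-exch x₁ loc))
  ... | Y₂ , x₂ , r₂ , _ = Y₂ , x , result r₁ r₂
   where
   x : Exch (c.X ++ d.X) C Y₂
   x = exch-trans ∈-++⁺ˡ x₁ (exch-mono (∈-++⁺ʳ c.X) x₂)

   same : ∀ {e} → e ≼ h → Y₂ e ≡ Y₁ e
   same e≼h = off x₂ _ λ e∈ → no-common inc e≼h (All.lookup d.below e∈)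

   stay : ∀ {Bs : List (List (Fin n))} → All (All (_≼ h)) Bs → Any (All (T ∘ Y₁)) Bs → Any (All (T ∘ Y₂)) Bs
   stay (b ∷ _) (here p) = here (All.zipWith (λ (e≼h , y) → subst T (sym (same e≼h)) y) (b , p))
   stay (_ ∷ bs) (there p) = there (stay bs p)

   hit : Hit Y₂ u v
   hit = hits x u v r (loc u v r λ e s → case-side e s (sides e s))
    where
    case-side : ∀ e → Sep e u v → e ≼ h ⊎ e ≼ k → e ∈ c.X ++ d.X
    case-side e s (inj₁ e≼h) = ∈-++⁺ˡ (covers-sep c.covers v⋠h e s e≼h)
    case-side e s (inj₂ e≼k) = ∈-++⁺ʳ c.X (covers-sep d.covers u⋠k e (sep-sym s) e≼k)

   result : Any (All (T ∘ Y₁)) c.Zero ⊎ (Any (All (T ∘ Y₁)) c.Neg × Missed Y₁ h u) →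
    T (Y₂ d.y) ⊎ Missed Y₂ k v → Any (All (T ∘ Y₂)) (c.Zero ++ List.map (d.y ∷_) c.Neg)
   result (inj₁ z) _ = Anyₚ.++⁺ˡ (stay c.below₀ z)
   result (inj₂ (z , m)) (inj₁ y) = Anyₚ.++⁺ʳ c.Zero (Anyₚ.map⁺ (Any.map (y ∷_) (stay c.below₋ z)))
   result (inj₂ (z , m)) (inj₂ m′) with hit
   ... | e , s , y with sides e s
   ... | inj₁ e≼h = ⊥-elim (missed-hit v⋠h m e s e≼h (subst T (same e≼h) y))
   ... | inj₂ e≼k = ⊥-elim (missed-hit u⋠k m′ e (sep-sym s) e≼k y)

 -- There is no part outside of `h` where the request could be hit, so `y` is forced.
 commit-alone : ∀ {u v h} → Req u v → ¬ v ≼ h → (∀ e → Sep e u v → e ≼ h) → Commit h u → Step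
 commit-alone {u} {v} {h} r v⋠h sides d = branch record
  { X = d.X
  ; Bs = [ d.y ] ∷ []
  ; size-∈ = ∈₀
  ; unique = [ [] ∷ [] ]
  ; small = ≤-trans d.small (≤ᵇ⇒≤ 12 window tt)
  ; valid = valid
  }
  where
  module d = Commit d
  valid : Valid d.X ([ d.y ] ∷ [])
  valid C loc with d.valid C loc
  ... | Y , x , inj₁ y , _ = Y , x , here [ y ]
  ... | Y , x , inj₂ m , _ with hits x u v r (loc u v r λ e s → covers-sep d.covers v⋠h e s (sides e s))
  ... | e , s , y = ⊥-elim (missed-hit v⋠h m e s (sides e s) y)

 -- Nothing passes root, so it may be added to a solution for free.
 commit-root : ∀ {u} → (d : Commit root u) → Commit.y d ≢ root → Step
 commit-root {u} d y≢root = branch record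
  { X = d.X ; Bs = [ d.y ] ∷ [] ; size-∈ = ∈₀ ; unique = [ [] ∷ [] ]
  ; small = ≤-trans d.small (≤ᵇ⇒≤ 12 window tt) ; valid = valid }
  where
  module d = Commit d
  no-root : ∀ {u v} → ¬ Sep root u v
  no-root {u} {v} (_ , inj₁ (_ , n)) = n (≼-root v)
  no-root {u} {v} (_ , inj₂ (_ , n)) = n (≼-root u)

  valid : Valid d.X ([ d.y ] ∷ [])
  valid C loc with T? (C root) | d.valid (C [ root ≔ true ]) loc⁺
   where
   loc⁺ : LocalHit d.X (C [ root ≔ true ])
   loc⁺ u v r S⊆X with loc u v r S⊆X
   ... | e , s , c = e , s , subst T (sym (≔-other C true λ { refl → no-root s })) c
  ... | yes c | Y , x , _ , f = Y , exch (λ e e∉ → trans (off x e e∉) (same e))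
   (≤-trans (cnt x) (≤-reflexive (count-cong same)))
   (λ u v r h → hits x u v r (let (e , s , q) = h in e , s , subst T (sym (same e)) q)) ,
   here (proj₂ (f (subst T (sym (≔-same C root true)) tt)) ∷ [])
   where
   same : ∀ e → (C [ root ≔ true ]) e ≡ C e
   same e with e ≟ᶠ root
   ... | no _ = refl
   ... | yes refl = sym (T⇒≡ c)
  ... | no ¬c | Y , x , _ , f = Y [ root ≔ false ] , exch off′ cnt′ hits′ ,
   here (subst T (sym (≔-other Y false y≢root)) (proj₂ yes-root) ∷ [])
   where
   yes-root = f (subst T (sym (≔-same C root true)) tt)
   ⊥ᵇ : ∀ {b} → ¬ T b → b ≡ false
   ⊥ᵇ {false} _ = refl
   ⊥ᵇ {true} n = ⊥-elim (n tt)
   off′ : ∀ e → e ∉ d.X → (Y [ root ≔ false ]) e ≡ C e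
   off′ e e∉ with e ≟ᶠ root
   ... | yes refl = sym (⊥ᵇ ¬c)
   ... | no e≢ = trans (off x e e∉) (≔-other C true e≢)
   cnt′ : count (Y [ root ≔ false ]) ≤ count C
   cnt′ = +-cancelʳ-≤ 1 _ _ (begin
    count (Y [ root ≔ false ]) + 1
    ≡⟨ cong (λ b → count (Y [ root ≔ false ]) + weight b) (T⇒≡ (proj₁ yes-root)) ⟨
    count (Y [ root ≔ false ]) + weight (Y root) ≡⟨ count-≔ Y root false ⟩
    count Y + 0 ≡⟨ +-identityʳ _ ⟩
    count Y ≤⟨ cnt x ⟩
    count (C [ root ≔ true ]) ≡⟨ +-identityʳ _ ⟨
    count (C [ root ≔ true ]) + 0
    ≡⟨ cong (λ b → count (C [ root ≔ true ]) + weight b) (⊥ᵇ ¬c) ⟨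
    count (C [ root ≔ true ]) + weight (C root) ≡⟨ count-≔ C root true ⟩
    count C + 1 ∎)
    where open ≤-Reasoning
   hits′ : ∀ u v → Req u v → Hit C u v → Hit (Y [ root ≔ false ]) u v
   hits′ u v r (e , s , c) with hits x u v r (e , s , subst T (sym (≔-other C true λ { refl → no-root s })) c)
   ... | e′ , s′ , y = e′ , s′ , subst T (sym (≔-other Y false λ { refl → no-root s′ })) y

-- Tables of exchanges

-- A list of elements is written as a hexadecimal numeral, whose digit d stands
-- for the element of index d − 1; 0 is the empty list.
digits : ∀ {m} → ℕ → List (Fin (suc m))
-- This is fuel for twelve digits; the longest numeral below has ten.
digits = read 12 []
 where
 index : ∀ {m} → ℕ → Fin (suc m)
 index {zero} _ = zero
 index {suc m} zero = zero
 index {suc m} (suc k) = suc (index k)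
 read : ∀ {m} → ℕ → List (Fin (suc m)) → ℕ → List (Fin (suc m))
 read zero l n = l
 read (suc fuel) l zero = l
 read (suc fuel) l (suc n) = read fuel (index (suc n % 16 ∸ 1) ∷ l) (suc n / 16)

table : ∀ {m} → List ℕ → Vec (List ℕ) (suc m) → List (ℕ × ℕ) → List (ℕ × ℕ) → Pattern (suc m)
table musts kernels moves goals = pattern′ (List.map digits musts) (Vec.map (List.map digits) kernels)
 (List.map (λ (a , b) → digits a , digits b) moves) (List.map (λ (a , b) → digits a , digits b) goals)

-- The kernel list of an element that must not be removed.
fixed : List ℕ
fixed = [ 0 ]

-- The leaf 1 is the middle of a path with the ends 2 and 3, and 4 is the vertex `h` above them. If
-- both ends are chosen they are traded for the middle and `h`, which takes over the requests that
-- leave.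
p3ᵖ : Checked 4
p3ᵖ = checked (table (0x12 ∷ [ 0x13 ])
 (fixed ∷ (1 ∷ [ 4 ]) ∷ (1 ∷ [ 4 ]) ∷ [ fixed ])
 [ (0x23 , 0x14) ] [ (1 , 0) ]) tt

-- The path is 1, ..., 5, and 6 is `h`. If 4 is not chosen then 3 and 5 are. If it is, then 2 is
-- chosen too unless 1 and 3 are, and these give way to 2 and 6.
p5ᵖ : Checked 6
p5ᵖ = checked (table (0x12 ∷ 0x23 ∷ 0x34 ∷ [ 0x45 ])
 ((2 ∷ [ 6 ]) ∷ fixed ∷ (2 ∷ 4 ∷ [ 6 ]) ∷ fixed ∷ fixed ∷ [ fixed ])
 [ (0x13 , 0x26) ] ((0x24 , 0) ∷ [ (0x35 , 0) ])) tt

-- The argument of `p5ᵖ` for the path 2, ..., 6, in the presence of a chosen neighbour 1 of 2, which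
-- covers the request between 1 and 2.
c6ᵖ : Checked 7
c6ᵖ = checked (table (1 ∷ 0x23 ∷ 0x34 ∷ 0x45 ∷ [ 0x56 ])
 (fixed ∷ (1 ∷ 3 ∷ [ 7 ]) ∷ fixed ∷ (3 ∷ 5 ∷ [ 7 ]) ∷ fixed ∷ fixed ∷ [ fixed ])
 [ (0x24 , 0x37) ] ((0x135 , 0) ∷ [ (0x146 , 0) ])) tt

-- In the tables named `pull` the element 1 is a chosen `h`. It hits every request that leaves, so
-- below it only the pairs matter, and the chosen elements can be rearranged until they include the
-- wanted one.
pull-isoᵖ : Checked 3
pull-isoᵖ = checked (table (1 ∷ [ 0x23 ])
 (fixed ∷ fixed ∷ [ 2 ∷ [ 1 ] ])
 [ (3 , 2) ] [ (0x12 , 0) ]) tt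

pull-endᵖ : Checked 5
pull-endᵖ = checked (table (1 ∷ 0x23 ∷ 0x34 ∷ [ 0x45 ])
 (fixed ∷ fixed ∷ (2 ∷ 4 ∷ [ 1 ]) ∷ fixed ∷ [ 4 ∷ [ 1 ] ])
 ((3 , 2) ∷ [ (0x35 , 0x24) ]) [ (0x12 , 0) ]) tt

pull-innerᵖ : Checked 5
pull-innerᵖ = checked (table (1 ∷ 0x23 ∷ 0x34 ∷ [ 0x45 ])
 (fixed ∷ (3 ∷ [ 1 ]) ∷ fixed ∷ fixed ∷ [ fixed ])
 [ (2 , 3) ] [ (0x13 , 0) ]) tt

pull-inner′ᵖ : Checked 5
pull-inner′ᵖ = checked (table (1 ∷ 0x23 ∷ 0x34 ∷ [ 0x45 ])
 (fixed ∷ fixed ∷ fixed ∷ fixed ∷ [ 4 ∷ [ 1 ] ])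
 [ (5 , 4) ] [ (0x14 , 0) ]) tt

pull-triᵖ : Checked 4
pull-triᵖ = checked (table (1 ∷ 0x23 ∷ 0x24 ∷ [ 0x34 ])
 (fixed ∷ fixed ∷ (2 ∷ 4 ∷ [ 1 ]) ∷ [ fixed ])
 [ (3 , 2) ] [ (0x12 , 0) ]) tt

pull-sqᵖ : Checked 5
pull-sqᵖ = checked (table (1 ∷ 0x23 ∷ 0x24 ∷ 0x35 ∷ [ 0x45 ])
 (fixed ∷ fixed ∷ (2 ∷ 5 ∷ [ 1 ]) ∷ (2 ∷ 5 ∷ [ 1 ]) ∷ [ fixed ])
 ((3 , 2) ∷ [ (0x34 , 0x25) ]) [ (0x12 , 0) ]) tt

pull-pentᵖ : Checked 6
pull-pentᵖ = checked (table (1 ∷ 0x23 ∷ 0x24 ∷ 0x35 ∷ 0x46 ∷ [ 0x56 ])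
 (fixed ∷ fixed ∷ (2 ∷ 5 ∷ [ 1 ]) ∷ (2 ∷ 6 ∷ [ 1 ]) ∷ fixed ∷ [ fixed ])
 ((3 , 2) ∷ [ (4 , 2) ]) [ (0x12 , 0) ]) tt

-- Again 1 is a chosen `h`. In the tables named `avoid` an element with two neighbours is given up
-- so that both neighbours are chosen; these become the two elements of a `Reserve`.
avoid-innerᵖ : Checked 5
avoid-innerᵖ = checked (table (1 ∷ 0x23 ∷ 0x34 ∷ [ 0x45 ])
 (fixed ∷ fixed ∷ (2 ∷ 4 ∷ [ 1 ]) ∷ fixed ∷ [ 4 ∷ [ 1 ] ])
 ((3 , 2) ∷ (3 , 4) ∷ [ (0x35 , 0x24) ]) [ (0x124 , 0) ]) tt

avoid-triᵖ : Checked 4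
avoid-triᵖ = checked (table (1 ∷ 0x23 ∷ 0x24 ∷ [ 0x34 ])
 (fixed ∷ (3 ∷ 4 ∷ [ 1 ]) ∷ fixed ∷ [ fixed ])
 ((2 , 3) ∷ [ (2 , 4) ]) [ (0x134 , 0) ]) tt

avoid-sqᵖ : Checked 5
avoid-sqᵖ = checked (table (1 ∷ 0x23 ∷ 0x24 ∷ 0x35 ∷ [ 0x45 ])
 (fixed ∷ (3 ∷ 4 ∷ [ 1 ]) ∷ fixed ∷ fixed ∷ [ 3 ∷ 4 ∷ [ 1 ] ])
 ((2 , 3) ∷ (2 , 4) ∷ [ (0x25 , 0x34) ]) [ (0x134 , 0) ]) tt

avoid-pentᵖ : Checked 6
avoid-pentᵖ = checked (table (1 ∷ 0x23 ∷ 0x24 ∷ 0x35 ∷ 0x46 ∷ [ 0x56 ])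
 (fixed ∷ (3 ∷ 4 ∷ [ 1 ]) ∷ fixed ∷ fixed ∷ (3 ∷ 6 ∷ [ 1 ]) ∷ [ fixed ])
 ((2 , 3) ∷ (2 , 4) ∷ [ (0x25 , 0x34) ]) [ (0x134 , 0) ]) tt

two-pairsᵖ : Checked 5
two-pairsᵖ = checked (table (1 ∷ 0x23 ∷ [ 0x45 ])
 (fixed ∷ fixed ∷ (2 ∷ [ 1 ]) ∷ fixed ∷ [ 4 ∷ [ 1 ] ])
 ((3 , 2) ∷ (5 , 4) ∷ [ (0x35 , 0x24) ]) [ (0x124 , 0) ]) tt

end-fullᵖ : Checked 5
end-fullᵖ = checked (table (2 ∷ 3 ∷ [ 5 ])
 (fixed ∷ fixed ∷ (2 ∷ 4 ∷ [ 1 ]) ∷ fixed ∷ [ 4 ∷ [ 1 ] ])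
 [ (0x35 , 0x41) ] [ (4 , 0) ]) tt

-- The numbering is `h`, `f`, `a`, `b`, `c`, `d`, `x`, `y`, and the kernels are the fields `via-f`
-- to `via-y` of `Gadget`.
gadget-kernels : Vec (List ℕ) 8
gadget-kernels = fixed ∷ (0x37 ∷ 0x48 ∷ [ 1 ]) ∷ (4 ∷ 0x27 ∷ [ 0x21 ]) ∷ (3 ∷ 0x28 ∷ [ 0x21 ]) ∷ (6 ∷ [ 0x21 ]) ∷ (5 ∷ [ 0x21 ]) ∷ (0x23 ∷ [ 1 ]) ∷ [ 0x24 ∷ [ 1 ] ]

gadget-musts : List ℕ
gadget-musts = 0x34 ∷ 0x56 ∷ 0x327 ∷ [ 0x428 ]

gadget-pull-cᵖ : Checked 8
gadget-pull-cᵖ = checked (table (1 ∷ gadget-musts) gadget-kernels [ (0x2345678 , 0x475) ] [ (0x15 , 0) ]) tt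

gadget-pull-xᵖ : Checked 8
gadget-pull-xᵖ = checked (table (1 ∷ gadget-musts) gadget-kernels [ (0x2345678 , 0x475) ] [ (0x17 , 0) ]) tt

gadget-pull-aᵖ : Checked 8
gadget-pull-aᵖ = checked (table (1 ∷ gadget-musts) gadget-kernels [ (0x2345678 , 0x385) ] [ (0x13 , 0) ]) tt

gadget-pull-fᵖ : Checked 8
gadget-pull-fᵖ = checked (table (1 ∷ gadget-musts) gadget-kernels [ (0x2345678 , 0x235) ] [ (0x12 , 0) ]) tt

gadget-pull-bcᵖ : Checked 8
gadget-pull-bcᵖ = checked (table (1 ∷ gadget-musts) gadget-kernels [ (0x2345678 , 0x475) ] [ (0x145 , 0) ]) tt

-- The trace on the gadget is replaced altogether: by `b` and `x`, `a` and `y`, `f` and `a`, or `f`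
-- and `b`, in each case with one of `c` and `d`, and with or without `h`.
gadget-moves : List (ℕ × ℕ)
gadget-moves = List.map (0x2345678 ,_) (0x475 ∷ 0x4751 ∷ 0x476 ∷ 0x4761 ∷ 0x385 ∷ 0x3851 ∷ 0x386 ∷ 0x3861 ∷ 0x235 ∷ 0x2351 ∷ 0x236 ∷ 0x2361 ∷ 0x245 ∷ 0x2451 ∷ 0x246 ∷ [ 0x2461 ])

gadget-cᵖ : Checked 8
gadget-cᵖ = checked (table gadget-musts gadget-kernels gadget-moves ((5 , 0) ∷ (0x647 , 0x521) ∷ [ (0x638 , 0x521) ])) tt

gadget-xᵖ : Checked 8
gadget-xᵖ = checked (table gadget-musts gadget-kernels gadget-moves ((0x47 , 0) ∷ (0x38 , 0) ∷ [ (0x235 , 0x71) ])) tt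

gadget-fᵖ : Checked 8
gadget-fᵖ = checked (table gadget-musts gadget-kernels gadget-moves ((0x235 , 0) ∷ (0x47 , 0x21) ∷ [ (0x38 , 0x21) ])) tt

gadget-aᵖ : Checked 8
gadget-aᵖ = checked (table gadget-musts gadget-kernels gadget-moves ((3 , 0) ∷ [ (0x47 , 0x321) ])) tt

tri-twinᵖ : Checked 3
tri-twinᵖ = checked (table [ 0x23 ]
 (fixed ∷ fixed ∷ [ 2 ∷ [ 1 ] ])
 [ (3 , 1) ] ((1 , 0) ∷ (3 , 0x21) ∷ [ (2 , 0x31) ])) tt

-- The elements are `f`, `a`, `b`, `c`, `d`, `x`, `g`. With `f` and `x` chosen, `f` is traded for
-- `g`, `a` for `b` and `d` for `c`; then `x`, `b`, `c` and `g` cover every request through `f`.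
f8ᵖ : Checked 7
f8ᵖ = checked (table (1 ∷ 6 ∷ 0x23 ∷ [ 0x45 ])
 ((6 ∷ 3 ∷ 4 ∷ [ 7 ]) ∷ (3 ∷ 0x16 ∷ [ 0x17 ]) ∷ fixed ∷ fixed ∷ (4 ∷ [ 0x17 ]) ∷ fixed ∷ [ fixed ])
 ((0x12 , 0x37) ∷ [ (0x125 , 0x347) ]) [ (0x36 , 0) ]) tt

f4ᵖ : Checked 6
f4ᵖ = checked (table (1 ∷ 3 ∷ 4 ∷ [ 5 ])
 (fixed ∷ fixed ∷ (2 ∷ 5 ∷ [ 6 ]) ∷ (1 ∷ 2 ∷ [ 6 ]) ∷ fixed ∷ [ fixed ])
 [ (0x34 , 0x26) ] [ (0x125 , 0) ]) tt

-- The elements are `g`, `f`, `a`, `b`, `c`, `d`, `k`, `x`, `z`, `y`, `w`. Pairs and links form a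
-- cycle `a b y w d c z x` of eight ends. The four pairs need four elements; a fifth one pays for
-- `g` together with every other end of the cycle. With four elements exactly, neither `f` nor `k`
-- is chosen, and the trace alternates along the cycle.
c8ᵖ : Checked 11
c8ᵖ = checked (table (0x34 ∷ 0x56 ∷ 0x89 ∷ 0xAB ∷ 0x3278 ∷ 0x427A ∷ 0x5279 ∷ [ 0x627B ])
 (fixed ∷ (0x38 ∷ 0x4A ∷ 0x59 ∷ 0x6B ∷ [ 1 ]) ∷ (4 ∷ 8 ∷ [ 1 ]) ∷ (3 ∷ 0xA ∷ [ 1 ]) ∷ (6 ∷ 9 ∷ [ 1 ]) ∷ (5 ∷ 0xB ∷ [ 1 ]) ∷ (0x38 ∷ 0x4A ∷ 0x59 ∷ 0x6B ∷ [ 1 ]) ∷ (9 ∷ 3 ∷ [ 1 ]) ∷ (8 ∷ 5 ∷ [ 1 ]) ∷ (0xB ∷ 4 ∷ [ 1 ]) ∷ [ 0xA ∷ 6 ∷ [ 1 ] ])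
 [ (0x23456789AB , 0x396A1) ] ((0x39 , 0) ∷ [ (0x85 , 0) ])) tt

-- Requests among the leaves below one vertex

module Stars {n} (I : Instance n) {root : Fin n} (tree : IsRooted (Instance.le I) root)
 (stuck : ¬ Rules.Step I root) where
 open Instance I
 open Exchange I
 open PatternMatch I
 open Rules I root
 open Sides I tree
 open IsRooted tree

 fire : {A : Set} → Step → A
 fire s = ⊥-elim (stuck s)

 record Direct (h a : Fin n) : Set where
  field
   alive : Alive a
   a≼h : a ≼ h
   a≢h : a ≢ h
   next : ∀ e → Alive e → a ≼ e → e ≼ h → e ≡ a ⊎ e ≡ h

 Leaf : Fin n → Set
 Leaf a = ∀ e → Alive e → e ≼ a → e ≡ a

 Joined : Fin n → Fin n → Fin n → Fin n → Set
 Joined a b u v = (∀ e → Sep e u v → e ≡ a ⊎ e ≡ b) × Sep a u v × Sep b u v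

 Edge : Fin n → Fin n → Set
 Edge a b = a ≢ b × ∃₂ λ u v → Req u v × Joined a b u v

 edge-sym : ∀ {a b} → Edge a b → Edge b a
 edge-sym (a≢b , u , v , r , only , sa , sb) = a≢b ∘ sym , u , v , r , (λ e s → Sum.swap (only e s)) , sb , sa

 edge-pair : ∀ {a b} → Edge a b → Pair a b
 edge-pair (_ , u , v , r , only , _) = u , v , r , only

 edge? : ∀ a b → Dec (Edge a b)
 edge? a b = ¬? (a ≟ᶠ b) ×-dec any? λ u → any? λ v → req? u v ×-dec
  (all? (λ e → sep? e u v →-dec ((e ≟ᶠ a) ⊎-dec (e ≟ᶠ b))) ×-dec sep? a u v ×-dec sep? b u v)

 edge-hit : ∀ {X C a b} → Edge a b → a ∈ X → b ∈ X → LocalHit X C → T (C a) ⊎ T (C b)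
 edge-hit {X} (_ , u , v , r , only , _) a∈ b∈ loc
  with loc u v r (λ e s → [ (λ { refl → a∈ }) , (λ { refl → b∈ }) ]′ (only e s))
 ... | e , s , c with only e s
 ... | inj₁ refl = inj₁ c
 ... | inj₂ refl = inj₂ c

 -- The empty kernel is contained in every request and met by no set: nothing has to be known about
 -- the element, and the exchange has to keep it.
 K₀ : ∀ {m} (xs : Vec (Fin n) m) {e} u v → Req u v → Sep e u v →
  Any (All (λ j → Sep (lookup xs j) u v)) ([] ∷ [])
 K₀ xs u v r s = here []

 must : ∀ {m} (xs : Vec (Fin n) m) (C : Fin n → Bool) {i j} → T (C (lookup xs i)) ⊎ T (C (lookup xs j)) →
  Any (λ i → T (C (lookup xs i))) (i ∷ [ j ])
 must xs C (inj₁ p) = here p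
 must xs C (inj₂ p) = here₁ p

 -- The elements strictly below h when nothing below h is left to do: leaves
 -- directly below h that are joined by requests in pairs (the plain ones), or
 -- members of gadgets.
 record Gadget (h : Fin n) : Set where
  field
   f a b c d x y : Fin n
   distinct : Distinct (f ∷ a ∷ b ∷ c ∷ d ∷ x ∷ y ∷ [ h ])
   direct-f : Direct h f
   direct-x : Direct h x
   direct-y : Direct h y
   leaf-x : Leaf x
   leaf-y : Leaf y
   direct-a : Direct f a
   direct-b : Direct f b
   direct-c : Direct f c
   direct-d : Direct f d
   leaf-a : Leaf a
   leaf-b : Leaf b
   leaf-c : Leaf c
   leaf-d : Leaf d
   below-f : ∀ e → Alive e → e ≼ f → e ∈ f ∷ a ∷ b ∷ c ∷ [ d ]
   pair-ab : Pair a b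
   pair-cd : Pair c d
   path-ax : ∃₂ λ u v → Req u v × (∀ e → Sep e u v → e ∈ a ∷ f ∷ [ x ])
   path-by : ∃₂ λ u v → Req u v × (∀ e → Sep e u v → e ∈ b ∷ f ∷ [ y ])
   via-f : Via f λ S → (S a × S x) ⊎ (S b × S y) ⊎ S h
   via-a : Via a λ S → S b ⊎ (S f × S x) ⊎ (S f × S h)
   via-b : Via b λ S → S a ⊎ (S f × S y) ⊎ (S f × S h)
   via-c : Via c λ S → S d ⊎ (S f × S h)
   via-d : Via d λ S → S c ⊎ (S f × S h)
   via-x : Via x λ S → (S f × S a) ⊎ S h
   via-y : Via y λ S → (S f × S b) ⊎ S h

  members : List (Fin n)
  members = f ∷ a ∷ b ∷ c ∷ d ∷ x ∷ [ y ]

 record Resolved (h : Fin n) : Set₁ where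
  field
   Plain : Fin n → Set
   direct : ∀ {a} → Plain a → Direct h a
   leaf : ∀ {a} → Plain a → Leaf a
   kernel : ∀ {a} → Plain a → ∀ u v → Req u v → Sep a u v →
    (∃ λ b → Plain b × a ≢ b × Joined a b u v) ⊎ Sep h u v
   classify : ∀ e → Alive e → e ≼ h → e ≢ h → Plain e ⊎ Σ (Gadget h) λ G → e ∈ Gadget.members G

 module Star (h : Fin n) (alive-h : Alive h) (Q : Resolved h) where
  open Resolved Q

  Nb : Fin n → Fin n → Set
  Nb a b = Edge a b × b ≢ h

  nb? : ∀ a b → Dec (Nb a b)
  nb? a b = edge? a b ×-dec ¬? (b ≟ᶠ h)

  ≢h : ∀ {a} → Plain a → a ≢ h
  ≢h p = Direct.a≢h (direct p)

  nb-plain : ∀ {a b} → Plain a → Nb a b → Plain b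
  nb-plain {a} {b} p ((a≢b , u , v , r , only , sa , sb) , b≢h) with kernel p u v r sa
  ... | inj₂ sh with only h sh
  ... | inj₁ h≡a = contradiction (sym h≡a) (≢h p)
  ... | inj₂ h≡b = contradiction (sym h≡b) b≢h
  nb-plain {a} {b} p ((a≢b , u , v , r , only , sa , sb) , b≢h)
   | inj₁ (b′ , pb′ , a≢b′ , _ , _ , sb′) with only b′ sb′
  ... | inj₁ b′≡a = contradiction (sym b′≡a) a≢b′
  ... | inj₂ refl = pb′

  nb-sym : ∀ {a b} → Plain a → Nb a b → Nb b a
  nb-sym p (e , _) = edge-sym e , ≢h p

  nb-≢ : ∀ {a b} → Nb a b → a ≢ b
  nb-≢ ((a≢b , _) , _) = a≢b

  record Deg1 (a b : Fin n) : Set where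
   field
    plain : Plain a
    nb : Nb a b
    only : ∀ z → Nb a z → z ≡ b

  record Deg2 (a b c : Fin n) : Set where
   field
    plain : Plain a
    nb₁ : Nb a b
    nb₂ : Nb a c
    b≢c : b ≢ c
    only : ∀ z → Nb a z → z ≡ b ⊎ z ≡ c

  deg2-swap : ∀ {a b c} → Deg2 a b c → Deg2 a c b
  deg2-swap D = record { plain = plain; nb₁ = nb₂; nb₂ = nb₁; b≢c = b≢c ∘ sym; only = λ z m → Sum.swap (only z m) }
   where open Deg2 D

  via : ∀ {a} → Plain a → Via a λ S → (∃ λ b → Nb a b × S b) ⊎ S h
  via p u v r s with kernel p u v r s
  ... | inj₂ sh = inj₂ sh
  ... | inj₁ (b , pb , a≢b , j@(_ , _ , sb)) = inj₁ (b , ((a≢b , u , v , r , j) , ≢h pb) , sb)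

  via₁ : ∀ {a b} → Deg1 a b → Via a λ S → S b ⊎ S h
  via₁ D u v r s with via (Deg1.plain D) u v r s
  ... | inj₂ sh = inj₂ sh
  ... | inj₁ (z , m , sz) with Deg1.only D z m
  ... | refl = inj₁ sz

  via₂ : ∀ {a b c} → Deg2 a b c → Via a λ S → S b ⊎ S c ⊎ S h
  via₂ D u v r s with via (Deg2.plain D) u v r s
  ... | inj₂ sh = inj₂ (inj₂ sh)
  ... | inj₁ (z , m , sz) with Deg2.only D z m
  ... | inj₁ refl = inj₁ sz
  ... | inj₂ refl = inj₂ (inj₁ sz)

  K₁ : ∀ {m} (xs : Vec (Fin n) m) {a b i j} → Deg1 a b → lookup xs i ≡ b → lookup xs j ≡ h →
   ∀ u v → Req u v → Sep a u v →
   Any (All (λ j → Sep (lookup xs j) u v)) ([ i ] ∷ [ j ] ∷ [])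
  K₁ xs D refl refl u v r s with via₁ D u v r s
  ... | inj₁ sb = here [ sb ]
  ... | inj₂ sh = here₁ [ sh ]

  K₂ : ∀ {m} (xs : Vec (Fin n) m) {a b c i j k} → Deg2 a b c →
   lookup xs i ≡ b → lookup xs j ≡ c → lookup xs k ≡ h →
   ∀ u v → Req u v → Sep a u v →
   Any (All (λ j → Sep (lookup xs j) u v)) ([ i ] ∷ [ j ] ∷ [ k ] ∷ [])
  K₂ xs D refl refl refl u v r s with via₂ D u v r s
  ... | inj₁ sb = here [ sb ]
  ... | inj₂ (inj₁ sc) = here₁ [ sc ]
  ... | inj₂ (inj₂ sh) = here₂ [ sh ]

  hit-nb : ∀ {X C a b} → Nb a b → a ∈ X → b ∈ X → LocalHit X C → T (C a) ⊎ T (C b)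
  hit-nb (e , _) = edge-hit e

  ≺root : ∀ {a} → Plain a → a ≢ root
  ≺root p refl = ≢h p (≼-antisym (Direct.a≼h (direct p)) (≼-root h))

  -- A leaf without neighbours can be traded for `h`, so it is deletable. A solution without a leaf
  -- that has three neighbours contains these, which gives a branching of sizes 1 and 3.
  degree′ : ∀ {a} → Plain a → ∃ (Deg1 a) ⊎ ∃₂ (Deg2 a)
  degree′ {a} p with any? (nb? a)
  ... | no none = fire (delete a h record
   { alive = Direct.alive (direct p) ; ≢root = ≺root p ; ≢g = ≢h p ; replaced = replaced })
   where
   replaced : ∀ u v → Req u v → Sep a u v → Sep h u v ⊎ _
   replaced u v r s with via p u v r s
   ... | inj₁ (b , m , _) = ⊥-elim (none (b , m))
   ... | inj₂ sh = inj₁ sh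
  ... | yes (b , mb) with any? (λ c → nb? a c ×-dec ¬? (c ≟ᶠ b))
  ... | no none = inj₁ (b , record { plain = p ; nb = mb ; only = λ z m → decidable-stable (z ≟ᶠ b) λ z≢b → none (z , m , z≢b) })
  ... | yes (c , mc , c≢b) with any? (λ d → nb? a d ×-dec (¬? (d ≟ᶠ b) ×-dec ¬? (d ≟ᶠ c)))
  ... | no none = inj₂ (b , c , record { plain = p ; nb₁ = mb ; nb₂ = mc ; b≢c = c≢b ∘ sym ; only = only })
   where
   only : ∀ z → Nb a z → z ≡ b ⊎ z ≡ c
   only z m with z ≟ᶠ b | z ≟ᶠ c
   ... | yes q | _ = inj₁ q
   ... | no _ | yes q = inj₂ q
   ... | no q | no q′ = ⊥-elim (none (z , m , q , q′))
  ... | yes (d , md , d≢b , d≢c) = fire (branch record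
   { X = X ; Bs = [ a ] ∷ [ b ∷ c ∷ [ d ] ] ; size-∈ = ∈₁
   ; unique = ([] ∷ []) ∷ [ (c≢b ∘ sym ∷ d≢b ∘ sym ∷ []) ∷ (d≢c ∘ sym ∷ []) ∷ [] ∷ [] ]
   ; small = ≤ᵇ⇒≤ 4 window tt ; valid = valid })
   where
   X = a ∷ b ∷ c ∷ [ d ]
   valid : Valid X ([ a ] ∷ [ b ∷ c ∷ [ d ] ])
   valid C loc with hit-nb mb ∈₀ ∈₁ loc | hit-nb mc ∈₀ ∈₂ loc | hit-nb md ∈₀ ∈₃ loc
   ... | inj₁ q | _ | _ = C , exch-refl , here [ q ]
   ... | inj₂ _ | inj₁ q | _ = C , exch-refl , here [ q ]
   ... | inj₂ _ | inj₂ _ | inj₁ q = C , exch-refl , here [ q ]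
   ... | inj₂ q | inj₂ q′ | inj₂ q″ = C , exch-refl , here₁ (q ∷ q′ ∷ [ q″ ])

  abstract
   degree : ∀ {a} → Plain a → ∃ (Deg1 a) ⊎ ∃₂ (Deg2 a)
   degree = degree′

  p3 : ∀ {a b c} → Deg1 a b → Deg2 b a c → Deg1 c b → Step
  p3 {a} {b} {c} A B C′ = branch record
   { X = X ; Bs = [ b ] ∷ [] ; size-∈ = ∈₀ ; unique = [ [] ∷ [] ]
   ; small = ≤ᵇ⇒≤ 4 window tt ; valid = valid }
   where
   X = b ∷ a ∷ c ∷ [ h ]
   xs = b ∷ a ∷ c ∷ [ h ]
   valid : Valid X ([ b ] ∷ [])
   valid C loc with match p3ᵖ xs
    ((nb-≢ (Deg2.nb₁ B) , nb-≢ (Deg2.nb₂ B) , ≢h (Deg2.plain B) , tt) ,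
    (Deg2.b≢c B , ≢h (Deg1.plain A) , tt) , (≢h (Deg1.plain C′) , tt) , tt , tt)
    (K₀ xs , K₁ xs A refl refl , K₁ xs C′ refl refl , K₀ xs , tt) C
    (must xs C (hit-nb (Deg2.nb₁ B) ∈₀ ∈₁ loc) ∷ must xs C (hit-nb (Deg2.nb₂ B) ∈₀ ∈₂ loc) ∷ [])
   ... | Y , x , here ([ q ] , _) = Y , x , here [ q ]

  -- Nothing is said about further neighbours of `d` and `e`, so that longer paths are covered as
  -- well.
  p5 : ∀ {a b c d e} → Deg1 a b → Deg2 b a c → Deg2 c b d → Nb d e → a ≢ d → a ≢ e → b ≢ e → c ≢ e → Step
  p5 {a} {b} {c} {d} {e} A B C′ m a≢d a≢e b≢e c≢e = branch record
   { X = X ; Bs = Bs ; size-∈ = ∈₃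
   ; unique = ([ b≢d ] ∷ [] ∷ []) ∷ [ [ c≢e ] ∷ [] ∷ [] ]
   ; small = ≤ᵇ⇒≤ 6 window tt ; valid = valid }
   where
   X = a ∷ b ∷ c ∷ d ∷ e ∷ [ h ]
   Bs = (b ∷ [ d ]) ∷ [ c ∷ [ e ] ]
   b≢d : b ≢ d
   b≢d = Deg2.b≢c C′
   pd = nb-plain (Deg2.plain C′) (Deg2.nb₂ C′)
   xs = a ∷ b ∷ c ∷ d ∷ e ∷ [ h ]
   valid : Valid X Bs
   valid C loc with match p5ᵖ xs
    ((nb-≢ (Deg1.nb A) , Deg2.b≢c B , a≢d , a≢e , ≢h (Deg1.plain A) , tt) ,
    (nb-≢ (Deg2.nb₂ B) , b≢d , b≢e , ≢h (Deg2.plain B) , tt) ,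
    (nb-≢ (Deg2.nb₂ C′) , c≢e , ≢h (Deg2.plain C′) , tt) ,
    (nb-≢ m , ≢h pd , tt) , (proj₂ m , tt) , tt , tt)
    (K₁ xs A refl refl , K₀ xs , K₂ xs C′ refl refl refl , K₀ xs , K₀ xs , K₀ xs , tt) C
    (must xs C (hit-nb (Deg1.nb A) ∈₀ ∈₁ loc) ∷ must xs C (hit-nb (Deg2.nb₂ B) ∈₁ ∈₂ loc) ∷
    must xs C (hit-nb (Deg2.nb₂ C′) ∈₂ ∈₃ loc) ∷ must xs C (hit-nb m ∈₃ ∈₄ loc) ∷ [])
   ... | Y , x , here (q ∷ [ r ] , _) = Y , x , here (q ∷ [ r ])
   ... | Y , x , here₁ (q ∷ [ r ] , _) = Y , x , here₁ (q ∷ [ r ])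

  -- A solution without `a` contains its neighbours `z` and `b`; `c6ᵖ` treats the others. As `z` may
  -- coincide with `f`, this includes the cycle of length six.
  c6 : ∀ {z a b c d e f} → Deg2 a z b → Deg2 b a c → Deg2 c b d → Deg2 d c e → Nb e f →
   a ≢ d → a ≢ e → a ≢ f → b ≢ e → b ≢ f → c ≢ f → d ≢ f → Step
  c6 {z} {a} {b} {c} {d} {e} {f} A B C′ D m a≢d a≢e a≢f b≢e b≢f c≢f d≢f = branch record
   { X = X ; Bs = Bs ; size-∈ = ∈₄
   ; unique = ((Deg2.b≢c A ∷ []) ∷ [] ∷ []) ∷
   ((a≢c ∷ [ a≢e ]) ∷ [ c≢e ] ∷ [] ∷ []) ∷
   ((a≢d ∷ [ a≢f ]) ∷ [ d≢f ] ∷ [] ∷ []) ∷ []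
   ; small = ≤ᵇ⇒≤ 8 window tt ; valid = valid }
   where
   X = a ∷ b ∷ c ∷ d ∷ e ∷ f ∷ h ∷ [ z ]
   Bs = (z ∷ [ b ]) ∷ (a ∷ c ∷ [ e ]) ∷ [ a ∷ d ∷ [ f ] ]
   a≢c = Deg2.b≢c B
   b≢d = Deg2.b≢c C′
   c≢e = Deg2.b≢c D
   pe = nb-plain (Deg2.plain D) (Deg2.nb₂ D)
   xs = a ∷ b ∷ c ∷ d ∷ e ∷ f ∷ [ h ]
   valid : Valid X Bs
   valid C loc with T? (C a)
   ... | no ¬q with hit-nb (Deg2.nb₁ A) ∈₀ ∈₇ loc | hit-nb (Deg2.nb₂ A) ∈₀ ∈₁ loc
   ... | inj₁ q | _ = contradiction q ¬q
   ... | inj₂ _ | inj₁ q = contradiction q ¬q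
   ... | inj₂ q | inj₂ r = C , exch-refl , here (q ∷ [ r ])
   valid C loc | yes qa with match c6ᵖ xs
    ((nb-≢ (Deg2.nb₂ A) , a≢c , a≢d , a≢e , a≢f , ≢h (Deg2.plain A) , tt) ,
    (nb-≢ (Deg2.nb₂ B) , b≢d , b≢e , b≢f , ≢h (Deg2.plain B) , tt) ,
    (nb-≢ (Deg2.nb₂ C′) , c≢e , c≢f , ≢h (Deg2.plain C′) , tt) ,
    (nb-≢ (Deg2.nb₂ D) , d≢f , ≢h (Deg2.plain D) , tt) ,
    (nb-≢ m , ≢h pe , tt) , (proj₂ m , tt) , tt , tt)
    (K₀ xs , K₂ xs B refl refl refl , K₀ xs , K₂ xs D refl refl refl ,
    K₀ xs , K₀ xs , K₀ xs , tt) C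
    (here qa ∷ must xs C (hit-nb (Deg2.nb₂ B) ∈₁ ∈₂ loc) ∷ must xs C (hit-nb (Deg2.nb₂ C′) ∈₂ ∈₃ loc) ∷
    must xs C (hit-nb (Deg2.nb₂ D) ∈₃ ∈₄ loc) ∷ must xs C (hit-nb m ∈₄ ∈₅ loc) ∷ [])
   ... | Y , x , here (q ∷ r ∷ [ s ] , _) =
    Y , exch-mono there-last x , here₁ (q ∷ r ∷ [ s ])
    where
    there-last : ∀ {g} → g ∈ a ∷ b ∷ c ∷ d ∷ e ∷ f ∷ [ h ] → g ∈ X
    there-last = ∈-++⁺ˡ
   ... | Y , x , here₁ (q ∷ r ∷ [ s ] , _) =
    Y , exch-mono there-last x , here₂ (q ∷ r ∷ [ s ])
    where
    there-last : ∀ {g} → g ∈ a ∷ b ∷ c ∷ d ∷ e ∷ f ∷ [ h ] → g ∈ X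
    there-last = ∈-++⁺ˡ

  data Shape (a : Fin n) : Set where
   iso : ∀ {b} → Deg1 a b → Deg1 b a → Shape a
   end : ∀ {b c d} → Deg1 a b → Deg2 b a c → Deg2 c b d → Deg1 d c → Shape a
   inner : ∀ {b c d} → Deg2 a b c → Deg1 b a → Deg2 c a d → Deg1 d c → Shape a
   tri : ∀ {b c} → Deg2 a b c → Deg2 b a c → Deg2 c a b → Shape a
   sq : ∀ {b c d} → Deg2 a b c → Deg2 b a d → Deg2 c a d → Deg2 d b c → Shape a
   pent : ∀ {b c d e} → Deg2 a b c → Deg2 b a d → Deg2 c a e → Deg2 d b e → Deg2 e c d → Shape a

  degree₁ : ∀ {a b c} → Plain a → Nb a b → Nb a c → b ≢ c → Deg2 a b c
  degree₁ p mb mc b≢c with degree p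
  ... | inj₁ (z , D) = contradiction (trans (Deg1.only D _ mb) (sym (Deg1.only D _ mc))) b≢c
  ... | inj₂ (y , z , D) with Deg2.only D _ mb | Deg2.only D _ mc
  ... | inj₁ refl | inj₁ refl = contradiction refl b≢c
  ... | inj₁ refl | inj₂ refl = D
  ... | inj₂ refl | inj₁ refl = deg2-swap D
  ... | inj₂ refl | inj₂ refl = contradiction refl b≢c

  degree₂ : ∀ {a b} → Plain a → Nb a b → Deg1 a b ⊎ ∃ (Deg2 a b)
  degree₂ p m with degree p
  ... | inj₁ (z , D) with Deg1.only D _ m
  ... | refl = inj₁ D
  degree₂ p m | inj₂ (y , z , D) with Deg2.only D _ m
  ... | inj₁ refl = inj₂ (z , D)
  ... | inj₂ refl = inj₂ (y , deg2-swap D)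

  -- A path that starts with an end of degree one has neither three vertices, by `p3`, nor more than
  -- four, by `p5`.
  path₄′ : ∀ {a b c} → Deg1 a b → Deg2 b a c → ∃ λ d → Deg2 c b d × Deg1 d c
  path₄′ {a} {b} {c} A B with degree₂ (nb-plain (Deg2.plain B) (Deg2.nb₂ B)) (nb-sym (Deg2.plain B) (Deg2.nb₂ B))
  ... | inj₁ C′ = fire (p3 A B C′)
  ... | inj₂ (d , C′) with degree₂ (nb-plain (Deg2.plain C′) (Deg2.nb₂ C′)) (nb-sym (Deg2.plain C′) (Deg2.nb₂ C′))
  ... | inj₁ D = d , C′ , D
  ... | inj₂ (e , D) = fire (p5 A B C′ (Deg2.nb₂ D) a≢d a≢e b≢e (Deg2.b≢c D))
   where
   a≢d : a ≢ d
   a≢d refl = nb-≢ (Deg2.nb₂ B) (sym (Deg1.only A c (nb-sym (Deg2.plain C′) (Deg2.nb₂ C′))))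
   pd = Deg2.plain D
   a≢e : a ≢ e
   a≢e refl with Deg1.only A d (nb-sym pd (Deg2.nb₂ D))
   ... | q = Deg2.b≢c C′ (sym q)
   b≢e : b ≢ e
   b≢e refl with Deg2.only B d (nb-sym pd (Deg2.nb₂ D))
   ... | inj₁ q = a≢d (sym q)
   ... | inj₂ q = nb-≢ (Deg2.nb₂ C′) (sym q)

  abstract
   path₄ : ∀ {a b c} → Deg1 a b → Deg2 b a c → ∃ λ d → Deg2 c b d × Deg1 d c
   path₄ = path₄′

  shape′ : ∀ {a} → Plain a → Shape a
  shape′ {a} p with degree p
  ... | inj₁ (b , A) with degree₂ (nb-plain p (Deg1.nb A)) (nb-sym p (Deg1.nb A))
  ... | inj₁ B = iso A B
  ... | inj₂ (c , B) with path₄ A B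
  ... | d , C′ , D = end A B C′ D
  shape′ {a} p | inj₂ (b , c , A)
   with degree₂ (nb-plain p (Deg2.nb₁ A)) (nb-sym p (Deg2.nb₁ A))
   | degree₂ (nb-plain p (Deg2.nb₂ A)) (nb-sym p (Deg2.nb₂ A))
  ... | inj₁ B | _ with path₄ B A
  ... | d , C′ , D = inner A B C′ D
  shape′ {a} p | inj₂ (b , c , A) | inj₂ _ | inj₁ C′ with path₄ C′ (deg2-swap A)
  ... | d , B , D = inner (deg2-swap A) C′ B D
  shape′ {a} p | inj₂ (b , c , A) | inj₂ (d , B) | inj₂ (e , C′) with d ≟ᶠ c
  ... | yes refl with Deg2.only C′ b (nb-sym (Deg2.plain B) (Deg2.nb₂ B))
  ... | inj₁ b≡a = contradiction (sym b≡a) (nb-≢ (Deg2.nb₁ A))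
  ... | inj₂ refl = tri A B C′
  shape′ {a} p | inj₂ (b , c , A) | inj₂ (d , B) | inj₂ (e , C′) | no d≢c with d ≟ᶠ e
  ... | yes refl = sq A B C′ (degree₁ pd (nb-sym (Deg2.plain B) (Deg2.nb₂ B)) (nb-sym (Deg2.plain C′) (Deg2.nb₂ C′)) (Deg2.b≢c A))
   where pd = nb-plain (Deg2.plain B) (Deg2.nb₂ B)
  ... | no d≢e with nb? d e
  ... | yes m = pent A B C′ (degree₁ pd (nb-sym (Deg2.plain B) (Deg2.nb₂ B)) m b≢e)
   (degree₁ pe (nb-sym (Deg2.plain C′) (Deg2.nb₂ C′)) (nb-sym pd m) (d≢c ∘ sym))
   where
   pd = nb-plain (Deg2.plain B) (Deg2.nb₂ B)
   pe = nb-plain (Deg2.plain C′) (Deg2.nb₂ C′)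
   b≢e : b ≢ e
   b≢e refl with Deg2.only B c (nb-sym (Deg2.plain C′) (Deg2.nb₂ C′))
   ... | inj₁ q = nb-≢ (Deg2.nb₂ A) (sym q)
   ... | inj₂ q = d≢c (sym q)
  -- The walk `e c a b d` does not close up to a cycle of length five. If it stops at `d` or one
  -- vertex later, `p5` applies from that end; otherwise `c6` does, even if it closes up to a cycle
  -- of length six.
  ... | no ¬m = long (degree₂ pd (nb-sym (Deg2.plain B) (Deg2.nb₂ B)))
   where
   pd = nb-plain (Deg2.plain B) (Deg2.nb₂ B)
   pe = nb-plain (Deg2.plain C′) (Deg2.nb₂ C′)
   B′ = B
   b≢e : b ≢ e
   b≢e refl with Deg2.only B c (nb-sym (Deg2.plain C′) (Deg2.nb₂ C′))
   ... | inj₁ q = nb-≢ (Deg2.nb₂ A) (sym q)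
   ... | inj₂ q = d≢c (sym q)
   a≢d = Deg2.b≢c B
   a≢e = Deg2.b≢c C′
   c≢e = nb-≢ (Deg2.nb₂ C′)
   long : Deg1 d b ⊎ ∃ (Deg2 d b) → Shape a
   long (inj₁ D) = fire (p5 D (deg2-swap B) A (Deg2.nb₂ C′) d≢c d≢e b≢e a≢e)
   long (inj₂ (f , D)) = longer (degree₂ pf (nb-sym pd (Deg2.nb₂ D)))
    where
    pf = nb-plain pd (Deg2.nb₂ D)
    f≢a : f ≢ a
    f≢a refl with Deg2.only A d (nb-sym pd (Deg2.nb₂ D))
    ... | inj₁ q = nb-≢ (Deg2.nb₂ B) (sym q)
    ... | inj₂ q = d≢c q
    f≢c : f ≢ c
    f≢c refl with Deg2.only C′ d (nb-sym pd (Deg2.nb₂ D))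
    ... | inj₁ q = a≢d (sym q)
    ... | inj₂ q = d≢e q
    f≢e : f ≢ e
    f≢e refl = ¬m (Deg2.nb₂ D)
    longer : Deg1 f d ⊎ ∃ (Deg2 f d) → Shape a
    longer (inj₁ F) = fire (p5 F (deg2-swap D) (deg2-swap B) (Deg2.nb₂ A)
     f≢a f≢c d≢c (Deg2.b≢c A))
    longer (inj₂ (g , F)) = fire (c6 (deg2-swap F) (deg2-swap D) (deg2-swap B) A (Deg2.nb₂ C′)
     f≢a f≢c f≢e d≢c d≢e b≢e a≢e)

  abstract
   shape : ∀ {a} → Plain a → Shape a
   shape = shape′

-- What a resolved subtree offers to a request that leaves it

module Interface {n} (I : Instance n) {root : Fin n} (tree : IsRooted (Instance.le I) root)
 (stuck : ¬ Rules.Step I root)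
 (h : Fin n) (alive-h : Instance.Alive I h) (Q : Stars.Resolved I tree stuck h) where
 open Instance I
 open Exchange I
 open PatternMatch I
 open Rules I root
 open Sides I tree
 open IsRooted tree
 open Stars I tree stuck
 open Star h alive-h Q
 open Resolved Q

 -- Once h is in a solution, the elements ys may be put there as well.
 record Reset (ys : List (Fin n)) : Set where
  field
   X : List (Fin n)
   small : length X ≤ 9
   below : All (_≼ h) X
   h∈X : h ∈ X
   valid : ∀ C → LocalHit X C → T (C h) → ∃ λ Y → Exch X C Y × All (T ∘ Y) (h ∷ ys)

 plain-≼ : ∀ {a} → Plain a → a ≼ h
 plain-≼ p = Direct.a≼h (direct p)

 -- The elements of one component and the requests inside it that a solution has to hit. Tables
 -- about the same component share these and differ only in the kernels, moves and goals.
 record Frame (m : ℕ) : Set where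
  field
   xs : Vec (Fin n) m
   h∈ : h ∈ Vec.toList xs
   small : length (Vec.toList xs) ≤ 9
   below : All (_≼ h) (Vec.toList xs)
   distinct : Distinct xs
   musts : List (List (Fin m))
   must-hit : ∀ C → LocalHit (Vec.toList xs) C → T (C h) → All (Any (λ i → T (C (lookup xs i)))) musts

 reset : ∀ {m} (F : Frame m) (P : Checked m) → Checked.musts P ≡ Frame.musts F →
  Kernels (Frame.xs F) (Frame.xs F) (Checked.kernels P) →
  ∀ {is ys} → Pattern.goals (Checked.pattern-of P) ≡ [ (is , []) ] → List.map (lookup (Frame.xs F)) is ≡ h ∷ ys → Reset ys
 reset F P refl ks {is} {ys} refl eq = record
  { X = Vec.toList xs ; small = small ; below = below ; h∈X = h∈ ; valid = valid }
  where
  open Frame F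
  valid : ∀ C → LocalHit (Vec.toList xs) C → T (C h) → ∃ λ Y → Exch (Vec.toList xs) C Y × All (T ∘ Y) (h ∷ ys)
  valid C loc ch with match P xs distinct ks C (must-hit C loc ch)
  ... | Y , x , here (q , _) = Y , x , subst (All (T ∘ Y)) eq (Allₚ.map⁺ q)

 h≢ : ∀ {a} → Plain a → h ≢ a
 h≢ p = ≢h p ∘ sym

 iso-frame : ∀ {a b} → Deg1 a b → Deg1 b a → Frame 3
 iso-frame {a} {b} A B = record
  { xs = xs ; h∈ = ∈₀ ; small = ≤ᵇ⇒≤ 3 9 tt ; below = ≼-refl h ∷ plain-≼ pa ∷ plain-≼ pb ∷ []
  ; distinct = (h≢ pa , h≢ pb , tt) , (nb-≢ (Deg1.nb A) , tt) , tt , tt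
  ; musts = Checked.musts pull-isoᵖ
  ; must-hit = λ C loc ch → here ch ∷ must xs C (hit-nb (Deg1.nb A) ∈₁ ∈₂ loc) ∷ [] }
  where
  pa = Deg1.plain A
  pb = Deg1.plain B
  xs : Vec (Fin n) 3
  xs = h ∷ a ∷ [ b ]

 path-frame : ∀ {a b c d} → Deg1 a b → Deg2 b a c → Deg2 c b d → Deg1 d c → Frame 5
 path-frame {a} {b} {c} {d} A B C′ D = record
  { xs = xs ; h∈ = ∈₀ ; small = ≤ᵇ⇒≤ 5 9 tt
  ; below = ≼-refl h ∷ plain-≼ pa ∷ plain-≼ pb ∷ plain-≼ pc ∷ plain-≼ pd ∷ []
  ; distinct = (h≢ pa , h≢ pb , h≢ pc , h≢ pd , tt) ,
  (nb-≢ (Deg1.nb A) , Deg2.b≢c B , a≢d , tt) ,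
  (nb-≢ (Deg2.nb₂ B) , Deg2.b≢c C′ , tt) , (nb-≢ (Deg2.nb₂ C′) , tt) , tt , tt
  ; musts = Checked.musts pull-endᵖ
  ; must-hit = λ C loc ch → here ch ∷ must xs C (hit-nb (Deg1.nb A) ∈₁ ∈₂ loc) ∷
  must xs C (hit-nb (Deg2.nb₂ B) ∈₂ ∈₃ loc) ∷ must xs C (hit-nb (Deg2.nb₂ C′) ∈₃ ∈₄ loc) ∷ [] }
  where
  pa = Deg1.plain A
  pb = Deg2.plain B
  pc = Deg2.plain C′
  pd = Deg1.plain D
  a≢d : a ≢ d
  a≢d refl = nb-≢ (Deg2.nb₂ B) (sym (Deg1.only A c (Deg1.nb D)))
  xs : Vec (Fin n) 5
  xs = h ∷ a ∷ b ∷ c ∷ [ d ]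

 tri-frame : ∀ {a b c} → Deg2 a b c → Deg2 b a c → Deg2 c a b → Frame 4
 tri-frame {a} {b} {c} A B C′ = record
  { xs = xs ; h∈ = ∈₀ ; small = ≤ᵇ⇒≤ 4 9 tt
  ; below = ≼-refl h ∷ plain-≼ pa ∷ plain-≼ pb ∷ plain-≼ pc ∷ []
  ; distinct = (h≢ pa , h≢ pb , h≢ pc , tt) , (nb-≢ (Deg2.nb₁ A) , nb-≢ (Deg2.nb₂ A) , tt) ,
  (Deg2.b≢c A , tt) , tt , tt
  ; musts = Checked.musts pull-triᵖ
  ; must-hit = λ C loc ch → here ch ∷ must xs C (hit-nb (Deg2.nb₁ A) ∈₁ ∈₂ loc) ∷
  must xs C (hit-nb (Deg2.nb₂ A) ∈₁ ∈₃ loc) ∷ must xs C (hit-nb (Deg2.nb₂ B) ∈₂ ∈₃ loc) ∷ [] }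
  where
  pa = Deg2.plain A
  pb = Deg2.plain B
  pc = Deg2.plain C′
  xs : Vec (Fin n) 4
  xs = h ∷ a ∷ b ∷ [ c ]

 sq-frame : ∀ {a b c d} → Deg2 a b c → Deg2 b a d → Deg2 c a d → Deg2 d b c → Frame 5
 sq-frame {a} {b} {c} {d} A B C′ D = record
  { xs = xs ; h∈ = ∈₀ ; small = ≤ᵇ⇒≤ 5 9 tt
  ; below = ≼-refl h ∷ plain-≼ pa ∷ plain-≼ pb ∷ plain-≼ pc ∷ plain-≼ pd ∷ []
  ; distinct = (h≢ pa , h≢ pb , h≢ pc , h≢ pd , tt) ,
  (nb-≢ (Deg2.nb₁ A) , nb-≢ (Deg2.nb₂ A) , Deg2.b≢c B , tt) ,
  (Deg2.b≢c A , nb-≢ (Deg2.nb₂ B) , tt) , (nb-≢ (Deg2.nb₂ C′) , tt) , tt , tt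
  ; musts = Checked.musts pull-sqᵖ
  ; must-hit = λ C loc ch → here ch ∷ must xs C (hit-nb (Deg2.nb₁ A) ∈₁ ∈₂ loc) ∷
  must xs C (hit-nb (Deg2.nb₂ A) ∈₁ ∈₃ loc) ∷ must xs C (hit-nb (Deg2.nb₂ B) ∈₂ ∈₄ loc) ∷
  must xs C (hit-nb (Deg2.nb₂ C′) ∈₃ ∈₄ loc) ∷ [] }
  where
  pa = Deg2.plain A
  pb = Deg2.plain B
  pc = Deg2.plain C′
  pd = Deg2.plain D
  xs : Vec (Fin n) 5
  xs = h ∷ a ∷ b ∷ c ∷ [ d ]

 pent-frame : ∀ {a b c d e} → Deg2 a b c → Deg2 b a d → Deg2 c a e → Deg2 d b e → Deg2 e c d → Frame 6
 pent-frame {a} {b} {c} {d} {e} A B C′ D E = record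
  { xs = xs ; h∈ = ∈₀ ; small = ≤ᵇ⇒≤ 6 9 tt
  ; below = ≼-refl h ∷ plain-≼ pa ∷ plain-≼ pb ∷ plain-≼ pc ∷ plain-≼ pd ∷ plain-≼ pe ∷ []
  ; distinct = (h≢ pa , h≢ pb , h≢ pc , h≢ pd , h≢ pe , tt) ,
  (nb-≢ (Deg2.nb₁ A) , nb-≢ (Deg2.nb₂ A) , Deg2.b≢c B , Deg2.b≢c C′ , tt) ,
  (Deg2.b≢c A , nb-≢ (Deg2.nb₂ B) , Deg2.b≢c D , tt) ,
  (Deg2.b≢c E , nb-≢ (Deg2.nb₂ C′) , tt) , (nb-≢ (Deg2.nb₂ D) , tt) , tt , tt
  ; musts = Checked.musts pull-pentᵖ
  ; must-hit = λ C loc ch → here ch ∷ must xs C (hit-nb (Deg2.nb₁ A) ∈₁ ∈₂ loc) ∷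
  must xs C (hit-nb (Deg2.nb₂ A) ∈₁ ∈₃ loc) ∷ must xs C (hit-nb (Deg2.nb₂ B) ∈₂ ∈₄ loc) ∷
  must xs C (hit-nb (Deg2.nb₂ C′) ∈₃ ∈₅ loc) ∷ must xs C (hit-nb (Deg2.nb₂ D) ∈₄ ∈₅ loc) ∷ [] }
  where
  pa = Deg2.plain A
  pb = Deg2.plain B
  pc = Deg2.plain C′
  pd = Deg2.plain D
  pe = Deg2.plain E
  xs : Vec (Fin n) 6
  xs = h ∷ a ∷ b ∷ c ∷ d ∷ [ e ]

 pull : ∀ {a} → Plain a → Reset [ a ]
 pull {a} p with shape p
 ... | iso A B = reset fr pull-isoᵖ refl
  (K₀ xs , K₀ xs , K₁ xs B refl refl , tt) refl refl
  where
  fr = iso-frame A B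
  open Frame fr using (xs)
 ... | end A B C′ D = reset fr pull-endᵖ refl
  (K₀ xs , K₀ xs , K₂ xs B refl refl refl , K₀ xs , K₁ xs D refl refl , tt) refl refl
  where
  fr = path-frame A B C′ D
  open Frame fr using (xs)
 ... | inner A B C′ D = reset fr pull-innerᵖ refl
  (K₀ xs , K₁ xs B refl refl , K₀ xs , K₀ xs , K₀ xs , tt) refl refl
  where
  fr = path-frame B A C′ D
  open Frame fr using (xs)
 ... | tri A B C′ = reset fr pull-triᵖ refl
  (K₀ xs , K₀ xs , K₂ xs B refl refl refl , K₀ xs , tt) refl refl
  where
  fr = tri-frame A B C′
  open Frame fr using (xs)
 ... | sq A B C′ D = reset fr pull-sqᵖ refl
  (K₀ xs , K₀ xs , K₂ xs B refl refl refl , K₂ xs C′ refl refl refl , K₀ xs , tt) refl refl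
  where
  fr = sq-frame A B C′ D
  open Frame fr using (xs)
 ... | pent A B C′ D E = reset fr pull-pentᵖ refl
  (K₀ xs , K₀ xs , K₂ xs B refl refl refl , K₂ xs C′ refl refl refl , K₀ xs , K₀ xs , tt) refl refl
  where
  fr = pent-frame A B C′ D E
  open Frame fr using (xs)

 NotIso : Fin n → Set
 NotIso e = ∀ {a b} → Deg1 a b → Deg1 b a → e ≢ a

 -- With `h` in a solution, two further elements come along for free, so that the case of `h`
 -- becomes a set of size three in a branching. `P` is there to keep the two away from a given pair,
 -- which can then contribute a fourth element.
 record Reserve (P : Fin n → Set) : Set where
  field
   e₁ e₂ : Fin n
   resets : Reset (e₁ ∷ [ e₂ ])
   e₁≢e₂ : e₁ ≢ e₂
   h≢e₁ : h ≢ e₁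
   h≢e₂ : h ≢ e₂
   e₁≼h : e₁ ≼ h
   e₂≼h : e₂ ≼ h
   P₁ : P e₁
   P₂ : P e₂

 map-reserve : ∀ {P Q : Fin n → Set} → (∀ {e} → P e → Q e) → Reserve P → Reserve Q
 map-reserve f R = record
  { resets = resets ; e₁≢e₂ = e₁≢e₂ ; h≢e₁ = h≢e₁ ; h≢e₂ = h≢e₂ ; e₁≼h = e₁≼h ; e₂≼h = e₂≼h ; P₁ = f P₁ ; P₂ = f P₂ }
  where open Reserve R

 not-iso : ∀ {a b c z} → Deg2 a b c → Nb z a → NotIso z
 not-iso D m A B refl with Deg1.only A _ m
 ... | refl = Deg2.b≢c D (trans (Deg1.only B _ (Deg2.nb₁ D)) (sym (Deg1.only B _ (Deg2.nb₂ D))))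

 reserve₂ : ∀ {a b c} → Deg2 a b c → Reset (b ∷ [ c ]) → Reserve NotIso
 reserve₂ A r = record
  { resets = r ; e₁≢e₂ = Deg2.b≢c A ; h≢e₁ = h≢ pb ; h≢e₂ = h≢ pc ; e₁≼h = plain-≼ pb ; e₂≼h = plain-≼ pc
  ; P₁ = not-iso A (nb-sym pa (Deg2.nb₁ A)) ; P₂ = not-iso A (nb-sym pa (Deg2.nb₂ A)) }
  where
  pa = Deg2.plain A
  pb = nb-plain pa (Deg2.nb₁ A)
  pc = nb-plain pa (Deg2.nb₂ A)

 reserve-path : ∀ {a b c d} → Deg1 a b → Deg2 b a c → Deg2 c b d → Deg1 d c → Reserve NotIso
 reserve-path A B C′ D = reserve₂ B (reset fr avoid-innerᵖ refl
  (K₀ xs , K₀ xs , K₂ xs B refl refl refl , K₀ xs , K₁ xs D refl refl , tt) refl refl)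
  where
  fr = path-frame A B C′ D
  open Frame fr using (xs)

 iso-or-reserve′ : ∀ {a} → Plain a → (∃ λ b → Deg1 a b × Deg1 b a) ⊎ Reserve NotIso
 iso-or-reserve′ p with shape p
 ... | iso A B = inj₁ (_ , A , B)
 ... | end A B C′ D = inj₂ (reserve-path A B C′ D)
 ... | inner A B C′ D = inj₂ (reserve-path B A′ C′ D)
  where A′ = A
 ... | tri A B C′ = inj₂ (reserve₂ A (reset fr avoid-triᵖ refl
  (K₀ xs , K₂ xs A refl refl refl , K₀ xs , K₀ xs , tt) refl refl))
  where
  fr = tri-frame A B C′
  open Frame fr using (xs)
 ... | sq A B C′ D = inj₂ (reserve₂ A (reset fr avoid-sqᵖ refl
  (K₀ xs , K₂ xs A refl refl refl , K₀ xs , K₀ xs , K₂ xs D refl refl refl , tt) refl refl))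
  where
  fr = sq-frame A B C′ D
  open Frame fr using (xs)
 ... | pent A B C′ D E = inj₂ (reserve₂ A (reset fr avoid-pentᵖ refl
  (K₀ xs , K₂ xs A refl refl refl , K₀ xs , K₀ xs , K₂ xs D refl refl refl , K₀ xs , tt) refl refl))
  where
  fr = pent-frame A B C′ D E
  open Frame fr using (xs)

 abstract
  iso-or-reserve : ∀ {a} → Plain a → (∃ λ b → Deg1 a b × Deg1 b a) ⊎ Reserve NotIso
  iso-or-reserve = iso-or-reserve′

 -- Below a chosen `h` the member chosen in a pair is arbitrary, so each pair provides one element.
 pairs-reserve : ∀ {a b c d} → Deg1 a b → Deg1 b a → Deg1 c d → Deg1 d c → c ≢ a → c ≢ b →
  {P : Fin n → Set} → P a → P c → Reserve P
 pairs-reserve {a} {b} {c} {d} A B C′ D c≢a c≢b Pa Pc = record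
  { resets = reset fr two-pairsᵖ refl
  (K₀ xs , K₀ xs , K₁ xs B refl refl , K₀ xs , K₁ xs D refl refl , tt) refl refl
  ; e₁≢e₂ = c≢a ∘ sym ; h≢e₁ = h≢ pa ; h≢e₂ = h≢ pc ; e₁≼h = plain-≼ pa ; e₂≼h = plain-≼ pc ; P₁ = Pa ; P₂ = Pc }
  where
  pa = Deg1.plain A
  pb = Deg1.plain B
  pc = Deg1.plain C′
  pd = Deg1.plain D
  a≢d : a ≢ d
  a≢d refl = c≢b (Deg1.only A c (Deg1.nb D))
  b≢d : b ≢ d
  b≢d refl = c≢a (Deg1.only B c (Deg1.nb D))
  xs : Vec (Fin n) 5
  xs = h ∷ a ∷ b ∷ c ∷ [ d ]
  fr : Frame 5
  fr = record
   { xs = xs ; h∈ = ∈₀ ; small = ≤ᵇ⇒≤ 5 9 tt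
   ; below = ≼-refl h ∷ plain-≼ pa ∷ plain-≼ pb ∷ plain-≼ pc ∷ plain-≼ pd ∷ []
   ; distinct = (h≢ pa , h≢ pb , h≢ pc , h≢ pd , tt) ,
   (nb-≢ (Deg1.nb A) , c≢a ∘ sym , a≢d , tt) ,
   (c≢b ∘ sym , b≢d , tt) , (nb-≢ (Deg1.nb C′) , tt) , tt , tt
   ; musts = Checked.musts two-pairsᵖ
   ; must-hit = λ C loc ch → here ch ∷ must xs C (hit-nb (Deg1.nb A) ∈₁ ∈₂ loc) ∷
   must xs C (hit-nb (Deg1.nb C′) ∈₃ ∈₄ loc) ∷ [] }

 module InGadget (G : Gadget h) where
  open Gadget G
  xs : Vec (Fin n) 8
  xs = h ∷ f ∷ a ∷ b ∷ c ∷ d ∷ x ∷ [ y ]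

  f≼h : f ≼ h
  f≼h = Direct.a≼h direct-f

  under : ∀ {e} → Direct f e → e ≼ h
  under de = ≼-trans (Direct.a≼h de) f≼h

  below-h : All (_≼ h) (Vec.toList xs)
  below-h = ≼-refl h ∷ f≼h ∷ under direct-a ∷ under direct-b ∷ under direct-c ∷ under direct-d ∷
   Direct.a≼h direct-x ∷ Direct.a≼h direct-y ∷ []

  Dist : ∀ {f a b c d x y} → Distinct (f ∷ a ∷ b ∷ c ∷ d ∷ x ∷ y ∷ [ h ]) →
   Distinct (h ∷ f ∷ a ∷ b ∷ c ∷ d ∷ x ∷ [ y ])
  Dist ((fa , fb , fc , fd , fx , fy , fh , _) , (ab , ac , ad , ax , ay , ah , _) ,
   (bc , bd , bx , by , bh , _) , (cd , cx , cy , ch , _) , (dx , dy , dh , _) ,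
   (xy , xh , _) , (yh , _) , _) =
   (fh ∘ sym , ah ∘ sym , bh ∘ sym , ch ∘ sym , dh ∘ sym , xh ∘ sym , yh ∘ sym , tt) ,
   (fa , fb , fc , fd , fx , fy , tt) , (ab , ac , ad , ax , ay , tt) ,
   (bc , bd , bx , by , tt) , (cd , cx , cy , tt) , (dx , dy , tt) , (xy , tt) , tt , tt

  dist : Distinct xs
  dist = Dist {f} {a} {b} {c} {d} {x} {y} distinct

  hit-list : ∀ {C} {is : List (Fin 8)} → (∃₂ λ u v → Req u v × (∀ e → Sep e u v → e ∈ List.map (lookup xs) is)) →
   LocalHit (Vec.toList xs) C → Any (λ i → T (C (lookup xs i))) is
  hit-list {C} {is} (u , v , r , only) loc with loc u v r (λ e s → inside is (only e s))
   where
   inside : ∀ {e} is → e ∈ List.map (lookup xs) is → e ∈ Vec.toList xs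
   inside (i ∷ is) ∈₀ = ∈-toList⁺ (∈-lookup i xs)
   inside (i ∷ is) (there p) = inside is p
  ... | e , s , q = locate is (only e s)
   where
   locate : ∀ is → e ∈ List.map (lookup xs) is → Any (λ i → T (C (lookup xs i))) is
   locate (i ∷ is) ∈₀ = here q
   locate (i ∷ is) (there p) = there (locate is p)

  pair-list : ∀ {a b} → Pair a b → ∃₂ λ u v → Req u v × (∀ e → Sep e u v → e ∈ a ∷ [ b ])
  pair-list (u , v , r , only) = u , v , r , λ e s → [ (λ { refl → ∈₀ }) , (λ { refl → ∈₁ }) ]′ (only e s)

  musts-hit : ∀ C → LocalHit (Vec.toList xs) C → All (Any (λ i → T (C (lookup xs i))))
   ((2F ∷ [ 3F ]) ∷ (4F ∷ [ 5F ]) ∷ (2F ∷ 1F ∷ [ 6F ]) ∷ [ 3F ∷ 1F ∷ [ 7F ] ])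
  musts-hit C loc = hit-list (pair-list pair-ab) loc ∷ hit-list (pair-list pair-cd) loc ∷
   hit-list path-ax loc ∷ hit-list path-by loc ∷ []

  Kernel : Fin 8 → Set
  Kernel i = ∀ u v → Req u v → Sep (lookup xs i) u v →
   Any (All (λ j → Sep (lookup xs j) u v)) (lookup (Checked.kernels gadget-cᵖ) i)

  kernels-hold : Kernels xs xs (Checked.kernels gadget-cᵖ)
  kernels-hold = K₀ xs , kf , ka , kb , kc , kd , kx , ky , tt
   where
   kf : Kernel 1F
   kf u v r s with via-f u v r s
   ... | inj₁ (p , q) = here (p ∷ [ q ])
   ... | inj₂ (inj₁ (p , q)) = here₁ (p ∷ [ q ])
   ... | inj₂ (inj₂ p) = here₂ [ p ]
   ka : Kernel 2F
   ka u v r s with via-a u v r s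
   ... | inj₁ p = here [ p ]
   ... | inj₂ (inj₁ (p , q)) = here₁ (p ∷ [ q ])
   ... | inj₂ (inj₂ (p , q)) = here₂ (p ∷ [ q ])
   kb : Kernel 3F
   kb u v r s with via-b u v r s
   ... | inj₁ p = here [ p ]
   ... | inj₂ (inj₁ (p , q)) = here₁ (p ∷ [ q ])
   ... | inj₂ (inj₂ (p , q)) = here₂ (p ∷ [ q ])
   kc : Kernel 4F
   kc u v r s with via-c u v r s
   ... | inj₁ p = here [ p ]
   ... | inj₂ (p , q) = here₁ (p ∷ [ q ])
   kd : Kernel 5F
   kd u v r s with via-d u v r s
   ... | inj₁ p = here [ p ]
   ... | inj₂ (p , q) = here₁ (p ∷ [ q ])
   kx : Kernel 6F
   kx u v r s with via-x u v r s
   ... | inj₁ (p , q) = here (p ∷ [ q ])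
   ... | inj₂ p = here₁ [ p ]
   ky : Kernel 7F
   ky u v r s with via-y u v r s
   ... | inj₁ (p , q) = here (p ∷ [ q ])
   ... | inj₂ p = here₁ [ p ]

  frame : Frame 8
  frame = record { xs = xs ; h∈ = ∈₀ ; small = ≤ᵇ⇒≤ 8 9 tt ; below = below-h ; distinct = dist ; musts = Checked.musts gadget-pull-cᵖ
   ; must-hit = λ C loc ch → here ch ∷ musts-hit C loc }

  pull-c : Reset [ c ]
  pull-c = reset frame gadget-pull-cᵖ refl kernels-hold refl refl
  pull-x : Reset [ x ]
  pull-x = reset frame gadget-pull-xᵖ refl kernels-hold refl refl
  pull-a : Reset [ a ]
  pull-a = reset frame gadget-pull-aᵖ refl kernels-hold refl refl
  pull-f : Reset [ f ]
  pull-f = reset frame gadget-pull-fᵖ refl kernels-hold refl refl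

  not-plain : ∀ {e} → Direct f e → ¬ Plain e
  not-plain de p with Direct.next (direct p) f (Direct.alive direct-f) (Direct.a≼h de) f≼h
  ... | inj₁ q = Direct.a≢h de (sym q)
  ... | inj₂ q = Direct.a≢h direct-f q

  under-≢h : ∀ {e} → Direct f e → h ≢ e
  under-≢h de refl = Direct.a≢h direct-f (≼-antisym f≼h (Direct.a≼h de))

  gadget-reserve : Reserve NotIso
  gadget-reserve = record
   { resets = reset frame gadget-pull-bcᵖ refl kernels-hold refl refl
   ; e₁≢e₂ = proj₁ (proj₁ (proj₂ (proj₂ distinct))) ; h≢e₁ = under-≢h direct-b ; h≢e₂ = under-≢h direct-c
   ; e₁≼h = under direct-b ; e₂≼h = under direct-c
   ; P₁ = λ A _ q → not-plain direct-b (subst Plain (sym q) (Deg1.plain A))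
   ; P₂ = λ A _ q → not-plain direct-c (subst Plain (sym q) (Deg1.plain A)) }

 -- Either h has something besides the pair a, b and at most one further pair,
 -- or it has exactly one further pair.
 data Content (a b : Fin n) : Set where
  more : Reserve (λ e → e ≢ a × e ≢ b) → Content a b
  two : ∀ {c d} → Deg1 c d → Deg1 d c → c ≢ a → c ≢ b →
   (∀ e → Alive e → e ≼ h → e ∈ h ∷ a ∷ b ∷ c ∷ [ d ]) → Content a b

 reserve-away : ∀ {a b} → Deg1 a b → Deg1 b a → Reserve NotIso → Reserve (λ e → e ≢ a × e ≢ b)
 reserve-away A B = map-reserve λ p → p A B , p B A

 -- A pair alone below `h` would be split. Anything larger than a second isolated pair provides a
 -- reserve away from `a` and `b`: a bigger component or a gadget does so by itself, and two further
 -- pairs provide one element each.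
 content′ : h ≢ root → ∀ {a b} → Deg1 a b → Deg1 b a → Content a b
 content′ h≢root {a} {b} A B
  with any? (λ e → T? (al e) ×-dec (T? (le e h) ×-dec (¬? (e ≟ᶠ h) ×-dec (¬? (e ≟ᶠ a) ×-dec ¬? (e ≟ᶠ b)))))
 ... | no none = fire (split h a b record
  { alive-f = alive-h ; ≢root = h≢root ; alive-a = Direct.alive da ; alive-b = Direct.alive db
  ; a≼f = Direct.a≼h da ; b≼f = Direct.a≼h db ; a≢f = Direct.a≢h da ; b≢f = Direct.a≢h db
  ; a⋠b = λ q → nb-≢ (Deg1.nb A) (leaf pb a (Direct.alive da) q)
  ; b⋠a = λ q → nb-≢ (Deg1.nb B) (leaf pa b (Direct.alive db) q)
  ; only = only ; pair = edge-pair (proj₁ (Deg1.nb A)) ; via-a = via₁ A ; via-b = via₁ B })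
  where
  pa = Deg1.plain A
  pb = Deg1.plain B
  da = direct pa
  db = direct pb
  only : ∀ e → Alive e → e ≼ h → e ≡ h ⊎ e ≡ a ⊎ e ≡ b
  only e ae e≼h with e ≟ᶠ h | e ≟ᶠ a | e ≟ᶠ b
  ... | yes q | _ | _ = inj₁ q
  ... | no _ | yes q | _ = inj₂ (inj₁ q)
  ... | no _ | no _ | yes q = inj₂ (inj₂ q)
  ... | no p | no q | no r = ⊥-elim (none (e , ae , e≼h , p , q , r))
 ... | yes (c , ac , c≼h , c≢h , c≢a , c≢b) with classify c ac c≼h c≢h
 ... | inj₂ (G , _) = more (reserve-away A B (InGadget.gadget-reserve G))
 ... | inj₁ pc with iso-or-reserve pc
 ... | inj₂ R = more (reserve-away A B R)
 ... | inj₁ (d , C′ , D)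
  with any? (λ e → T? (al e) ×-dec (T? (le e h) ×-dec (¬? (e ≟ᶠ h) ×-dec (¬? (e ≟ᶠ a) ×-dec (¬? (e ≟ᶠ b)
  ×-dec (¬? (e ≟ᶠ c) ×-dec ¬? (e ≟ᶠ d)))))))
 ... | no none = two C′ D c≢a c≢b only
  where
  only : ∀ e → Alive e → e ≼ h → e ∈ h ∷ a ∷ b ∷ c ∷ [ d ]
  only e ae e≼h with e ≟ᶠ h | e ≟ᶠ a | e ≟ᶠ b | e ≟ᶠ c | e ≟ᶠ d
  ... | yes q | _ | _ | _ | _ = here q
  ... | no _ | yes q | _ | _ | _ = here₁ q
  ... | no _ | no _ | yes q | _ | _ = here₂ q
  ... | no _ | no _ | no _ | yes q | _ = here₃ q
  ... | no _ | no _ | no _ | no _ | yes q = here₄ q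
  ... | no p | no q | no r | no s | no t = ⊥-elim (none (e , ae , e≼h , p , q , r , s , t))
 ... | yes (e , ae , e≼h , e≢h , e≢a , e≢b , e≢c , e≢d) with classify e ae e≼h e≢h
 ... | inj₂ (G , _) = more (reserve-away A B (InGadget.gadget-reserve G))
 ... | inj₁ pe with iso-or-reserve pe
 ... | inj₂ R = more (reserve-away A B R)
 ... | inj₁ (z , E , Z) = more (pairs-reserve C′ D E Z e≢c e≢d (c≢a , c≢b) (e≢a , e≢b))

 abstract
  content : h ≢ root → ∀ {a b} → Deg1 a b → Deg1 b a → Content a b
  content = content′

 pair-reserve : h ≢ root → ∀ {a b} → Deg1 a b → Deg1 b a → Reserve (λ _ → ⊤)
 pair-reserve h≢root A B with content h≢root A B
 ... | two C′ D c≢a c≢b _ = pairs-reserve A B C′ D c≢a c≢b tt tt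
 ... | more R = map-reserve _ R

 reserve : h ≢ root → ∀ e → Alive e → e ≼ h → e ≢ h → Reserve (λ _ → ⊤)
 reserve h≢root e ae e≼h e≢h with classify e ae e≼h e≢h
 ... | inj₂ (G , _) = map-reserve _ (InGadget.gadget-reserve G)
 ... | inj₁ p with iso-or-reserve p
 ... | inj₁ (_ , A , B) = pair-reserve h≢root A B
 ... | inj₂ R = map-reserve _ R

 chain-leaf : ∀ {a u} → Direct h a → Leaf a → u ≼ a → ∀ e → Alive e → u ≼ e → e ≼ h → e ≡ a ⊎ e ≡ h
 chain-leaf da la u≼a e ae u≼e e≼h with ≼-chain u≼e u≼a
 ... | inj₁ e≼a = inj₁ (la e ae e≼a)
 ... | inj₂ a≼e = Direct.next da e ae a≼e e≼h

 commit-top : ∀ {u} → (∀ e → Alive e → u ≼ e → e ≼ h → e ≡ h) → Commit h u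
 commit-top {u} only = record
  { X = [ h ] ; small = ≤ᵇ⇒≤ 1 12 tt ; below = ≼-refl h ∷ []
  ; covers = λ e ae u≼e e≼h → here (only e ae u≼e e≼h) ; y = h ; y≼h = ≼-refl h ; valid = valid }
  where
  valid : ∀ C → LocalHit [ h ] C → ∃ λ Y → Exch [ h ] C Y ×
   (T (Y h) ⊎ Missed Y h u) × (T (C h) → T (Y h) × T (Y h))
  valid C loc with T? (C h)
  ... | yes ch = C , exch-refl , inj₁ ch , λ p → p , p
  ... | no ¬ch = C , exch-refl , inj₂ (λ e ae u≼e e≼h → subst (¬_ ∘ T ∘ C) (sym (only e ae u≼e e≼h)) ¬ch) ,
   λ p → p , p

 commit-from : ∀ {u y} → Reset [ y ] → y ≼ h → (∀ e → Alive e → u ≼ e → e ≼ h → e ≡ y ⊎ e ≡ h) → Commit h u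
 commit-from {u} {y} r y≼h only = record
  { X = y ∷ X ; small = s≤s (≤-trans small (≤ᵇ⇒≤ 9 11 tt)) ; below = y≼h ∷ below
  ; covers = λ e ae u≼e e≼h → [ here , (λ { refl → there h∈X }) ]′ (only e ae u≼e e≼h)
  ; y = y ; y≼h = y≼h ; valid = committed }
  where
  open Reset r
  committed : ∀ C → LocalHit (y ∷ X) C → ∃ λ Y → Exch (y ∷ X) C Y ×
   (T (Y y) ⊎ Missed Y h u) × (T (C h) → T (Y h) × T (Y y))
  committed C loc with T? (C h)
  ... | yes ch with valid C (local-mono there loc) ch
  ... | Y , x , yh ∷ [ yy ] = Y , exch-mono there x , inj₁ yy , λ _ → yh , yy
  committed C loc | no ¬ch with T? (C y)
  ... | yes cy = C , exch-refl , inj₁ cy , λ ch → contradiction ch ¬ch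
  ... | no ¬cy = C , exch-refl , inj₂ missed , λ ch → contradiction ch ¬ch
   where
   missed : Missed C h u
   missed e ae u≼e e≼h with only e ae u≼e e≼h
   ... | inj₁ refl = ¬cy
   ... | inj₂ refl = ¬ch

 -- The request enters at `h` itself. If `h` is chosen, the reserve makes this a set of size three.
 -- If not, then nothing is known about the solution below `h`, whence the empty set in `Neg`.
 closed-top : ∀ {u} → Reserve (λ _ → ⊤) → (∀ e → Alive e → u ≼ e → e ≼ h → e ≡ h) → Closed h u
 closed-top {u} R only = record
  { X = X ; small = ≤-trans small (≤ᵇ⇒≤ 9 13 tt) ; below = below
  ; covers = λ e ae u≼e e≼h → subst (_∈ X) (sym (only e ae u≼e e≼h)) h∈X
  ; Zero = [ h ∷ e₁ ∷ [ e₂ ] ] ; Neg = [] ∷ [] ; size-∈ = ∈₂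
  ; unique₀ = [ (h≢e₁ ∷ [ h≢e₂ ]) ∷ [ e₁≢e₂ ] ∷ [] ∷ [] ] ; unique₋ = [] ∷ []
  ; below₀ = [ ≼-refl h ∷ e₁≼h ∷ [ e₂≼h ] ] ; below₋ = [] ∷ [] ; h∉ = [] ∷ []
  ; valid = closed }
  where
  open Reserve R
  open Reset resets
  closed : ∀ C → LocalHit X C → ∃ λ Y → Exch X C Y ×
   (Any (All (T ∘ Y)) [ h ∷ e₁ ∷ [ e₂ ] ] ⊎ (Any (All (T ∘ Y)) ([] ∷ []) × Missed Y h u))
  closed C loc with T? (C h)
  ... | no ¬ch = C , exch-refl , inj₂ (here [] , λ e ae u≼e e≼h → subst (¬_ ∘ T ∘ C) (sym (only e ae u≼e e≼h)) ¬ch)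
  ... | yes ch with valid C loc ch
  ... | Y , x , ys = Y , x , inj₁ (here ys)

 closed₂ : ∀ {a b c u} → Deg2 a b c → u ≼ a → Closed h u
 closed₂ {a} {b} {c} {u} A u≼a = record
  { X = a ∷ b ∷ c ∷ X ; small = s≤s (s≤s (s≤s (≤-trans small (≤ᵇ⇒≤ 9 10 tt))))
  ; below = plain-≼ pa ∷ plain-≼ pb ∷ plain-≼ pc ∷ below
  ; covers = λ e ae u≼e e≼h → [ here , (λ { refl → there (there (there h∈X)) }) ]′ (only e ae u≼e e≼h)
  ; Zero = [ a ] ∷ [] ; Neg = [ b ∷ [ c ] ] ; size-∈ = ∈₁
  ; unique₀ = [ [] ∷ [] ] ; unique₋ = [ (Deg2.b≢c A ∷ []) ∷ [] ∷ [] ]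
  ; below₀ = [ plain-≼ pa ∷ [] ] ; below₋ = [ plain-≼ pb ∷ plain-≼ pc ∷ [] ]
  ; h∉ = [ h≢ pb ∷ h≢ pc ∷ [] ] ; valid = closed }
  where
  pa = Deg2.plain A
  pb = nb-plain pa (Deg2.nb₁ A)
  pc = nb-plain pa (Deg2.nb₂ A)
  open Reset (pull pa)
  only = chain-leaf (direct pa) (leaf pa) u≼a
  closed : ∀ C → LocalHit (a ∷ b ∷ c ∷ X) C → ∃ λ Y → Exch (a ∷ b ∷ c ∷ X) C Y ×
   (Any (All (T ∘ Y)) ([ a ] ∷ []) ⊎ (Any (All (T ∘ Y)) [ b ∷ [ c ] ] × Missed Y h u))
  closed C loc with T? (C h)
  ... | yes ch with valid C (local-mono (there ∘ there ∘ there) loc) ch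
  ... | Y , x , yh ∷ [ ya ] = Y , exch-mono (there ∘ there ∘ there) x , inj₁ (here [ ya ])
  closed C loc | no ¬ch with T? (C a)
  ... | yes ca = C , exch-refl , inj₁ (here [ ca ])
  ... | no ¬ca with hit-nb (Deg2.nb₁ A) ∈₀ ∈₁ loc | hit-nb (Deg2.nb₂ A) ∈₀ ∈₂ loc
  ... | inj₁ ca | _ = contradiction ca ¬ca
  ... | inj₂ _ | inj₁ ca = contradiction ca ¬ca
  ... | inj₂ cb | inj₂ cc = C , exch-refl , inj₂ (here (cb ∷ [ cc ]) , missed)
   where
   missed : Missed C h u
   missed e ae u≼e e≼h with only e ae u≼e e≼h
   ... | inj₁ refl = ¬ca
   ... | inj₂ refl = ¬ch

 -- As `a` has just one neighbour, the branching is on `c`, which has two. Without `c`, both `b` and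
 -- `d` are chosen; should `a` be chosen besides, then `b` and `d` are traded for `c` and `h`.
 closed-end : ∀ {a b c d u} → Deg1 a b → Deg2 b a c → Deg2 c b d → Deg1 d c → u ≼ a → Closed h u
 closed-end {a} {b} {c} {d} {u} A B C′ D u≼a = record
  { X = h ∷ a ∷ b ∷ c ∷ [ d ] ; small = ≤ᵇ⇒≤ 5 13 tt ; below = below
  ; covers = λ e ae u≼e e≼h → [ (λ { refl → ∈₁ }) , (λ { refl → ∈₀ }) ]′ (only e ae u≼e e≼h)
  ; Zero = [ c ] ∷ [] ; Neg = [ b ∷ [ d ] ] ; size-∈ = ∈₁
  ; unique₀ = [ [] ∷ [] ] ; unique₋ = [ (Deg2.b≢c C′ ∷ []) ∷ [] ∷ [] ]
  ; below₀ = [ plain-≼ pc ∷ [] ] ; below₋ = [ plain-≼ pb ∷ plain-≼ pd ∷ [] ]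
  ; h∉ = [ h≢ pb ∷ h≢ pd ∷ [] ] ; valid = closed }
  where
  pa = Deg1.plain A
  pb = Deg2.plain B
  pc = Deg2.plain C′
  pd = Deg1.plain D
  fr = path-frame A B C′ D
  open Frame fr
  only = chain-leaf (direct pa) (leaf pa) u≼a
  r : Reset [ c ]
  r = reset fr pull-inner′ᵖ refl
   (K₀ xs , K₀ xs , K₀ xs , K₀ xs , K₁ xs D refl refl , tt) refl refl
  closed : ∀ C → LocalHit (Vec.toList xs) C → ∃ λ Y → Exch (Vec.toList xs) C Y ×
   (Any (All (T ∘ Y)) ([ c ] ∷ []) ⊎ (Any (All (T ∘ Y)) [ b ∷ [ d ] ] × Missed Y h u))
  closed C loc with T? (C h)
  ... | yes ch with Reset.valid r C loc ch
  ... | Y , x , yh ∷ [ yc ] = Y , x , inj₁ (here [ yc ])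
  closed C loc | no ¬ch with T? (C c)
  ... | yes cc = C , exch-refl , inj₁ (here [ cc ])
  ... | no ¬cc with hit-nb (Deg2.nb₂ B) ∈₂ ∈₃ loc | hit-nb (Deg2.nb₂ C′) ∈₃ ∈₄ loc
  ... | inj₂ cc | _ = contradiction cc ¬cc
  ... | inj₁ _ | inj₁ cc = contradiction cc ¬cc
  ... | inj₁ cb | inj₂ cd with T? (C a)
  ... | yes ca with match end-fullᵖ xs distinct
   (K₀ xs , K₀ xs , K₂ xs B refl refl refl , K₀ xs , K₁ xs D refl refl , tt) C
   (here ca ∷ here cb ∷ here cd ∷ [])
  ... | Y , x , here ([ yc ] , _) = Y , x , inj₁ (here [ yc ])
  closed C loc | no ¬ch | no ¬cc | inj₁ cb | inj₂ cd | no ¬ca = C , exch-refl , inj₂ (here (cb ∷ [ cd ]) , missed)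
   where
   missed : Missed C h u
   missed e ae u≼e e≼h with only e ae u≼e e≼h
   ... | inj₁ refl = ¬ca
   ... | inj₂ refl = ¬ch

 -- At an isolated pair there is only a `Commit`, because the branching on its member has sizes 1
 -- and 2 once the other side has contributed, and this is too slow. These ends are what the
 -- analysis one level higher has to deal with.
 data Status (u : Fin n) : Set where
  closed : Closed h u → (c : Commit h u) → Commit.y c ≢ h → Status u
  isolated : ∀ {a b} → Deg1 a b → Deg1 b a → u ≼ a → Status u

 status-plain : ∀ {a u} → Plain a → u ≼ a → Status u
 status-plain {a} {u} p u≼a = by (shape p)
  where
  cm = commit-from (pull p) (plain-≼ p) (chain-leaf (direct p) (leaf p) u≼a)
  by : Shape a → Status u
  by (iso A B) = isolated A B u≼a
  by (end A B C′ D) = closed (closed-end A B C′ D u≼a) cm (≢h p)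
  by (inner A _ _ _) = closed (closed₂ A u≼a) cm (≢h p)
  by (tri A _ _) = closed (closed₂ A u≼a) cm (≢h p)
  by (sq A _ _ _) = closed (closed₂ A u≼a) cm (≢h p)
  by (pent A _ _ _ _) = closed (closed₂ A u≼a) cm (≢h p)

 module GadgetStatus (G : Gadget h) where
  open Gadget G
  open InGadget G

  ClosedIn : Fin n → List (List (Fin n)) → List (List (Fin n)) → Set
  ClosedIn u Zero Neg = ∀ C → LocalHit (Vec.toList xs) C → ∃ λ Y → Exch (Vec.toList xs) C Y ×
   (Any (All (T ∘ Y)) Zero ⊎ (Any (All (T ∘ Y)) Neg × Missed Y h u))

  h∉ₓ : ∀ {e} → Direct h e → h ≢ e
  h∉ₓ de = Direct.a≢h de ∘ sym

  private
   fa = proj₁ (proj₁ distinct)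
   fb = proj₁ (proj₂ (proj₁ distinct))
   fc = proj₁ (proj₂ (proj₂ (proj₁ distinct)))
   fd = proj₁ (proj₂ (proj₂ (proj₂ (proj₁ distinct))))
   ab = proj₁ (proj₁ (proj₂ distinct))
   ac = proj₁ (proj₂ (proj₁ (proj₂ distinct)))
   ad = proj₁ (proj₂ (proj₂ (proj₁ (proj₂ distinct))))
   ay = proj₁ (proj₂ (proj₂ (proj₂ (proj₂ (proj₁ (proj₂ distinct))))))
   bd = proj₁ (proj₂ (proj₁ (proj₂ (proj₂ distinct))))
   bx = proj₁ (proj₂ (proj₂ (proj₁ (proj₂ (proj₂ distinct)))))
   dx = proj₁ (proj₁ (proj₂ (proj₂ (proj₂ (proj₂ distinct)))))
   dy = proj₁ (proj₂ (proj₁ (proj₂ (proj₂ (proj₂ (proj₂ distinct))))))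
   cd = proj₁ (proj₁ (proj₂ (proj₂ (proj₂ distinct))))

   b-x : Unique (b ∷ [ x ])
   b-x = [ bx ] ∷ [] ∷ []
   a-y : Unique (a ∷ [ y ])
   a-y = [ ay ] ∷ [] ∷ []
   f-a-c : Unique (f ∷ a ∷ [ c ])
   f-a-c = (fa ∷ [ fc ]) ∷ [ ac ] ∷ [] ∷ []
   b-x≼ : All (_≼ h) (b ∷ [ x ])
   b-x≼ = under direct-b ∷ Direct.a≼h direct-x ∷ []
   a-y≼ : All (_≼ h) (a ∷ [ y ])
   a-y≼ = under direct-a ∷ Direct.a≼h direct-y ∷ []
   f-a-c≼ : All (_≼ h) (f ∷ a ∷ [ c ])
   f-a-c≼ = f≼h ∷ under direct-a ∷ under direct-c ∷ []
   h-b-x : All (h ≢_) (b ∷ [ x ])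
   h-b-x = under-≢h direct-b ∷ h∉ₓ direct-x ∷ []
   h-a-y : All (h ≢_) (a ∷ [ y ])
   h-a-y = under-≢h direct-a ∷ h∉ₓ direct-y ∷ []
   h-f-a-c : All (h ≢_) (f ∷ a ∷ [ c ])
   h-f-a-c = h∉ₓ direct-f ∷ under-≢h direct-a ∷ under-≢h direct-c ∷ []

  chain-under : ∀ {e u} → Direct f e → Leaf e → u ≼ e → ∀ z → Alive z → u ≼ z → z ≼ h → z ≡ e ⊎ z ≡ f ⊎ z ≡ h
  chain-under de le u≼e z az u≼z z≼h with ≼-chain u≼z u≼e
  ... | inj₁ z≼e = inj₁ (le z az z≼e)
  ... | inj₂ e≼z with ≼-chain e≼z (Direct.a≼h de)
  ... | inj₁ z≼f = Sum.map₂ inj₁ (Direct.next de z az e≼z z≼f)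
  ... | inj₂ f≼z = inj₂ (Direct.next direct-f z az f≼z z≼h)

  -- Two vertices above `p` may hit the request in its place, `f` and `h`; whichever is chosen, `p`
  -- can be chosen in addition.
  commit-under : ∀ {p q u} → Direct f p → Leaf p → p ≢ q → f ≢ q → Direct f q → Pair p q →
   (Via q λ S → S p ⊎ S f) → Reset [ p ] → u ≼ p → Commit h u
  commit-under {p} {q} {u} dp lp p≢q f≢q dq pr via-q r u≼p = record
   { X = f ∷ p ∷ q ∷ X ; small = s≤s (s≤s (s≤s small)) ; below = f≼h ∷ under dp ∷ under dq ∷ below
   ; covers = λ e ae u≼e e≼h → cover (only e ae u≼e e≼h)
   ; y = p ; y≼h = under dp ; valid = committed }
   where
   open Reset r
   only = chain-under dp lp u≼p
   cover : ∀ {e} → e ≡ p ⊎ e ≡ f ⊎ e ≡ h → e ∈ f ∷ p ∷ q ∷ X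
   cover (inj₁ refl) = ∈₁
   cover (inj₂ (inj₁ refl)) = ∈₀
   cover (inj₂ (inj₂ refl)) = there (there (there h∈X))
   zs : Vec (Fin n) 3
   zs = f ∷ p ∷ [ q ]
   kq : Via q λ S → Any (All (λ j → S (lookup zs j))) ([ 1F ] ∷ [ 0F ] ∷ [])
   kq u v r s with via-q u v r s
   ... | inj₁ sp = here [ sp ]
   ... | inj₂ sf = here₁ [ sf ]
   hit-pair : ∀ {C} → Pair p q → LocalHit (f ∷ p ∷ q ∷ X) C → Any (λ i → T (C (lookup zs i))) (1F ∷ [ 2F ])
   hit-pair (u , v , r , o) loc with loc u v r (λ e s → [ (λ { refl → ∈₁ }) , (λ { refl → ∈₂ }) ]′ (o e s))
   ... | e , s , c with o e s
   ... | inj₁ refl = here c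
   ... | inj₂ refl = here₁ c
   committed : ∀ C → LocalHit (f ∷ p ∷ q ∷ X) C → ∃ λ Y → Exch (f ∷ p ∷ q ∷ X) C Y ×
    (T (Y p) ⊎ Missed Y h u) × (T (C h) → T (Y h) × T (Y p))
   committed C loc with T? (C h)
   ... | yes ch with valid C (local-mono (there ∘ there ∘ there) loc) ch
   ... | Y , x , yh ∷ [ yy ] = Y , exch-mono (there ∘ there ∘ there) x , inj₁ yy , λ _ → yh , yy
   committed C loc | no ¬ch with T? (C f)
   -- Here `f` plays the part of `h` in the table.
   ... | yes cf with match pull-isoᵖ zs
    ((Direct.a≢h dp ∘ sym , f≢q , tt) , (p≢q , tt) , tt , tt)
    (K₀ zs , K₀ zs , kq , tt) C (here cf ∷ hit-pair {C} pr loc ∷ [])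
   ... | Y , x , here (_ ∷ [ yp ] , _) = Y , exch-mono ∈-++⁺ˡ x , inj₁ yp , λ ch → contradiction ch ¬ch
   committed C loc | no ¬ch | no ¬cf with T? (C p)
   ... | yes cp = C , exch-refl , inj₁ cp , λ ch → contradiction ch ¬ch
   ... | no ¬cp = C , exch-refl , inj₂ missed , λ ch → contradiction ch ¬ch
    where
    missed : Missed C h u
    missed e ae u≼e e≼h with only e ae u≼e e≼h
    ... | inj₁ refl = ¬cp
    ... | inj₂ (inj₁ refl) = ¬cf
    ... | inj₂ (inj₂ refl) = ¬ch

  status-c : ∀ {u} → u ≼ c → Status u
  status-c {u} u≼c = closed record
   { X = Vec.toList xs ; small = ≤ᵇ⇒≤ 8 13 tt ; below = below-h
   ; covers = λ e ae u≼e e≼h → [ (λ { refl → ∈₄ }) , [ (λ { refl → ∈₁ }) , (λ { refl → ∈₀ }) ]′ ]′ (only e ae u≼e e≼h)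
   ; Zero = [ c ] ∷ [] ; Neg = (d ∷ b ∷ [ x ]) ∷ [ d ∷ a ∷ [ y ] ]
   ; size-∈ = ∈₇
   ; unique₀ = [ [] ∷ [] ]
   ; unique₋ = ((bd ∘ sym ∷ [ dx ]) ∷ b-x) ∷ [ (ad ∘ sym ∷ [ dy ]) ∷ a-y ]
   ; below₀ = [ under direct-c ∷ [] ] ; below₋ = (under direct-d ∷ b-x≼) ∷ [ under direct-d ∷ a-y≼ ]
   ; h∉ = (under-≢h direct-d ∷ h-b-x) ∷ [ under-≢h direct-d ∷ h-a-y ] ; valid = valid }
   (commit-under direct-c leaf-c cd fd direct-d pair-cd (λ u v r s → Sum.map₂ proj₁ (via-d u v r s)) pull-c u≼c)
   (under-≢h direct-c ∘ sym)
   where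
   only = chain-under direct-c leaf-c u≼c
   missed : ∀ {Y} → ¬ T (Y c) → ¬ T (Y f) → ¬ T (Y h) → Missed Y h u
   missed nc nf nh e ae u≼e e≼h with only e ae u≼e e≼h
   ... | inj₁ refl = nc
   ... | inj₂ (inj₁ refl) = nf
   ... | inj₂ (inj₂ refl) = nh
   valid : ClosedIn u ([ c ] ∷ []) ((d ∷ b ∷ [ x ]) ∷ [ d ∷ a ∷ [ y ] ])
   valid C loc with match gadget-cᵖ xs dist kernels-hold C (musts-hit C loc)
   ... | Y , e , here ([ p ] , _) = Y , e , inj₁ (here [ p ])
   ... | Y , e , here₁ (p ∷ q ∷ [ r ] , nc ∷ nf ∷ [ nh ]) =
    Y , e , inj₂ (here (p ∷ q ∷ [ r ]) , missed {Y} nc nf nh)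
   ... | Y , e , here₂ (p ∷ q ∷ [ r ] , nc ∷ nf ∷ [ nh ]) =
    Y , e , inj₂ (here₁ (p ∷ q ∷ [ r ]) , missed {Y} nc nf nh)

  status-a : ∀ {u} → u ≼ a → Status u
  status-a {u} u≼a = closed record
   { X = Vec.toList xs ; small = ≤ᵇ⇒≤ 8 13 tt ; below = below-h
   ; covers = λ e ae u≼e e≼h → [ (λ { refl → ∈₂ }) , [ (λ { refl → ∈₁ }) , (λ { refl → ∈₀ }) ]′ ]′ (only e ae u≼e e≼h)
   ; Zero = [ a ] ∷ [] ; Neg = [ b ∷ [ x ] ]
   ; size-∈ = ∈₁
   ; unique₀ = [ [] ∷ [] ] ; unique₋ = [ b-x ]
   ; below₀ = [ under direct-a ∷ [] ] ; below₋ = [ b-x≼ ] ; h∉ = [ h-b-x ] ; valid = valid }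
   (commit-under direct-a leaf-a ab fb direct-b pair-ab
   (λ u v r s → Sum.map₂ [ proj₁ , proj₁ ]′ (via-b u v r s)) pull-a u≼a)
   (under-≢h direct-a ∘ sym)
   where
   only = chain-under direct-a leaf-a u≼a
   valid : ClosedIn u ([ a ] ∷ []) [ b ∷ [ x ] ]
   valid C loc with match gadget-aᵖ xs dist kernels-hold C (musts-hit C loc)
   ... | Y , e , here ([ p ] , _) = Y , e , inj₁ (here [ p ])
   ... | Y , e , here₁ (p ∷ [ q ] , na ∷ nf ∷ [ nh ]) = Y , e , inj₂ (here (p ∷ [ q ]) , missed)
    where
    missed : Missed Y h u
    missed z az u≼z z≼h with only z az u≼z z≼h
    ... | inj₁ refl = na
    ... | inj₂ (inj₁ refl) = nf
    ... | inj₂ (inj₂ refl) = nh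

  status-x : ∀ {u} → u ≼ x → Status u
  status-x {u} u≼x = closed record
   { X = Vec.toList xs ; small = ≤ᵇ⇒≤ 8 13 tt ; below = below-h
   ; covers = λ e ae u≼e e≼h → [ (λ { refl → ∈₆ }) , (λ { refl → ∈₀ }) ]′ (only e ae u≼e e≼h)
   ; Zero = (b ∷ [ x ]) ∷ [ a ∷ [ y ] ] ; Neg = [ f ∷ a ∷ [ c ] ]
   ; size-∈ = ∈₆
   ; unique₀ = b-x ∷ [ a-y ] ; unique₋ = [ f-a-c ]
   ; below₀ = b-x≼ ∷ [ a-y≼ ] ; below₋ = [ f-a-c≼ ] ; h∉ = [ h-f-a-c ] ; valid = valid }
   (commit-from pull-x (Direct.a≼h direct-x) only) (Direct.a≢h direct-x)
   where
   only = chain-leaf direct-x leaf-x u≼x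
   valid : ClosedIn u ((b ∷ [ x ]) ∷ [ a ∷ [ y ] ]) [ f ∷ a ∷ [ c ] ]
   valid C loc with match gadget-xᵖ xs dist kernels-hold C (musts-hit C loc)
   ... | Y , e , here (p ∷ [ q ] , _) = Y , e , inj₁ (here (p ∷ [ q ]))
   ... | Y , e , here₁ (p ∷ [ q ] , _) = Y , e , inj₁ (here₁ (p ∷ [ q ]))
   ... | Y , e , here₂ (p ∷ q ∷ [ r ] , nx ∷ [ nh ]) = Y , e , inj₂ (here (p ∷ q ∷ [ r ]) , missed)
    where
    missed : Missed Y h u
    missed z az u≼z z≼h with only z az u≼z z≼h
    ... | inj₁ refl = nx
    ... | inj₂ refl = nh

  status-f : ∀ {u} → (∀ e → Alive e → u ≼ e → e ≼ h → e ≡ f ⊎ e ≡ h) → Status u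
  status-f {u} only = closed record
   { X = Vec.toList xs ; small = ≤ᵇ⇒≤ 8 13 tt ; below = below-h
   ; covers = λ e ae u≼e e≼h → [ (λ { refl → ∈₁ }) , (λ { refl → ∈₀ }) ]′ (only e ae u≼e e≼h)
   ; Zero = [ f ∷ a ∷ [ c ] ] ; Neg = (b ∷ [ x ]) ∷ [ a ∷ [ y ] ]
   ; size-∈ = ∈₅
   ; unique₀ = [ f-a-c ] ; unique₋ = b-x ∷ [ a-y ]
   ; below₀ = [ f-a-c≼ ] ; below₋ = b-x≼ ∷ [ a-y≼ ] ; h∉ = h-b-x ∷ [ h-a-y ] ; valid = valid }
   (commit-from pull-f f≼h only) (Direct.a≢h direct-f)
   where
   missed : ∀ {Y} → ¬ T (Y f) → ¬ T (Y h) → Missed Y h u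
   missed nf nh z az u≼z z≼h with only z az u≼z z≼h
   ... | inj₁ refl = nf
   ... | inj₂ refl = nh
   valid : ClosedIn u [ f ∷ a ∷ [ c ] ] ((b ∷ [ x ]) ∷ [ a ∷ [ y ] ])
   valid C loc with match gadget-fᵖ xs dist kernels-hold C (musts-hit C loc)
   ... | Y , e , here (p ∷ q ∷ [ r ] , _) = Y , e , inj₁ (here (p ∷ q ∷ [ r ]))
   ... | Y , e , here₁ (p ∷ [ q ] , nf ∷ [ nh ]) = Y , e , inj₂ (here (p ∷ [ q ]) , missed {Y} nf nh)
   ... | Y , e , here₂ (p ∷ [ q ] , nf ∷ [ nh ]) =
    Y , e , inj₂ (here₁ (p ∷ [ q ]) , missed {Y} nf nh)

 pair-sym : ∀ {a b} → Pair a b → Pair b a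
 pair-sym (u , v , r , o) = u , v , r , λ e s → Sum.swap (o e s)

 mirror-ab mirror-cd : Gadget h → Gadget h
 mirror-ab G = record
  { f = f ; a = b ; b = a ; c = c ; d = d ; x = y ; y = x
  ; distinct = reorder distinct
  ; direct-f = direct-f ; direct-x = direct-y ; direct-y = direct-x ; leaf-x = leaf-y ; leaf-y = leaf-x
  ; direct-a = direct-b ; direct-b = direct-a ; direct-c = direct-c ; direct-d = direct-d
  ; leaf-a = leaf-b ; leaf-b = leaf-a ; leaf-c = leaf-c ; leaf-d = leaf-d
  ; below-f = λ e ae e≼f → swapped (below-f e ae e≼f)
  ; pair-ab = pair-sym pair-ab ; pair-cd = pair-cd ; path-ax = path-by ; path-by = path-ax
  ; via-f = λ u v r s → shuffle (via-f u v r s)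
  ; via-a = via-b ; via-b = via-a ; via-c = via-c ; via-d = via-d ; via-x = via-y ; via-y = via-x }
  where
  open Gadget G
  shuffle : ∀ {A B C : Set} → A ⊎ B ⊎ C → B ⊎ A ⊎ C
  shuffle (inj₁ p) = inj₂ (inj₁ p)
  shuffle (inj₂ (inj₁ p)) = inj₁ p
  shuffle (inj₂ (inj₂ p)) = inj₂ (inj₂ p)
  swapped : f ∷ a ∷ b ∷ c ∷ [ d ] ⊆ f ∷ b ∷ a ∷ c ∷ [ d ]
  swapped (here p) = here p
  swapped (here₁ p) = here₂ p
  swapped (here₂ p) = here₁ p
  swapped (there (there (there p))) = there (there (there p))
  reorder : ∀ {f a b c d x y} → Distinct (f ∷ a ∷ b ∷ c ∷ d ∷ x ∷ y ∷ [ h ]) →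
   Distinct (f ∷ b ∷ a ∷ c ∷ d ∷ y ∷ x ∷ [ h ])
  reorder ((fa , fb , fc , fd , fx , fy , fh , _) , (ab , ac , ad , ax , ay , ah , _) ,
   (bc , bd , bx , by , bh , _) , (cd , cx , cy , ch , _) , (dx , dy , dh , _) ,
   (xy , xh , _) , (yh , _) , _) =
   (fb , fa , fc , fd , fy , fx , fh , tt) , (ab ∘ sym , bc , bd , by , bx , bh , tt) ,
   (ac , ad , ay , ax , ah , tt) , (cd , cy , cx , ch , tt) , (dy , dx , dh , tt) ,
   (xy ∘ sym , yh , tt) , (xh , tt) , tt , tt
 mirror-cd G = record
  { f = f ; a = a ; b = b ; c = d ; d = c ; x = x ; y = y
  ; distinct = reorder distinct
  ; direct-f = direct-f ; direct-x = direct-x ; direct-y = direct-y ; leaf-x = leaf-x ; leaf-y = leaf-y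
  ; direct-a = direct-a ; direct-b = direct-b ; direct-c = direct-d ; direct-d = direct-c
  ; leaf-a = leaf-a ; leaf-b = leaf-b ; leaf-c = leaf-d ; leaf-d = leaf-c
  ; below-f = λ e ae e≼f → swapped (below-f e ae e≼f)
  ; pair-ab = pair-ab ; pair-cd = pair-sym pair-cd ; path-ax = path-ax ; path-by = path-by
  ; via-f = via-f ; via-a = via-a ; via-b = via-b ; via-c = via-d ; via-d = via-c ; via-x = via-x ; via-y = via-y }
  where
  open Gadget G
  swapped : f ∷ a ∷ b ∷ c ∷ [ d ] ⊆ f ∷ a ∷ b ∷ d ∷ [ c ]
  swapped (here p) = here p
  swapped (here₁ p) = here₁ p
  swapped (here₂ p) = here₂ p
  swapped (here₃ p) = here₄ p
  swapped (here₄ p) = here₃ p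
  reorder : ∀ {f a b c d x y} → Distinct (f ∷ a ∷ b ∷ c ∷ d ∷ x ∷ y ∷ [ h ]) →
   Distinct (f ∷ a ∷ b ∷ d ∷ c ∷ x ∷ y ∷ [ h ])
  reorder ((fa , fb , fc , fd , fx , fy , fh , _) , (ab , ac , ad , ax , ay , ah , _) ,
   (bc , bd , bx , by , bh , _) , (cd , cx , cy , ch , _) , (dx , dy , dh , _) ,
   (xy , xh , _) , (yh , _) , _) =
   (fa , fb , fd , fc , fx , fy , fh , tt) , (ab , ad , ac , ax , ay , ah , tt) ,
   (bd , bc , bx , by , bh , tt) , (cd ∘ sym , dx , dy , dh , tt) , (cx , cy , ch , tt) ,
   (xy , xh , tt) , (yh , tt) , tt , tt

 status-under : (G : Gadget h) → ∀ {u e} → e ∈ Gadget.a G ∷ Gadget.b G ∷ Gadget.c G ∷ Gadget.d G ∷ [] →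
  u ≼ e → Status u
 status-under G ∈₀ = GadgetStatus.status-a G
 status-under G ∈₁ = GadgetStatus.status-a (mirror-ab G)
 status-under G ∈₂ = GadgetStatus.status-c G
 status-under G ∈₃ = GadgetStatus.status-c (mirror-cd G)

 status-member : (G : Gadget h) → ∀ {u e} → e ∈ Gadget.members G → u ≼ e → Status u
 status-member G {u} ∈₀ u≼f
  with any? (λ e → T? (al e) ×-dec (T? (le u e) ×-dec (T? (le e (Gadget.f G)) ×-dec ¬? (e ≟ᶠ Gadget.f G))))
 ... | no none = GadgetStatus.status-f G only
  where
  open Gadget G
  only : ∀ e → Alive e → u ≼ e → e ≼ h → e ≡ f ⊎ e ≡ h
  only e ae u≼e e≼h with ≼-chain u≼e u≼f
  ... | inj₁ e≼f = inj₁ (decidable-stable (e ≟ᶠ f) λ e≢f → none (e , ae , u≼e , e≼f , e≢f))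
  ... | inj₂ f≼e = Direct.next direct-f e ae f≼e e≼h
 ... | yes (e , ae , u≼e , e≼f , e≢f) with Gadget.below-f G e ae e≼f
 ... | here e≡f = contradiction e≡f e≢f
 ... | there e∈ = status-under G e∈ u≼e
 status-member G (here₁ p) = status-under G (here p)
 status-member G (here₂ p) = status-under G (here₁ p)
 status-member G (here₃ p) = status-under G (here₂ p)
 status-member G (here₄ p) = status-under G (here₃ p)
 status-member G ∈₅ = GadgetStatus.status-x G
 status-member G ∈₆ = GadgetStatus.status-x (mirror-ab G)

 status-at : ∀ {u e} → Alive e → u ≼ e → e ≼ h → e ≢ h → Status u
 status-at {u} {e} ae u≼e e≼h e≢h with classify e ae e≼h e≢h
 ... | inj₁ p = status-plain p u≼e
 ... | inj₂ (G , e∈) = status-member G e∈ u≼e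

-- Requests between different children of a vertex

module Region {n} (I : Instance n) {root : Fin n} (tree : IsRooted (Instance.le I) root)
 (stuck : ¬ Rules.Step I root)
 (g : Fin n) (alive-g : Instance.Alive I g)
 (below : ∀ h → Instance.Alive I h → T (Instance.le I h g) → h ≢ g → Stars.Resolved I tree stuck h) where
 open Instance I
 open Exchange I
 open PatternMatch I
 open Rules I root
 open Sides I tree
 open IsRooted tree
 open Stars I tree stuck

 module Below {h} (dh : Direct g h) where
  private
   Q = below h (Direct.alive dh) (Direct.a≼h dh) (Direct.a≢h dh)
  open Star h (Direct.alive dh) Q public
  open Interface I tree stuck h (Direct.alive dh) Q public
  open Resolved Q public

  twin-plain : ∀ {a b} → Deg1 a b → Plain a
  twin-plain = Deg1.plain

  twin-nb : ∀ {a b} → Deg1 a b → Nb a b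
  twin-nb = Deg1.nb

  twin-only : ∀ {a b} → Deg1 a b → ∀ z → Nb a z → z ≡ b
  twin-only = Deg1.only

 module B = Below

 child-≢root : ∀ {h} → Direct g h → h ≢ root
 child-≢root dh refl = Direct.a≢h dh (≼-antisym (Direct.a≼h dh) (≼-root g))

 children : ∀ {h k} → Direct g h → Direct g k → h ≢ k → Incomparable h k
 children {h} {k} dh dk h≢k = below-k , below-h
  where
  below-k : ¬ h ≼ k
  below-k h≼k with Direct.next dh k (Direct.alive dk) h≼k (Direct.a≼h dk)
  ... | inj₁ k≡h = h≢k (sym k≡h)
  ... | inj₂ k≡g = Direct.a≢h dk k≡g
  below-h : ¬ k ≼ h
  below-h k≼h with Direct.next dk h (Direct.alive dh) k≼h (Direct.a≼h dh)
  ... | inj₁ h≡k = h≢k h≡k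
  ... | inj₂ h≡g = Direct.a≢h dh h≡g

 apart : ∀ {h k e e′} → Direct g h → Direct g k → h ≢ k → e ≼ h → e′ ≼ k → e ≢ e′
 apart dh dk h≢k e≼h e≼k refl = no-common (children dh dk h≢k) e≼h e≼k

 private
  greatest : ∀ {P : Fin n → Set} → (∀ e → Dec (P e)) → (∀ {e f} → P e → P f → e ≼ f ⊎ f ≼ e) →
   (l : List (Fin n)) → (∀ e → e ∈ l → ¬ P e) ⊎ ∃ λ m → P m × (∀ e → e ∈ l → P e → e ≼ m)
  greatest P? total [] = inj₁ λ _ ()
  greatest P? total (x ∷ l) with P? x | greatest P? total l
  ... | no ¬p | inj₁ none = inj₁ λ { e ∈₀ → ¬p ; e (there e∈) → none e e∈ }
  ... | no ¬p | inj₂ (m , pm , max) =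
   inj₂ (m , pm , λ { e ∈₀ p → ⊥-elim (¬p p) ; e (there e∈) p → max e e∈ p })
  ... | yes p | inj₁ none =
   inj₂ (x , p , λ { e ∈₀ _ → ≼-refl x ; e (there e∈) q → ⊥-elim (none e e∈ q) })
  ... | yes p | inj₂ (m , pm , max) with total p pm
  ... | inj₁ x≼m = inj₂ (m , pm , λ { e ∈₀ _ → x≼m ; e (there e∈) q → max e e∈ q })
  ... | inj₂ m≼x = inj₂ (x , p , λ { e ∈₀ _ → ≼-refl x ; e (there e∈) q → ≼-trans (max e e∈ q) m≼x })

 top′ : ∀ {u} → u ≼ g → (∀ e → Alive e → u ≼ e → e ≼ g → e ≡ g) ⊎ ∃ λ h → Direct g h × u ≼ h
 top′ {u} u≼g with greatest {λ e → Alive e × u ≼ e × e ≼ g × e ≢ g}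
  (λ e → T? (al e) ×-dec (T? (le u e) ×-dec (T? (le e g) ×-dec ¬? (e ≟ᶠ g))))
  (λ p q → ≼-chain (proj₁ (proj₂ p)) (proj₁ (proj₂ q))) (List.allFin n)
 ... | inj₁ none = inj₁ λ e ae u≼e e≼g → decidable-stable (e ≟ᶠ g) λ e≢g → none e (∈-allFin e) (ae , u≼e , e≼g , e≢g)
 ... | inj₂ (h , (ah , u≼h , h≼g , h≢g) , max) = inj₂ (h , dh , u≼h)
  where
  dh : Direct g h
  dh = record { alive = ah ; a≼h = h≼g ; a≢h = h≢g ; next = next }
   where
   next : ∀ e → Alive e → h ≼ e → e ≼ g → e ≡ h ⊎ e ≡ g
   next e ae h≼e e≼g with e ≟ᶠ g
   ... | yes e≡g = inj₂ e≡g
   ... | no e≢g = inj₁ (≼-antisym (max e (∈-allFin e) (ae , ≼-trans u≼h h≼e , e≼g , e≢g)) h≼e)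

 abstract
  top : ∀ {u} → u ≼ g → (∀ e → Alive e → u ≼ e → e ≼ g → e ≡ g) ⊎ ∃ λ h → Direct g h × u ≼ h
  top = top′

 data Kind {h} (dh : Direct g h) (u : Fin n) : Set where
  closed : Closed h u → Commit h u → Kind dh u
  leafᵏ : Leaf h → Kind dh u
  twinᵏ : ∀ {a b} → B.Deg1 dh a b → B.Deg1 dh b a → u ≼ a → Kind dh u

 kind′ : ∀ {h u} (dh : Direct g h) → u ≼ h → Kind dh u
 kind′ {h} {u} dh u≼h
  with any? (λ e → T? (al e) ×-dec (T? (le u e) ×-dec (T? (le e h) ×-dec ¬? (e ≟ᶠ h))))
 ... | yes (e , ae , u≼e , e≼h , e≢h) with B.status-at dh ae u≼e e≼h e≢h
 ... | Interface.closed c d _ = closed c d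
 ... | Interface.isolated A Z u≼a = twinᵏ A Z u≼a
 kind′ {h} {u} dh u≼h | no none with any? (λ e → T? (al e) ×-dec (T? (le e h) ×-dec ¬? (e ≟ᶠ h)))
 ... | no none′ = leafᵏ λ e ae e≼h → decidable-stable (e ≟ᶠ h) λ e≢h → none′ (e , ae , e≼h , e≢h)
 ... | yes (e , ae , e≼h , e≢h) = closed (B.closed-top dh (B.reserve dh (child-≢root dh) e ae e≼h e≢h) only)
  (B.commit-top dh only)
  where
  only : ∀ e → Alive e → u ≼ e → e ≼ h → e ≡ h
  only e ae u≼e e≼h = decidable-stable (e ≟ᶠ h) λ e≢h → none (e , ae , u≼e , e≼h , e≢h)

 abstract
  kind : ∀ {h u} (dh : Direct g h) → u ≼ h → Kind dh u
  kind = kind′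

 commit-of : ∀ {h u} (dh : Direct g h) → Kind dh u → Commit h u
 commit-of dh (closed _ d) = d
 commit-of dh (leafᵏ l) = B.commit-top dh λ e ae _ e≼h → l e ae e≼h
 commit-of dh (twinᵏ A Z u≼a) = B.commit-from dh (B.pull dh p) (B.plain-≼ dh p)
  (B.chain-leaf dh (B.direct dh p) (B.leaf dh p) u≼a)
  where p = B.twin-plain dh A

 -- An end y below the child t of g is what a request may use there: t itself
 -- if it is a leaf, or a member of an isolated pair.
 data End : Fin n → Fin n → Set where
  leafE : ∀ {y} → Direct g y → Leaf y → End y y
  twinE : ∀ {h y b} (dh : Direct g h) → B.Deg1 dh y b → B.Deg1 dh b y → End y h

 mate : ∀ {y t} → End y t → Fin n
 mate {y} (leafE _ _) = y
 mate (twinE {b = b} _ _ _) = b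

 directE : ∀ {y t} → End y t → Direct g t
 directE (leafE dy _) = dy
 directE (twinE dh _ _) = dh

 aliveE : ∀ {y t} → End y t → Alive y
 aliveE (leafE dy _) = Direct.alive dy
 aliveE (twinE dh A _) = Direct.alive (B.direct dh (B.twin-plain dh A))

 leafOfE : ∀ {y t} → End y t → Leaf y
 leafOfE (leafE _ ly) = ly
 leafOfE (twinE dh A _) = B.leaf dh (B.twin-plain dh A)

 y≼t : ∀ {y t} → End y t → y ≼ t
 y≼t (leafE _ _) = ≼-refl _
 y≼t (twinE dh A _) = B.plain-≼ dh (B.twin-plain dh A)

 mate≼t : ∀ {y t} (E : End y t) → mate E ≼ t
 mate≼t (leafE _ _) = ≼-refl _
 mate≼t (twinE dh _ Z) = B.plain-≼ dh (B.twin-plain dh Z)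

 dom : ∀ {y t} → End y t → List (Fin n)
 dom {y} {t} E = y ∷ t ∷ mate E ∷ []

 dom-≼ : ∀ {y t} (E : End y t) → All (_≼ t) (dom E)
 dom-≼ E = y≼t E ∷ ≼-refl _ ∷ mate≼t E ∷ []

 same-top : ∀ {y t s} → End y t → End y s → t ≡ s
 same-top {t = t} {s} E F = decidable-stable (t ≟ᶠ s) λ t≢s → apart (directE E) (directE F) t≢s (y≼t E) (y≼t F) refl

 away : ∀ {h t L e} → Direct g h → Direct g t → t ≢ h → All (_≼ h) L → e ≼ t → e ∉ L
 away dh dt t≢h (p ∷ ps) e≼t ∈₀ = apart dt dh t≢h e≼t p refl
 away dh dt t≢h (p ∷ ps) e≼t (there e∈) = away dh dt t≢h ps e≼t e∈

 -- For an end that is itself a child of `g` the vertices `y` and `t` coincide, so `only` may list a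
 -- vertex twice.
 record LinkAt (y t z s u v : Fin n) : Set where
  field
   only : ∀ e → Sep e u v → e ∈ y ∷ t ∷ z ∷ [ s ]
   t≢s : t ≢ s
   sep-y : Sep y u v
   sep-t : Sep t u v
   sep-z : Sep z u v
   sep-s : Sep s u v

 Link : Fin n → Fin n → Fin n → Fin n → Set
 Link y t z s = ∃₂ λ u v → Req u v × LinkAt y t z s u v

 link-flip : ∀ {y t z s u v} → LinkAt y t z s u v → LinkAt z s y t u v
 link-flip l = record { only = λ e x → rot (only e x) ; t≢s = t≢s ∘ sym
  ; sep-y = sep-z ; sep-t = sep-s ; sep-z = sep-y ; sep-s = sep-t }
  where
  open LinkAt l
  rot : ∀ {e y t z s : Fin n} → e ∈ y ∷ t ∷ z ∷ [ s ] → e ∈ z ∷ s ∷ y ∷ [ t ]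
  rot (here p) = here₂ p
  rot (here₁ p) = here₃ p
  rot (here₂ p) = here p
  rot (here₃ p) = here₁ p

 flip-link : ∀ {y t z s} → Link y t z s → Link z s y t
 flip-link (u , v , r , l) = u , v , r , link-flip l

 link-swap : ∀ {y t z s u v} → LinkAt y t z s u v → LinkAt y t z s v u
 link-swap l = record { only = λ e x → only e (sep-sym x) ; t≢s = t≢s ; sep-y = sep-sym sep-y
  ; sep-t = sep-sym sep-t ; sep-z = sep-sym sep-z ; sep-s = sep-sym sep-s }
  where open LinkAt l

 link-hit : ∀ {X C y t z s} → Link y t z s → y ∈ X → t ∈ X → z ∈ X → s ∈ X → LocalHit X C →
  (T (C y) ⊎ T (C t)) ⊎ (T (C z) ⊎ T (C s))
 link-hit {X} (u , v , r , l) y∈ t∈ z∈ s∈ loc with loc u v r (λ e x → inside (LinkAt.only l e x))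
  where
  inside : _ ⊆ X
  inside ∈₀ = y∈
  inside ∈₁ = t∈
  inside ∈₂ = z∈
  inside ∈₃ = s∈
 ... | e , x , c with LinkAt.only l e x
 ... | ∈₀ = inj₁ (inj₁ c)
 ... | ∈₁ = inj₁ (inj₂ c)
 ... | ∈₂ = inj₂ (inj₁ c)
 ... | ∈₃ = inj₂ (inj₂ c)

 -- A request inside g that leaves a child of g joins two ends.
 Crossing : Fin n → Fin n → Fin n → Set
 Crossing h u v = ∃₂ λ y z → ∃ λ s → End y h × End z s × LinkAt y h z s u v

 private
  -- A `Closed` side branches together with a `Commit` of the other side, and a request whose other
  -- end is at `g` itself has one side only. What admits no step is a request with a leaf or an
  -- isolated pair on both sides.
  cross-from : ∀ {h u v} → Req u v → (dh : Direct g h) → u ≼ h → ¬ v ≼ h → v ≼ g → Crossing h u v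
  cross-from {h} {u} {v} r dh u≼h v⋠h v≼g with top v≼g
  ... | inj₁ none = fire (commit-alone r v⋠h sides (commit-of dh (kind dh u≼h)))
   where
   sides : ∀ e → Sep e u v → e ≼ h
   sides e (ae , inj₁ (u≼e , v⋠e)) with ≼-chain u≼e u≼h
   ... | inj₁ e≼h = e≼h
   ... | inj₂ h≼e with ≼-chain h≼e (Direct.a≼h dh)
   ... | inj₂ g≼e = ⊥-elim (v⋠e (≼-trans v≼g g≼e))
   ... | inj₁ e≼g with Direct.next dh e ae h≼e e≼g
   ... | inj₁ refl = ≼-refl h
   ... | inj₂ refl = ⊥-elim (v⋠e v≼g)
   sides e (ae , inj₂ (v≼e , u⋠e)) with ≼-chain v≼e v≼g
   ... | inj₂ g≼e = ⊥-elim (u⋠e (≼-trans u≼h (≼-trans (Direct.a≼h dh) g≼e)))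
   ... | inj₁ e≼g with none e ae v≼e e≼g
   ... | refl = ⊥-elim (u⋠e (≼-trans u≼h (Direct.a≼h dh)))
  ... | inj₂ (k , dk , v≼k) = both (kind dh u≼h) (kind dk v≼k)
   where
   h≢k : h ≢ k
   h≢k refl = v⋠h v≼k
   inc = children dh dk h≢k
   u⋠k : ¬ u ≼ k
   u⋠k u≼k = no-common inc u≼h u≼k
   side : ∀ {p q k l} (dl : Direct g l) (dk : Direct g k) → l ≢ k → p ≼ l → q ≼ k → ∀ e → Alive e → p ≼ e → ¬ q ≼ e → e ≼ l
   side dl dk l≢k p≼l q≼k e ae p≼e q⋠e with ≼-chain p≼e p≼l
   ... | inj₁ e≼l = e≼l
   ... | inj₂ l≼e with ≼-chain l≼e (Direct.a≼h dl)
   ... | inj₂ g≼e = ⊥-elim (q⋠e (≼-trans q≼k (≼-trans (Direct.a≼h dk) g≼e)))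
   ... | inj₁ e≼g with Direct.next dl e ae l≼e e≼g
   ... | inj₁ refl = ≼-refl _
   ... | inj₂ refl = ⊥-elim (q⋠e (≼-trans q≼k (Direct.a≼h dk)))
   sides : ∀ e → Sep e u v → e ≼ h ⊎ e ≼ k
   sides e (ae , inj₁ (u≼e , v⋠e)) = inj₁ (side dh dk h≢k u≼h v≼k e ae u≼e v⋠e)
   sides e (ae , inj₂ (v≼e , u⋠e)) = inj₂ (side dk dh (h≢k ∘ sym) v≼k u≼h e ae v≼e u⋠e)

   EndAt : ∀ {h} → Direct g h → Fin n → Set
   EndAt {h} dh u = ∃ λ y → End y h × u ≼ y × (∀ e → Alive e → u ≼ e → e ≼ h → e ≡ y ⊎ e ≡ h)

   end-leaf : ∀ {h u} (dh : Direct g h) → u ≼ h → Leaf h → EndAt dh u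
   end-leaf dh u≼h l = _ , leafE dh l , u≼h , λ e ae _ e≼h → inj₁ (l e ae e≼h)

   end-twin : ∀ {h u a b} (dh : Direct g h) → B.Deg1 dh a b → B.Deg1 dh b a → u ≼ a → EndAt dh u
   end-twin dh A Z u≼a = _ , twinE dh A Z , u≼a , B.chain-leaf dh (B.direct dh p) (B.leaf dh p) u≼a
    where p = B.twin-plain dh A

   join : EndAt dh u → EndAt dk v → Crossing h u v
   join (y , Y , u≼y , onlyY) (z , Z , v≼z , onlyZ) = y , z , k , Y , Z , record
    { only = only ; t≢s = h≢k
    ; sep-y = aliveE Y , inj₁ (u≼y , λ v≼y → v⋠h (≼-trans v≼y (y≼t Y)))
    ; sep-t = Direct.alive dh , inj₁ (u≼h , v⋠h)
    ; sep-z = aliveE Z , inj₂ (v≼z , λ u≼z → u⋠k (≼-trans u≼z (y≼t Z)))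
    ; sep-s = Direct.alive dk , inj₂ (v≼k , u⋠k) }
    where
    only : ∀ e → Sep e u v → e ∈ y ∷ h ∷ z ∷ [ k ]
    only e (ae , inj₁ (u≼e , v⋠e)) with onlyY e ae u≼e (side dh dk h≢k u≼h v≼k e ae u≼e v⋠e)
    ... | inj₁ p = here p
    ... | inj₂ p = here₁ p
    only e (ae , inj₂ (v≼e , u⋠e)) with onlyZ e ae v≼e (side dk dh (h≢k ∘ sym) v≼k u≼h e ae v≼e u⋠e)
    ... | inj₁ p = here₂ p
    ... | inj₂ p = here₃ p

   both : Kind dh u → Kind dk v → Crossing h u v
   both (closed c _) kv = fire (closed-commit r v⋠h u⋠k inc sides c (commit-of dk kv))
   both ku@(leafᵏ _) (closed c _) =
    fire (closed-commit (req-sym {u} {v} r) u⋠k v⋠h (proj₂ inc , proj₁ inc)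
    (λ e x → Sum.swap (sides e (sep-sym x))) c (commit-of dh ku))
   both ku@(twinᵏ _ _ _) (closed c _) =
    fire (closed-commit (req-sym {u} {v} r) u⋠k v⋠h (proj₂ inc , proj₁ inc)
    (λ e x → Sum.swap (sides e (sep-sym x))) c (commit-of dh ku))
   both (leafᵏ l) (leafᵏ m) = join (end-leaf dh u≼h l) (end-leaf dk v≼k m)
   both (leafᵏ l) (twinᵏ A Z q) = join (end-leaf dh u≼h l) (end-twin dk A Z q)
   both (twinᵏ A Z p) (leafᵏ m) = join (end-twin dh A Z p) (end-leaf dk v≼k m)
   both (twinᵏ A Z p) (twinᵏ A′ Z′ q) = join (end-twin dh A Z p) (end-twin dk A′ Z′ q)

  inside-g : ∀ {h u v} → Direct g h → u ≼ h → ¬ Sep g u v → v ≼ g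
  inside-g {v = v} dh u≼h ns with T? (le v g)
  ... | yes v≼g = v≼g
  ... | no v⋠g = ⊥-elim (ns (alive-g , inj₁ (≼-trans u≼h (Direct.a≼h dh) , v⋠g)))

 cross′ : ∀ {h u v} → Req u v → Direct g h → Sep h u v → ¬ Sep g u v → Crossing h u v
 cross′ r dh (ah , inj₁ (u≼h , v⋠h)) ns = cross-from r dh u≼h v⋠h (inside-g dh u≼h ns)
 cross′ {h} {u} {v} r dh (ah , inj₂ (v≼h , u⋠h)) ns
  with cross-from (req-sym {u} {v} r) dh v≼h u⋠h (inside-g dh v≼h (ns ∘ sep-sym))
 ... | y , z , s , Y , Z , l = y , z , s , Y , Z , link-swap l

 abstract
  cross : ∀ {h u v} → Req u v → Direct g h → Sep h u v → ¬ Sep g u v → Crossing h u v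
  cross = cross′

 link-end : ∀ {y t z s u v x} → End y t → End z s → LinkAt y t z s u v → End x t → Sep x u v → x ≡ y
 link-end {y} {t} Y Z l X sx with LinkAt.only l _ sx
 ... | here p = p
 ... | ∈₁ = sym (leafOfE X y (aliveE Y) (y≼t Y))
 ... | ∈₂ = ⊥-elim (apart (directE Y) (directE Z) (LinkAt.t≢s l) (y≼t X) (y≼t Z) refl)
 ... | ∈₃ =
  ⊥-elim (apart (directE Y) (directE Z) (LinkAt.t≢s l) (y≼t X) (≼-refl _) refl)

 Partner : Fin n → Fin n → Fin n → Fin n → Set
 Partner y t u v = ∃₂ λ z s → End z s × LinkAt y t z s u v

 leave : ∀ {y t u v} → End y t → Req u v → Sep y u v → Sep t u v → ¬ Sep g u v → Partner y t u v
 leave Y r sy st ns with cross r (directE Y) st ns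
 ... | y′ , z , s , Y′ , Z , l with link-end Y′ Z l Y sy
 ... | refl = z , s , Z , l

 via-end : ∀ {y t} (Y : End y t) → ∀ u v → Req u v → Sep y u v →
  (Sep (mate Y) u v × mate Y ≢ y) ⊎ (Sep t u v × (Sep g u v ⊎ Partner y t u v))
 via-end Y@(leafE _ _) u v r sy with sep? g u v
 ... | yes sg = inj₂ (sy , inj₁ sg)
 ... | no ns = inj₂ (sy , inj₂ (leave Y r sy sy ns))
 via-end Y@(twinE dh A _) u v r sy with B.via₁ dh A u v r sy
 ... | inj₁ sb = inj₁ (sb , B.nb-≢ dh (B.twin-nb dh A) ∘ sym)
 ... | inj₂ st with sep? g u v
 ... | yes sg = inj₂ (st , inj₁ sg)
 ... | no ns = inj₂ (st , inj₂ (leave Y r sy st ns))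

 -- A link that is hit on this side is then hit by `y` itself, as `t` is not chosen without `y`.
 data Settled (C : Fin n → Bool) (y t : Fin n) : Set where
  inˢ : T (C y) → Settled C y t
  outˢ : ¬ T (C y) → ¬ T (C t) → Settled C y t

 settled-use : ∀ {C y t} → Settled C y t → T (C y) ⊎ T (C t) → T (C y)
 settled-use (inˢ p) _ = p
 settled-use (outˢ _ _) (inj₁ q) = q
 settled-use (outˢ _ n) (inj₂ q) = ⊥-elim (n q)

 settled-keep : ∀ {C D y t} → D y ≡ C y → D t ≡ C t → Settled C y t → Settled D y t
 settled-keep p q (inˢ c) = inˢ (subst T (sym p) c)
 settled-keep p q (outˢ m n) = outˢ (subst (¬_ ∘ T) (sym p) m) (subst (¬_ ∘ T) (sym q) n)

 moved : ∀ {y t} → End y t → List (Fin n)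
 moved {y} E = y ∷ mate E ∷ []

 moved-≼ : ∀ {y t} (E : End y t) → All (_≼ t) (moved E)
 moved-≼ E = y≼t E ∷ mate≼t E ∷ []

 t∉moved : ∀ {y t b} (dh : Direct g t) → B.Deg1 dh y b → B.Deg1 dh b y → t ∉ y ∷ [ b ]
 t∉moved dh A Z (here p) = B.h≢ dh (B.twin-plain dh A) p
 t∉moved dh A Z (here₁ p) = B.h≢ dh (B.twin-plain dh Z) p

 -- If `t` is chosen without `y` then the mate of `y` is chosen, and as `t` takes care of the
 -- requests that leave, `y` can replace the mate. Because `t` itself stays as it is, two pairs
 -- below the same child can be settled one after the other.
 settle′ : ∀ {X y t} (E : End y t) C → LocalHit X C → (dom E ⊆ X) →
  ∃ λ D → Exch (moved E) C D × Settled D y t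
 settle′ {y = y} (leafE _ _) C loc ⊆X with T? (C y)
 ... | yes c = C , exch-refl , inˢ c
 ... | no ¬c = C , exch-refl , outˢ ¬c ¬c
 settle′ {X} {y} {t} (twinE {b = b} dh A Z) C loc ⊆X with T? (C y) | T? (C t)
 ... | yes c | _ = C , exch-refl , inˢ c
 ... | no ¬c | no ¬d = C , exch-refl , outˢ ¬c ¬d
 ... | no ¬c | yes d with match pull-isoᵖ (Fr.xs) Fr.distinct
  (K₀ Fr.xs , K₀ Fr.xs , B.K₁ dh Fr.xs Z refl refl , tt) C
  (here d ∷ must Fr.xs C (B.hit-nb dh (B.twin-nb dh A) (⊆X ∈₀) (⊆X ∈₂) loc) ∷ [])
  where module Fr = B.Frame dh (B.iso-frame dh A Z)
 ... | D , x , here (dt ∷ [ dy ] , _) = D , exch off′ (cnt x) (hits x) , inˢ dy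
  where
  T-≡′ : ∀ {a b} → T a → T b → a ≡ b
  T-≡′ {true} {true} _ _ = refl
  off′ : ∀ e → e ∉ y ∷ [ b ] → D e ≡ C e
  off′ e e∉ with e ≟ᶠ t
  ... | yes refl = T-≡′ dt d
  ... | no e≢t = off x e λ { (here p) → e≢t p ; (there e∈) → e∉ e∈ }

 abstract
  settle : ∀ {X y t} (E : End y t) C → LocalHit X C → (dom E ⊆ X) →
   ∃ λ D → Exch (moved E) C D × Settled D y t
  settle = settle′

 data Tri (C : Fin n → Bool) (h a b : Fin n) : Set where
  topᵗ : T (C h) → Tri C h a b
  firstᵗ : T (C a) → ¬ T (C b) → ¬ T (C h) → Tri C h a b
  secondᵗ : T (C b) → ¬ T (C a) → ¬ T (C h) → Tri C h a b

 -- One of the two is chosen anyway, and if both are then one of them is traded for `h`.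
 tri′ : ∀ {X h a b} (dh : Direct g h) → B.Deg1 dh a b → B.Deg1 dh b a → ∀ C → LocalHit X C →
  (h ∷ a ∷ [ b ] ⊆ X) → ∃ λ D → Exch (h ∷ a ∷ [ b ]) C D × Tri D h a b
 tri′ dh A Z C loc ⊆X with match tri-twinᵖ Fr.xs Fr.distinct
  (K₀ Fr.xs , K₀ Fr.xs , B.K₁ dh Fr.xs Z refl refl , tt) C
  (must Fr.xs C (B.hit-nb dh (B.twin-nb dh A) (⊆X ∈₁) (⊆X ∈₂) loc) ∷ [])
  where module Fr = B.Frame dh (B.iso-frame dh A Z)
 ... | D , x , here ([ p ] , _) = D , x , topᵗ p
 ... | D , x , here₁ ([ p ] , q ∷ [ r ]) = D , x , secondᵗ p q r
 ... | D , x , here₂ ([ p ] , q ∷ [ r ]) = D , x , firstᵗ p q r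

 abstract
  tri : ∀ {X h a b} (dh : Direct g h) → B.Deg1 dh a b → B.Deg1 dh b a → ∀ C → LocalHit X C →
   (h ∷ a ∷ [ b ] ⊆ X) → ∃ λ D → Exch (h ∷ a ∷ [ b ]) C D × Tri D h a b
  tri = tri′

 infixr 5 _⨾_
 _⨾_ : ∀ {X C D E} → Exch X C D → Exch X D E → Exch X C E
 _⨾_ = exch-trans id

 keep-settled : ∀ {L C D y t} → Exch L C D → y ∉ L → t ∉ L → Settled C y t → Settled D y t
 keep-settled x y∉ t∉ = settled-keep (off x _ y∉) (off x _ t∉)

 twin-≼ : ∀ {h a b} (dh : Direct g h) → B.Deg1 dh a b → B.Deg1 dh b a → All (_≼ h) (h ∷ a ∷ [ b ])
 twin-≼ dh A Z = ≼-refl _ ∷ B.plain-≼ dh (B.twin-plain dh A) ∷ B.plain-≼ dh (B.twin-plain dh Z) ∷ []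

 far : ∀ {h L y t} (dh : Direct g h) → All (_≼ h) L → h ≢ t → End y t → y ∉ L × t ∉ L
 far dh L≼h h≢t Y = away dh (directE Y) (h≢t ∘ sym) L≼h (y≼t Y) , away dh (directE Y) (h≢t ∘ sym) L≼h (≼-refl _)

 far-settled : ∀ {h L C D y t} (dh : Direct g h) → All (_≼ h) L → h ≢ t → End y t → Exch L C D →
  Settled C y t → Settled D y t
 far-settled dh L≼h h≢t Y x = keep-settled x (proj₁ (far dh L≼h h≢t Y)) (proj₂ (far dh L≼h h≢t Y))

 -- Settling `z` changes nothing but `z` and its mate, so a free `y` remains settled.
 Free : ∀ {y t z s} → End y t → End z s → Set
 Free {y} {z = z} Y Z = y ≢ z × y ≢ mate Z

 free-settled : ∀ {y t z s C D} (Y : End y t) (Z : End z s) → Free Y Z → Exch (moved Z) C D →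
  Settled C y t → Settled D y t
 free-settled {y} {t} Y Z (y≢z , y≢m) x = keep-settled x
  (λ { (here p) → y≢z p ; (here₁ p) → y≢m p }) (away-top Z y≢z)
  where
  away-top : ∀ {z s} (Z : End z s) → y ≢ z → t ∉ moved Z
  away-top (leafE dz lz) y≢z ∈₀ = y≢z (lz y (aliveE Y) (y≼t Y))
  away-top (leafE dz lz) y≢z ∈₁ = y≢z (lz y (aliveE Y) (y≼t Y))
  away-top (twinE dk A B′) y≢z t∈ = t∉ t∈
   where
   not-child : ∀ {a b} → B.Deg1 dk a b → t ≢ a
   not-child A refl with Direct.next (directE Y) _ (Direct.alive dk) (B.plain-≼ dk (B.twin-plain dk A)) (Direct.a≼h dk)
   ... | inj₁ p = B.≢h dk (B.twin-plain dk A) (sym p)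
   ... | inj₂ p = Direct.a≢h dk p
   t∉ : t ∉ moved (twinE dk A B′)
   t∉ (here p) = not-child A p
   t∉ (here₁ p) = not-child B′ p

 hit-far : ∀ {X C y t z s} → Link y t z s → y ∈ X → t ∈ X → z ∈ X → s ∈ X → LocalHit X C →
  Settled C z s → ¬ T (C y) → ¬ T (C t) → T (C z)
 hit-far L y∈ t∈ z∈ s∈ loc sZ ¬y ¬t with link-hit L y∈ t∈ z∈ s∈ loc
 ... | inj₁ (inj₁ p) = ⊥-elim (¬y p)
 ... | inj₁ (inj₂ p) = ⊥-elim (¬t p)
 ... | inj₂ q = settled-use sZ q

 top-≢ : ∀ {y t z s} → Link y t z s → t ≢ s
 top-≢ (_ , _ , _ , l) = LinkAt.t≢s l

 -- Both members of a pair are linked to the same end `y`. Unless `h` is chosen, and with it the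
 -- reserve, one of `a` and `b` is not, and its link forces `y`: the sizes are 1 and 3.
 module F1 {h a b y t} (dh : Direct g h) (A : B.Deg1 dh a b) (Z : B.Deg1 dh b a) (Y : End y t)
  (L : Link a h y t) (M : Link b h y t) where
  R : B.Reserve dh (λ _ → ⊤)
  R = B.pair-reserve dh (child-≢root dh) A Z
  module R = B.Reserve dh R
  module S = B.Reset dh R.resets
  X : List (Fin n)
  X = dom Y ++ (h ∷ a ∷ [ b ]) ++ S.X
  Bs : List (List (Fin n))
  Bs = [ y ] ∷ [ h ∷ R.e₁ ∷ [ R.e₂ ] ]
  inP : h ∷ a ∷ [ b ] ⊆ X
  inP p = ∈-++⁺ʳ (dom Y) (∈-++⁺ˡ p)
  inS : S.X ⊆ X
  inS p = ∈-++⁺ʳ (dom Y) (∈-++⁺ʳ (h ∷ a ∷ [ b ]) p)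
  inM : moved Y ⊆ X
  inM (here p) = here p
  inM (here₁ p) = here₂ p
  valid : Valid X Bs
  valid C loc with settle Y C loc ∈-++⁺ˡ
  ... | C₁ , x₁ , s₁ with tri dh A Z C₁ (local-exch x₁ loc) inP
  ... | C₂ , x₂ , topᵗ ch with S.valid C₂ (local-mono inS (local-exch x₂ (local-exch x₁ loc))) ch
  ... | D , x₃ , ds = D , exch-mono inM x₁ ⨾ exch-mono inP x₂ ⨾ exch-mono inS x₃ , here₁ ds
  valid C loc | C₁ , x₁ , s₁ | C₂ , x₂ , firstᵗ _ ¬b ¬h =
   C₂ , exch-mono inM x₁ ⨾ exch-mono inP x₂ ,
   here (hit-far M (inP ∈₂) (inP ∈₀) ∈₀ ∈₁
   (local-exch x₂ (local-exch x₁ loc)) (far-settled dh (twin-≼ dh A Z) (top-≢ L) Y x₂ s₁) ¬b ¬h ∷ [])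
  valid C loc | C₁ , x₁ , s₁ | C₂ , x₂ , secondᵗ _ ¬a ¬h =
   C₂ , exch-mono inM x₁ ⨾ exch-mono inP x₂ ,
   here (hit-far L (inP ∈₁) (inP ∈₀) ∈₀ ∈₁
   (local-exch x₂ (local-exch x₁ loc)) (far-settled dh (twin-≼ dh A Z) (top-≢ L) Y x₂ s₁) ¬a ¬h ∷ [])

  result : Step
  result = branch record { X = X ; Bs = Bs ; size-∈ = ∈₁
   ; unique = ([] ∷ []) ∷ [ (R.h≢e₁ ∷ [ R.h≢e₂ ]) ∷ [ R.e₁≢e₂ ] ∷ [] ∷ [] ]
   ; small = ≤-trans (+-monoʳ-≤ 6 S.small) (≤ᵇ⇒≤ 15 window tt) ; valid = valid }

 moved⊆dom : ∀ {y t} (Y : End y t) {e} → e ∈ moved Y → e ∈ dom Y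
 moved⊆dom Y (here p) = here p
 moved⊆dom Y (here₁ p) = here₂ p

 -- A leaf with three links: it is chosen, or else all the three opposite ends are.
 module D3 {x y t z s w r} (X₀ : End x x) (Y : End y t) (Z : End z s) (W : End w r)
  (L : Link x x y t) (M : Link x x z s) (N : Link x x w r)
  (y≢z : Free Y Z) (y≢w : Free Y W) (z≢w : Free Z W) where
  X : List (Fin n)
  X = x ∷ dom Y ++ dom Z ++ dom W
  Bs : List (List (Fin n))
  Bs = [ x ] ∷ [ y ∷ z ∷ [ w ] ]
  inY : dom Y ⊆ X
  inY p = there (∈-++⁺ˡ p)
  inZ : dom Z ⊆ X
  inZ p = there (∈-++⁺ʳ (dom Y) (∈-++⁺ˡ p))
  inW : dom W ⊆ X
  inW p = there (∈-++⁺ʳ (dom Y) (∈-++⁺ʳ (dom Z) p))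
  valid : Valid X Bs
  valid C loc with settle Y C loc inY
  ... | C₁ , x₁ , s₁ with settle Z C₁ (local-exch x₁ loc) inZ
  ... | C₂ , x₂ , s₂ with settle W C₂ (local-exch x₂ (local-exch x₁ loc)) inW
  ... | C₃ , x₃ , s₃ = C₃ , ex , pick (T? (C₃ x))
   where
   loc₃ = local-exch x₃ (local-exch x₂ (local-exch x₁ loc))
   ex : Exch X C C₃
   ex = exch-mono (inY ∘ moved⊆dom Y) x₁ ⨾ exch-mono (inZ ∘ moved⊆dom Z) x₂ ⨾ exch-mono (inW ∘ moved⊆dom W) x₃
   pick : Dec (T (C₃ x)) → Any (All (T ∘ C₃)) Bs
   pick (yes c) = here [ c ]
   pick (no ¬c) = there (here
    (hit-far L ∈₀ ∈₀ (inY ∈₀) (inY ∈₁) loc₃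
    (free-settled Y W y≢w x₃ (free-settled Y Z y≢z x₂ s₁)) ¬c ¬c ∷
    hit-far M ∈₀ ∈₀ (inZ ∈₀) (inZ ∈₁) loc₃
    (free-settled Z W z≢w x₃ s₂) ¬c ¬c ∷
    hit-far N ∈₀ ∈₀ (inW ∈₀) (inW ∈₁) loc₃ s₃ ¬c ¬c ∷ []))

  result : Step
  result = branch record { X = X ; Bs = Bs ; size-∈ = ∈₁
   ; unique = ([] ∷ []) ∷ [ (proj₁ y≢z ∷ proj₁ y≢w ∷ []) ∷ (proj₁ z≢w ∷ []) ∷ [] ∷ [] ]
   ; small = ≤ᵇ⇒≤ 10 window tt ; valid = valid }

 -- One member of a pair has two links: `a` is chosen, or else its mate and both opposite ends are.
 module RuleA {h a b y t z s} (dh : Direct g h) (A : B.Deg1 dh a b) (E : B.Deg1 dh b a)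
  (Y : End y t) (Z : End z s) (L : Link a h y t) (M : Link a h z s) (y≢z : Free Y Z) where
  P : List (Fin n)
  P = h ∷ a ∷ [ b ]
  X : List (Fin n)
  X = P ++ dom Y ++ dom Z
  Bs : List (List (Fin n))
  Bs = [ a ] ∷ [ b ∷ y ∷ [ z ] ]
  inP : P ⊆ X
  inP = ∈-++⁺ˡ
  inY : dom Y ⊆ X
  inY p = ∈-++⁺ʳ P (∈-++⁺ˡ p)
  inZ : dom Z ⊆ X
  inZ p = ∈-++⁺ʳ P (∈-++⁺ʳ (dom Y) p)
  T₀ : End a h
  T₀ = twinE dh A E
  T⊆P : dom T₀ ⊆ P
  T⊆P (here p) = here₁ p
  T⊆P (here₁ p) = here p
  T⊆P (here₂ p) = here₂ p
  valid : Valid X Bs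
  valid C loc with settle Y C loc inY
  ... | C₁ , x₁ , s₁ with settle Z C₁ (local-exch x₁ loc) inZ
  ... | C₂ , x₂ , s₂ with settle T₀ C₂ (local-exch x₂ (local-exch x₁ loc)) (inP ∘ T⊆P)
  ... | C₃ , x₃ , s₃ = C₃ , ex , pick s₃
   where
   loc₃ = local-exch x₃ (local-exch x₂ (local-exch x₁ loc))
   ex : Exch X C C₃
   ex = exch-mono (inY ∘ moved⊆dom Y) x₁ ⨾ exch-mono (inZ ∘ moved⊆dom Z) x₂ ⨾
    exch-mono (inP ∘ T⊆P ∘ moved⊆dom T₀) x₃
   pick : Settled C₃ a h → Any (All (T ∘ C₃)) Bs
   pick (inˢ c) = here [ c ]
   pick (outˢ ¬a ¬h) = there (here (cb ∷
    hit-far L (inP ∈₁) (inP ∈₀) (inY ∈₀) (inY ∈₁) loc₃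
    (far-settled dh (moved-≼ T₀) (top-≢ L) Y x₃ (free-settled Y Z y≢z x₂ s₁)) ¬a ¬h ∷
    hit-far M (inP ∈₁) (inP ∈₀) (inZ ∈₀) (inZ ∈₁) loc₃
    (far-settled dh (moved-≼ T₀) (top-≢ M) Z x₃ s₂) ¬a ¬h ∷ []))
    where
    cb : T (C₃ b)
    cb with B.hit-nb dh (B.twin-nb dh A) (inP ∈₁) (inP ∈₂) loc₃
    ... | inj₁ c = ⊥-elim (¬a c)
    ... | inj₂ c = c

  result : Step
  result = branch record { X = X ; Bs = Bs ; size-∈ = ∈₁
   ; unique = ([] ∷ []) ∷ [ (b≢ Y L ∷ b≢ Z M ∷ []) ∷ (proj₁ y≢z ∷ []) ∷ [] ∷ [] ]
   ; small = ≤ᵇ⇒≤ 9 window tt ; valid = valid }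
   where
   b≢ : ∀ {y t} (Y : End y t) → Link a h y t → b ≢ y
   b≢ Y L = apart dh (directE Y) (top-≢ L) (mate≼t T₀) (y≼t Y)

 -- The tight case, of sizes 2, 2 and 4. If `h` is not chosen, exactly one of `a` and `b` is, and
 -- the link of the other one forces its partner. If `h` is chosen then so are `a` and a reserve
 -- away from the pair, which is the reason for the predicate in `Reserve`.
 module F2 {h a b x t y s} (dh : Direct g h) (A : B.Deg1 dh a b) (E : B.Deg1 dh b a)
  (X₀ : End x t) (Y₀ : End y s) (L : Link a h x t) (M : Link b h y s)
  (R : B.Reserve dh (λ e → e ≢ a × e ≢ b)) where
  module R = B.Reserve dh R
  module S = B.Reset dh R.resets
  P : List (Fin n)
  P = h ∷ a ∷ [ b ]
  X : List (Fin n)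
  X = P ++ dom X₀ ++ dom Y₀ ++ S.X
  Bs : List (List (Fin n))
  Bs = (a ∷ [ y ]) ∷ (b ∷ [ x ]) ∷ [ h ∷ a ∷ R.e₁ ∷ [ R.e₂ ] ]
  inP : P ⊆ X
  inP = ∈-++⁺ˡ
  inX : dom X₀ ⊆ X
  inX p = ∈-++⁺ʳ P (∈-++⁺ˡ p)
  inY : dom Y₀ ⊆ X
  inY p = ∈-++⁺ʳ P (∈-++⁺ʳ (dom X₀) (∈-++⁺ˡ p))
  inS : S.X ⊆ X
  inS p = ∈-++⁺ʳ P (∈-++⁺ʳ (dom X₀) (∈-++⁺ʳ (dom Y₀) p))
  T₀ : End a h
  T₀ = twinE dh A E
  T⊆P : dom T₀ ⊆ P
  T⊆P (here p) = here₁ p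
  T⊆P (here₁ p) = here p
  T⊆P (here₂ p) = here₂ p
  ∉T : ∀ {e} → e ≢ a × e ≢ b → e ∉ a ∷ [ b ]
  ∉T (p , q) (here e≡a) = p e≡a
  ∉T (p , q) (here₁ e≡b) = q e≡b

  far-off : ∀ {C D e y t} (Y : End y t) → h ≢ t → e ≼ h → Exch (moved Y) C D → T (C e) → T (D e)
  far-off Y h≢t e≼h x = keep x (away (directE Y) dh h≢t (moved-≼ Y) e≼h)

  far-not : ∀ {C D e y t} (Y : End y t) → h ≢ t → e ≼ h → Exch (moved Y) C D → ¬ T (C e) → ¬ T (D e)
  far-not Y h≢t e≼h x = subst (¬_ ∘ T) (sym (off x _ (away (directE Y) dh h≢t (moved-≼ Y) e≼h)))

  a≼h = y≼t T₀
  b≼h = mate≼t T₀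

  valid : Valid X Bs
  valid C loc with tri dh A E C loc inP
  ... | C₁ , x₁ , topᵗ ch with S.valid C₁ (local-mono inS (local-exch x₁ loc)) ch
  ... | C₂ , x₂ , dh′ ∷ d₁ ∷ [ d₂ ] with settle T₀ C₂ (local-exch x₂ (local-exch x₁ loc)) (inP ∘ T⊆P)
  ... | C₃ , x₃ , s₃ = C₃ , exch-mono inP x₁ ⨾ exch-mono inS x₂ ⨾ exch-mono (inP ∘ T⊆P ∘ moved⊆dom T₀) x₃ ,
   here₂ (ch₃ ∷ settled-use s₃ (inj₂ ch₃) ∷ keep x₃ (∉T R.P₁) d₁ ∷ keep x₃ (∉T R.P₂) d₂ ∷ [])
   where ch₃ = keep x₃ (t∉moved dh A E) dh′
  valid C loc | C₁ , x₁ , firstᵗ ca ¬b ¬h with settle Y₀ C₁ (local-exch x₁ loc) inY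
  ... | C₂ , x₂ , s₂ = C₂ , exch-mono inP x₁ ⨾ exch-mono (inY ∘ moved⊆dom Y₀) x₂ ,
   here (far-off Y₀ (top-≢ M) a≼h x₂ ca ∷
   hit-far M (inP ∈₂) (inP ∈₀) (inY ∈₀) (inY ∈₁)
   (local-exch x₂ (local-exch x₁ loc)) s₂
   (far-not Y₀ (top-≢ M) b≼h x₂ ¬b) (far-not Y₀ (top-≢ M) (≼-refl h) x₂ ¬h) ∷ [])
  valid C loc | C₁ , x₁ , secondᵗ cb ¬a ¬h with settle X₀ C₁ (local-exch x₁ loc) inX
  ... | C₂ , x₂ , s₂ = C₂ , exch-mono inP x₁ ⨾ exch-mono (inX ∘ moved⊆dom X₀) x₂ ,
   there (here (far-off X₀ (top-≢ L) b≼h x₂ cb ∷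
   hit-far L (inP ∈₁) (inP ∈₀) (inX ∈₀) (inX ∈₁)
   (local-exch x₂ (local-exch x₁ loc)) s₂
   (far-not X₀ (top-≢ L) a≼h x₂ ¬a) (far-not X₀ (top-≢ L) (≼-refl h) x₂ ¬h) ∷ []))

  result : Step
  result = branch record { X = X ; Bs = Bs ; size-∈ = ∈₆
   ; unique = ((apart dh (directE Y₀) (top-≢ M) a≼h (y≼t Y₀) ∷ []) ∷ [] ∷ []) ∷
   ((apart dh (directE X₀) (top-≢ L) b≼h (y≼t X₀) ∷ []) ∷ [] ∷ []) ∷
   ((B.h≢ dh (B.twin-plain dh A) ∷ R.h≢e₁ ∷ [ R.h≢e₂ ]) ∷
   (proj₁ R.P₁ ∘ sym ∷ proj₁ R.P₂ ∘ sym ∷ []) ∷ [ R.e₁≢e₂ ] ∷ [] ∷ []) ∷ []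
   ; small = ≤-trans (+-monoʳ-≤ 9 S.small) (≤ᵇ⇒≤ 18 window tt) ; valid = valid }

 record Twins (f a b c d : Fin n) : Set where
  field
   dh : Direct g f
   A : B.Deg1 dh a b
   E : B.Deg1 dh b a
   C′ : B.Deg1 dh c d
   D′ : B.Deg1 dh d c
   c≢a : c ≢ a
   c≢b : c ≢ b
   only : ∀ e → Alive e → e ≼ f → e ∈ f ∷ a ∷ b ∷ c ∷ [ d ]

  a≢d : a ≢ d
  a≢d refl = c≢b (B.twin-only dh A c (B.twin-nb dh D′))
  b≢d : b ≢ d
  b≢d refl = c≢a (B.twin-only dh E c (B.twin-nb dh D′))

 swapˡ : ∀ {f a b c d} → Twins f a b c d → Twins f b a c d
 swapˡ {f} {a} {b} {c} {d} Q = record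
  { dh = dh ; A = E ; E = A ; C′ = C′ ; D′ = D′ ; c≢a = c≢b ; c≢b = c≢a ; only = λ e ae l → move (only e ae l) }
  where
  open Twins Q
  move : f ∷ a ∷ b ∷ c ∷ [ d ] ⊆ f ∷ b ∷ a ∷ c ∷ [ d ]
  move (here p) = here p
  move (here₁ p) = here₂ p
  move (here₂ p) = here₁ p
  move (there (there (there p))) = there (there (there p))

 swapʳ : ∀ {f a b c d} → Twins f a b c d → Twins f a b d c
 swapʳ {f} {a} {b} {c} {d} Q = record
  { dh = dh ; A = A ; E = E ; C′ = D′ ; D′ = C′ ; c≢a = a≢d ∘ sym ; c≢b = b≢d ∘ sym ; only = λ e ae l → move (only e ae l) }
  where
  open Twins Q
  move : f ∷ a ∷ b ∷ c ∷ [ d ] ⊆ f ∷ a ∷ b ∷ d ∷ [ c ]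
  move (here p) = here p
  move (here₁ p) = here₁ p
  move (here₂ p) = here₂ p
  move (here₃ p) = here₄ p
  move (here₄ p) = here₃ p

 module Two {f a b c d} (H : Twins f a b c d) where
  open Twins H public
  P : List (Fin n)
  P = f ∷ a ∷ b ∷ c ∷ [ d ]
  Ta : End a f
  Ta = twinE dh A E
  Tb : End b f
  Tb = twinE dh E A
  Tc : End c f
  Tc = twinE dh C′ D′
  Td : End d f
  Td = twinE dh D′ C′
  ab⊆P : f ∷ a ∷ [ b ] ⊆ P
  ab⊆P (here p) = here p
  ab⊆P (here₁ p) = here₁ p
  ab⊆P (here₂ p) = here₂ p
  a⊆P : dom Ta ⊆ P
  a⊆P (here p) = here₁ p
  a⊆P (here₁ p) = here p
  a⊆P (here₂ p) = here₂ p
  c⊆P : dom Tc ⊆ P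
  c⊆P (here p) = here₃ p
  c⊆P (here₁ p) = here p
  c⊆P (here₂ p) = here₄ p
  f≢a : f ≢ a
  f≢a = B.h≢ dh (B.twin-plain dh A)
  f≢b : f ≢ b
  f≢b = B.h≢ dh (B.twin-plain dh E)
  f≢c : f ≢ c
  f≢c = B.h≢ dh (B.twin-plain dh C′)
  f≢d : f ≢ d
  f≢d = B.h≢ dh (B.twin-plain dh D′)
  a≢b : a ≢ b
  a≢b = B.nb-≢ dh (B.twin-nb dh A)
  c≢d : c ≢ d
  c≢d = B.nb-≢ dh (B.twin-nb dh C′)

  c-or-d : ∀ {X C} → LocalHit X C → (P ⊆ X) → ¬ T (C c) → T (C d)
  c-or-d loc ⊆X ¬c with B.hit-nb dh (B.twin-nb dh C′) (⊆X (c⊆P ∈₀)) (⊆X (c⊆P ∈₂)) loc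
  ... | inj₁ p = ⊥-elim (¬c p)
  ... | inj₂ p = p

  far-off : ∀ {L C D e t} → Direct g t → f ≢ t → All (_≼ t) L → e ≼ f → Exch L C D → T (C e) → T (D e)
  far-off dt f≢t L≼t e≼f x = keep x (away dt dh f≢t L≼t e≼f)

  far-not : ∀ {L C D e t} → Direct g t → f ≢ t → All (_≼ t) L → e ≼ f → Exch L C D → ¬ T (C e) → ¬ T (D e)
  far-not dt f≢t L≼t e≼f x = subst (¬_ ∘ T) (sym (off x _ (away dt dh f≢t L≼t e≼f)))

  -- The branching is on `c`, which a chosen `f` brings along. Without `c` both `d` and `z` are
  -- chosen, and exactly one of `a` and `b`, together with the partner of the other one. These are
  -- the sizes 1, 4 and 4; `z` has to be free so that it counts separately.
  module F3 {x t y s z r} (X₀ : End x t) (Y₀ : End y s) (Z₀ : End z r)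
   (L : Link a f x t) (M : Link b f y s) (N : Link c f z r) (zx : Free Z₀ X₀) (zy : Free Z₀ Y₀) where
   X : List (Fin n)
   X = P ++ dom X₀ ++ dom Y₀ ++ dom Z₀
   Bs : List (List (Fin n))
   Bs = [ c ] ∷ (d ∷ z ∷ b ∷ [ x ]) ∷ [ d ∷ z ∷ a ∷ [ y ] ]
   inP : P ⊆ X
   inP = ∈-++⁺ˡ
   inX : dom X₀ ⊆ X
   inX p = ∈-++⁺ʳ P (∈-++⁺ˡ p)
   inY : dom Y₀ ⊆ X
   inY p = ∈-++⁺ʳ P (∈-++⁺ʳ (dom X₀) (∈-++⁺ˡ p))
   inZ : dom Z₀ ⊆ X
   inZ p = ∈-++⁺ʳ P (∈-++⁺ʳ (dom X₀) (∈-++⁺ʳ (dom Y₀) p))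

   finish : ∀ {p q w k} C → LocalHit X C → (Q : End q f) (W : End w k) → q ∈ P → f ≢ k → Link q f w k →
    p ≼ f → (dom W ⊆ X) → Free Z₀ W →
    T (C p) → ¬ T (C q) → ¬ T (C f) → ¬ T (C c) →
    ∃ λ D → Exch X C D × All (T ∘ D) (d ∷ z ∷ p ∷ [ w ])
   finish C loc Q W q∈ f≢k K p≼f inW free cp ¬q ¬f ¬c with settle Z₀ C loc inZ
   ... | C₁ , x₁ , s₁ with settle W C₁ (local-exch x₁ loc) inW
   ... | C₂ , x₂ , s₂ = C₂ , exch-mono (inZ ∘ moved⊆dom Z₀) x₁ ⨾ exch-mono (inW ∘ moved⊆dom W) x₂ ,
    through (y≼t Td) (c-or-d loc inP ¬c) ∷
    hit-far N (inP (c⊆P ∈₀)) (inP ∈₀) (inZ ∈₀) (inZ ∈₁) loc₂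
    (free-settled Z₀ W free x₂ s₁) (through-not (y≼t Tc) ¬c) (through-not (≼-refl f) ¬f) ∷
    through p≼f cp ∷
    hit-far K (inP q∈) (inP ∈₀) (inW ∈₀) (inW ∈₁) loc₂ s₂
    (through-not (y≼t Q) ¬q) (through-not (≼-refl f) ¬f) ∷ []
    where
    loc₂ = local-exch x₂ (local-exch x₁ loc)
    through : ∀ {e} → e ≼ f → T (C e) → T (C₂ e)
    through e≼f = far-off (directE W) f≢k (moved-≼ W) e≼f x₂ ∘ far-off (directE Z₀) (top-≢ N) (moved-≼ Z₀) e≼f x₁
    through-not : ∀ {e} → e ≼ f → ¬ T (C e) → ¬ T (C₂ e)
    through-not e≼f = far-not (directE W) f≢k (moved-≼ W) e≼f x₂ ∘ far-not (directE Z₀) (top-≢ N) (moved-≼ Z₀) e≼f x₁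

   valid : Valid X Bs
   valid C loc with tri dh A E C loc (inP ∘ ab⊆P)
   ... | C₁ , x₁ , topᵗ cf with settle Tc C₁ (local-exch x₁ loc) (inP ∘ c⊆P)
   ... | C₂ , x₂ , s₂ = C₂ , exch-mono (inP ∘ ab⊆P) x₁ ⨾ exch-mono (inP ∘ c⊆P ∘ moved⊆dom Tc) x₂ ,
    here (settled-use s₂ (inj₂ (keep x₂ (t∉moved dh C′ D′) cf)) ∷ [])
   valid C loc | C₁ , x₁ , firstᵗ ca ¬b ¬f with T? (C₁ c)
   ... | yes cc = C₁ , exch-mono (inP ∘ ab⊆P) x₁ , here [ cc ]
   ... | no ¬c with finish C₁ (local-exch x₁ loc) Tb Y₀ ∈₂ (top-≢ M) M (y≼t Ta) inY zy ca ¬b ¬f ¬c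
   ... | C₂ , x₂ , q = C₂ , exch-mono (inP ∘ ab⊆P) x₁ ⨾ x₂ , here₂ q
   valid C loc | C₁ , x₁ , secondᵗ cb ¬a ¬f with T? (C₁ c)
   ... | yes cc = C₁ , exch-mono (inP ∘ ab⊆P) x₁ , here [ cc ]
   ... | no ¬c with finish C₁ (local-exch x₁ loc) Ta X₀ ∈₁ (top-≢ L) L (y≼t Tb) inX zx cb ¬a ¬f ¬c
   ... | C₂ , x₂ , q = C₂ , exch-mono (inP ∘ ab⊆P) x₁ ⨾ x₂ , here₁ q

   result : Step
   result = branch record { X = X ; Bs = Bs
    ; size-∈ = ∈₇
    ; unique = ([] ∷ []) ∷
    ((off-z Td ∷ b≢d ∘ sym ∷ apart dh (directE X₀) (top-≢ L) (y≼t Td) (y≼t X₀) ∷ []) ∷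
    (off-z Tb ∘ sym ∷ proj₁ zx ∷ []) ∷ (apart dh (directE X₀) (top-≢ L) (y≼t Tb) (y≼t X₀) ∷ []) ∷ [] ∷ []) ∷
    ((off-z Td ∷ a≢d ∘ sym ∷ apart dh (directE Y₀) (top-≢ M) (y≼t Td) (y≼t Y₀) ∷ []) ∷
    (off-z Ta ∘ sym ∷ proj₁ zy ∷ []) ∷ (apart dh (directE Y₀) (top-≢ M) (y≼t Ta) (y≼t Y₀) ∷ []) ∷ [] ∷ []) ∷ []
    ; small = ≤ᵇ⇒≤ 14 window tt ; valid = valid }
    where
    off-z : ∀ {q} → End q f → q ≢ z
    off-z Q = apart dh (directE Z₀) (top-≢ N) (y≼t Q) (y≼t Z₀)

  -- W is what has to be looked at to see that w is in a solution without x.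
  module F8 {x t y s w} (X₀ : End x t) (Y₀ : End y s) (L : Link a f x t) (M : Link b f y s)
   (via-a : Via a λ S → S b ⊎ (S f × (S x ⊎ S g)))
   (via-d : Via d λ S → S c ⊎ (S f × S g))
   (via-f : Via f λ S → S x ⊎ S b ⊎ S c ⊎ S g)
   {k} (dk : Direct g k) (f≢k : f ≢ k) (w≼k : w ≼ k)
   (W : List (Fin n)) (W≼ : All (_≼ k) W) (W-small : length W ≤ 6)
   (block : ∀ C → LocalHit (x ∷ W) C → ¬ T (C x) → ∃ λ D → Exch W C D × T (D w)) where
   Q : List (Fin n)
   Q = f ∷ a ∷ b ∷ c ∷ d ∷ x ∷ [ g ]
   X : List (Fin n)
   X = Q ++ dom X₀ ++ dom Y₀ ++ W
   Bs : List (List (Fin n))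
   Bs = (b ∷ [ x ]) ∷ (a ∷ [ y ]) ∷ [ f ∷ a ∷ c ∷ [ w ] ]
   inQ : Q ⊆ X
   inQ = ∈-++⁺ˡ
   inP : P ⊆ X
   inP p = inQ (∈-++⁺ˡ p)
   inX : dom X₀ ⊆ X
   inX p = ∈-++⁺ʳ Q (∈-++⁺ˡ p)
   inY : dom Y₀ ⊆ X
   inY p = ∈-++⁺ʳ Q (∈-++⁺ʳ (dom X₀) (∈-++⁺ˡ p))
   inW : W ⊆ X
   inW p = ∈-++⁺ʳ Q (∈-++⁺ʳ (dom X₀) (∈-++⁺ʳ (dom Y₀) p))
   inW′ : x ∷ W ⊆ X
   inW′ ∈₀ = inX ∈₀
   inW′ (there p) = inW p

   xs : Vec (Fin n) 7
   xs = f ∷ a ∷ b ∷ c ∷ d ∷ x ∷ [ g ]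

   away-x : ∀ {e} → e ≼ f → e ≢ x
   away-x e≼f = apart dh (directE X₀) (top-≢ L) e≼f (y≼t X₀)
   below-g : ∀ {e t} → Direct g t → e ≼ t → e ≢ g
   below-g dt e≼t refl = Direct.a≢h dt (≼-antisym (Direct.a≼h dt) e≼t)

   distinct : Distinct xs
   distinct = (f≢a , f≢b , f≢c , f≢d , away-x (≼-refl f) , Direct.a≢h dh , tt) ,
    (a≢b , c≢a ∘ sym , a≢d , away-x (y≼t Ta) , below-g dh (y≼t Ta) , tt) ,
    (c≢b ∘ sym , b≢d , away-x (y≼t Tb) , below-g dh (y≼t Tb) , tt) ,
    (c≢d , away-x (y≼t Tc) , below-g dh (y≼t Tc) , tt) ,
    (away-x (y≼t Td) , below-g dh (y≼t Td) , tt) , (below-g (directE X₀) (y≼t X₀) , tt) , tt , tt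

   Kernel : Fin 7 → Set
   Kernel i = ∀ u v → Req u v → Sep (lookup xs i) u v →
    Any (All (λ j → Sep (lookup xs j) u v)) (lookup (Checked.kernels f8ᵖ) i)
   kf : Kernel 0F
   kf u v r s with via-f u v r s
   ... | inj₁ p = here [ p ]
   ... | inj₂ (inj₁ p) = here₁ [ p ]
   ... | inj₂ (inj₂ (inj₁ p)) = here₂ [ p ]
   ... | inj₂ (inj₂ (inj₂ p)) = here₃ [ p ]
   ka : Kernel 1F
   ka u v r s with via-a u v r s
   ... | inj₁ p = here [ p ]
   ... | inj₂ (p , inj₁ q) = here₁ (p ∷ [ q ])
   ... | inj₂ (p , inj₂ q) = here₂ (p ∷ [ q ])
   kd : Kernel 4F
   kd u v r s with via-d u v r s
   ... | inj₁ p = here [ p ]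
   ... | inj₂ (p , q) = here₁ (p ∷ [ q ])

   valid : Valid X Bs
   valid C loc with tri dh A E C loc (inP ∘ ab⊆P)
   ... | C₁ , x₁ , topᵗ cf with T? (C₁ x)
   ... | yes cx with match f8ᵖ xs distinct
    (kf , ka , K₀ xs , K₀ xs , kd , K₀ xs , K₀ xs , tt) C₁
    (here cf ∷ here cx ∷
    must xs C₁ (B.hit-nb dh (B.twin-nb dh A) (inP ∈₁) (inP ∈₂) (local-exch x₁ loc)) ∷
    must xs C₁ (B.hit-nb dh (B.twin-nb dh C′) (inP (c⊆P ∈₀)) (inP (c⊆P ∈₂)) (local-exch x₁ loc)) ∷ [])
   ... | C₂ , x₂ , here (q ∷ [ q′ ] , _) =
    C₂ , exch-mono (inP ∘ ab⊆P) x₁ ⨾ exch-mono inQ x₂ , here (q ∷ [ q′ ])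
   valid C loc | C₁ , x₁ , topᵗ cf | no ¬x with block C₁ (local-mono inW′ (local-exch x₁ loc)) ¬x
   ... | C₂ , x₂ , cw with settle Ta C₂ (local-exch x₂ (local-exch x₁ loc)) (inP ∘ a⊆P)
   ... | C₃ , x₃ , s₃ with settle Tc C₃ (local-exch x₃ (local-exch x₂ (local-exch x₁ loc))) (inP ∘ c⊆P)
   ... | C₄ , x₄ , s₄ =
    C₄ , exch-mono (inP ∘ ab⊆P) x₁ ⨾ exch-mono inW x₂ ⨾ exch-mono (inP ∘ a⊆P ∘ moved⊆dom Ta) x₃ ⨾
    exch-mono (inP ∘ c⊆P ∘ moved⊆dom Tc) x₄ ,
    there (there (here (cf₄ ∷ keep x₄ a∉ (settled-use s₃ (inj₂ cf₃)) ∷ settled-use s₄ (inj₂ cf₄) ∷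
    keep x₄ (away dh dk (f≢k ∘ sym) (moved-≼ Tc) w≼k) (keep x₃ (away dh dk (f≢k ∘ sym) (moved-≼ Ta) w≼k) cw) ∷ [])))
    where
    cf₃ = keep x₃ (t∉moved dh A E) (far-off dk f≢k W≼ (≼-refl f) x₂ cf)
    cf₄ = keep x₄ (t∉moved dh C′ D′) cf₃
    a∉ : a ∉ c ∷ [ d ]
    a∉ (here p) = c≢a (sym p)
    a∉ (here₁ p) = a≢d p
   valid C loc | C₁ , x₁ , firstᵗ ca ¬b ¬f with settle Y₀ C₁ (local-exch x₁ loc) inY
   ... | C₂ , x₂ , s₂ = C₂ , exch-mono (inP ∘ ab⊆P) x₁ ⨾ exch-mono (inY ∘ moved⊆dom Y₀) x₂ ,
    there (here (far-off (directE Y₀) (top-≢ M) (moved-≼ Y₀) (y≼t Ta) x₂ ca ∷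
    hit-far M (inP ∈₂) (inP ∈₀) (inY ∈₀) (inY ∈₁)
    (local-exch x₂ (local-exch x₁ loc)) s₂ (far-not (directE Y₀) (top-≢ M) (moved-≼ Y₀) (y≼t Tb) x₂ ¬b)
    (far-not (directE Y₀) (top-≢ M) (moved-≼ Y₀) (≼-refl f) x₂ ¬f) ∷ []))
   valid C loc | C₁ , x₁ , secondᵗ cb ¬a ¬f with settle X₀ C₁ (local-exch x₁ loc) inX
   ... | C₂ , x₂ , s₂ = C₂ , exch-mono (inP ∘ ab⊆P) x₁ ⨾ exch-mono (inX ∘ moved⊆dom X₀) x₂ ,
    here (far-off (directE X₀) (top-≢ L) (moved-≼ X₀) (y≼t Tb) x₂ cb ∷
    hit-far L (inP ∈₁) (inP ∈₀) (inX ∈₀) (inX ∈₁)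
    (local-exch x₂ (local-exch x₁ loc)) s₂ (far-not (directE X₀) (top-≢ L) (moved-≼ X₀) (y≼t Ta) x₂ ¬a)
    (far-not (directE X₀) (top-≢ L) (moved-≼ X₀) (≼-refl f) x₂ ¬f) ∷ [])

   result : Step
   result = branch record { X = X ; Bs = Bs ; size-∈ = ∈₆
    ; unique = ((away-x (y≼t Tb) ∷ []) ∷ [] ∷ []) ∷
    ((apart dh (directE Y₀) (top-≢ M) (y≼t Ta) (y≼t Y₀) ∷ []) ∷ [] ∷ []) ∷
    ((f≢a ∷ f≢c ∷ apart dh dk f≢k (≼-refl f) w≼k ∷ []) ∷ (c≢a ∘ sym ∷ apart dh dk f≢k (y≼t Ta) w≼k ∷ []) ∷
    (apart dh dk f≢k (y≼t Tc) w≼k ∷ []) ∷ [] ∷ []) ∷ []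
    ; small = ≤-trans (+-monoʳ-≤ 13 W-small) (≤ᵇ⇒≤ 19 window tt) ; valid = valid }

  -- The leaf `x` is a partner of both `a` and `c`. If `a` is chosen without `b` and `f`, then so is
  -- `y`; should `c` be missing, then `d` and `x` are chosen and give way to `c` and `g`.
  module F4 {x y s} (dx : Direct g x) (lx : Leaf x) (Y₀ : End y s)
   (L : Link a f x x) (M : Link b f y s) (N : Link c f x x) (x≢y : x ≢ y)
   (via-d : Via d λ S → S c ⊎ S y ⊎ S g)
   (via-x : Via x λ S → S a ⊎ S c ⊎ S g) where
   X₀ : End x x
   X₀ = leafE dx lx
   Q : List (Fin n)
   Q = f ∷ a ∷ b ∷ c ∷ d ∷ x ∷ [ g ]
   X : List (Fin n)
   X = Q ++ dom Y₀
   Bs : List (List (Fin n))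
   Bs = (x ∷ [ b ]) ∷ (a ∷ c ∷ [ y ]) ∷ [ f ∷ a ∷ [ c ] ]
   inP : P ⊆ X
   inP p = ∈-++⁺ˡ {xs = Q} (∈-++⁺ˡ {xs = P} p)
   x∈ : x ∈ X
   x∈ = ∈₅
   inY : dom Y₀ ⊆ X
   inY p = ∈-++⁺ʳ Q p
   xs : Vec (Fin n) 6
   xs = a ∷ c ∷ d ∷ x ∷ y ∷ [ g ]
   inXs : Vec.toList xs ⊆ X
   inXs (here p) = inP (here₁ p)
   inXs (here₁ p) = inP (here₃ p)
   inXs (here₂ p) = inP (here₄ p)
   inXs ∈₃ = x∈
   inXs (here₄ p) = inY (here p)
   inXs (here₅ p) = ∈-++⁺ˡ {xs = Q} (here₆ p)

   away-x : ∀ {e} → e ≼ f → e ≢ x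
   away-x e≼f = apart dh dx (top-≢ L) e≼f (≼-refl x)
   away-y : ∀ {e} → e ≼ f → e ≢ y
   away-y e≼f = apart dh (directE Y₀) (top-≢ M) e≼f (y≼t Y₀)
   below-g : ∀ {e t} → Direct g t → e ≼ t → e ≢ g
   below-g dt e≼t refl = Direct.a≢h dt (≼-antisym (Direct.a≼h dt) e≼t)

   distinct : Distinct xs
   distinct = (c≢a ∘ sym , a≢d , away-x (y≼t Ta) , away-y (y≼t Ta) , below-g dh (y≼t Ta) , tt) ,
    (c≢d , away-x (y≼t Tc) , away-y (y≼t Tc) , below-g dh (y≼t Tc) , tt) ,
    (away-x (y≼t Td) , away-y (y≼t Td) , below-g dh (y≼t Td) , tt) ,
    (x≢y , below-g dx (≼-refl x) , tt) , (below-g (directE Y₀) (y≼t Y₀) , tt) , tt , tt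

   Kernel : Fin 6 → Set
   Kernel i = ∀ u v → Req u v → Sep (lookup xs i) u v →
    Any (All (λ j → Sep (lookup xs j) u v)) (lookup (Checked.kernels f4ᵖ) i)
   kd : Kernel 2F
   kd u v r s with via-d u v r s
   ... | inj₁ p = here [ p ]
   ... | inj₂ (inj₁ p) = here₁ [ p ]
   ... | inj₂ (inj₂ p) = here₂ [ p ]
   kx : Kernel 3F
   kx u v r s with via-x u v r s
   ... | inj₁ p = here [ p ]
   ... | inj₂ (inj₁ p) = here₁ [ p ]
   ... | inj₂ (inj₂ p) = here₂ [ p ]

   x-hit : ∀ {C q} → q ∈ P → Link q f x x → LocalHit X C → ¬ T (C q) → ¬ T (C f) → T (C x)
   x-hit {C} q∈ K loc ¬q ¬f with T? (C x)
   ... | yes cx = cx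
   ... | no ¬x = hit-far K (inP q∈) (inP ∈₀) x∈ x∈ loc (outˢ ¬x ¬x) ¬q ¬f

   valid : Valid X Bs
   valid C loc with tri dh A E C loc (inP ∘ ab⊆P)
   ... | C₁ , x₁ , topᵗ cf with settle Ta C₁ (local-exch x₁ loc) (inP ∘ a⊆P)
   ... | C₂ , x₂ , s₂ with settle Tc C₂ (local-exch x₂ (local-exch x₁ loc)) (inP ∘ c⊆P)
   ... | C₃ , x₃ , s₃ =
    C₃ , exch-mono (inP ∘ ab⊆P) x₁ ⨾ exch-mono (inP ∘ a⊆P ∘ moved⊆dom Ta) x₂ ⨾ exch-mono (inP ∘ c⊆P ∘ moved⊆dom Tc) x₃ ,
    here₂ (cf₃ ∷ keep x₃ a∉ (settled-use s₂ (inj₂ cf₂)) ∷ settled-use s₃ (inj₂ cf₃) ∷ [])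
    where
    cf₂ = keep x₂ (t∉moved dh A E) cf
    cf₃ = keep x₃ (t∉moved dh C′ D′) cf₂
    a∉ : a ∉ c ∷ [ d ]
    a∉ (here p) = c≢a (sym p)
    a∉ (here₁ p) = a≢d p
   valid C loc | C₁ , x₁ , secondᵗ cb ¬a ¬f =
    C₁ , exch-mono (inP ∘ ab⊆P) x₁ , here (x-hit ∈₁ L (local-exch x₁ loc) ¬a ¬f ∷ [ cb ])
   valid C loc | C₁ , x₁ , firstᵗ ca ¬b ¬f with settle Y₀ C₁ (local-exch x₁ loc) inY
   ... | C₂ , x₂ , s₂ with T? (C₂ c)
   ... | yes cc = C₂ , exch-mono (inP ∘ ab⊆P) x₁ ⨾ exch-mono (inY ∘ moved⊆dom Y₀) x₂ ,
    there (here (far-off (directE Y₀) (top-≢ M) (moved-≼ Y₀) (y≼t Ta) x₂ ca ∷ cc ∷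
    hit-far M (inP ∈₂) (inP ∈₀) (inY ∈₀) (inY ∈₁)
    (local-exch x₂ (local-exch x₁ loc)) s₂ (far-not (directE Y₀) (top-≢ M) (moved-≼ Y₀) (y≼t Tb) x₂ ¬b)
    (far-not (directE Y₀) (top-≢ M) (moved-≼ Y₀) (≼-refl f) x₂ ¬f) ∷ []))
   ... | no ¬c with match f4ᵖ xs distinct
    (K₀ xs , K₀ xs , kd , kx , K₀ xs , K₀ xs , tt) C₂
    (here (far-off (directE Y₀) (top-≢ M) (moved-≼ Y₀) (y≼t Ta) x₂ ca) ∷
    here (c-or-d (local-exch x₂ (local-exch x₁ loc)) inP ¬c) ∷
    here (x-hit ∈₃ N (local-exch x₂ (local-exch x₁ loc)) ¬c
    (far-not (directE Y₀) (top-≢ M) (moved-≼ Y₀) (≼-refl f) x₂ ¬f)) ∷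
    here (hit-far M (inP ∈₂) (inP ∈₀) (inY ∈₀) (inY ∈₁)
    (local-exch x₂ (local-exch x₁ loc)) s₂ (far-not (directE Y₀) (top-≢ M) (moved-≼ Y₀) (y≼t Tb) x₂ ¬b)
    (far-not (directE Y₀) (top-≢ M) (moved-≼ Y₀) (≼-refl f) x₂ ¬f)) ∷ [])
   ... | C₃ , x₃ , here (q ∷ q′ ∷ [ q″ ] , _) =
    C₃ , exch-mono (inP ∘ ab⊆P) x₁ ⨾ exch-mono (inY ∘ moved⊆dom Y₀) x₂ ⨾ exch-mono inXs x₃ ,
    here₁ (q ∷ q′ ∷ [ q″ ])

   result : Step
   result = branch record { X = X ; Bs = Bs ; size-∈ = ∈₄
    ; unique = ((away-x (y≼t Tb) ∘ sym ∷ []) ∷ [] ∷ []) ∷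
    ((c≢a ∘ sym ∷ away-y (y≼t Ta) ∷ []) ∷ (away-y (y≼t Tc) ∷ []) ∷ [] ∷ []) ∷
    ((f≢a ∷ [ f≢c ]) ∷ (c≢a ∘ sym ∷ []) ∷ [] ∷ []) ∷ []
    ; small = ≤ᵇ⇒≤ 10 window tt ; valid = valid }

 Silent : Fin n → Fin n → Set
 Silent y t = ∀ u v → Req u v → Sep y u v → Sep t u v → Sep g u v

 partner? : ∀ {y t} → End y t → (∃₂ λ z s → End z s × Link y t z s) ⊎ Silent y t
 partner? {y} {t} Y with any? (λ u → any? λ v → req? u v ×-dec (sep? y u v ×-dec (sep? t u v ×-dec ¬? (sep? g u v))))
 ... | no none = inj₂ λ u v r sy st → decidable-stable (sep? g u v) λ ns → none (u , v , r , sy , st , ns)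
 ... | yes (u , v , r , sy , st , ns) with leave Y r sy st ns
 ... | z , s , Z , l = inj₁ (z , s , Z , u , v , r , l)

 -- If `x` were the mate of `z`, both members of a pair would be linked to `y`, which is the
 -- situation of `F1`.
 free : ∀ {x t z s y q} (X : End x t) (Z : End z s) → End y q → x ≢ z → Link x t y q → Link z s y q → Free X Z
 free X (leafE _ _) Y x≢z L M = x≢z , x≢z
 free {x} X Z@(twinE {b = b} ds A E) Y x≢z L M = x≢z , λ x≡b → mates x≡b X L
  where
  mates : x ≡ b → End x _ → Link x _ _ _ → ⊥
  mates refl X L with same-top X (twinE ds E A)
  ... | refl = stuck (F1.result ds A E Y M L)

 -- Two partners would be free of each other, and then `RuleA` branches on `a`.
 unique-partner : ∀ {h a b x t z s} (dh : Direct g h) → B.Deg1 dh a b → B.Deg1 dh b a →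
  End x t → End z s → Link a h x t → Link a h z s → z ≡ x
 unique-partner {z = z} {s} dh A E X Z L M = decidable-stable (z ≟ᶠ _) λ z≢x →
  stuck (RuleA.result dh A E X Z L M (free X Z (twinE dh A E) (z≢x ∘ sym) (flip-link L) (flip-link M)))

 Tied : Fin n → Fin n → Fin n → Fin n → Set
 Tied a b f x = Via a λ S → S b ⊎ (S f × (S x ⊎ S g))

 tied : ∀ {h a b x t} (dh : Direct g h) → B.Deg1 dh a b → B.Deg1 dh b a → End x t → Link a h x t → Tied a b h x
 tied dh A E X L u v r sa with via-end (twinE dh A E) u v r sa
 ... | inj₁ (sb , _) = inj₁ sb
 ... | inj₂ (sh , inj₁ sg) = inj₂ (sh , inj₂ sg)
 ... | inj₂ (sh , inj₂ (z , s , Z , l)) with unique-partner dh A E X Z L (u , v , r , l)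
 ... | refl = inj₂ (sh , inj₁ (LinkAt.sep-z l))

 lonely : ∀ {h a b} (dh : Direct g h) → B.Deg1 dh a b → Silent a h →
  Via a λ S → S b ⊎ (S h × S g)
 lonely dh A none u v r sa with B.via₁ dh A u v r sa
 ... | inj₁ sb = inj₁ sb
 ... | inj₂ sh = inj₂ (sh , none u v r sa sh)

 collect : ∀ {m} {P : Fin m → Set} {Q : Set} → (∀ i → P i ⊎ Q) → (∀ i → P i) ⊎ Q
 collect {zero} f = inj₁ λ ()
 collect {suc m} f with f zero | collect (f ∘ suc)
 ... | inj₂ q | _ = inj₂ q
 ... | inj₁ _ | inj₂ q = inj₂ q
 ... | inj₁ p | inj₁ r = inj₁ λ { zero → p ; (suc i) → r i }

 record Torn (h : Fin n) : Set where
  field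
   {a b x t y s} : Fin n
   dh : Direct g h
   A : B.Deg1 dh a b
   E : B.Deg1 dh b a
   X₀ : End x t
   Y₀ : End y s
   L : Link a h x t
   M : Link b h y s

 -- Suppose that in every pair below `h` that is linked at all, one mate has no partner inside `g`.
 -- Then the linked member can be chosen in place of its mate whenever `h` is in a solution, and `h`
 -- is deletable in favour of `g`.
 torn : ∀ {h} (dh : Direct g h) → ¬ Leaf h → Torn h
 torn {h} dh ¬leaf with collect {Q = Torn h} (λ u → collect {P = λ v → Req u v → Sep h u v → Sep g u v ⊎ ∃ λ a → Sep a u v × Good h g a} (at u))
  where
  at : ∀ u v → (Req u v → Sep h u v → Sep g u v ⊎ ∃ λ a → Sep a u v × Good h g a) ⊎ Torn h
  at u v with req? u v ×-dec (sep? h u v ×-dec ¬? (sep? g u v))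
  ... | no none = inj₁ λ r sh → inj₁ (decidable-stable (sep? g u v) λ ns → none (r , sh , ns))
  ... | yes (r , sh , ns) with cross r dh sh ns
  ... | a , z , s , leafE _ l , Z , l′ = ⊥-elim (¬leaf l)
  ... | a , z , s , twinE {b = b} dh′ A E , Z , l = by (partner? (twinE dh′ E A))
   where
   by : (∃₂ λ y s → End y s × Link b h y s) ⊎ Silent b h → _
   by (inj₁ (y , s′ , Y , M)) = inj₂ record { dh = dh′ ; A = A ; E = E ; X₀ = Z ; Y₀ = Y ; L = u , v , r , l ; M = M }
   by (inj₂ none) = inj₁ λ _ _ → inj₂ (a , LinkAt.sep-y l , B.≢h dh′ (B.twin-plain dh′ A) , b ,
    B.nb-≢ dh′ (B.twin-nb dh′ E) , B.≢h dh′ (B.twin-plain dh′ E) , edge-pair (proj₁ (B.twin-nb dh′ A)) ,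
    λ u v r sb → lonely dh′ E none u v r sb)
 ... | inj₂ t = t
 ... | inj₁ all = fire (delete h g record { alive = Direct.alive dh ; ≢root = child-≢root dh ; ≢g = Direct.a≢h dh
  ; replaced = all })

 module Quad {f a b c d} (Q : Twins f a b c d) where
  open Two Q using (dh; A; E; D′; only; Ta; f≢a; module F8)

  end-below : ∀ {e} → End e f → e ∈ a ∷ b ∷ c ∷ [ d ]
  end-below Y@(leafE _ l) = ⊥-elim (f≢a (sym (l a (aliveE Ta) (y≼t Ta))))
  end-below Y@(twinE dh′ A′ _) with only _ (aliveE Y) (y≼t Y)
  ... | here p = ⊥-elim (B.h≢ dh′ (B.twin-plain dh′ A′) (sym p))
  ... | there p = p

  leaving : Via f λ S → S g ⊎ ∃ λ e → e ∈ a ∷ b ∷ c ∷ [ d ] × S e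
  leaving u v r sf with sep? g u v
  ... | yes sg = inj₁ sg
  ... | no ns with cross r dh sf ns
  ... | e , z , s , Y , Z , l = inj₂ (e , end-below Y , LinkAt.sep-y l)

  -- A request through `p` and `f` has one end below `p` and the other one outside of `f`, and
  -- neither is below `q`.
  never-both : ∀ {p q} (P′ : B.Deg1 dh p q) → B.Deg1 dh q p → ∀ {u v} → Sep p u v → Sep f u v → ¬ Sep q u v
  never-both {p} {q} P′ Q′ {u} {v} sp sf sq = clash sp sf sq
   where
   pp = B.twin-plain dh P′
   pq = B.twin-plain dh Q′
   p≢q = B.nb-≢ dh (B.twin-nb dh P′)
   not-both : ∀ {u} → u ≼ p → u ≼ q → ⊥
   not-both u≼p u≼q with ≼-chain u≼p u≼q
   ... | inj₁ p≼q = p≢q (B.leaf dh pq p (Direct.alive (B.direct dh pp)) p≼q)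
   ... | inj₂ q≼p = p≢q (sym (B.leaf dh pp q (Direct.alive (B.direct dh pq)) q≼p))
   clash : ∀ {u v} → Sep p u v → Sep f u v → Sep q u v → ⊥
   clash (_ , inj₁ (u≼p , _)) _ (_ , inj₁ (u≼q , _)) = not-both u≼p u≼q
   clash (_ , inj₂ (v≼p , _)) _ (_ , inj₂ (v≼q , _)) = not-both v≼p v≼q
   clash (_ , inj₁ (u≼p , _)) (_ , inj₁ (_ , v⋠f)) (_ , inj₂ (v≼q , _)) = v⋠f (≼-trans v≼q (B.plain-≼ dh pq))
   clash (_ , inj₁ (u≼p , _)) (_ , inj₂ (_ , u⋠f)) (_ , inj₂ _) = u⋠f (≼-trans u≼p (B.plain-≼ dh pp))
   clash (_ , inj₂ (v≼p , _)) (_ , inj₂ (_ , u⋠f)) (_ , inj₁ (u≼q , _)) = u⋠f (≼-trans u≼q (B.plain-≼ dh pq))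
   clash (_ , inj₂ (v≼p , _)) (_ , inj₁ (_ , v⋠f)) (_ , inj₁ _) = v⋠f (≼-trans v≼p (B.plain-≼ dh pp))

  pass : ∀ {p q w} (P′ : B.Deg1 dh p q) → B.Deg1 dh q p → Tied p q f w → ∀ u v → Req u v → Sep p u v → Sep f u v →
   Sep w u v ⊎ Sep g u v
  pass P′ Q′ tie u v r sp sf with tie u v r sp
  ... | inj₁ sq = ⊥-elim (never-both P′ Q′ sp sf sq)
  ... | inj₂ (_ , sw) = sw

  module Untied {x t y s} (X₀ : End x t) (Y₀ : End y s) (L : Link a f x t) (M : Link b f y s)
   (x≢y : x ≢ y) (silent : Silent d f) where
   tie-a = tied dh A E X₀ L
   tie-b = tied dh E A Y₀ M
   via-d = lonely dh D′ silent

   via-f : Via f λ S → (S a × S x) ⊎ (S b × S y) ⊎ S c ⊎ S g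
   via-f u v r sf with leaving u v r sf
   ... | inj₁ sg = inj₂ (inj₂ (inj₂ sg))
   ... | inj₂ (_ , ∈₂ , sc) = inj₂ (inj₂ (inj₁ sc))
   ... | inj₂ (_ , ∈₃ , sd) = inj₂ (inj₂ (inj₂ (silent u v r sd sf)))
   ... | inj₂ (_ , ∈₀ , sa) with pass A E tie-a u v r sa sf
   ... | inj₁ sx = inj₁ (sa , sx)
   ... | inj₂ sg = inj₂ (inj₂ (inj₂ sg))
   via-f u v r sf | inj₂ (_ , ∈₁ , sb) with pass E A tie-b u v r sb sf
   ... | inj₁ sy = inj₂ (inj₁ (sb , sy))
   ... | inj₂ sg = inj₂ (inj₂ (inj₂ sg))

   via-f′ : Via f λ S → S x ⊎ S b ⊎ S c ⊎ S g
   via-f′ u v r sf with via-f u v r sf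
   ... | inj₁ (_ , sx) = inj₁ sx
   ... | inj₂ (inj₁ (sb , _)) = inj₂ (inj₁ sb)
   ... | inj₂ (inj₂ p) = inj₂ (inj₂ p)

   fire-twin : ∀ {m} (dt : Direct g t) → B.Deg1 dt x m → B.Deg1 dt m x → Step
   fire-twin {m} dt P′ Q′ = F8.result {w = m} X₀ Y₀ L M tie-a via-d via-f′ dt (top-≢ L) (B.plain-≼ dt (B.twin-plain dt Q′)) [ m ]
    (B.plain-≼ dt (B.twin-plain dt Q′) ∷ []) (≤ᵇ⇒≤ 1 6 tt) block
    where
    block : ∀ C → LocalHit (x ∷ [ m ]) C → ¬ T (C x) → ∃ λ D → Exch [ m ] C D × T (D m)
    block C loc ¬x with B.hit-nb dt (B.twin-nb dt P′) ∈₀ ∈₁ loc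
    ... | inj₁ cx = ⊥-elim (¬x cx)
    ... | inj₂ cm = C , exch-refl , cm

   fire-link : ∀ {z k} (Z : End z k) → t ≡ x → Link x x z k → f ≢ k → Step
   fire-link {z} {k} Z refl N f≢k = F8.result {w = z} X₀ Y₀ L M tie-a via-d via-f′ (directE Z) f≢k (y≼t Z) (dom Z) (dom-≼ Z) (≤ᵇ⇒≤ 3 6 tt) block
    where
    block : ∀ C → LocalHit (x ∷ dom Z) C → ¬ T (C x) → ∃ λ D → Exch (dom Z) C D × T (D z)
    block C loc ¬x with settle Z C loc there
    ... | C₁ , x₁ , s₁ = C₁ , exch-mono (moved⊆dom Z) x₁ ,
     hit-far N ∈₀ ∈₀ ∈₁ ∈₂ (local-exch x₁ loc) s₁ ¬x₁ ¬x₁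
     where
     ¬x₁ = subst (¬_ ∘ T) (sym (off x₁ x (away (directE Z) (directE X₀) (top-≢ N) (moved-≼ Z) (≼-refl x)))) ¬x

   record Bound : Set where
    field
     top-x : t ≡ x
     leaf : Leaf x
     via-x : Via x λ S → S a ⊎ S c ⊎ S g

   -- Otherwise `F8` applies: if `x` is a member of a pair then its mate serves as `w`, and if the
   -- leaf `x` has a partner other than `a` and `c` then this one does. Either is chosen in a
   -- solution without `x`.
   bound : Bound
   bound = go X₀ refl
    where
    go : ∀ {t′} (X : End x t′) → t ≡ t′ → Bound
    go (twinE dt P′ Q′) refl = fire (fire-twin dt P′ Q′)
    go X@(leafE dx lx) refl
     with any? (λ u → any? λ v → req? u v ×-dec (sep? x u v ×-dec (¬? (sep? g u v) ×-dec (¬? (sep? a u v) ×-dec ¬? (sep? c u v)))))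
    ... | yes (u , v , r , sx , ns , na , nc) with leave X r sx sx ns
    ... | z , k , Z , l = fire (fire-link Z refl (u , v , r , l) f≢k)
     where
     f≢k : f ≢ k
     f≢k refl with end-below Z
     ... | ∈₀ = na (LinkAt.sep-z l)
     ... | ∈₁ = x≢y (unique-partner dh E A Y₀ X₀ M (flip-link (u , v , r , l)))
     ... | ∈₂ = nc (LinkAt.sep-z l)
     ... | ∈₃ = ns (silent u v r (LinkAt.sep-z l) (LinkAt.sep-s l))
    go X@(leafE dx lx) refl | no none = record { top-x = refl ; leaf = lx ; via-x = via }
     where
     via : Via x λ S → S a ⊎ S c ⊎ S g
     via u v r sx with sep? a u v | sep? c u v | sep? g u v
     ... | yes sa | _ | _ = inj₁ sa
     ... | no _ | yes sc | _ = inj₂ (inj₁ sc)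
     ... | no _ | no _ | yes sg = inj₂ (inj₂ sg)
     ... | no na | no nc | no ns = ⊥-elim (none (u , v , r , sx , ns , na , nc))

 outside : ∀ {f x e t u v} → Direct g f → Direct g t → f ≢ t → e ≼ f → x ≼ t → Sep e u v → Sep x u v → Sep f u v
 outside {f} {x} {e} {t} df dt f≢t e≼f x≼t = out
  where
  under : ∀ {u v} → u ≼ e → Sep x u v → ¬ v ≼ f
  under u≼e (_ , inj₁ (u≼x , _)) _ = no-common (children df dt f≢t) (≼-trans u≼e e≼f) (≼-trans u≼x x≼t)
  under u≼e (_ , inj₂ (v≼x , _)) v≼f = no-common (children df dt f≢t) v≼f (≼-trans v≼x x≼t)
  out : ∀ {u v} → Sep e u v → Sep x u v → Sep f u v
  out (_ , inj₁ (u≼e , _)) sx = Direct.alive df , inj₁ (≼-trans u≼e e≼f , under u≼e sx)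
  out (_ , inj₂ (v≼e , _)) sx = Direct.alive df , inj₂ (≼-trans v≼e e≼f , under v≼e (sep-sym sx))

 below-≢g : ∀ {e t} → Direct g t → e ≼ t → e ≢ g
 below-≢g dt e≼t refl = Direct.a≢h dt (≼-antisym (Direct.a≼h dt) e≼t)

 module Finish {f a b c d} (Q : Twins f a b c d)
  {x y} (dx : Direct g x) (lx : Leaf x) (dy : Direct g y) (ly : Leaf y)
  (L : Link a f x x) (M : Link b f y y) (x≢y : x ≢ y) (silent : Silent d f)
  (bound-x : Via x λ S → S a ⊎ S c ⊎ S g)
  (bound-y : Via y λ S → S b ⊎ S c ⊎ S g) where
  open Two Q using (dh; A; E; C′; D′; c≢a; c≢b; only; a≢d; b≢d; Ta; Tb; Tc; Td; f≢a; f≢b; f≢c; f≢d; a≢b; c≢d; module F3; module F4)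
  X₀ : End x x
  X₀ = leafE dx lx
  Y₀ : End y y
  Y₀ = leafE dy ly
  open Quad.Untied Q X₀ Y₀ L M x≢y silent using (tie-a; tie-b; via-d; via-f)

  -- A partner of `c` that is `x` or `y` leads to `F4`, up to the symmetry between `a` and `b`. Any
  -- other one leads to `F3`, and freeness comes down to being different since `x` and `y` are
  -- leaves.
  with-c : ∀ {z s} → End z s → Link c f z s → Step
  with-c {z} Z N with z ≟ᶠ x
  ... | yes refl with same-top Z X₀
  ... | refl = F4.result dx lx Y₀ L M N x≢y
   (λ u v r sd → Sum.map₂ (inj₂ ∘ proj₂) (via-d u v r sd)) bound-x
  with-c {z} Z N | no z≢x with z ≟ᶠ y
  ... | yes refl with same-top Z Y₀
  ... | refl = Two.F4.result (swapˡ Q) dy ly X₀ M L N (x≢y ∘ sym)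
   (λ u v r sd → Sum.map₂ (inj₂ ∘ proj₂) (via-d u v r sd)) bound-y
  with-c {z} Z N | no z≢x | no z≢y = F3.result X₀ Y₀ Z L M N (z≢x , z≢x) (z≢y , z≢y)

  module WithoutC (silent-c : Silent c f) where
   apart-fx : ∀ {e} → e ≼ f → e ≢ x
   apart-fx e≼f = apart dh dx (top-≢ L) e≼f (≼-refl x)
   apart-fy : ∀ {e} → e ≼ f → e ≢ y
   apart-fy e≼f = apart dh dy (top-≢ M) e≼f (≼-refl y)

   path : ∀ {p w} → Link p f w w → ∃₂ λ u v → Req u v × (∀ e → Sep e u v → e ∈ p ∷ f ∷ [ w ])
   path (u , v , r , l) = u , v , r , λ e s → three (LinkAt.only l e s)
    where
    three : ∀ {e p f w : Fin n} → e ∈ p ∷ f ∷ w ∷ [ w ] → e ∈ p ∷ f ∷ [ w ]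
    three (here q) = here q
    three (here₁ q) = here₁ q
    three (here₂ q) = here₂ q
    three (here₃ q) = here₂ q

   tie : ∀ {p q w} → Tied p q f w → Via p λ S → S q ⊎ (S f × S w) ⊎ (S f × S g)
   tie t u v r s with t u v r s
   ... | inj₁ p = inj₁ p
   ... | inj₂ (p , inj₁ q) = inj₂ (inj₁ (p , q))
   ... | inj₂ (p , inj₂ q) = inj₂ (inj₂ (p , q))

   leaf-via : ∀ {p w} → Direct g w → f ≢ w → p ≼ f →
    (Via w λ S → S p ⊎ S c ⊎ S g) →
    Via w λ S → (S f × S p) ⊎ S g
   leaf-via dw f≢w p≼f bd u v r s with bd u v r s
   ... | inj₁ sp = inj₁ (outside dh dw f≢w p≼f (≼-refl _) sp s , sp)
   ... | inj₂ (inj₁ sc) = inj₂ (silent-c u v r sc (outside dh dw f≢w (y≼t Tc) (≼-refl _) sc s))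
   ... | inj₂ (inj₂ sg) = inj₂ sg

   gadget : Gadget g
   gadget = record
    { f = f ; a = a ; b = b ; c = c ; d = d ; x = x ; y = y
    ; distinct = (f≢a , f≢b , f≢c , f≢d , apart-fx (≼-refl f) , apart-fy (≼-refl f) , Direct.a≢h dh , tt) ,
    (a≢b , c≢a ∘ sym , a≢d , apart-fx (y≼t Ta) , apart-fy (y≼t Ta) , below-≢g dh (y≼t Ta) , tt) ,
    (c≢b ∘ sym , b≢d , apart-fx (y≼t Tb) , apart-fy (y≼t Tb) , below-≢g dh (y≼t Tb) , tt) ,
    (c≢d , apart-fx (y≼t Tc) , apart-fy (y≼t Tc) , below-≢g dh (y≼t Tc) , tt) ,
    (apart-fx (y≼t Td) , apart-fy (y≼t Td) , below-≢g dh (y≼t Td) , tt) ,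
    (x≢y , Direct.a≢h dx , tt) , (Direct.a≢h dy , tt) , tt , tt
    ; direct-f = dh ; direct-x = dx ; direct-y = dy ; leaf-x = lx ; leaf-y = ly
    ; direct-a = B.direct dh (B.twin-plain dh A) ; direct-b = B.direct dh (B.twin-plain dh E)
    ; direct-c = B.direct dh (B.twin-plain dh C′) ; direct-d = B.direct dh (B.twin-plain dh D′)
    ; leaf-a = leafOfE Ta ; leaf-b = leafOfE Tb ; leaf-c = leafOfE Tc ; leaf-d = leafOfE Td
    ; below-f = only
    ; pair-ab = edge-pair (proj₁ (B.twin-nb dh A)) ; pair-cd = edge-pair (proj₁ (B.twin-nb dh C′))
    ; path-ax = path L ; path-by = path M
    ; via-f = via-f″
    ; via-a = tie tie-a ; via-b = tie tie-b ; via-c = lonely dh C′ silent-c ; via-d = via-d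
    ; via-x = leaf-via dx (top-≢ L) (y≼t Ta) bound-x ; via-y = leaf-via dy (top-≢ M) (y≼t Tb) bound-y }
    where
    via-f″ : Via f λ S → (S a × S x) ⊎ (S b × S y) ⊎ S g
    via-f″ u v r s with via-f u v r s
    ... | inj₁ p = inj₁ p
    ... | inj₂ (inj₁ p) = inj₂ (inj₁ p)
    ... | inj₂ (inj₂ (inj₁ sc)) = inj₂ (inj₂ (silent-c u v r sc s))
    ... | inj₂ (inj₂ (inj₂ sg)) = inj₂ (inj₂ sg)

  result : Σ (Gadget g) λ G → Gadget.f G ≡ f
  result with partner? Tc
  ... | inj₁ (z , s , Z , N) = fire (with-c Z N)
  ... | inj₂ none = WithoutC.gadget none , refl

 untied : ∀ {f a b c d x t y s} → Twins f a b c d →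
  End x t → End y s → Link a f x t → Link b f y s → x ≢ y → Silent d f →
  Σ (Gadget g) λ G → Gadget.f G ≡ f
 untied Q X₀ Y₀ L M x≢y silent =
  go X₀ Y₀ L M (Quad.Untied.bound Q X₀ Y₀ L M x≢y silent)
  (Quad.Untied.bound (swapˡ Q) Y₀ X₀ M L (x≢y ∘ sym) silent)
  where
  module U = Quad.Untied Q X₀ Y₀ L M x≢y silent using (Bound)
  module V = Quad.Untied (swapˡ Q) Y₀ X₀ M L (x≢y ∘ sym) silent using (Bound)
  go : End _ _ → End _ _ → Link _ _ _ _ → Link _ _ _ _ → U.Bound → V.Bound → _
  go X₀ Y₀ L M record { top-x = refl ; leaf = lx ; via-x = vx } record { top-x = refl ; leaf = ly ; via-x = vy } =
   Finish.result Q (directE X₀) lx (directE Y₀) ly L M x≢y silent vx vy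

 apart-vec : ∀ {m h k e} (ys : Vec (Fin n) m) → Direct g h → Direct g k → h ≢ k → e ≼ h →
  All (_≼ k) (Vec.toList ys) → Apart e ys
 apart-vec [] dh dk h≢k e≼h [] = tt
 apart-vec (y ∷ ys) dh dk h≢k e≼h (p ∷ ps) = apart dh dk h≢k e≼h p , apart-vec ys dh dk h≢k e≼h ps

 module C8 {f a b c d k x z y w} (Q : Twins f a b c d) (R : Twins k x z y w)
  (L : Link a f x k) (M : Link b f y k) (N : Link c f z k) (K : Link d f w k) where
  module F = Two Q using (A; C′; D′; E; P; Ta; Tb; Tc; Td; a≢b; a≢d; b≢d; c≢a; c≢b; c≢d; c⊆P; dh; f≢a; f≢b; f≢c; f≢d)
  module G = Two R using (A; C′; D′; E; P; Ta; Tb; Tc; Td; a≢b; a≢d; b≢d; c≢a; c≢b; c≢d; c⊆P; dh; f≢a; f≢b; f≢c; f≢d)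
  module QF = Quad Q using (leaving; pass)
  module QG = Quad R using (leaving; pass)
  f≢k = top-≢ L

  ks : Vec (Fin n) 5
  ks = k ∷ x ∷ z ∷ y ∷ [ w ]
  xs : Vec (Fin n) 11
  xs = g ∷ f ∷ a ∷ b ∷ c ∷ d ∷ ks

  ks≼ : All (_≼ k) (Vec.toList ks)
  ks≼ = ≼-refl k ∷ y≼t G.Ta ∷ y≼t G.Tb ∷ y≼t G.Tc ∷ y≼t G.Td ∷ []

  distinct : Distinct xs
  distinct =
   (Direct.a≢h F.dh ∘ sym , g≢ F.Ta , g≢ F.Tb , g≢ F.Tc , g≢ F.Td , Direct.a≢h G.dh ∘ sym , g≢ G.Ta , g≢ G.Tb , g≢ G.Tc , g≢ G.Td , tt) ,
   (F.f≢a , F.f≢b , F.f≢c , F.f≢d , aside (≼-refl f)) ,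
   (F.a≢b , F.c≢a ∘ sym , F.a≢d , aside (y≼t F.Ta)) , (F.c≢b ∘ sym , F.b≢d , aside (y≼t F.Tb)) ,
   (F.c≢d , aside (y≼t F.Tc)) , aside (y≼t F.Td) ,
   (G.f≢a , G.f≢b , G.f≢c , G.f≢d , tt) , (G.a≢b , G.c≢a ∘ sym , G.a≢d , tt) , (G.c≢b ∘ sym , G.b≢d , tt) ,
   (G.c≢d , tt) , tt , tt
   where
   aside : ∀ {e} → e ≼ f → Apart e ks
   aside e≼f = apart-vec ks F.dh G.dh f≢k e≼f ks≼
   g≢ : ∀ {e t} → End e t → g ≢ e
   g≢ P = below-≢g (directE P) (y≼t P) ∘ sym

  Kernel : Fin 11 → Set
  Kernel i = ∀ u v → Req u v → Sep (lookup xs i) u v →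
   Any (All (λ j → Sep (lookup xs j) u v)) (lookup (Checked.kernels c8ᵖ) i)

  three : ∀ {p q w h i j l} → Tied p q h w → lookup xs i ≡ q → lookup xs j ≡ w → lookup xs l ≡ g →
   Via p λ S → Any (All (λ j → S (lookup xs j))) ([ i ] ∷ [ j ] ∷ [ l ] ∷ [])
  three t eq eq′ eq″ u v r s with t u v r s
  ... | inj₁ p = here (subst (λ e → Sep e u v) (sym eq) p ∷ [])
  ... | inj₂ (_ , inj₁ p) = here₁ (subst (λ e → Sep e u v) (sym eq′) p ∷ [])
  ... | inj₂ (_ , inj₂ p) = here₂ (subst (λ e → Sep e u v) (sym eq″) p ∷ [])

  ta = tied F.dh F.A F.E G.Ta L
  tb = tied F.dh F.E F.A G.Tc M
  tc = tied F.dh F.C′ F.D′ G.Tb N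
  td = tied F.dh F.D′ F.C′ G.Td K
  tx = tied G.dh G.A G.E F.Ta (flip-link L)
  ty = tied G.dh G.C′ G.D′ F.Tb (flip-link M)
  tz = tied G.dh G.E G.A F.Tc (flip-link N)
  tw = tied G.dh G.D′ G.C′ F.Td (flip-link K)

  kf : Kernel 1F
  kf u v r s with QF.leaving u v r s
  ... | inj₁ sg = here₄ [ sg ]
  ... | inj₂ (_ , ∈₀ , sa) with QF.pass F.A F.E ta u v r sa s
  ... | inj₁ sx = here (sa ∷ [ sx ])
  ... | inj₂ sg = here₄ [ sg ]
  kf u v r s | inj₂ (_ , ∈₁ , sb) with QF.pass F.E F.A tb u v r sb s
  ... | inj₁ sy = here₁ (sb ∷ [ sy ])
  ... | inj₂ sg = here₄ [ sg ]
  kf u v r s | inj₂ (_ , ∈₂ , sc) with QF.pass F.C′ F.D′ tc u v r sc s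
  ... | inj₁ sz = here₂ (sc ∷ [ sz ])
  ... | inj₂ sg = here₄ [ sg ]
  kf u v r s | inj₂ (_ , ∈₃ , sd) with QF.pass F.D′ F.C′ td u v r sd s
  ... | inj₁ sw = here₃ (sd ∷ [ sw ])
  ... | inj₂ sg = here₄ [ sg ]

  kk : Kernel 6F
  kk u v r s with QG.leaving u v r s
  ... | inj₁ sg = here₄ [ sg ]
  ... | inj₂ (_ , ∈₀ , sx) with QG.pass G.A G.E tx u v r sx s
  ... | inj₁ sa = here (sa ∷ [ sx ])
  ... | inj₂ sg = here₄ [ sg ]
  kk u v r s | inj₂ (_ , ∈₁ , sz) with QG.pass G.E G.A tz u v r sz s
  ... | inj₁ sc = here₂ (sc ∷ [ sz ])
  ... | inj₂ sg = here₄ [ sg ]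
  kk u v r s | inj₂ (_ , ∈₂ , sy) with QG.pass G.C′ G.D′ ty u v r sy s
  ... | inj₁ sb = here₁ (sb ∷ [ sy ])
  ... | inj₂ sg = here₄ [ sg ]
  kk u v r s | inj₂ (_ , ∈₃ , sw) with QG.pass G.D′ G.C′ tw u v r sw s
  ... | inj₁ sd = here₃ (sd ∷ [ sw ])
  ... | inj₂ sg = here₄ [ sg ]

  inF : F.P ⊆ Vec.toList xs
  inF p = there (∈-++⁺ˡ {xs = F.P} p)
  inG : G.P ⊆ Vec.toList xs
  inG p = there (∈-++⁺ʳ F.P p)

  link-must : ∀ {C p q i j} → Link p f q k → p ∈ F.P → q ∈ G.P → lookup xs i ≡ p → lookup xs j ≡ q →
   LocalHit (Vec.toList xs) C → Any (λ i → T (C (lookup xs i))) (i ∷ 1F ∷ 6F ∷ [ j ])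
  link-must {C} l p∈ q∈ eq eq′ loc with link-hit l (inF p∈) (inF ∈₀) (inG q∈) (inG ∈₀) loc
  ... | inj₁ (inj₁ c) = here (subst (T ∘ C) (sym eq) c)
  ... | inj₁ (inj₂ c) = here₁ c
  ... | inj₂ (inj₁ c) = here₃ (subst (T ∘ C) (sym eq′) c)
  ... | inj₂ (inj₂ c) = here₂ c

  Bs : List (List (Fin n))
  Bs = (a ∷ [ z ]) ∷ [ x ∷ [ c ] ]

  valid : Valid (Vec.toList xs) Bs
  valid C loc with match c8ᵖ xs distinct
   (K₀ xs , kf , three ta refl refl refl , three tb refl refl refl , three tc refl refl refl , three td refl refl refl ,
   kk , three tx refl refl refl , three tz refl refl refl , three ty refl refl refl , three tw refl refl refl , tt) C
   (must xs C (B.hit-nb F.dh (B.twin-nb F.dh F.A) (inF ∈₁) (inF ∈₂) loc) ∷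
   must xs C (B.hit-nb F.dh (B.twin-nb F.dh F.C′) (inF (F.c⊆P ∈₀)) (inF (F.c⊆P ∈₂)) loc) ∷
   must xs C (B.hit-nb G.dh (B.twin-nb G.dh G.A) (inG ∈₁) (inG ∈₂) loc) ∷
   must xs C (B.hit-nb G.dh (B.twin-nb G.dh G.C′) (inG (G.c⊆P ∈₀)) (inG (G.c⊆P ∈₂)) loc) ∷
   link-must {C} L ∈₁ ∈₁ refl refl loc ∷
   link-must {C} M ∈₂ ∈₃ refl refl loc ∷
   link-must {C} N ∈₃ ∈₂ refl refl loc ∷
   link-must {C} K ∈₄ ∈₄ refl refl loc ∷ [])
  ... | D , e , here (p ∷ [ q ] , _) = D , e , here (p ∷ [ q ])
  ... | D , e , here₁ (p ∷ [ q ] , _) = D , e , here₁ (p ∷ [ q ])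

  result : Step
  result = branch record { X = Vec.toList xs ; Bs = Bs ; size-∈ = ∈₃
   ; unique = ((apart F.dh G.dh f≢k (y≼t F.Ta) (y≼t G.Tb) ∷ []) ∷ [] ∷ []) ∷
   ((apart F.dh G.dh f≢k (y≼t F.Tc) (y≼t G.Ta) ∘ sym ∷ []) ∷ [] ∷ []) ∷ []
   ; small = ≤ᵇ⇒≤ 11 window tt ; valid = valid }

 free? : ∀ {y t z s} (Y : End y t) (Z : End z s) → Dec (Free Y Z)
 free? {y} {z = z} Y Z = ¬? (y ≟ᶠ z) ×-dec ¬? (y ≟ᶠ mate Z)

 Same : Fin n → ∀ {x t} → End x t → Set
 Same z {x} X = z ≡ x ⊎ z ≡ mate X

 same : ∀ {y t z s} (Y : End y t) (Z : End z s) → ¬ Free Y Z → Same y Z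
 same {y} {z = z} Y Z ¬free with y ≟ᶠ z | y ≟ᶠ mate Z
 ... | yes p | _ = inj₁ p
 ... | no _ | yes q = inj₂ q
 ... | no p | no q = ⊥-elim (¬free (p , q))

 -- The pair x, z below k linked to the ends a and c below f: unless a step
 -- exists, the partners of the other pair below k are b and d.
 module Other {f a b c d k x z y s w r} (Q : Twins f a b c d) (dk : Direct g k) (X : B.Deg1 dk x z) (Z : B.Deg1 dk z x)
  (Y₀ : End y s) (W₀ : End w r)
  (L : Link a f x k) (N : Link c f z k) (M : Link b f y s) (K : Link d f w r) where
  open Two Q using (dh; A; E; C′; D′; c≢a; c≢b; Ta; Tc)
  Tx : End x k
  Tx = twinE dk X Z
  Tz : End z k
  Tz = twinE dk Z X

  record Others : Set where
   field
    {p q} : Fin n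
    rest : Twins k x z p q
    p-is : p ≡ y ⊎ p ≡ w
    q-is : q ≡ y ⊎ q ≡ w

  identify : ∀ {p q} → Twins k x z q p → p ≡ y ⊎ p ≡ w
  identify {p} R with partner? (Two.Td R)
  ... | inj₂ silent = fire (Quad.Untied.fire-twin R Ta Tc (flip-link L) (flip-link N) (c≢a ∘ sym) silent dh A E)
  ... | inj₁ (e , l , Eₑ , J) with free? Eₑ Ta ×-dec free? Eₑ Tc
  ... | yes (fa , fc) = fire (Two.F3.result (swapʳ R) Ta Tc Eₑ (flip-link L) (flip-link N) J fa fc)
  ... | no ¬both with free? Eₑ Ta
  ... | no ¬fa = from-a (same Eₑ Ta ¬fa) Eₑ J
   where
   Tp = Two.Td R
   from-a : ∀ {e l} → Same e Ta → End e l → Link p k e l → p ≡ y ⊎ p ≡ w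
   from-a (inj₁ refl) Eₑ J with same-top Eₑ Ta
   ... | refl = ⊥-elim (Twins.a≢d R (sym (unique-partner dh A E Tx Tp L (flip-link J))))
   from-a (inj₂ refl) Eₑ J with same-top Eₑ (twinE dh E A)
   ... | refl = inj₁ (unique-partner dh E A Y₀ Tp M (flip-link J))
  ... | yes fa = from-c (same Eₑ Tc λ fc → ¬both (fa , fc)) Eₑ J
   where
   Tp = Two.Td R
   from-c : ∀ {e l} → Same e Tc → End e l → Link p k e l → p ≡ y ⊎ p ≡ w
   from-c (inj₁ refl) Eₑ J with same-top Eₑ Tc
   ... | refl = ⊥-elim (Twins.b≢d R (sym (unique-partner dh C′ D′ Tz Tp N (flip-link J))))
   from-c (inj₂ refl) Eₑ J with same-top Eₑ (twinE dh D′ C′)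
   ... | refl = inj₂ (unique-partner dh D′ C′ W₀ Tp K (flip-link J))

  others : Others
  others = go (B.content dk (child-≢root dk) X Z)
   where
   go : B.Content dk x z → Others
   go (Interface.more R) = fire (F2.result dk X Z Ta Tc (flip-link L) (flip-link N) R)
   go (Interface.two C′ D′ c≢a c≢b only) = record { rest = R ; p-is = identify (swapʳ R) ; q-is = identify R }
    where
    R : Twins k x z _ _
    R = record { dh = dk ; A = X ; E = Z ; C′ = C′ ; D′ = D′ ; c≢a = c≢a ; c≢b = c≢b ; only = only }

 data Clash (z : Fin n) : ∀ {x t} → End x t → Set where
  leafᶜ : ∀ {dz lz} → Clash z (leafE {z} dz lz)
  twinᶜ : ∀ {k x} {dk : Direct g k} {X : B.Deg1 dk x z} {Z : B.Deg1 dk z x} → Clash z (twinE dk X Z)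

 -- In a pair `z` cannot be `x` itself, since the two partners `a` and `c` of `x` would have to
 -- coincide. So it is the mate.
 clash : ∀ {f a b c d x t z r} → Twins f a b c d → (X : End x t) → End z r → Link a f x t → Link c f z r → Same z X → Clash z X
 clash Q (leafE dx lx) Z L N (inj₁ refl) = leafᶜ
 clash Q (leafE dx lx) Z L N (inj₂ refl) = leafᶜ
 clash Q (twinE dk X Z′) Z L N (inj₂ refl) = twinᶜ
 clash Q (twinE dk X Z′) Z L N (inj₁ refl) with same-top Z (twinE dk X Z′)
 ... | refl = ⊥-elim (Twins.c≢a Q (unique-partner dk X Z′ (Two.Ta Q) (Two.Tc Q) (flip-link L) (flip-link N)))

 twin-not-child : ∀ {k p y} (dk : Direct g k) {q : Fin n} → B.Deg1 dk p q → Direct g y → p ≢ y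
 twin-not-child dk P′ dy refl with Direct.next dy _ (Direct.alive dk) (B.plain-≼ dk (B.twin-plain dk P′)) (Direct.a≼h dk)
 ... | inj₁ q = B.≢h dk (B.twin-plain dk P′) (sym q)
 ... | inj₂ q = Direct.a≢h dk q

 module Full {f a b c d} (Q : Twins f a b c d) where
  open Two Q using (dh; C′; D′; c≢a; Ta; Tc; module F4)

  -- If `x` and `y` are leaves then `F4` applies, or `D3` in case that `x` has a third link. If one
  -- of them belongs to a pair then by `Other` the second pair below the same `k` has the remaining
  -- partners as members, which is absurd for a leaf. Two such pairs make up the cycle of `C8`.
  matched : ∀ {x t y s z r w q} (X₀ : End x t) (Y₀ : End y s) (Z₀ : End z r) (W₀ : End w q) →
   Link a f x t → Link b f y s → Link c f z r → Link d f w q → x ≢ y → z ≢ w →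
   Clash z X₀ → Clash w Y₀ → Step
  matched {x} {y = y} X₀@(leafE dx lx) Y₀@(leafE dy ly) Z₀ W₀ L M N K x≢y z≢w leafᶜ leafᶜ
   with same-top Z₀ X₀ | same-top W₀ Y₀
  ... | refl | refl = F4.result dx lx Y₀ L M N x≢y via-d via-x
   where
   via-d : Via d λ S → S c ⊎ S y ⊎ S g
   via-d u v r sd = Sum.map₂ proj₂ (tied dh D′ C′ Y₀ K u v r sd)
   via-x : Via x λ S → S a ⊎ S c ⊎ S g
   via-x u v r sx with sep? a u v | sep? c u v | sep? g u v
   ... | yes sa | _ | _ = inj₁ sa
   ... | no _ | yes sc | _ = inj₂ (inj₁ sc)
   ... | no _ | no _ | yes sg = inj₂ (inj₂ sg)
   ... | no na | no nc | no ns with leave X₀ r sx sx ns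
   ... | e , k , Eₑ , l = fire (D3.result X₀ Ta Tc Eₑ (flip-link L) (flip-link N) J
    (free Ta Tc X₀ (c≢a ∘ sym) L N)
    (free Ta Eₑ X₀ (λ { refl → na (LinkAt.sep-z l) }) L (flip-link J))
    (free Tc Eₑ X₀ (λ { refl → nc (LinkAt.sep-z l) }) N (flip-link J)))
    where J = u , v , r , l
  matched X₀@(leafE dx lx) Y₀@(twinE dk Y W) Z₀ W₀ L M N K x≢y z≢w leafᶜ twinᶜ
   with same-top Z₀ X₀ | same-top W₀ (twinE dk W Y)
  ... | refl | refl = ⊥-elim ([ bad , bad ]′ (O.Others.p-is o))
   where
   module O = Other (swapˡ (swapʳ Q)) dk Y W X₀ Z₀ M K L N using (Others; module Others; others)
   o = O.others
   bad : O.Others.p o ≢ _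
   bad = twin-not-child (Twins.dh (O.Others.rest o)) (Twins.C′ (O.Others.rest o)) dx
  matched X₀@(twinE dk X Z) Y₀@(leafE dy ly) Z₀ W₀ L M N K x≢y z≢w twinᶜ leafᶜ
   with same-top Z₀ (twinE dk Z X)
  ... | refl = ⊥-elim ([ bad , bad ]′ (O.Others.p-is o))
   where
   module O = Other Q dk X Z Y₀ W₀ L N M K using (Others; module Others; others)
   o = O.others
   bad : O.Others.p o ≢ _
   bad = twin-not-child (Twins.dh (O.Others.rest o)) (Twins.C′ (O.Others.rest o)) dy
  matched {y = y} {s} {w = w} {q} X₀@(twinE {k} dk X Z) Y₀@(twinE dl Y W) Z₀ W₀ L M N K x≢y z≢w twinᶜ twinᶜ
   with same-top Z₀ (twinE dk Z X)
  ... | refl = by O.others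
   where
   module O = Other Q dk X Z Y₀ W₀ L N M K using (Others; module Others; others)
   by : O.Others → Step
   by o = go p-is q-is rest
    where
    open O.Others o
    go : ∀ {p q} → p ≡ y ⊎ p ≡ w → q ≡ y ⊎ q ≡ w → Twins k _ _ p q → Step
    go (inj₁ refl) (inj₁ refl) R = ⊥-elim (Two.c≢d R refl)
    go (inj₂ refl) (inj₂ refl) R = ⊥-elim (Two.c≢d R refl)
    go (inj₁ refl) (inj₂ refl) R with same-top Y₀ (Two.Tc R) | same-top W₀ (Two.Td R)
    ... | refl | refl = C8.result Q R L M N K
    go (inj₂ refl) (inj₁ refl) R with same-top Y₀ (Two.Td R) | same-top W₀ (Two.Tc R)
    ... | refl | refl = C8.result Q (swapʳ R) L M N K

 -- `F3` applies when `z`, or `w` by symmetry, is free of both `x` and `y`. As each of `x` and `y`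
 -- can clash with one end only, the failure for both matches `z` and `w` with `x` and `y` in one of
 -- the two orders.
 full : ∀ {f a b c d x t y s z r w q} → Twins f a b c d →
  End x t → End y s → End z r → End w q →
  Link a f x t → Link b f y s → Link c f z r → Link d f w q → x ≢ y → Step
 full {z = z} {r} {w} {q} Q X₀ Y₀ Z₀ W₀ L M N K x≢y
  with z ≟ᶠ w
 ... | yes refl with same-top Z₀ W₀
 ... | refl = F1.result (Twins.dh Q) (Twins.C′ Q) (Twins.D′ Q) Z₀ N K
 full {z = z} {r} {w} {q} Q X₀ Y₀ Z₀ W₀ L M N K x≢y
  | no z≢w = choose (free? Z₀ X₀) (free? Z₀ Y₀) (free? W₀ X₀) (free? W₀ Y₀)
  where
  not-same : ∀ {x t z r w q} (X : End x t) → z ≢ w → Clash z X → Clash w X → ⊥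
  not-same (leafE _ _) z≢w leafᶜ leafᶜ = z≢w refl
  not-same (twinE _ _ _) z≢w twinᶜ twinᶜ = z≢w refl

  choose : Dec (Free Z₀ X₀) → Dec (Free Z₀ Y₀) → Dec (Free W₀ X₀) → Dec (Free W₀ Y₀) → Step
  choose (yes zx) (yes zy) _ _ = Two.F3.result Q X₀ Y₀ Z₀ L M N zx zy
  choose _ _ (yes wx) (yes wy) =
   Two.F3.result (swapʳ Q) X₀ Y₀ W₀ L M K wx wy
  choose (no zx) _ (no wx) _ = ⊥-elim (not-same {r = r} {q = q} X₀ z≢w
   (clash Q X₀ Z₀ L N (same Z₀ X₀ zx)) (clash (swapʳ Q) X₀ W₀ L K (same W₀ X₀ wx)))
  choose _ (no zy) _ (no wy) = ⊥-elim (not-same {r = r} {q = q} Y₀ z≢w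
   (clash (swapˡ Q) Y₀ Z₀ M N (same Z₀ Y₀ zy)) (clash (swapˡ (swapʳ Q)) Y₀ W₀ M K (same W₀ Y₀ wy)))
  choose (no zx) _ _ (no wy) = Full.matched Q X₀ Y₀ Z₀ W₀ L M N K x≢y z≢w
   (clash Q X₀ Z₀ L N (same Z₀ X₀ zx)) (clash (swapˡ (swapʳ Q)) Y₀ W₀ M K (same W₀ Y₀ wy))
  choose _ (no zy) (no wx) _ = Full.matched (swapˡ Q)
   Y₀ X₀ Z₀ W₀ M L N K (x≢y ∘ sym) z≢w
   (clash (swapˡ Q) Y₀ Z₀ M N (same Z₀ Y₀ zy)) (clash (swapʳ Q) X₀ W₀ L K (same W₀ X₀ wx))

 -- A torn pair with a reserve besides it, or with a common partner of both members, admits a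
 -- branching. So exactly two pairs lie below `h`; if all four members had partners then `full`
 -- would apply, and a member without one leads to the gadget.
 star′ : ∀ {h} → Direct g h → ¬ Leaf h → Σ (Gadget g) λ G → Gadget.f G ≡ h
 star′ {h} dh₀ ¬leaf = go (torn dh₀ ¬leaf)
  where
  go : Torn h → Σ (Gadget g) λ G → Gadget.f G ≡ h
  go record { a = a ; b = b ; x = x ; t = t ; y = y ; s = s ; dh = dh ; A = A ; E = E ; X₀ = X₀ ; Y₀ = Y₀ ; L = L ; M = M }
   with x ≟ᶠ y
  ... | yes refl with same-top X₀ Y₀
  ... | refl = fire (F1.result dh A E X₀ L M)
  go record { a = a ; b = b ; dh = dh ; A = A ; E = E ; X₀ = X₀ ; Y₀ = Y₀ ; L = L ; M = M } | no x≢y =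
   inside (B.content dh (child-≢root dh) A E)
   where
   inside : B.Content dh a b → Σ (Gadget g) λ G → Gadget.f G ≡ h
   inside (Interface.more R) = fire (F2.result dh A E X₀ Y₀ L M R)
   inside (Interface.two {c} {d} C′ D′ c≢a c≢b only) = by (partner? (twinE dh C′ D′)) (partner? (twinE dh D′ C′))
    where
    Q : Twins h a b c d
    Q = record { dh = dh ; A = A ; E = E ; C′ = C′ ; D′ = D′ ; c≢a = c≢a ; c≢b = c≢b ; only = only }
    by : (∃₂ λ z s → End z s × Link c h z s) ⊎ Silent c h → (∃₂ λ w q → End w q × Link d h w q) ⊎ Silent d h →
     Σ (Gadget g) λ G → Gadget.f G ≡ h
    by _ (inj₂ silent) = untied Q X₀ Y₀ L M x≢y silent
    by (inj₂ silent) _ = untied (swapʳ Q) X₀ Y₀ L M x≢y silent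
    by (inj₁ (_ , _ , Z₀ , N)) (inj₁ (_ , _ , W₀ , K)) =
     fire (full Q X₀ Y₀ Z₀ W₀ L M N K x≢y)

 abstract
  star : ∀ {h} → Direct g h → ¬ Leaf h → Σ (Gadget g) λ G → Gadget.f G ≡ h
  star = star′

 leaf? : ∀ h → Dec (Leaf h)
 leaf? h with any? (λ e → T? (al e) ×-dec (T? (le e h) ×-dec ¬? (e ≟ᶠ h)))
 ... | yes (e , ae , e≼h , e≢h) = no λ l → e≢h (l e ae e≼h)
 ... | no none = yes λ e ae e≼h → decidable-stable (e ≟ᶠ h) λ e≢h → none (e , ae , e≼h , e≢h)

 -- This sets the leaves `x` and `y` of gadgets apart from the plain leaves by a property that can
 -- be decided without a gadget at hand.
 Mixed : Fin n → Set
 Mixed y = ∃₂ λ u v → Req u v × Sep y u v × ¬ Sep g u v × ∃ λ h → Alive h × h ≼ g × Sep h u v × ¬ Leaf h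

 mixed? : ∀ y → Dec (Mixed y)
 mixed? y = any? λ u → any? λ v → req? u v ×-dec (sep? y u v ×-dec (¬? (sep? g u v) ×-dec
  any? (λ h → T? (al h) ×-dec (T? (le h g) ×-dec (sep? h u v ×-dec ¬? (leaf? h))))))

 record PlainLeaf (y : Fin n) : Set where
  field
   direct : Direct g y
   leaf : Leaf y
   pure : ¬ Mixed y

 mixed-member : ∀ {y} → Direct g y → Leaf y → Mixed y → Σ (Gadget g) λ G → y ≡ Gadget.x G ⊎ y ≡ Gadget.y G
 mixed-member {y} dy ly (u , v , r , sy , ns , h , ah , h≼g , sh , ¬lh) with leave (leafE dy ly) r sy sy ns
 ... | z , s , Z , l = go Z l
  where
  go : ∀ {z s} → End z s → LinkAt y y z s u v → Σ (Gadget g) λ G → y ≡ Gadget.x G ⊎ y ≡ Gadget.y G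
  go Z@(leafE dz lz) l with LinkAt.only l h sh
  ... | ∈₀ = ⊥-elim (¬lh ly)
  ... | ∈₁ = ⊥-elim (¬lh ly)
  ... | ∈₂ = ⊥-elim (¬lh lz)
  ... | ∈₃ = ⊥-elim (¬lh lz)
  go {z} {s} Z@(twinE dk A E) l with star dk (λ ls → B.h≢ dk (B.twin-plain dk A) (sym (ls z (aliveE Z) (y≼t Z))))
  ... | G , refl = G , which (via-f u v r (LinkAt.sep-s l))
   where
   open Gadget G hiding (y)
   only-y : ∀ {w} → Direct g w → Leaf w → Sep w u v → w ≡ y
   only-y dw lw sw with LinkAt.only l _ sw
   ... | here p = p
   ... | here₁ p = p
   ... | here₂ p = ⊥-elim (twin-not-child dk A dw (sym p))
   ... | here₃ p = ⊥-elim (B.h≢ dk (B.twin-plain dk A) (trans (sym p)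
    (sym (lw z (aliveE Z) (subst (z ≼_) (sym p) (y≼t Z))))))
   which : (Sep a u v × Sep x u v) ⊎ (Sep b u v × Sep (Gadget.y G) u v) ⊎ Sep g u v → y ≡ Gadget.x G ⊎ y ≡ Gadget.y G
   which (inj₁ (_ , sx)) = inj₁ (sym (only-y direct-x leaf-x sx))
   which (inj₂ (inj₁ (_ , sw))) = inj₂ (sym (only-y direct-y leaf-y sw))
   which (inj₂ (inj₂ sg)) = ⊥-elim (ns sg)

 resolved : Resolved g
 resolved = record { Plain = PlainLeaf ; direct = PlainLeaf.direct ; leaf = PlainLeaf.leaf ; kernel = kernel ; classify = classify }
  where
  kernel : ∀ {a} → PlainLeaf a → ∀ u v → Req u v → Sep a u v →
   (∃ λ b → PlainLeaf b × a ≢ b × Joined a b u v) ⊎ Sep g u v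
  kernel {a} p u v r sa with sep? g u v
  ... | yes sg = inj₂ sg
  ... | no ns with leave (leafE direct leaf) r sa sa ns
   where open PlainLeaf p
  ... | z , s , twinE dk A E , l = ⊥-elim (PlainLeaf.pure p (u , v , r , sa , ns , s , Direct.alive dk , Direct.a≼h dk ,
   LinkAt.sep-s l , λ ls → B.h≢ dk (B.twin-plain dk A) (sym (ls z (aliveE (twinE dk A E)) (y≼t (twinE dk A E))))))
  ... | z , _ , leafE dz lz , l = inj₁ (z , record { direct = dz ; leaf = lz ; pure = pure } , a≢z , joined , sa , LinkAt.sep-z l)
   where
   a≢z : a ≢ z
   a≢z = LinkAt.t≢s l
   joined : ∀ e → Sep e u v → e ≡ a ⊎ e ≡ z
   joined e s with LinkAt.only l e s
   ... | here q = inj₁ q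
   ... | here₁ q = inj₁ q
   ... | here₂ q = inj₂ q
   ... | here₃ q = inj₂ q
   no-leaf-top : ∀ (G : Gadget g) {w} → Leaf w → Gadget.f G ≢ w
   no-leaf-top G lw refl = Direct.a≢h direct-a (lw a′ (Direct.alive direct-a) (Direct.a≼h direct-a))
    where open Gadget G renaming (a to a′)
   not-in : (G : Gadget g) → ¬ Sep (Gadget.f G) u v
   not-in G sf with joined _ sf
   ... | inj₁ q = no-leaf-top G (PlainLeaf.leaf p) q
   ... | inj₂ q = no-leaf-top G lz q
   -- A request through a leaf of a gadget passes the top of the gadget or leaves `g`, whereas this
   -- one stays inside and passes two leaves only.
   pure : ¬ Mixed z
   pure m with mixed-member dz lz m
   ... | G , inj₁ refl = [ not-in G ∘ proj₁ , ns ]′ (Gadget.via-x G u v r (LinkAt.sep-z l))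
   ... | G , inj₂ refl = [ not-in G ∘ proj₁ , ns ]′ (Gadget.via-y G u v r (LinkAt.sep-z l))
  classify : ∀ e → Alive e → e ≼ g → e ≢ g → PlainLeaf e ⊎ Σ (Gadget g) λ G → e ∈ Gadget.members G
  classify e ae e≼g e≢g with top e≼g
  ... | inj₁ none = ⊥-elim (e≢g (none e ae (≼-refl e) e≼g))
  ... | inj₂ (h , dh , e≼h) with leaf? h
  ... | no ¬lh with star dh ¬lh
  ... | G , refl = inj₂ (G , widen (Gadget.below-f G e ae e≼h))
   where
   widen : e ∈ _ → e ∈ Gadget.members G
   widen p = ∈-++⁺ˡ p
  classify e ae e≼g e≢g | inj₂ (h , dh , e≼h) | yes lh with lh e ae e≼h
  ... | refl = by (mixed? e)
   where
   by : Dec (Mixed e) → PlainLeaf e ⊎ Σ (Gadget g) λ G → e ∈ Gadget.members G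
   by (no ¬m) = inj₁ (record { direct = dh ; leaf = lh ; pure = ¬m })
   by (yes m) with mixed-member dh lh m
   ... | G , inj₁ q = inj₂ (G , here₅ q)
   ... | G , inj₂ q = inj₂ (G , here₆ q)

-- Sets as lists and as characteristic functions

char : List (Fin n) → Fin n → Bool
char [] e = false
char (b ∷ B) = char B [ b ≔ true ]

char⁺ : ∀ {B : List (Fin n)} {e} → e ∈ B → T (char B e)
char⁺ {B = b ∷ B} {e} e∈ with e ≟ᶠ b
... | yes _ = tt
... | no e≢b with e∈
... | here e≡b = contradiction e≡b e≢b
... | there e∈B = char⁺ e∈B

char⁻ : ∀ (B : List (Fin n)) {e} → T (char B e) → e ∈ B
char⁻ (b ∷ B) {e} t with e ≟ᶠ b
... | yes e≡b = here e≡b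
... | no _ = there (char⁻ B t)

count-char-≤ : (B : List (Fin n)) → count (char B) ≤ length B
count-char-≤ {n} [] = ≤-reflexive (zeros n)
 where
 zeros : ∀ n → count {n} (char []) ≡ 0
 zeros zero = refl
 zeros (suc n) = zeros n
count-char-≤ (b ∷ B) = begin
 count (char B [ b ≔ true ]) ≤⟨ m≤m+n _ _ ⟩
 count (char B [ b ≔ true ]) + weight (char B b) ≡⟨ count-≔ (char B) b true ⟩
 count (char B) + 1 ≤⟨ +-monoˡ-≤ 1 (count-char-≤ B) ⟩
 length B + 1 ≡⟨ +-comm (length B) 1 ⟩
 suc (length B) ∎
 where open ≤-Reasoning

count-remove : (C : Fin n → Bool) (B : List (Fin n)) → Unique B → All (T ∘ C) B →
 count (λ e → C e ∧ not (char B e)) + length B ≤ count C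
count-remove C [] _ _ = ≤-trans (≤-reflexive (+-identityʳ _)) (count-mono λ e t → proj₁ (∧⁻ {C e} t))
count-remove C (b ∷ B) (b∉ ∷ u) (cb ∷ cB) = begin
 count D + suc (length B) ≡⟨ +-suc (count D) (length B) ⟩
 suc (count D) + length B ≤⟨ +-monoˡ-≤ (length B) one-less ⟩
 count E + length B ≤⟨ count-remove C B u cB ⟩
 count C ∎
 where
 open ≤-Reasoning
 D E : _ → Bool
 D e = C e ∧ not (char (b ∷ B) e)
 E e = C e ∧ not (char B e)
 Eb : T (E b)
 Eb = ∧⁺ {C b} (cb , T-not⁺ λ t → All.lookup b∉ (char⁻ B t) refl)
 pointwise : ∀ e → T (D e) → T ((E [ b ≔ false ]) e)
 pointwise e t with e ≟ᶠ b
 ... | yes refl = proj₂ (∧⁻ {C e} t)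
 ... | no _ = t
 one-less : suc (count D) ≤ count E
 one-less = begin
  suc (count D) ≤⟨ s≤s (count-mono pointwise) ⟩
  suc (count (E [ b ≔ false ])) ≡⟨ +-comm 1 _ ⟩
  count (E [ b ≔ false ]) + 1 ≡⟨ cong (λ x → count (E [ b ≔ false ]) + weight x) (T⇒≡ Eb) ⟨
  count (E [ b ≔ false ]) + weight (E b) ≡⟨ count-≔ E b false ⟩
  count E + 0 ≡⟨ +-identityʳ _ ⟩
  count E ∎

count-strict : {C D : Fin n → Bool} (x : Fin n) → (∀ e → T (C e) → T (D e)) → ¬ T (C x) → T (D x) → count C < count D
count-strict {C = C} {D} x C⊆D ¬cx dx = begin-strict
 count C ≤⟨ count-mono (λ e t → ∧⁺ {D e} (C⊆D e t , T-not⁺ {char [ x ] e} (other e t))) ⟩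
 count (λ e → D e ∧ not (char [ x ] e)) <⟨ m<m+n _ (s≤s z≤n) ⟩
 count (λ e → D e ∧ not (char [ x ] e)) + 1 ≤⟨ count-remove D [ x ] ([] ∷ []) [ dx ] ⟩
 count D ∎
 where
 open ≤-Reasoning
 other : ∀ e → T (C e) → ¬ T (char [ x ] e)
 other e ce t with char⁻ [ x ] {e} t
 ... | ∈₀ = ¬cx ce

count-split : (C P : Fin n → Bool) → count C ≡ count (λ e → C e ∧ P e) + count (λ e → C e ∧ not (P e))
count-split {zero} C P = refl
count-split {suc n} C P = begin
 weight (C zero) + count (C ∘ suc)
 ≡⟨ cong₂ _+_ (one (C zero) (P zero)) (count-split (C ∘ suc) (P ∘ suc)) ⟩
 (w₁ + w₂) + (c₁ + c₂) ≡⟨ +-assoc w₁ w₂ _ ⟩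
 w₁ + (w₂ + (c₁ + c₂)) ≡⟨ cong (w₁ +_) (+-assoc w₂ c₁ c₂) ⟨
 w₁ + ((w₂ + c₁) + c₂) ≡⟨ cong (λ x → w₁ + (x + c₂)) (+-comm w₂ c₁) ⟩
 w₁ + ((c₁ + w₂) + c₂) ≡⟨ cong (w₁ +_) (+-assoc c₁ w₂ c₂) ⟩
 w₁ + (c₁ + (w₂ + c₂)) ≡⟨ +-assoc w₁ c₁ _ ⟨
 (w₁ + c₁) + (w₂ + c₂) ∎
 where
 open ≡-Reasoning
 w₁ = weight (C zero ∧ P zero)
 w₂ = weight (C zero ∧ not (P zero))
 c₁ = count (λ e → C (suc e) ∧ P (suc e))
 c₂ = count (λ e → C (suc e) ∧ not (P (suc e)))
 one : ∀ a b → weight a ≡ weight (a ∧ b) + weight (a ∧ not b)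
 one true true = refl
 one true false = refl
 one false b = refl

count-∨ : (C D : Fin n → Bool) → count (λ e → C e ∨ D e) ≤ count C + count D
count-∨ {zero} C D = z≤n
count-∨ {suc n} C D = begin
 weight (C zero ∨ D zero) + count (λ e → C (suc e) ∨ D (suc e))
 ≤⟨ +-mono-≤ (one (C zero) (D zero)) (count-∨ (C ∘ suc) (D ∘ suc)) ⟩
 (c + d) + (cs + ds) ≡⟨ +-assoc c d _ ⟩
 c + (d + (cs + ds)) ≡⟨ cong (c +_) (+-assoc d cs ds) ⟨
 c + ((d + cs) + ds) ≡⟨ cong (λ x → c + (x + ds)) (+-comm d cs) ⟩
 c + ((cs + d) + ds) ≡⟨ cong (c +_) (+-assoc cs d ds) ⟩
 c + (cs + (d + ds)) ≡⟨ +-assoc c cs _ ⟨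
 (c + cs) + (d + ds) ∎
 where
 open ≤-Reasoning
 c = weight (C zero)
 d = weight (D zero)
 cs = count (C ∘ suc)
 ds = count (D ∘ suc)
 one : ∀ a b → weight (a ∨ b) ≤ weight a + weight b
 one true b = s≤s z≤n
 one false b = ≤-refl

elements : (Fin n → Bool) → List (Fin n)
elements {zero} C = []
elements {suc n} C = (if C zero then zero ∷_ else id) (List.map suc (elements (C ∘ suc)))

length-elements : (C : Fin n → Bool) → length (elements C) ≡ count C
length-elements {zero} C = refl
length-elements {suc n} C with C zero
... | true = cong suc (trans (length-map suc (elements (C ∘ suc))) (length-elements (C ∘ suc)))
... | false = trans (length-map suc (elements (C ∘ suc))) (length-elements (C ∘ suc))

∈-elements⁺ : (C : Fin n → Bool) → ∀ {e} → T (C e) → e ∈ elements C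
∈-elements⁺ {suc n} C {zero} t with C zero
... | true = ∈₀
∈-elements⁺ {suc n} C {suc e} t with C zero
... | true = there (∈-map⁺ suc (∈-elements⁺ (C ∘ suc) t))
... | false = ∈-map⁺ suc (∈-elements⁺ (C ∘ suc) t)

∈-elements⁻ : (C : Fin n → Bool) → ∀ {e} → e ∈ elements C → T (C e)
∈-elements⁻ {suc n} C e∈ with C zero in eq
∈-elements⁻ {suc n} C ∈₀ | true = subst T (sym eq) tt
∈-elements⁻ {suc n} C (there e∈) | true with ∈-map⁻ suc e∈
... | _ , e∈′ , refl = ∈-elements⁻ (C ∘ suc) e∈′
∈-elements⁻ {suc n} C e∈ | false with ∈-map⁻ suc e∈
... | _ , e∈′ , refl = ∈-elements⁻ (C ∘ suc) e∈′

-- Soundness of the steps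

module Solutions {n} (I : Instance n) where
 open Instance I

 Solution : ℕ → (Fin n → Bool) → Set
 Solution k C = count C ≤ k × (∀ u v → Req u v → Hit C u v)

 Solvable : ℕ → Set
 Solvable k = ∃ (Solution k)

module Solve {n} (I : Instance n) where
 open Instance I
 open Solutions I

 ListHit : List (Fin n) → Fin n → Fin n → Set
 ListHit A u v = ∃ λ e → Sep e u v × e ∈ A

 -- Valid in terms of lists, as the algorithm checks it.
 ListValid : List (Fin n) → List (List (Fin n)) → Set
 ListValid X Bs = ∀ A → length A ≤ window → (∀ e → e ∈ A → e ∈ X) →
  (∀ u v → Req u v → (∀ e → Sep e u v → e ∈ X) → ListHit A u v) →
  ∃ λ Y → length Y ≡ length A × (∀ u v → Req u v → ListHit A u v → ListHit Y u v) × Any (All (_∈ Y)) Bs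

 count-exchange : ∀ (C : Fin n → Bool) {a b} → a ≢ b → T (C b) → count (C [ b ≔ false ] [ a ≔ true ]) ≤ count C
 count-exchange C {a} {b} a≢b cb = +-cancelʳ-≤ (weight (D a)) _ _ (begin
  count (D [ a ≔ true ]) + weight (D a) ≡⟨ count-≔ D a true ⟩
  count D + 1 ≡⟨ cong (λ x → count D + weight x) (T⇒≡ cb) ⟨
  count D + weight (C b) ≡⟨ count-≔ C b false ⟩
  count C + 0 ≤⟨ +-monoʳ-≤ (count C) z≤n ⟩
  count C + weight (D a) ∎)
  where
  open ≤-Reasoning
  D = C [ b ≔ false ]

 exchange-≤ : ∀ (C : Fin n → Bool) {a b k} → a ≢ b → T (C b) → count C ≤ k → count (C [ b ≔ false ] [ a ≔ true ]) ≤ k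
 exchange-≤ C a≢b cb small = ≤-trans (count-exchange C a≢b cb) small

 set-true : ∀ (C : Fin n → Bool) (a : Fin n) → T ((C [ a ≔ true ]) a)
 set-true C a = subst T (sym (≔-same C a true)) tt

 set-keep : ∀ (C : Fin n → Bool) {a e : Fin n} → T (C e) → T ((C [ a ≔ true ]) e)
 set-keep C {a} {e} c with e ≟ᶠ a
 ... | yes _ = tt
 ... | no _ = c

 swap-keep : ∀ (C : Fin n → Bool) {a b e : Fin n} → e ≢ b → T (C e) → T ((C [ b ≔ false ] [ a ≔ true ]) e)
 swap-keep C {a} {b} e≢b c = set-keep (C [ b ≔ false ]) (subst T (sym (≔-other C false e≢b)) c)

 module _ (root : Fin n) where
  open Rules I root

  -- The formulas of the algorithm compare lengths of lists only for equality, so a solution that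
  -- has become smaller is padded with elements of `A`.
  valid-list : ∀ {X Bs} → Valid X Bs → ListValid X Bs
  valid-list {X} {Bs} valid A _ _ local with valid (char A)
   (λ u v r S⊆X → let (e , s , e∈) = local u v r S⊆X in e , s , char⁺ e∈)
  ... | Y , x , goal = L , proj₁ (proj₂ padded) ,
   (λ u v r (e , s , e∈) → let (e′ , s′ , y) = Exchange.Exch.hits x u v r (e , s , char⁺ e∈)
                in e′ , s′ , proj₂ (proj₂ padded) (∈-elements⁺ Y y)) ,
   Any.map (All.map (λ y → proj₂ (proj₂ padded) (∈-elements⁺ Y y))) goal
   where
   few : length (elements Y) ≤ length A
   few = ≤-trans (≤-reflexive (length-elements Y)) (≤-trans (Exchange.Exch.cnt x) (count-char-≤ A))
   pad : ∀ (A E : List (Fin n)) → length E ≤ length A → ∃ λ L → length L ≡ length A × (E ⊆ L)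
   pad A [] _ = A , refl , λ ()
   pad (a ∷ A) (e ∷ E) (s≤s le) with pad A E le
   ... | L , len , sub = e ∷ L , cong suc len , λ { (here p) → here p ; (there p) → there (sub p) }
   padded = pad A (elements Y) few
   L = proj₁ padded

 module Deletion {f g : Fin n} {root : Fin n} (del : Rules.Deletable I root f g)
  (J : Instance n) (same-le : Instance.le J ≡ le)
  (alive⁺ : ∀ e → Alive e → e ≢ f → Instance.Alive J e)
  (alive⁻ : ∀ e → Instance.Alive J e → Alive e)
  (req⁺ : ∀ u v → Req u v → Instance.Req J u v)
  (req⁻ : ∀ u v → Instance.Req J u v → Req u v) where
  open Rules.Deletable del
  private module J = Instance J

  sep⁺ : ∀ {e u v} → e ≢ f → Sep e u v → J.Sep e u v
  sep⁺ {e} {u} {v} e≢f (ae , s) rewrite same-le = alive⁺ e ae e≢f , s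
  sep⁻ : ∀ {e u v} → J.Sep e u v → Sep e u v
  sep⁻ {e} {u} {v} (ae , s) rewrite same-le = alive⁻ e ae , s

  Spared : (Fin n → Bool) → Fin n × Fin n → Set
  Spared C (u , v) = Req u v → Sep f u v → ¬ Sep g u v → ∃ λ e → e ≢ f × Sep e u v × T (C e)

  -- The pairs are treated one at a time by trading `b` for `a`. The pairs treated before stay
  -- spared: a request that was hit by `b` passes `a` or else `g`, and the latter exempts it.
  spare : ∀ {k} → (Ps : List (Fin n × Fin n)) → ∀ C → Solution k C → T (C f) →
   ∃ λ D → Solution k D × T (D f) × All (Spared D) Ps
  spare [] C sol cf = C , sol , cf , []
  spare ((u , v) ∷ Ps) C sol cf with spare Ps C sol cf
  ... | D , (small , hit) , df , spared
   with any? (λ e → ¬? (e ≟ᶠ f) ×-dec (sep? e u v ×-dec T? (D e))) | req? u v ×-dec (sep? f u v ×-dec ¬? (sep? g u v))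
  ... | yes found | _ = D , (small , hit) , df , (λ _ _ _ → found) ∷ spared
  ... | no _ | no none = D , (small , hit) , df , (λ r s ns → ⊥-elim (none (r , s , ns))) ∷ spared
  ... | no none | yes (r , sf , ns) with replaced u v r sf
  ... | inj₁ sg = ⊥-elim (ns sg)
  ... | inj₂ (a , sa , a≢f , b , b≢a , b≢f , (u′ , v′ , r′ , only) , via) =
   D [ b ≔ false ] [ a ≔ true ] , (exchange-≤ D (b≢a ∘ sym) db small , hit′) , swap-keep D (b≢f ∘ sym) df ,
   (λ _ _ _ → a , a≢f , sa , set-true (D [ b ≔ false ]) a) ∷ All.map (λ {p} → respare p) spared
   where
   db : T (D b)
   db with hit u′ v′ r′
   ... | e , s , d with only e s
   ... | inj₁ refl = ⊥-elim (none (e , a≢f , sa , d))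
   ... | inj₂ refl = d
   hit′ : ∀ u v → Req u v → Hit (D [ b ≔ false ] [ a ≔ true ]) u v
   hit′ u v r with hit u v r
   ... | e , s , d with e ≟ᶠ b
   ... | no e≢b = e , s , swap-keep D e≢b d
   ... | yes refl with via u v r s
   ... | inj₁ sa = a , sa , set-true (D [ b ≔ false ]) a
   ... | inj₂ (sf , _) = f , sf , swap-keep D (b≢f ∘ sym) df
   respare : ∀ p → Spared D p → Spared (D [ b ≔ false ] [ a ≔ true ]) p
   respare (u , v) sp r sf ns with sp r sf ns
   ... | e , e≢f , s , d with e ≟ᶠ b
   ... | no e≢b = e , e≢f , s , swap-keep D e≢b d
   ... | yes refl with via u v r s
   ... | inj₁ sa = a , a≢f , sa , set-true (D [ b ≔ false ]) a
   ... | inj₂ (_ , sg) = ⊥-elim (ns sg)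

  forth : ∀ {k} → Solvable k → Solutions.Solvable J k
  forth (C , small , hit) with T? (C f)
  ... | no ¬cf = C , small , λ u v r → let (e , s , c) = hit u v (req⁻ u v r)
                     in e , sep⁺ (λ { refl → ¬cf c }) s , c
  ... | yes cf with spare (List.cartesianProduct (List.allFin n) (List.allFin n)) C (small , hit) cf
  ... | D , (small′ , hit′) , df , spared = D [ f ≔ false ] [ g ≔ true ] ,
   exchange-≤ D (≢g ∘ sym) df small′ , final
   where
   all-pairs : ∀ u v → Spared D (u , v)
   all-pairs u v = All.lookup spared (∈-cartesianProduct⁺ (∈-allFin u) (∈-allFin v))
   final : ∀ u v → J.Req u v → Instance.Hit J (D [ f ≔ false ] [ g ≔ true ]) u v
   final u v r with sep? f u v
   ... | no ¬sf with hit′ u v (req⁻ u v r)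
   ... | e , s , d = e , sep⁺ e≢f s , swap-keep D e≢f d
    where
    e≢f : e ≢ f
    e≢f refl = ¬sf s
   final u v r | yes sf with sep? g u v
   ... | yes sg = g , sep⁺ (≢g ∘ sym) sg , set-true (D [ f ≔ false ]) g
   ... | no ¬sg with all-pairs u v (req⁻ u v r) sf ¬sg
   ... | e , e≢f , s , d = e , sep⁺ e≢f s , swap-keep D e≢f d

  back : ∀ {k} → Solutions.Solvable J k → Solvable k
  back (C , small , hit) = C , small , λ u v r → let (e , s , c) = hit u v (req⁺ u v r) in e , sep⁻ s , c

 module Splitting {f a b : Fin n} {root : Fin n} (tree : IsRooted le root) (sp : Rules.Splittable I root f a b)
  (J : Instance n) (same-le : Instance.le J ≡ le)
  (alive⁺ : ∀ e → Alive e → e ≢ f → Instance.Alive J e)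
  (alive⁻ : ∀ e → Instance.Alive J e → Alive e × e ≢ f) where
  open Rules.Splittable sp
  open IsRooted tree
  private module J = Instance J

  Selfish : Fin n → Fin n → Set
  Selfish u v = u ≼ f × ¬ v ≼ f × ¬ u ≼ a × ¬ u ≼ b

  selfish? : ∀ u v → Dec (Selfish u v)
  selfish? u v = T? _ ×-dec (¬? (T? _) ×-dec (¬? (T? _) ×-dec ¬? (T? _)))

  -- A request with an end in the part of the tree at `f` above the branches `a` and `b` is doubled,
  -- with new ends at `a` and at `b`. One of the pair is chosen in any case; choosing both now has
  -- the meaning of choosing `f` and one of them before, at the same price.
  New : Fin n → Fin n → Set
  New u v = (Req u v × ¬ Selfish u v × ¬ Selfish v u) ⊎ ((u ≡ a ⊎ u ≡ b) × ∃ λ w → Req w v × Selfish w v)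

  module _ (req⁺ : ∀ u v → New u v → T (J.rq u v)) (req⁻ : ∀ u v → T (J.rq u v) → New u v) where
   sep⁺ : ∀ {e u v} → e ≢ f → Sep e u v → J.Sep e u v
   sep⁺ {e} {u} {v} e≢f (ae , s) rewrite same-le = alive⁺ e ae e≢f , s
   sep⁻ : ∀ {e u v} → J.Sep e u v → Sep e u v × e ≢ f
   sep⁻ {e} {u} {v} (ae , s) rewrite same-le = (proj₁ (alive⁻ e ae) , s) , proj₂ (alive⁻ e ae)

   Twin : Fin n → Fin n → Set
   Twin p q = Alive p × p ≼ f × p ≢ f × ¬ p ≼ q × (∀ e → Alive e → e ≼ f → e ≡ f ⊎ e ≡ p ⊎ e ≡ q)

   twin-a : Twin a b
   twin-a = alive-a , a≼f , a≢f , a⋠b , only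
   twin-b : Twin b a
   twin-b = alive-b , b≼f , b≢f , b⋠a , λ e ae l → Sum.map₂ Sum.swap (only e ae l)

   move : ∀ {p q w v e} → Twin p q → w ≼ f → ¬ w ≼ p → ¬ w ≼ q → ¬ v ≼ f → e ≢ f → Sep e w v → Sep e p v
   move {p} {q} {w} {v} {e} (_ , p≼f , _ , _ , onlyf) w≼f ¬wp ¬wq ¬vf e≢f (ae , inj₁ (w≼e , v⋠e))
    with ≼-chain w≼e w≼f
   ... | inj₂ f≼e = ae , inj₁ (≼-trans p≼f f≼e , v⋠e)
   ... | inj₁ e≼f with onlyf e ae e≼f
   ... | inj₁ q = ⊥-elim (e≢f q)
   ... | inj₂ (inj₁ refl) = ⊥-elim (¬wp w≼e)
   ... | inj₂ (inj₂ refl) = ⊥-elim (¬wq w≼e)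
   move {e = e} (_ , p≼f , _ , _ , onlyf) w≼f ¬wp ¬wq ¬vf e≢f (ae , inj₂ (v≼e , w⋠e)) =
    ae , inj₂ (v≼e , λ p≼e → bad (≼-chain p≼e p≼f))
    where
    bad : _ → ⊥
    bad (inj₁ e≼f) = ¬vf (≼-trans v≼e e≼f)
    bad (inj₂ f≼e) = w⋠e (≼-trans w≼f f≼e)

   move-back : ∀ {p q w v e} → Twin p q → w ≼ f → ¬ v ≼ f → e ≢ f → e ≢ p → Sep e p v → Sep e w v
   move-back {p} {q} {w} {v} {e} (_ , p≼f , _ , p⋠q , onlyf) w≼f ¬vf e≢f e≢p (ae , inj₁ (p≼e , v⋠e))
    with ≼-chain p≼e p≼f
   ... | inj₂ f≼e = ae , inj₁ (≼-trans w≼f f≼e , v⋠e)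
   ... | inj₁ e≼f with onlyf e ae e≼f
   ... | inj₁ q = ⊥-elim (e≢f q)
   ... | inj₂ (inj₁ q) = ⊥-elim (e≢p q)
   ... | inj₂ (inj₂ refl) = ⊥-elim (p⋠q p≼e)
   move-back {e = e} (_ , p≼f , _ , _ , onlyf) w≼f ¬vf e≢f e≢p (ae , inj₂ (v≼e , p⋠e)) =
    ae , inj₂ (v≼e , λ w≼e → bad (≼-chain w≼e w≼f))
    where
    bad : _ → ⊥
    bad (inj₁ e≼f) = ¬vf (≼-trans v≼e e≼f)
    bad (inj₂ f≼e) = p⋠e (≼-trans p≼f f≼e)

   a≢b : a ≢ b
   a≢b refl = a⋠b (≼-refl a)

   J-req : ∀ {u v} → New u v → J.Req u v
   J-req n = inj₁ (req⁺ _ _ n)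

   forth : ∀ {k} → Solvable k → Solutions.Solvable J k
   forth {k} (C , small , hit) = by (T? (C f))
    where
    in-pair : T (C a) ⊎ T (C b)
    in-pair with pair
    ... | u , v , r , o with hit u v r
    ... | e , s , c with o e s
    ... | inj₁ refl = inj₁ c
    ... | inj₂ refl = inj₂ c

    plug : ∀ {D} → (∀ e → e ≢ f → T (C e) → T (D e)) → (T (C f) → T (D a) × T (D b)) →
     ∀ u v → J.Req u v → J.Hit D u v
    plug {D} keep both u v (inj₂ r) = J.hit-sym {D} {v} {u} (plug {D} keep both v u (inj₁ r))
    plug {D} keep both u v (inj₁ r) with req⁻ u v r
    ... | inj₁ (r′ , ¬uv , ¬vu) with hit u v r′
    ... | e , s , c with e ≟ᶠ f
    ... | no e≢f = e , sep⁺ e≢f s , keep e e≢f c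
    ... | yes refl = through s
     where
     below : ∀ {u v} → u ≼ e → ¬ v ≼ e → ¬ Selfish u v → J.Hit D u v
     below {u} {v} u≼f v⋠f ¬s with T? (le u a) | T? (le u b)
     ... | yes u≼a | _ = a , sep⁺ a≢f (alive-a , inj₁ (u≼a , λ v≼a → v⋠f (≼-trans v≼a a≼f))) , proj₁ (both c)
     ... | no _ | yes u≼b = b , sep⁺ b≢f (alive-b , inj₁ (u≼b , λ v≼b → v⋠f (≼-trans v≼b b≼f))) , proj₂ (both c)
     ... | no p | no q = ⊥-elim (¬s (u≼f , v⋠f , p , q))
     through : Sep e u v → J.Hit D u v
     through (_ , inj₁ (u≼f , v⋠f)) = below u≼f v⋠f ¬uv
     through (_ , inj₂ (v≼f , u⋠f)) = J.hit-sym {D} {v} {u} (below v≼f u⋠f ¬vu)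
    plug {D} keep both u v (inj₁ r) | inj₂ (u-is , w , r′ , w≼f , v⋠f , ¬wa , ¬wb) with hit w v r′
    ... | e , s , c with e ≟ᶠ f
    ... | no e≢f = e , sep⁺ e≢f (twin u-is) , keep e e≢f c
     where
     twin : u ≡ a ⊎ u ≡ b → Sep e u v
     twin (inj₁ refl) = move twin-a w≼f ¬wa ¬wb v⋠f e≢f s
     twin (inj₂ refl) = move twin-b w≼f ¬wb ¬wa v⋠f e≢f s
    ... | yes refl = end u-is
     where
     end : u ≡ a ⊎ u ≡ b → J.Hit D u v
     end (inj₁ refl) = a , sep⁺ a≢f (alive-a , inj₁ (≼-refl a , λ v≼a → v⋠f (≼-trans v≼a a≼f))) , proj₁ (both c)
     end (inj₂ refl) = b , sep⁺ b≢f (alive-b , inj₁ (≼-refl b , λ v≼b → v⋠f (≼-trans v≼b b≼f))) , proj₂ (both c)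

    by : Dec (T (C f)) → Solutions.Solvable J k
    by (no ¬cf) = C , small , plug {C} (λ _ _ c → c) (⊥-elim ∘ ¬cf)
    -- One of the pair is chosen already, so `f` can be traded for the other one.
    by (yes cf) with in-pair
    ... | inj₁ ca = C [ f ≔ false ] [ b ≔ true ] , exchange-≤ C b≢f cf small ,
     plug {C [ f ≔ false ] [ b ≔ true ]} (λ e e≢f → swap-keep C e≢f) (λ _ → swap-keep C a≢f ca , set-true (C [ f ≔ false ]) b)
    ... | inj₂ cb = C [ f ≔ false ] [ a ≔ true ] , exchange-≤ C a≢f cf small ,
     plug {C [ f ≔ false ] [ a ≔ true ]} (λ e e≢f → swap-keep C e≢f) (λ _ → set-true (C [ f ≔ false ]) a , swap-keep C b≢f cb)

   back : ∀ {k} → Solutions.Solvable J k → Solvable k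
   back {k} (C , small , hit) = by (T? (C a)) (T? (C b))
    where
    old : ∀ {D} → (∀ u v → Req u v → ∀ e → Sep e u v → T (C e) → Hit D u v) →
     (∀ u v → Req u v → Selfish u v → Hit D u v) → ∀ u v → Req u v → Hit D u v
    old {D} keep self u v r with selfish? u v | selfish? v u
    ... | yes s | _ = self u v r s
    ... | no _ | yes s = hit-sym {D} {v} {u} (self v u (req-sym {u} {v} r) s)
    ... | no ¬s | no ¬s′ with hit u v (J-req (inj₁ (r , ¬s , ¬s′)))
    ... | e , s , c = keep u v r e (proj₁ (sep⁻ s)) c

    lone : ∀ {p q} → Twin p q → (p ≡ a ⊎ p ≡ b) → ¬ T (C p) → ∀ u v → Req u v → Selfish u v → Hit C u v
    lone tw p-is ¬cp u v r s@(u≼f , v⋠f , _) with hit _ v (J-req (inj₂ (p-is , u , r , s)))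
    ... | e , s′ , c = e , move-back tw u≼f v⋠f (proj₂ (sep⁻ s′)) (λ { refl → ¬cp c }) (proj₁ (sep⁻ s′)) , c

    by : Dec (T (C a)) → Dec (T (C b)) → Solvable k
    by (no ¬ca) _ = C , small , old {C} (λ u v r e s c → e , s , c) (lone twin-a (inj₁ refl) ¬ca)
    by _ (no ¬cb) = C , small , old {C} (λ u v r e s c → e , s , c) (lone twin-b (inj₂ refl) ¬cb)
    -- Both are chosen, so `b` is traded back for `f`; the requests through `b` pass `a` or `f`.
    by (yes ca) (yes cb) = D , exchange-≤ C (b≢f ∘ sym) cb small , old {D} keep
     λ u v _ (u≼f , v⋠f , _) → f , (alive-f , inj₁ (u≼f , v⋠f)) , set-true (C [ b ≔ false ]) f
     where
     D = C [ b ≔ false ] [ f ≔ true ]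
     keep : ∀ u v → Req u v → ∀ e → Sep e u v → T (C e) → Hit D u v
     keep u v r e s c with e ≟ᶠ b
     ... | no e≢b = e , s , swap-keep C e≢b c
     ... | yes refl with via-b u v r s
     ... | inj₁ sa = a , sa , swap-keep C a≢b ca
     ... | inj₂ sf = f , sf , set-true (C [ b ≔ false ]) f

 module Cutting {X : List (Fin n)} {Bs : List (List (Fin n))} (small-X : length X ≤ window) (valid : ListValid X Bs) where
  private
   count-char-split : ∀ (C : Fin n → Bool) → count (λ e → C e ∧ char X e) ≤ window
   count-char-split C = ≤-trans (≤-trans (count-mono λ e t → proj₂ (∧⁻ {C e} t)) (count-char-≤ X)) small-X

  -- The exchange is applied to the trace of `C` on `X`, and the result is put together with the
  -- part of `C` outside of `X`, which is left alone.
  choose : ∀ {k} C → Solution k C → ∃ λ D → Solution k D × Any (All (T ∘ D)) Bs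
  choose {k} C (small , hit) = finish (valid A (≤-trans (≤-reflexive (length-elements (λ e → C e ∧ char X e))) (count-char-split C)) inside local)
   where
   A = elements (λ e → C e ∧ char X e)
   inside : ∀ e → e ∈ A → e ∈ X
   inside e e∈ = char⁻ X (proj₂ (∧⁻ {C e} (∈-elements⁻ (λ e → C e ∧ char X e) e∈)))
   local : ∀ u v → Req u v → (∀ e → Sep e u v → e ∈ X) → ListHit A u v
   local u v r S⊆X with hit u v r
   ... | e , s , c = e , s , ∈-elements⁺ (λ e → C e ∧ char X e) (∧⁺ {C e} (c , char⁺ (S⊆X e s)))
   finish : _ → ∃ λ D → Solution k D × Any (All (T ∘ D)) Bs
   finish (Y , len , hits , goal) = D , (≤-trans few small , hit′) , Any.map (All.map λ {e} y → inY e y) goal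
    where
    D : Fin n → Bool
    D e = (C e ∧ not (char X e)) ∨ char Y e
    inY : ∀ e → e ∈ Y → T (D e)
    inY e y = ∨⁺ {C e ∧ not (char X e)} (inj₂ (char⁺ y))
    few : count D ≤ count C
    few = begin
     count D ≤⟨ count-∨ (λ e → C e ∧ not (char X e)) (char Y) ⟩
     count (λ e → C e ∧ not (char X e)) + count (char Y) ≤⟨ +-monoʳ-≤ (count (λ e → C e ∧ not (char X e))) (count-char-≤ Y) ⟩
     count (λ e → C e ∧ not (char X e)) + length Y ≡⟨ cong (count (λ e → C e ∧ not (char X e)) +_) (trans len (length-elements (λ e → C e ∧ char X e))) ⟩
     count (λ e → C e ∧ not (char X e)) + count (λ e → C e ∧ char X e) ≡⟨ +-comm (count (λ e → C e ∧ not (char X e))) _ ⟩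
     count (λ e → C e ∧ char X e) + count (λ e → C e ∧ not (char X e)) ≡⟨ count-split C (char X) ⟨
     count C ∎
     where open ≤-Reasoning
    hit′ : ∀ u v → Req u v → Hit D u v
    hit′ u v r with hit u v r
    ... | e , s , c with T? (char X e)
    ... | no ¬x = e , s , ∨⁺ {C e ∧ not (char X e)} (inj₁ (∧⁺ {C e} (c , T-not⁺ ¬x)))
    ... | yes x with hits u v r (e , s , ∈-elements⁺ (λ e → C e ∧ char X e) (∧⁺ {C e} (c , x)))
    ... | e′ , s′ , y = e′ , s′ , inY e′ y

 record Cut (B : List (Fin n)) (J : Instance n) : Set where
  field
   same-le : Instance.le J ≡ le
   same-al : Instance.al J ≡ al
   req⁺ : ∀ u v → T (rq u v) → (∀ b → b ∈ B → ¬ Sep b u v) → T (Instance.rq J u v)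
   req⁻ : ∀ u v → T (Instance.rq J u v) → T (rq u v) × (∀ b → b ∈ B → ¬ Sep b u v)

  private module J = Instance J

  sepJ⁺ : ∀ {e u v} → Sep e u v → J.Sep e u v
  sepJ⁺ s rewrite same-le | same-al = s
  sepJ⁻ : ∀ {e u v} → J.Sep e u v → Sep e u v
  sepJ⁻ s rewrite same-le | same-al = s

  cut-forth : ∀ {k D} → Solution k D → Unique B → All (T ∘ D) B → length B ≤ k × Solutions.Solvable J (k ∸ length B)
  cut-forth {k} {D} (small , hit) uniq B⊆D = ≤-trans (≤-trans (m≤n+m _ _) total) small ,
   E , m+n≤o⇒m≤o∸n _ (≤-trans total small) , hit′
   where
   E : Fin n → Bool
   E e = D e ∧ not (char B e)
   total = count-remove D B uniq B⊆D
   hit₁ : ∀ u v → T (J.rq u v) → J.Hit E u v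
   hit₁ u v r with req⁻ u v r
   ... | r′ , away with hit u v (inj₁ r′)
   ... | e , s , d = e , sepJ⁺ s , ∧⁺ {D e} (d , T-not⁺ λ t → away e (char⁻ B t) s)
   hit′ : ∀ u v → J.Req u v → J.Hit E u v
   hit′ u v (inj₁ r) = hit₁ u v r
   hit′ u v (inj₂ r) = J.hit-sym {E} {v} {u} (hit₁ v u r)

  cut-back : ∀ {k} → length B ≤ k → Solutions.Solvable J (k ∸ length B) → Solvable k
  cut-back {k} B≤k (E , small , hit) = D , few , hit′
   where
   D : Fin n → Bool
   D e = E e ∨ char B e
   few : count D ≤ k
   few = begin
    count D ≤⟨ count-∨ E (char B) ⟩
    count E + count (char B) ≤⟨ +-mono-≤ small (count-char-≤ B) ⟩
    k ∸ length B + length B ≡⟨ m∸n+n≡m B≤k ⟩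
    k ∎
    where open ≤-Reasoning
   hit₁ : ∀ u v → T (rq u v) → Hit D u v
   hit₁ u v r with Any.any? (λ b → sep? b u v) B
   ... | yes found = let (b , b∈ , s) = find found in b , s , ∨⁺ {E b} (inj₂ (char⁺ b∈))
   ... | no none with hit u v (inj₁ (req⁺ u v r λ b b∈ s → none (lose b∈ s)))
   ... | e , s , c = e , sepJ⁻ s , ∨⁺ {E e} (inj₁ c)
   hit′ : ∀ u v → Req u v → Hit D u v
   hit′ u v (inj₁ r) = hit₁ u v r
   hit′ u v (inj₂ r) = hit-sym {D} {v} {u} (hit₁ v u r)

-- Existence of a step

module Completeness {n} (I : Instance n) {root : Fin n} (tree : IsRooted (Instance.le I) root)
 (alive-root : Instance.Alive I root) where
 open Instance I
 open Rules I root
 open Sides I tree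
 open IsRooted tree

 module _ (stuck : ¬ Step) where
  open Stars I tree stuck

  below-count : Fin n → ℕ
  below-count g = count (λ e → le e g)

  fewer : ∀ {h g} → h ≼ g → h ≢ g → below-count h < below-count g
  fewer {h} {g} h≼g h≢g = count-strict g (λ e e≼h → ≼-trans e≼h h≼g) (λ g≼h → h≢g (≼-antisym h≼g g≼h)) (≼-refl g)

  -- Induction up the tree, on the number of vertices below `g`.
  resolve : ∀ k g → below-count g < k → Alive g → Resolved g
  resolve (suc k) g (s≤s lt) ag = Region.resolved I tree stuck g ag
   λ h ah h≼g h≢g → resolve k h (<-≤-trans (fewer h≼g h≢g) lt) ah

  -- No request passes the root, so the vertex `e` lies strictly below it. There the resolved
  -- structure commits the end to some `y` other than the root, and the root is free: this forces
  -- `y`, a branching with a single set.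
  contradict : ∀ {u v e} → Req u v → Sep e u v → ⊥
  contradict {u} {v} r (ae , inj₁ (u≼e , v⋠e)) = stuck (commit (status-at ae u≼e (≼-root _) λ { refl → v⋠e (≼-root v) }))
   where
   open Interface I tree stuck root alive-root (resolve _ root ≤-refl alive-root)
   commit : Status u → Step
   commit (closed _ d y≢) = commit-root d y≢
   commit (isolated A Z u≼a) = commit-root (commit-from (pull p) (plain-≼ p) (chain-leaf (Stars.Resolved.direct Q p) (Stars.Resolved.leaf Q p) u≼a))
    λ q → h≢ p (sym q)
    where
    Q = resolve _ root ≤-refl alive-root
    p = Stars.Star.Deg1.plain A
  contradict {u} {v} r (ae , inj₂ s) = contradict {v} {u} (req-sym {u} {v} r) (ae , inj₁ s)

-- Polynomial bounds

data Bound : Set where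
 𝕏 : Bound
 𝕂 : ℕ → Bound
 _⊕_ _⊗_ : Bound → Bound → Bound
 _⊙_ : Bound → Bound → Bound

infixl 6 _⊕_
infixl 7 _⊗_
infixl 8 _⊙_

at : Bound → ℕ → ℕ
at 𝕏 x = x
at (𝕂 c) x = c
at (p ⊕ q) x = at p x + at q x
at (p ⊗ q) x = at p x * at q x
at (p ⊙ q) x = at p (at q x)

at-mono : ∀ p {x y} → x ≤ y → at p x ≤ at p y
at-mono 𝕏 l = l
at-mono (𝕂 c) l = ≤-refl
at-mono (p ⊕ q) l = +-mono-≤ (at-mono p l) (at-mono q l)
at-mono (p ⊗ q) l = *-mono-≤ (at-mono p l) (at-mono q l)
at-mono (p ⊙ q) l = at-mono p (at-mono q l)

private
 add mul compose : Polynomial → Polynomial → Polynomial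
 add [] q = q
 add p [] = p
 add (a ∷ p) (b ∷ q) = (a + b) ∷ add p q
 mul [] q = []
 mul (a ∷ p) q = add (List.map (a *_) q) (0 ∷ mul p q)
 compose [] q = []
 compose (a ∷ p) q = add (a ∷ []) (mul q (compose p q))

 ⟦add⟧ : ∀ p q x → ⟦ add p q ⟧ x ≡ ⟦ p ⟧ x + ⟦ q ⟧ x
 ⟦add⟧ [] q x = refl
 ⟦add⟧ (a ∷ p) [] x = sym (+-identityʳ _)
 ⟦add⟧ (a ∷ p) (b ∷ q) x = trans (cong (λ s → a + b + x * s) (⟦add⟧ p q x))
  (solve 5 (λ a b x p q → a :+ b :+ x :* (p :+ q) := (a :+ x :* p) :+ (b :+ x :* q)) refl
  a b x (⟦ p ⟧ x) (⟦ q ⟧ x))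

 ⟦scale⟧ : ∀ a q x → ⟦ List.map (a *_) q ⟧ x ≡ a * ⟦ q ⟧ x
 ⟦scale⟧ a [] x = sym (*-zeroʳ a)
 ⟦scale⟧ a (b ∷ q) x = trans (cong (λ s → a * b + x * s) (⟦scale⟧ a q x))
  (solve 4 (λ a b x q → a :* b :+ x :* (a :* q) := a :* (b :+ x :* q)) refl a b x (⟦ q ⟧ x))

 ⟦mul⟧ : ∀ p q x → ⟦ mul p q ⟧ x ≡ ⟦ p ⟧ x * ⟦ q ⟧ x
 ⟦mul⟧ [] q x = refl
 ⟦mul⟧ (a ∷ p) q x = trans (⟦add⟧ (List.map (a *_) q) (0 ∷ mul p q) x)
  (trans (cong₂ (λ s t → s + x * t) (⟦scale⟧ a q x) (⟦mul⟧ p q x))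
  (solve 4 (λ a x p q → a :* q :+ x :* (p :* q) := (a :+ x :* p) :* q) refl a x (⟦ p ⟧ x) (⟦ q ⟧ x)))

 ⟦compose⟧ : ∀ p q x → ⟦ compose p q ⟧ x ≡ ⟦ p ⟧ (⟦ q ⟧ x)
 ⟦compose⟧ [] q x = refl
 ⟦compose⟧ (a ∷ p) q x = trans (⟦add⟧ (a ∷ []) (mul q (compose p q)) x)
  (cong₂ _+_ (trans (cong (a +_) (*-zeroʳ x)) (+-identityʳ a))
  (trans (⟦mul⟧ q (compose p q) x) (cong (⟦ q ⟧ x *_) (⟦compose⟧ p q x))))

-- Bounds are kept symbolic, with composition as a constructor, and are expanded into coefficients
-- only here.
polynomial : Bound → Polynomial
polynomial 𝕏 = 0 ∷ 1 ∷ []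
polynomial (𝕂 c) = c ∷ []
polynomial (p ⊕ q) = add (polynomial p) (polynomial q)
polynomial (p ⊗ q) = mul (polynomial p) (polynomial q)
polynomial (p ⊙ q) = compose (polynomial p) (polynomial q)

⟦polynomial⟧ : ∀ p x → ⟦ polynomial p ⟧ x ≡ at p x
⟦polynomial⟧ 𝕏 x = solve 1 (λ x → con 0 :+ x :* (con 1 :+ x :* con 0) := x) refl x
⟦polynomial⟧ (𝕂 c) x = trans (cong (c +_) (*-zeroʳ x)) (+-identityʳ c)
⟦polynomial⟧ (p ⊕ q) x = trans (⟦add⟧ (polynomial p) (polynomial q) x) (cong₂ _+_ (⟦polynomial⟧ p x) (⟦polynomial⟧ q x))
⟦polynomial⟧ (p ⊗ q) x = trans (⟦mul⟧ (polynomial p) (polynomial q) x) (cong₂ _*_ (⟦polynomial⟧ p x) (⟦polynomial⟧ q x))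
⟦polynomial⟧ (p ⊙ q) x = trans (⟦compose⟧ (polynomial p) (polynomial q) x)
 (trans (cong ⟦ polynomial p ⟧ (⟦polynomial⟧ q x)) (⟦polynomial⟧ p (at q x)))

-- A language of polynomial-time functions on data

-- Lists are encoded by cons and nil, and booleans as the lists of length 0 and
-- 1, so that the comprehension forᵉ l e is also the bounded quantifier ∃.  In e,
-- 0 is the element and 1 the rest of the list after it.
data Ex (n : ℕ) : Set where
 ref : Fin n → Ex n
 nilᵉ : Ex n
 consᵉ : Ex n → Ex n → Ex n
 caseᵉ : Ex n → Ex n → Ex (2 + n) → Ex n
 letᵉ : Ex n → Ex (1 + n) → Ex n
 forᵉ : Ex n → Ex (2 + n) → Ex n
 eqᵉ : Ex n → Ex n → Ex n

append : Datum → Datum → Datum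
append nil ys = ys
append (cons x xs) ys = cons x (append xs ys)

flatMap : (Datum → Datum → Datum) → Datum → Datum
flatMap f nil = nil
flatMap f (cons x xs) = append (f x xs) (flatMap f xs)

eqᵈ : Datum → Datum → Bool
eqᵈ nil nil = true
eqᵈ nil (cons _ _) = false
eqᵈ (cons _ _) nil = false
eqᵈ (cons a b) (cons c d) = eqᵈ a c ∧ eqᵈ b d

run : ∀ {n} → Ex n → Vec Datum n → Datum
run (ref i) γ = lookup γ i
run nilᵉ γ = nil
run (consᵉ a b) γ = cons (run a γ) (run b γ)
run (caseᵉ a b c) γ with run a γ
... | nil = run b γ
... | cons l r = run c (l ∷ r ∷ γ)
run (letᵉ a b) γ = run b (run a γ ∷ γ)
run (forᵉ l e) γ = flatMap (λ x xs → run e (x ∷ xs ∷ γ)) (run l γ)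
run (eqᵉ a b) γ = encodeBool (eqᵈ (run a γ) (run b γ))

v0 : ∀ {m} → Fin (1 + m)
v0 = zero
v1 : ∀ {m} → Fin (2 + m)
v1 = suc v0
v2 : ∀ {m} → Fin (3 + m)
v2 = suc v1
v3 : ∀ {m} → Fin (4 + m)
v3 = suc v2
v5 : ∀ {m} → Fin (6 + m)
v5 = suc (suc v3)
v7 : ∀ {m} → Fin (8 + m)
v7 = suc (suc v5)
v9 : ∀ {m} → Fin (10 + m)
v9 = suc (suc v7)

appendᵗ eqᵗ : ∀ {m} → Tm m
appendᵗ = fun (fun (case (var v2) (var v0) (cons (var v0) (app (app (var v5) (var v1)) (var v2)))))
eqᵗ = fun (fun (case (var v2)
 (case (var v0) (cons nil nil) nil)
 (case (var v2) nil
 (case (app (app (var v7) (var v2)) (var v0)) nil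
 (app (app (var v9) (var v5)) (var v3))))))

lift : ∀ {n m} → (Fin n → Fin m) → Fin (1 + n) → Fin (1 + m)
lift σ zero = zero
lift σ (suc i) = suc (σ i)

-- Under a comprehension lie the list, the loop, the tail and the head.
loopVar : ∀ {n m} → (Fin n → Fin m) → Fin (2 + n) → Fin (4 + m)
loopVar σ zero = zero
loopVar σ (suc zero) = suc zero
loopVar σ (suc (suc i)) = suc (suc (suc (suc (σ i))))

letVar : ∀ {n m} → (Fin n → Fin m) → Fin (1 + n) → Fin (2 + m)
letVar σ zero = zero
letVar σ (suc i) = suc (suc (σ i))

compile : ∀ {n m} → (Fin n → Fin m) → Ex n → Tm m
compile σ (ref i) = var (σ i)
compile σ nilᵉ = nil
compile σ (consᵉ a b) = cons (compile σ a) (compile σ b)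
compile σ (caseᵉ a b c) = case (compile σ a) (compile σ b) (compile (lift (lift σ)) c)
compile σ (letᵉ a b) = app (fun (compile (letVar σ) b)) (compile σ a)
compile σ (forᵉ l e) = app (fun (case (var v0) nil
 (app (app appendᵗ (compile (loopVar σ) e)) (app (var v3) (var v1))))) (compile σ l)
compile σ (eqᵉ a b) = app (app eqᵗ (compile σ a)) (compile σ b)

total : ∀ {n} → Vec Datum n → ℕ
total [] = 0
total (d ∷ γ) = size d + total γ

-- The variable stands for the total size of the environment. Under a binder the environment grows
-- by the value bound, which explains the substitutions of `outᵇ a ⊕ 𝕏`. The factors 10 and 20 are
-- the times of `append` and of the equality test per unit of size.
outᵇ costᵇ : ∀ {n} → Ex n → Bound
outᵇ (ref i) = 𝕏
outᵇ nilᵉ = 𝕂 1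
outᵇ (consᵉ a b) = 𝕂 1 ⊕ outᵇ a ⊕ outᵇ b
outᵇ (caseᵉ a b c) = outᵇ b ⊕ outᵇ c ⊙ (outᵇ a ⊕ 𝕏)
outᵇ (letᵉ a b) = outᵇ b ⊙ (outᵇ a ⊕ 𝕏)
outᵇ (forᵉ l e) = 𝕂 1 ⊕ outᵇ l ⊗ outᵇ e ⊙ (outᵇ l ⊕ 𝕏)
outᵇ (eqᵉ a b) = 𝕂 3
costᵇ (ref i) = 𝕂 1
costᵇ nilᵉ = 𝕂 1
costᵇ (consᵉ a b) = 𝕂 1 ⊕ costᵇ a ⊕ costᵇ b
costᵇ (caseᵉ a b c) = 𝕂 1 ⊕ costᵇ a ⊕ (costᵇ b ⊕ costᵇ c ⊙ (outᵇ a ⊕ 𝕏))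
costᵇ (letᵉ a b) = 𝕂 2 ⊕ costᵇ a ⊕ costᵇ b ⊙ (outᵇ a ⊕ 𝕏)
costᵇ (forᵉ l e) = 𝕂 5 ⊕ costᵇ l ⊕
 outᵇ l ⊗ (𝕂 9 ⊕ costᵇ e ⊙ (outᵇ l ⊕ 𝕏) ⊕ 𝕂 10 ⊗ outᵇ e ⊙ (outᵇ l ⊕ 𝕏))
costᵇ (eqᵉ a b) = 𝕂 4 ⊕ costᵇ a ⊕ costᵇ b ⊕ 𝕂 20 ⊗ outᵇ a

size-append : ∀ x y → size (append x y) ≤ size x + size y
size-append nil y = n≤1+n (size y)
size-append (cons x xs) y = s≤s (begin
 size x + size (append xs y) ≤⟨ +-monoʳ-≤ (size x) (size-append xs y) ⟩
 size x + (size xs + size y) ≡⟨ +-assoc (size x) _ _ ⟨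
 size x + size xs + size y ∎)
 where open ≤-Reasoning

retime : ∀ {n} {γ : Env n} {e v s t} → s ≡ t → γ ⊢ e ⇓ v ⟨ s ⟩ → γ ⊢ e ⇓ v ⟨ t ⟩
retime refl p = p

data _⊑_ (s : Datum) : Datum → Set where
 ⊑-refl : s ⊑ s
 ⊑-tail : ∀ {y xs} → s ⊑ xs → s ⊑ cons y xs

⊑-trans : ∀ {a b c} → a ⊑ b → b ⊑ c → a ⊑ c
⊑-trans p ⊑-refl = p
⊑-trans p (⊑-tail q) = ⊑-tail (⊑-trans p q)

⊑-size : ∀ {s d} → s ⊑ d → size s ≤ size d
⊑-size ⊑-refl = ≤-refl
⊑-size (⊑-tail {y} {xs} p) = ≤-trans (⊑-size p) (≤-trans (m≤n+m (size xs) (size y)) (n≤1+n _))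

size-flatMap : ∀ f d {B} → (∀ x xs → cons x xs ⊑ d → size (f x xs) ≤ B) → size (flatMap f d) ≤ 1 + size d * B
size-flatMap f nil bd = s≤s z≤n
size-flatMap f (cons x xs) {B} bd = begin
 size (append (f x xs) (flatMap f xs)) ≤⟨ size-append (f x xs) _ ⟩
 size (f x xs) + size (flatMap f xs) ≤⟨ +-mono-≤ (bd x xs ⊑-refl) (size-flatMap f xs (λ y ys p → bd y ys (⊑-tail p))) ⟩
 B + (1 + size xs * B) ≡⟨ +-suc B _ ⟩
 1 + suc (size xs) * B ≤⟨ s≤s (*-monoˡ-≤ B (s≤s (m≤n+m (size xs) (size x)))) ⟩
 1 + suc (size x + size xs) * B ∎
 where open ≤-Reasoning

lookup-total : ∀ {n} (γ : Vec Datum n) i → size (lookup γ i) ≤ total γ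
lookup-total (d ∷ γ) zero = m≤m+n (size d) _
lookup-total (d ∷ γ) (suc i) = ≤-trans (lookup-total γ i) (m≤n+m _ (size d))

size-bool : ∀ b → size (encodeBool b) ≤ 3
size-bool false = s≤s z≤n
size-bool true = ≤-refl

entry : ∀ {n} x xs (γ : Vec Datum n) {A M} → size (cons x xs) ≤ A → total γ ≤ M → total (x ∷ xs ∷ γ) ≤ A + M
entry x xs γ p q = ≤-trans (≤-reflexive (sym (+-assoc (size x) (size xs) (total γ)))) (+-mono-≤ (≤-trans (n≤1+n _) p) q)

out-bound : ∀ {n} (e : Ex n) γ {M} → total γ ≤ M → size (run e γ) ≤ at (outᵇ e) M
out-bound (ref i) γ l = ≤-trans (lookup-total γ i) l
out-bound nilᵉ γ l = ≤-refl
out-bound (consᵉ a b) γ l = s≤s (+-mono-≤ (out-bound a γ l) (out-bound b γ l))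
out-bound (caseᵉ a b c) γ {M} l with run a γ | out-bound a γ l
... | nil | _ = ≤-trans (out-bound b γ l) (m≤m+n _ _)
... | cons x y | o = ≤-trans (out-bound c (x ∷ y ∷ γ) (entry x y γ o l)) (m≤n+m _ (at (outᵇ b) M))
out-bound (letᵉ a b) γ l = out-bound b _ (+-mono-≤ (out-bound a γ l) l)
out-bound (forᵉ d e) γ {M} l = ≤-trans
 (size-flatMap (λ x xs → run e (x ∷ xs ∷ γ)) (run d γ) λ x xs p → out-bound e (x ∷ xs ∷ γ)
 (entry x xs γ (≤-trans (⊑-size p) (out-bound d γ l)) l))
 (s≤s (*-monoˡ-≤ _ (out-bound d γ l)))
out-bound (eqᵉ a b) γ l = size-bool _

timeAppend : Datum → ℕ
timeAppend nil = 3
timeAppend (cons x xs) = 10 + timeAppend xs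

timeAppend-≤ : ∀ x → timeAppend x ≤ 10 * size x
timeAppend-≤ nil = ≤ᵇ⇒≤ 3 10 tt
timeAppend-≤ (cons x xs) = begin
 10 + timeAppend xs ≤⟨ +-monoʳ-≤ 10 (timeAppend-≤ xs) ⟩
 10 + 10 * size xs ≤⟨ +-monoʳ-≤ 10 (*-monoʳ-≤ 10 (m≤n+m (size xs) (size x))) ⟩
 10 + 10 * (size x + size xs) ≡⟨ *-suc 10 (size x + size xs) ⟨
 10 * size (cons x xs) ∎
 where open ≤-Reasoning

private
 appendBody : ∀ {m} → Tm (4 + m)
 appendBody = case (var v2) (var v0) (cons (var v0) (app (app (var v5) (var v1)) (var v2)))

 eqBody : ∀ {m} → Tm (4 + m)
 eqBody = case (var v2)
  (case (var v0) (cons nil nil) nil)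
  (case (var v2) nil
  (case (app (app (var v7) (var v2)) (var v0)) nil
  (app (app (var v9) (var v5)) (var v3))))

 frame : ∀ {m} → Tm (4 + m) → Datum → Datum → Env m → Env (4 + m)
 frame t x y δ = ⌜ y ⌝ ∷ closure (⌜ x ⌝ ∷ closure δ (fun t) ∷ δ) t ∷ ⌜ x ⌝ ∷ closure δ (fun t) ∷ δ

 append-run : ∀ {m} x y (δ : Env m) → frame appendBody x y δ ⊢ appendBody ⇓ ⌜ append x y ⌝ ⟨ timeAppend x ⟩
 append-run nil y δ = case-nil (var v2) (var v0)
 append-run (cons x xs) y δ = case-cons (var v2) (cons (var v0)
  (app (app (var v5) (var v1) (fun appendBody)) (var v2) (append-run xs y δ)))

timeEq : Datum → Datum → ℕ
timeEq nil nil = 7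
timeEq nil (cons _ _) = 5
timeEq (cons _ _) nil = 5
timeEq (cons a b) (cons c d) with eqᵈ a c
... | false = 12 + timeEq a c
... | true = 17 + timeEq a c + timeEq b d

timeEq-≤ : ∀ x y → timeEq x y ≤ 20 * size x
timeEq-≤ nil nil = ≤ᵇ⇒≤ 7 20 tt
timeEq-≤ nil (cons _ _) = ≤ᵇ⇒≤ 5 20 tt
timeEq-≤ (cons a b) nil = ≤-trans (≤ᵇ⇒≤ 5 20 tt) (*-monoʳ-≤ 20 {1} {size (cons a b)} (s≤s z≤n))
timeEq-≤ (cons a b) (cons c d) with eqᵈ a c
... | false = begin
 12 + timeEq a c ≤⟨ +-mono-≤ (≤ᵇ⇒≤ 12 20 tt) (timeEq-≤ a c) ⟩
 20 + 20 * size a ≡⟨ *-suc 20 (size a) ⟨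
 20 * suc (size a) ≤⟨ *-monoʳ-≤ 20 (s≤s (m≤m+n (size a) (size b))) ⟩
 20 * size (cons a b) ∎
 where open ≤-Reasoning
... | true = begin
 17 + timeEq a c + timeEq b d ≤⟨ +-mono-≤ (+-mono-≤ (≤ᵇ⇒≤ 17 20 tt) (timeEq-≤ a c)) (timeEq-≤ b d) ⟩
 20 + 20 * size a + 20 * size b ≡⟨ solve 2 (λ a b → con 20 :+ con 20 :* a :+ con 20 :* b := con 20 :* (con 1 :+ (a :+ b))) refl (size a) (size b) ⟩
 20 * size (cons a b) ∎
 where open ≤-Reasoning

private
 eq-run : ∀ {m} x y (δ : Env m) → frame eqBody x y δ ⊢ eqBody ⇓ ⌜ encodeBool (eqᵈ x y) ⌝ ⟨ timeEq x y ⟩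
 eq-run nil nil δ = case-nil (var v2) (case-nil (var v0) (cons nil nil))
 eq-run nil (cons _ _) δ = case-nil (var v2) (case-cons (var v0) nil)
 eq-run (cons _ _) nil δ = case-cons (var v2) (case-nil (var v2) nil)
 eq-run (cons a b) (cons c d) δ with eqᵈ a c | eq-run a c δ
 ... | false | r = retime (cong (11 +_) (+-comm (timeEq a c) 1))
  (case-cons (var v2) (case-cons (var v2) (case-nil
  (app (app (var v7) (var v2) (fun eqBody)) (var v0) r) nil)))
 ... | true | r = retime (solve 2 (λ s t → con 11 :+ (s :+ (con 6 :+ t)) := con 17 :+ s :+ t) refl (timeEq a c) (timeEq b d))
  (case-cons (var v2) (case-cons (var v2) (case-cons
  (app (app (var v7) (var v2) (fun eqBody)) (var v0) r)
  (app (app (var v9) (var v5) (fun eqBody)) (var v3) (eq-run b d δ)))))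

Matches : ∀ {n m} → (Fin n → Fin m) → Vec Datum n → Env m → Set
Matches σ γ δ = ∀ i → lookup δ (σ i) ≡ ⌜ lookup γ i ⌝

record Evaluates {m} (δ : Env m) (t : Tm m) (d : Datum) (B : ℕ) : Set where
 constructor evaluates
 field
  time : ℕ
  deriv : δ ⊢ t ⇓ ⌜ d ⌝ ⟨ time ⟩
  limit : time ≤ B

compile-runs : ∀ {n m} (e : Ex n) (σ : Fin n → Fin m) γ δ → Matches σ γ δ → ∀ {M} → total γ ≤ M →
 Evaluates δ (compile σ e) (run e γ) (at (costᵇ e) M)
compile-runs (ref i) σ γ δ μ l = evaluates 1 (subst (λ v → δ ⊢ var (σ i) ⇓ v ⟨ 1 ⟩) (μ i) (var (σ i))) ≤-refl
compile-runs nilᵉ σ γ δ μ l = evaluates 1 nil ≤-refl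
compile-runs (consᵉ a b) σ γ δ μ l with compile-runs a σ γ δ μ l | compile-runs b σ γ δ μ l
... | evaluates s p p≤ | evaluates t q q≤ = evaluates _ (cons p q) (s≤s (+-mono-≤ p≤ q≤))
compile-runs (caseᵉ a b c) σ γ δ μ {M} l with run a γ | out-bound a γ l | compile-runs a σ γ δ μ l
... | nil | _ | evaluates s p p≤ with compile-runs b σ γ δ μ l
... | evaluates t q q≤ = evaluates _ (case-nil p q) (s≤s (+-mono-≤ p≤ (≤-trans q≤ (m≤m+n _ _))))
compile-runs (caseᵉ a b c) σ γ δ μ {M} l | cons x y | o | evaluates s p p≤
 with compile-runs c (lift (lift σ)) (x ∷ y ∷ γ) (⌜ x ⌝ ∷ ⌜ y ⌝ ∷ δ) (λ { zero → refl ; (suc zero) → refl ; (suc (suc i)) → μ i })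
 (entry x y γ o l)
... | evaluates t q q≤ = evaluates _ (case-cons p q) (s≤s (+-mono-≤ p≤ (≤-trans q≤ (m≤n+m _ (at (costᵇ b) M)))))
compile-runs (letᵉ a b) σ γ δ μ l with compile-runs a σ γ δ μ l
... | evaluates s p p≤ with compile-runs b (letVar σ) (run a γ ∷ γ) (⌜ run a γ ⌝ ∷ closure δ (compile (letVar σ) b) ∷ δ)
 (λ { zero → refl ; (suc i) → μ i }) (+-mono-≤ (out-bound a γ l) l)
... | evaluates t q q≤ = evaluates _ (app (fun _) p q) (s≤s (s≤s (+-mono-≤ p≤ q≤)))
compile-runs {m = m} (forᵉ d e) σ γ δ μ {M} l with compile-runs d σ γ δ μ l
... | evaluates s p p≤ = evaluates _ (app (fun body) p (Evaluates.deriv w)) (begin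
 suc (1 + s + Evaluates.time w) ≤⟨ s≤s (s≤s (+-mono-≤ p≤ (Evaluates.limit w))) ⟩
 2 + (at (costᵇ d) M + (3 + size (run d γ) * R))
 ≤⟨ +-monoʳ-≤ 2 (+-monoʳ-≤ (at (costᵇ d) M) (+-monoʳ-≤ 3 (*-monoˡ-≤ R (out-bound d γ l)))) ⟩
 2 + (at (costᵇ d) M + (3 + at (outᵇ d) M * R))
 ≡⟨ solve 2 (λ c r → con 2 :+ (c :+ (con 3 :+ r)) := con 5 :+ c :+ r) refl (at (costᵇ d) M) (at (outᵇ d) M * R) ⟩
 5 + at (costᵇ d) M + at (outᵇ d) M * R ∎)
 where
 open ≤-Reasoning
 N = at (outᵇ d) M + M
 R = 9 + at (costᵇ e) N + 10 * at (outᵇ e) N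
 body : Tm (2 + m)
 body = case (var v0) nil (app (app appendᵗ (compile (loopVar σ) e)) (app (var v3) (var v1)))

 loop : ∀ xs → xs ⊑ run d γ →
  Evaluates (⌜ xs ⌝ ∷ closure δ body ∷ δ) body (flatMap (λ x xs → run e (x ∷ xs ∷ γ)) xs) (3 + size xs * R)
 loop nil sub = evaluates 3 (case-nil (var v0) nil) (m≤m+n 3 _)
 loop (cons x xs) sub with loop xs (⊑-trans (⊑-tail ⊑-refl) sub)
  | compile-runs e (loopVar σ) (x ∷ xs ∷ γ) (⌜ x ⌝ ∷ ⌜ xs ⌝ ∷ ⌜ cons x xs ⌝ ∷ closure δ body ∷ δ)
  (λ { zero → refl ; (suc zero) → refl ; (suc (suc i)) → μ i }) (entry x xs γ (≤-trans (⊑-size sub) (out-bound d γ l)) l)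
 ... | evaluates r q q≤ | evaluates t q′ q′≤ = evaluates _
  (case-cons (var v0) (app (app (fun (fun appendBody)) q′ (fun appendBody)) (app (var v3) (var v1) q)
  (append-run (run e (x ∷ xs ∷ γ)) _ _)))
  (begin
  suc (1 + suc (suc (1 + t + 1) + suc (2 + r) + TA))
  ≡⟨ solve 3 (λ t r a → con 2 :+ (con 1 :+ ((con 1 :+ (con 1 :+ t :+ con 1)) :+ (con 3 :+ r) :+ a)) := (con 9 :+ t :+ a) :+ r) refl t r TA ⟩
  (9 + t + TA) + r
  ≤⟨ +-mono-≤ (+-mono-≤ (+-monoʳ-≤ 9 q′≤) (≤-trans (timeAppend-≤ (run e (x ∷ xs ∷ γ))) (*-monoʳ-≤ 10 (out-bound e (x ∷ xs ∷ γ) room)))) q≤ ⟩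
  R + (3 + size xs * R)
  ≡⟨ solve 2 (λ r s → r :+ (con 3 :+ s) := con 3 :+ (r :+ s)) refl R (size xs * R) ⟩
  3 + suc (size xs) * R
  ≤⟨ +-monoʳ-≤ 3 (*-monoˡ-≤ R (s≤s (m≤n+m (size xs) (size x)))) ⟩
  3 + size (cons x xs) * R ∎)
  where
  TA = timeAppend (run e (x ∷ xs ∷ γ))
  room : total (x ∷ xs ∷ γ) ≤ N
  room = entry x xs γ (≤-trans (⊑-size sub) (out-bound d γ l)) l
 w = loop (run d γ) ⊑-refl
compile-runs (eqᵉ a b) σ γ δ μ {M} l with compile-runs a σ γ δ μ l | compile-runs b σ γ δ μ l
... | evaluates s p p≤ | evaluates t q q≤ = evaluates _
 (app (app (fun _) p (fun eqBody)) q (eq-run (run a γ) (run b γ) δ))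
 (begin
 suc (suc (1 + s + 1) + t + E)
 ≡⟨ solve 3 (λ s t e → con 1 :+ ((con 1 :+ (con 1 :+ s :+ con 1)) :+ t :+ e) := con 4 :+ s :+ t :+ e) refl s t E ⟩
 4 + s + t + E
 ≤⟨ +-mono-≤ (+-mono-≤ (+-monoʳ-≤ 4 p≤) q≤) (≤-trans (timeEq-≤ (run a γ) (run b γ)) (*-monoʳ-≤ 20 (out-bound a γ l))) ⟩
 4 + at (costᵇ a) M + at (costᵇ b) M + 20 * at (outᵇ a) M ∎)
 where
 open ≤-Reasoning
 E = timeEq (run a γ) (run b γ)

-- The search tree explored from a state; nil is the accepting state, and a
-- list of states is accepted if one of them is.
module Search (next : Ex 1) where
 module _ (M : ℕ) where
  data Explores : Datum → Bool → ℕ → Set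
  data ExploresAny : Datum → Bool → ℕ → Set

  data Explores where
   accepted : Explores nil true 1
   expand : ∀ {x y b N} → size (cons x y) ≤ M → ExploresAny (run next (cons x y ∷ [])) b N →
    Explores (cons x y) b (suc N)

  data ExploresAny where
   exhausted : ExploresAny nil false 0
   succeeds : ∀ {x xs N} → Explores x true N → ExploresAny (cons x xs) true N
   fails : ∀ {x xs b N N′} → Explores x false N → ExploresAny xs b N′ → ExploresAny (cons x xs) b (N + N′)

 private
  argument : ∀ {m} → Fin 1 → Fin (3 + m)
  argument _ = v2

  anyBody : ∀ {m} → Tm (6 + m)
  anyBody = case (var v0) nil (case (app (var v7) (var v0)) (app (var v3) (var v1)) (cons nil nil))

  solveBody : ∀ {m} → Tm (2 + m)
  solveBody = case (var v0) (cons nil nil) (app (fun anyBody) (compile argument next))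

 search : Ex 1 → Algorithm
 search init = app (fun solveBody) (compile id init)

 nodeᵇ : Bound
 nodeᵇ = 𝕂 16 ⊕ costᵇ next

 private
  solving : Datum → Env 1 → Env 3
  solving s δ = ⌜ s ⌝ ∷ closure δ solveBody ∷ δ

  trying : Datum → Datum → Datum → Env 1 → Env 7
  trying l x y δ = ⌜ l ⌝ ∷ closure δ′ anyBody ∷ δ′
   where
   δ′ : Env 5
   δ′ = ⌜ x ⌝ ∷ ⌜ y ⌝ ∷ solving (cons x y) δ

 module _ {M : ℕ} (δ : Env 1) where
  private
   K = at nodeᵇ M

  -- The surplus 9 pays for the steps around a call in `anyBody`, so that the times of the subtrees
  -- just add up. The constant 16 in `nodeᵇ` is what this requires.
  solve-runs : ∀ {s b N} → Explores M s b N →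
   ∃ λ t → (solving s δ ⊢ solveBody ⇓ ⌜ encodeBool b ⌝ ⟨ t ⟩) × t + 9 ≤ N * K
  any-runs : ∀ {l b N} x y → ExploresAny M l b N →
   ∃ λ t → (trying l x y δ ⊢ anyBody ⇓ ⌜ encodeBool b ⌝ ⟨ t ⟩) × t ≤ 3 + N * K

  solve-runs accepted = 5 , case-nil (var v0) (cons nil nil) ,
   ≤-trans (≤ᵇ⇒≤ 14 16 tt) (≤-trans (m≤m+n 16 (at (costᵇ next) M)) (m≤m+n K 0))
  solve-runs (expand {x} {y} {b} {N} small any) with
   compile-runs next argument (cons x y ∷ []) (⌜ x ⌝ ∷ ⌜ y ⌝ ∷ solving (cons x y) δ) (λ { zero → refl })
   (≤-trans (≤-reflexive (+-identityʳ _)) small)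
   | any-runs x y any
  ... | evaluates c p c≤ | t , q , t≤ = _ , case-cons (var v0) (app (fun anyBody) p q) , (begin
   suc (1 + suc (1 + c + t)) + 9
   ≡⟨ solve 2 (λ c t → con 1 :+ (con 1 :+ (con 1 :+ (con 1 :+ c :+ t))) :+ con 9 := con 13 :+ c :+ t) refl c t ⟩
   13 + c + t ≤⟨ +-mono-≤ (+-monoʳ-≤ 13 c≤) t≤ ⟩
   13 + C + (3 + N * K)
   ≡⟨ solve 2 (λ c n → con 13 :+ c :+ (con 3 :+ n) := (con 16 :+ c) :+ n) refl C (N * K) ⟩
   K + N * K ∎)
   where
   open ≤-Reasoning
   C = at (costᵇ next) M
  any-runs x y exhausted = 3 , case-nil (var v0) nil , ≤-refl
  any-runs x y (succeeds {N = N} e) with solve-runs e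
  ... | t , p , t≤ = _ , case-cons (var v0) (case-cons (app (var v7) (var v0) p) (cons nil nil)) , (begin
   suc (1 + suc (suc (1 + 1 + t) + 3))
   ≡⟨ solve 1 (λ t → con 3 :+ ((con 3 :+ t) :+ con 3) := t :+ con 9) refl t ⟩
   t + 9 ≤⟨ t≤ ⟩
   N * K ≤⟨ m≤n+m _ 3 ⟩
   3 + N * K ∎)
   where open ≤-Reasoning
  any-runs x y (fails {N = N} {N′} e es) with solve-runs e | any-runs x y es
  ... | t , p , t≤ | t′ , p′ , t′≤ = _ ,
   case-cons (var v0) (case-nil (app (var v7) (var v0) p) (app (var v3) (var v1) p′)) , (begin
   suc (1 + suc (suc (1 + 1 + t) + suc (1 + 1 + t′)))
   ≡⟨ solve 2 (λ t u → con 3 :+ ((con 3 :+ t) :+ (con 3 :+ u)) := (t :+ con 9) :+ u) refl t t′ ⟩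
   (t + 9) + t′ ≤⟨ +-mono-≤ t≤ t′≤ ⟩
   N * K + (3 + N′ * K) ≡⟨ solve 3 (λ n n′ k → n :* k :+ (con 3 :+ n′ :* k) := con 3 :+ (n :+ n′) :* k) refl N N′ K ⟩
   3 + (N + N′) * K ∎)
   where open ≤-Reasoning

 search-runs : ∀ init x {M b N} → Explores M (run init [ x ]) b N →
  ∃ λ t → (search init On x Outputs b InTime t) × t ≤ 2 + at (costᵇ init) (size x) + N * at nodeᵇ M
 search-runs init x {M} {N = N} e with compile-runs init id [ x ] (⌜ x ⌝ ∷ []) (λ { zero → refl }) (≤-reflexive (+-identityʳ (size x)))
  | solve-runs (⌜ x ⌝ ∷ []) e
 ... | evaluates c p c≤ | t , q , t≤ = _ , app (fun solveBody) p q ,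
  s≤s (s≤s (+-mono-≤ c≤ (≤-trans (m≤m+n t 9) t≤)))

-- First-order formulas

-- Formulas with i variables for vertices and j variables for lists of vertices
-- of length at most window, in the language of partially rooted trees.
infixr 6 _∧ᶠ_
infixr 5 _∨ᶠ_
infixr 4 _→ᶠ_
data Form (i j : ℕ) : Set where
 leᶠ adᶠ rqᶠ eqᶠ : Fin i → Fin i → Form i j
 alᶠ : Fin i → Form i j
 inᶠ : Fin i → Fin j → Form i j
 longᶠ : Fin j → Fin j → Form i j
 ¬ᶠ_ : Form i j → Form i j
 _∧ᶠ_ _∨ᶠ_ _→ᶠ_ : Form i j → Form i j → Form i j
 ∃ᶠ_ ∀ᶠ_ : Form (1 + i) j → Form i j
 ∃ˡ_ ∀ˡ_ : Form i (1 + j) → Form i j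

record Model (n : ℕ) : Set where
 field
  ad : Fin n → Fin n → Bool
  inst : Instance n
 open Instance inst public

member : Fin n → List (Fin n) → Bool
member v [] = false
member v (w ∷ L) = does (v ≟ᶠ w) ∨ member v L

upTo distinct : ℕ → List (List (Fin n))
upTo zero = [] ∷ []
upTo {n} (suc k) = [] ∷ List.concatMap (λ v → List.concatMap (λ l → [ v ∷ l ]) (upTo k)) (List.allFin n)
distinct zero = [] ∷ []
distinct {n} (suc k) = List.concatMap (λ v → List.concatMap
 (λ l → if member v l then [] else (v ∷ l) ∷ []) (distinct k)) (List.allFin n)

module _ (M : Model n) where
 open Model M

 holds : Form i j → Vec (Fin n) i → Vec (List (Fin n)) j → Set
 holds (leᶠ x y) xs Ls = T (le (lookup xs x) (lookup xs y))
 holds (adᶠ x y) xs Ls = T (ad (lookup xs x) (lookup xs y))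
 holds (rqᶠ x y) xs Ls = T (rq (lookup xs x) (lookup xs y))
 holds (eqᶠ x y) xs Ls = lookup xs x ≡ lookup xs y
 holds (alᶠ x) xs Ls = T (al (lookup xs x))
 holds (inᶠ x y) xs Ls = lookup xs x ∈ lookup Ls y
 holds (longᶠ x y) xs Ls = length (lookup Ls x) ≡ length (lookup Ls y)
 holds (¬ᶠ φ) xs Ls = ¬ holds φ xs Ls
 holds (φ ∧ᶠ ψ) xs Ls = holds φ xs Ls × holds ψ xs Ls
 holds (φ ∨ᶠ ψ) xs Ls = holds φ xs Ls ⊎ holds ψ xs Ls
 holds (φ →ᶠ ψ) xs Ls = holds φ xs Ls → holds ψ xs Ls
 holds (∃ᶠ φ) xs Ls = ∃ λ x → holds φ (x ∷ xs) Ls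
 holds (∀ᶠ φ) xs Ls = ∀ x → holds φ (x ∷ xs) Ls
 holds (∃ˡ φ) xs Ls = ∃ λ L → length L ≤ window × holds φ xs (L ∷ Ls)
 holds (∀ˡ φ) xs Ls = ∀ L → length L ≤ window → holds φ xs (L ∷ Ls)

 eval : Form i j → Vec (Fin n) i → Vec (List (Fin n)) j → Bool
 eval (leᶠ x y) xs Ls = le (lookup xs x) (lookup xs y)
 eval (adᶠ x y) xs Ls = ad (lookup xs x) (lookup xs y)
 eval (rqᶠ x y) xs Ls = rq (lookup xs x) (lookup xs y)
 eval (eqᶠ x y) xs Ls = does (lookup xs x ≟ᶠ lookup xs y)
 eval (alᶠ x) xs Ls = al (lookup xs x)
 eval (inᶠ x y) xs Ls = member (lookup xs x) (lookup Ls y)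
 eval (longᶠ x y) xs Ls = length (lookup Ls x) ≡ᵇ length (lookup Ls y)
 eval (¬ᶠ φ) xs Ls = not (eval φ xs Ls)
 eval (φ ∧ᶠ ψ) xs Ls = eval φ xs Ls ∧ eval ψ xs Ls
 eval (φ ∨ᶠ ψ) xs Ls = eval φ xs Ls ∨ eval ψ xs Ls
 eval (φ →ᶠ ψ) xs Ls = not (eval φ xs Ls) ∨ eval ψ xs Ls
 eval (∃ᶠ φ) xs Ls = any (λ x → eval φ (x ∷ xs) Ls) (List.allFin n)
 eval (∀ᶠ φ) xs Ls = not (any (λ x → not (eval φ (x ∷ xs) Ls)) (List.allFin n))
 eval (∃ˡ φ) xs Ls = any (λ L → eval φ xs (L ∷ Ls)) (upTo window)
 eval (∀ˡ φ) xs Ls = not (any (λ L → not (eval φ xs (L ∷ Ls))) (upTo window))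

∈-concatMap⁺ : {A B : Set} (f : A → List B) {x : A} {y : B} {xs : List A} → x ∈ xs → y ∈ f x → y ∈ List.concatMap f xs
∈-concatMap⁺ f {xs = x ∷ xs} ∈₀ q = ∈-++⁺ˡ q
∈-concatMap⁺ f {xs = x ∷ xs} (there p) q = ∈-++⁺ʳ (f x) (∈-concatMap⁺ f p q)

∈-concatMap⁻ : {A B : Set} (f : A → List B) {y : B} (xs : List A) → y ∈ List.concatMap f xs → ∃ λ x → x ∈ xs × y ∈ f x
∈-concatMap⁻ f (x ∷ xs) p with ∈-++⁻ (f x) p
... | inj₁ q = x , ∈₀ , q
... | inj₂ q with ∈-concatMap⁻ f xs q
... | x′ , p′ , q′ = x′ , there p′ , q′

∈-upTo⁺ : ∀ k (L : List (Fin n)) → length L ≤ k → L ∈ upTo k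
∈-upTo⁺ zero [] l = ∈₀
∈-upTo⁺ (suc k) [] l = ∈₀
∈-upTo⁺ (suc k) (v ∷ L) (s≤s l) = there (∈-concatMap⁺ _ (∈-allFin v)
 (∈-concatMap⁺ (λ l → [ v ∷ l ]) (∈-upTo⁺ k L l) ∈₀))

∈-upTo⁻ : ∀ k {L : List (Fin n)} → L ∈ upTo k → length L ≤ k
∈-upTo⁻ zero ∈₀ = z≤n
∈-upTo⁻ (suc k) ∈₀ = z≤n
∈-upTo⁻ {n} (suc k) (there p) with ∈-concatMap⁻ _ (List.allFin n) p
... | v , _ , q with ∈-concatMap⁻ _ (upTo k) q
... | L , r , ∈₀ = s≤s (∈-upTo⁻ k r)

member-reflects : ∀ (v : Fin n) L → Reflects (v ∈ L) (member v L)
member-reflects v [] = ofⁿ λ ()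
member-reflects v (w ∷ L) with v ≟ᶠ w | member v L | member-reflects v L
... | yes refl | _ | _ = ofʸ ∈₀
... | no v≢w | true | ofʸ p = ofʸ (there p)
... | no v≢w | false | ofⁿ ¬p = ofⁿ λ { (here q) → v≢w q ; (there q) → ¬p q }

∈-fresh : ∀ (v : Fin n) L → v ∉ L → v ∷ L ∈ (if member v L then [] else (v ∷ L) ∷ [])
∈-fresh v L v∉ with member v L | member-reflects v L
... | true | ofʸ p = ⊥-elim (v∉ p)
... | false | _ = ∈₀

∈-distinct⁺ : ∀ (L : List (Fin n)) → Unique L → L ∈ distinct (length L)
∈-distinct⁺ [] u = ∈₀
∈-distinct⁺ (v ∷ L) (v∉ ∷ u) = ∈-concatMap⁺ _ (∈-allFin v) (∈-concatMap⁺ _ (∈-distinct⁺ L u)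
 (∈-fresh v L λ v∈ → All.lookup v∉ v∈ refl))

∈-distinct⁻ : ∀ k {L : List (Fin n)} → L ∈ distinct k → length L ≡ k × Unique L
∈-distinct⁻ zero ∈₀ = refl , []
∈-distinct⁻ {n} (suc k) p with ∈-concatMap⁻ _ (List.allFin n) p
... | v , _ , q with ∈-concatMap⁻ _ (distinct k) q
... | L , r , s with member v L | member-reflects v L | s
... | false | ofⁿ v∉ | ∈₀ = cong suc (proj₁ (∈-distinct⁻ k r)) ,
 All.tabulate (λ w∈ → λ { refl → v∉ w∈ }) ∷ proj₂ (∈-distinct⁻ k r)

some-reflects : {A : Set} {P : A → Set} {p : A → Bool} (xs : List A) → (∀ x → Reflects (P x) (p x)) →
 Reflects (∃ λ x → x ∈ xs × P x) (any p xs)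
some-reflects [] r = ofⁿ λ ()
some-reflects {p = p} (x ∷ xs) r with p x | r x | any p xs | some-reflects xs r
... | true | ofʸ a | _ | _ = ofʸ (x , ∈₀ , a)
... | false | ofⁿ _ | true | ofʸ (y , q) = ofʸ (y , there (proj₁ q) , proj₂ q)
... | false | ofⁿ a | false | ofⁿ b = ofⁿ λ { (_ , ∈₀ , c) → a c ; (y , there q , c) → b (y , q , c) }

map-reflects : {A B : Set} {b : Bool} → (A → B) → (B → A) → Reflects A b → Reflects B b
map-reflects f g (ofʸ a) = ofʸ (f a)
map-reflects f g (ofⁿ ¬a) = ofⁿ (¬a ∘ g)

stable : {A : Set} {b : Bool} → Reflects A b → ¬ ¬ A → A
stable (ofʸ a) _ = a
stable (ofⁿ ¬a) ¬¬ = ⊥-elim (¬¬ ¬a)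

module _ (M : Model n) where
 open Model M

 eval-reflects : ∀ (φ : Form i j) xs Ls → Reflects (holds M φ xs Ls) (eval M φ xs Ls)
 eval-reflects (leᶠ x y) xs Ls = T-reflects _
 eval-reflects (adᶠ x y) xs Ls = T-reflects _
 eval-reflects (rqᶠ x y) xs Ls = T-reflects _
 eval-reflects (eqᶠ x y) xs Ls = proof (lookup xs x ≟ᶠ lookup xs y)
 eval-reflects (alᶠ x) xs Ls = T-reflects _
 eval-reflects (inᶠ x y) xs Ls = member-reflects _ _
 eval-reflects (longᶠ x y) xs Ls = fromEquivalence (≡ᵇ⇒≡ _ _) (≡⇒≡ᵇ _ _)
 eval-reflects (¬ᶠ φ) xs Ls = ¬-reflects (eval-reflects φ xs Ls)
 eval-reflects (φ ∧ᶠ ψ) xs Ls = eval-reflects φ xs Ls ×-reflects eval-reflects ψ xs Ls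
 eval-reflects (φ ∨ᶠ ψ) xs Ls = eval-reflects φ xs Ls ⊎-reflects eval-reflects ψ xs Ls
 eval-reflects (φ →ᶠ ψ) xs Ls = eval-reflects φ xs Ls →-reflects eval-reflects ψ xs Ls
 eval-reflects (∃ᶠ φ) xs Ls = map-reflects (λ (x , _ , p) → x , p) (λ (x , p) → x , ∈-allFin x , p)
  (some-reflects (List.allFin n) λ x → eval-reflects φ (x ∷ xs) Ls)
 eval-reflects (∀ᶠ φ) xs Ls = map-reflects
  (λ ¬∃ x → stable (eval-reflects φ (x ∷ xs) Ls) λ ¬p → ¬∃ (x , ∈-allFin x , ¬p)) (λ ∀p (x , _ , ¬p) → ¬p (∀p x))
  (¬-reflects (some-reflects (List.allFin n) λ x → ¬-reflects (eval-reflects φ (x ∷ xs) Ls)))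
 eval-reflects (∃ˡ φ) xs Ls = map-reflects
  (λ (L , p , q) → L , ∈-upTo⁻ window p , q) (λ (L , p , q) → L , ∈-upTo⁺ window L p , q)
  (some-reflects (upTo window) λ L → eval-reflects φ xs (L ∷ Ls))
 eval-reflects (∀ˡ φ) xs Ls = map-reflects
  (λ ¬∃ L l → stable (eval-reflects φ xs (L ∷ Ls)) λ ¬p → ¬∃ (L , ∈-upTo⁺ window L l , ¬p))
  (λ ∀p (L , p , ¬p) → ¬p (∀p L (∈-upTo⁻ window p)))
  (¬-reflects (some-reflects (upTo window) λ L → ¬-reflects (eval-reflects φ xs (L ∷ Ls))))

truth : Datum → Bool
truth nil = false
truth (cons _ _) = true

len : Datum → ℕ
len nil = 0
len (cons _ d) = suc (len d)

contains : Datum → Datum → Bool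
contains x nil = false
contains x (cons y l) = eqᵈ x y ∨ contains x l

truth-append : ∀ a b → truth (append a b) ≡ truth a ∨ truth b
truth-append nil b = refl
truth-append (cons _ _) b = refl

truth-encodeBool : ∀ b → truth (encodeBool b) ≡ b
truth-encodeBool true = refl
truth-encodeBool false = refl

truth-flatMap : {A : Set} (f : A → Datum) {F : Datum → Datum → Datum} {p : A → Bool} →
 (∀ x r → truth (F (f x) r) ≡ p x) → ∀ xs → truth (flatMap F (encodeList f xs)) ≡ any p xs
truth-flatMap f h [] = refl
truth-flatMap f {F} h (x ∷ xs) = trans (truth-append (F (f x) _) _) (cong₂ _∨_ (h x _) (truth-flatMap f h xs))

contains-loop : ∀ x l → truth (flatMap (λ y _ → encodeBool (eqᵈ x y)) l) ≡ contains x l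
contains-loop x nil = refl
contains-loop x (cons y l) = trans (truth-append (encodeBool (eqᵈ x y)) _)
 (cong₂ _∨_ (truth-encodeBool (eqᵈ x y)) (contains-loop x l))

contains-append : ∀ x a b → contains x (append a b) ≡ contains x a ∨ contains x b
contains-append x nil b = refl
contains-append x (cons y a) b = trans (cong (eqᵈ x y ∨_) (contains-append x a b)) (sym (∨-assoc (eqᵈ x y) _ _))

contains-flatMap : {A : Set} (f : A → Datum) {F : Datum → Datum → Datum} {p : A → Bool} → ∀ x →
 (∀ y r → contains x (F (f y) r) ≡ p y) → ∀ xs → contains x (flatMap F (encodeList f xs)) ≡ any p xs
contains-flatMap f x h [] = refl
contains-flatMap f {F} x h (y ∷ ys) = trans (contains-append x (F (f y) _) _) (cong₂ _∨_ (h y _) (contains-flatMap f x h ys))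

encodeList-++ : {A : Set} (f : A → Datum) → ∀ xs ys → encodeList f (xs ++ ys) ≡ append (encodeList f xs) (encodeList f ys)
encodeList-++ f [] ys = refl
encodeList-++ f (x ∷ xs) ys = cong (cons (f x)) (encodeList-++ f xs ys)

flatMap-encode : {A B : Set} (f : A → Datum) (h : B → Datum) {F : Datum → Datum → Datum} {g : A → List B} →
 (∀ x r → F (f x) r ≡ encodeList h (g x)) → ∀ xs →
 flatMap F (encodeList f xs) ≡ encodeList h (List.concatMap g xs)
flatMap-encode f h e [] = refl
flatMap-encode f h {g = g} e (x ∷ xs) = trans (cong₂ append (e x _) (flatMap-encode f h e xs))
 (sym (encodeList-++ h (g x) (List.concatMap g xs)))

eqᵈ-refl : ∀ x → eqᵈ x x ≡ true
eqᵈ-refl nil = refl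
eqᵈ-refl (cons a b) = cong₂ _∧_ (eqᵈ-refl a) (eqᵈ-refl b)

eqᵈ-sound : ∀ x y → T (eqᵈ x y) → x ≡ y
eqᵈ-sound nil nil t = refl
eqᵈ-sound (cons a b) (cons c d) t = cong₂ cons (eqᵈ-sound a c (proj₁ q)) (eqᵈ-sound b d (proj₂ q))
 where q = ∧⁻ {eqᵈ a c} t

iff⇒≡ : ∀ {a b} → (T a → T b) → (T b → T a) → a ≡ b
iff⇒≡ {true} {true} f g = refl
iff⇒≡ {true} {false} f g = ⊥-elim (f tt)
iff⇒≡ {false} {true} f g = ⊥-elim (g tt)
iff⇒≡ {false} {false} f g = refl

encodeℕᵇ-injective : ∀ {x y} → encodeℕᵇ x ≡ encodeℕᵇ y → x ≡ y
encodeℕᵇ-injective {ℕᵇ.zero} {ℕᵇ.zero} e = refl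
encodeℕᵇ-injective {2[1+ x ]} {2[1+ y ]} e = cong 2[1+_] (encodeℕᵇ-injective (proj₂ (cons-injective e)))
 where
 cons-injective : ∀ {a b c d} → Datum.cons a b ≡ cons c d → a ≡ c × b ≡ d
 cons-injective refl = refl , refl
encodeℕᵇ-injective {1+[2 x ]} {1+[2 y ]} e = cong 1+[2_] (encodeℕᵇ-injective (proj₂ (cons-injective e)))
 where
 cons-injective : ∀ {a b c d} → Datum.cons a b ≡ cons c d → a ≡ c × b ≡ d
 cons-injective refl = refl , refl

encodeℕ-injective : ∀ {x y} → encodeℕ x ≡ encodeℕ y → x ≡ y
encodeℕ-injective e = fromℕ-injective (encodeℕᵇ-injective e)

eqᵈ-encodeFin : (u v : Fin n) → eqᵈ (encodeFin u) (encodeFin v) ≡ does (u ≟ᶠ v)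
eqᵈ-encodeFin u v with u ≟ᶠ v
... | yes refl = eqᵈ-refl (encodeFin u)
... | no u≢v = iff⇒≡ (λ t → u≢v (toℕ-injective (encodeℕ-injective (eqᵈ-sound _ _ t)))) (λ ())

contains-member : (v : Fin n) (L : List (Fin n)) → contains (encodeFin v) (encodeList encodeFin L) ≡ member v L
contains-member v [] = refl
contains-member v (w ∷ L) = cong₂ _∨_ (eqᵈ-encodeFin v w) (contains-member v L)

encodePair : Fin n → Fin n → Datum
encodePair u v = cons (encodeFin u) (encodeFin v)

-- States

data Slot : Set where
 vertsˢ edgesˢ orderˢ aliveˢ pairsˢ budgetˢ : Slot

pack : (Slot → Datum) → Datum
pack D = cons (D vertsˢ) (cons (D edgesˢ) (cons (D orderˢ) (cons (D aliveˢ) (cons (D pairsˢ) (D budgetˢ)))))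

-- A relation may be given by any list with the right members, whatever its order and repetitions.
-- Only the list of vertices is prescribed, since the quantifiers run through it.
record Encodes (M : Model n) (D : Slot → Datum) : Set where
 open Model M
 field
  verts : D vertsˢ ≡ encodeList encodeFin (List.allFin n)
  edges : ∀ u v → contains (encodePair u v) (D edgesˢ) ≡ ad u v
  order : ∀ u v → contains (encodePair u v) (D orderˢ) ≡ le u v
  alive : ∀ u → contains (encodeFin u) (D aliveˢ) ≡ al u
  pairs : ∀ u v → contains (encodePair u v) (D pairsˢ) ≡ rq u v

-- Where the values of the variables and the components of the state are.
record Names (i j m : ℕ) : Set where
 field
  vert : Fin i → Fin m
  list : Fin j → Fin m
  slot : Slot → Fin m

open Names

later : Fin m → Fin (2 + m)
later x = suc (suc x)

shift : Names i j m → Names i j (2 + m)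
shift N = record { vert = later ∘ vert N ; list = later ∘ list N ; slot = later ∘ slot N }

addVert : Names i j m → Names (1 + i) j (2 + m)
addVert N = record { vert = λ { zero → zero ; (suc x) → later (vert N x) } ; list = later ∘ list N ; slot = later ∘ slot N }

addList : Names i j m → Names i (1 + j) (2 + m)
addList N = record { vert = later ∘ vert N ; list = λ { zero → zero ; (suc x) → later (list N x) } ; slot = later ∘ slot N }

record Fits (D : Slot → Datum) (xs : Vec (Fin n) i) (Ls : Vec (List (Fin n)) j) (N : Names i j m) (γ : Vec Datum m) : Set where
 field
  vert-fits : ∀ x → lookup γ (vert N x) ≡ encodeFin (lookup xs x)
  list-fits : ∀ x → lookup γ (list N x) ≡ encodeList encodeFin (lookup Ls x)
  slot-fits : ∀ s → lookup γ (slot N s) ≡ D s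

open Fits

module _ {D : Slot → Datum} {xs : Vec (Fin n) i} {Ls : Vec (List (Fin n)) j} {N : Names i j m} {γ : Vec Datum m} where
 fits-shift : ∀ {x y} → Fits D xs Ls N γ → Fits D xs Ls (shift N) (x ∷ y ∷ γ)
 fits-shift f = record { vert-fits = vert-fits f ; list-fits = list-fits f ; slot-fits = slot-fits f }

 fits-vert : ∀ {v y} → Fits D xs Ls N γ → Fits D (v ∷ xs) Ls (addVert N) (encodeFin v ∷ y ∷ γ)
 fits-vert f = record { vert-fits = λ { zero → refl ; (suc x) → vert-fits f x } ; list-fits = list-fits f ; slot-fits = slot-fits f }

 fits-list : ∀ {L y} → Fits D xs Ls N γ → Fits D xs (L ∷ Ls) (addList N) (encodeList encodeFin L ∷ y ∷ γ)
 fits-list f = record { vert-fits = vert-fits f ; list-fits = λ { zero → refl ; (suc x) → list-fits f x } ; slot-fits = slot-fits f }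

trueᵉ : Ex m
trueᵉ = consᵉ nilᵉ nilᵉ

notᵉ : Ex m → Ex m
notᵉ a = caseᵉ a trueᵉ nilᵉ

run-notᵉ : ∀ (a : Ex m) γ → truth (run (notᵉ a) γ) ≡ not (truth (run a γ))
run-notᵉ a γ with run a γ
... | nil = refl
... | cons _ _ = refl

upToᵉ distinctᵉ : Fin m → ℕ → Ex m
upToᵉ V zero = trueᵉ
upToᵉ V (suc k) = consᵉ nilᵉ (forᵉ (ref V) (forᵉ (upToᵉ (later V) k) (consᵉ (consᵉ (ref v2) (ref v0)) nilᵉ)))
distinctᵉ V zero = trueᵉ
distinctᵉ V (suc k) = forᵉ (ref V) (forᵉ (distinctᵉ (later V) k)
 (caseᵉ (forᵉ (ref v0) (eqᵉ (ref (later v2)) (ref v0))) (consᵉ (consᵉ (ref v2) (ref v0)) nilᵉ) nilᵉ))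

encodeLists : List (List (Fin n)) → Datum
encodeLists = encodeList (encodeList encodeFin)

run-upToᵉ : ∀ (V : Fin m) γ → lookup γ V ≡ encodeList encodeFin (List.allFin n) → ∀ k → run (upToᵉ V k) γ ≡ encodeLists (upTo {n} k)
run-upToᵉ V γ e zero = refl
run-upToᵉ {n = n} V γ e (suc k) = cong (cons nil) (trans (cong (flatMap _) e) (flatMap-encode encodeFin (encodeList encodeFin)
 (λ v r → trans (cong (flatMap _) (run-upToᵉ (later V) (encodeFin v ∷ r ∷ γ) e k))
 (flatMap-encode (encodeList encodeFin) (encodeList encodeFin) (λ _ _ → refl) (upTo k)))
 (List.allFin n)))

run-distinctᵉ : ∀ (V : Fin m) γ → lookup γ V ≡ encodeList encodeFin (List.allFin n) → ∀ k → run (distinctᵉ V k) γ ≡ encodeLists (distinct {n} k)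
run-distinctᵉ V γ e zero = refl
run-distinctᵉ {n = n} V γ e (suc k) = trans (cong (flatMap _) e) (flatMap-encode encodeFin (encodeList encodeFin)
 (λ v r → trans (cong (flatMap _) (run-distinctᵉ (later V) (encodeFin v ∷ r ∷ γ) e k))
 (flatMap-encode (encodeList encodeFin) (encodeList encodeFin) (λ L r′ → fresh v L r r′) (distinct k)))
 (List.allFin n))
 where
 fresh : ∀ v L r r′ → run (caseᵉ (forᵉ (ref v0) (eqᵉ (ref (later v2)) (ref v0))) (consᵉ (consᵉ (ref v2) (ref v0)) nilᵉ) nilᵉ)
  (encodeList encodeFin L ∷ r′ ∷ encodeFin v ∷ r ∷ γ) ≡ encodeLists (if member v L then [] else (v ∷ L) ∷ [])
 fresh v L r r′ = by (flatMap (λ y _ → encodeBool (eqᵈ (encodeFin v) y)) (encodeList encodeFin L)) refl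
  (trans (contains-loop (encodeFin v) (encodeList encodeFin L)) (contains-member v L))
  where
  by : ∀ d → flatMap (λ y _ → encodeBool (eqᵈ (encodeFin v) y)) (encodeList encodeFin L) ≡ d → truth d ≡ member v L →
   run (caseᵉ (forᵉ (ref v0) (eqᵉ (ref (later v2)) (ref v0))) (consᵉ (consᵉ (ref v2) (ref v0)) nilᵉ) nilᵉ)
   (encodeList encodeFin L ∷ r′ ∷ encodeFin v ∷ r ∷ γ) ≡ encodeLists (if member v L then [] else (v ∷ L) ∷ [])
  by nil eq t rewrite eq | sym t = refl
  by (cons _ _) eq t rewrite eq | sym t = refl

toEx : Names i j m → Form i j → Ex m
toEx N (leᶠ x y) = forᵉ (ref (slot N orderˢ)) (eqᵉ (consᵉ (ref (later (vert N x))) (ref (later (vert N y)))) (ref v0))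
toEx N (adᶠ x y) = forᵉ (ref (slot N edgesˢ)) (eqᵉ (consᵉ (ref (later (vert N x))) (ref (later (vert N y)))) (ref v0))
toEx N (rqᶠ x y) = forᵉ (ref (slot N pairsˢ)) (eqᵉ (consᵉ (ref (later (vert N x))) (ref (later (vert N y)))) (ref v0))
toEx N (eqᶠ x y) = eqᵉ (ref (vert N x)) (ref (vert N y))
toEx N (alᶠ x) = forᵉ (ref (slot N aliveˢ)) (eqᵉ (ref (later (vert N x))) (ref v0))
toEx N (inᶠ x y) = forᵉ (ref (list N y)) (eqᵉ (ref (later (vert N x))) (ref v0))
toEx N (longᶠ x y) = eqᵉ (forᵉ (ref (list N x)) trueᵉ) (forᵉ (ref (list N y)) trueᵉ)
toEx N (¬ᶠ φ) = notᵉ (toEx N φ)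
toEx N (φ ∧ᶠ ψ) = caseᵉ (notᵉ (toEx N φ)) (toEx N ψ) nilᵉ
toEx N (φ ∨ᶠ ψ) = caseᵉ (toEx N φ) (toEx N ψ) trueᵉ
toEx N (φ →ᶠ ψ) = caseᵉ (notᵉ (toEx N φ)) (toEx N ψ) trueᵉ
toEx N (∃ᶠ φ) = forᵉ (ref (slot N vertsˢ)) (toEx (addVert N) φ)
toEx N (∀ᶠ φ) = notᵉ (forᵉ (ref (slot N vertsˢ)) (notᵉ (toEx (addVert N) φ)))
toEx N (∃ˡ φ) = forᵉ (upToᵉ (slot N vertsˢ) window) (toEx (addList N) φ)
toEx N (∀ˡ φ) = notᵉ (forᵉ (upToᵉ (slot N vertsˢ) window) (notᵉ (toEx (addList N) φ)))

private
 run-case : ∀ (a b : Ex m) c γ {x y z} → truth (run a γ) ≡ x → truth (run b γ) ≡ y →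
  (∀ l r → truth (run c (l ∷ r ∷ γ)) ≡ z) → truth (run (caseᵉ a b c) γ) ≡ (if x then z else y)
 run-case a b c γ p q r with run a γ
 run-case a b c γ refl q r | nil = q
 run-case a b c γ refl q r | cons x y = r x y

 if-or : ∀ x {y} → (if x then true else y) ≡ x ∨ y
 if-or true = refl
 if-or false = refl

 if-and : ∀ x {y} → (if not x then false else y) ≡ x ∧ y
 if-and true = refl
 if-and false = refl

 unary : List (Fin n) → Datum
 unary = encodeList (λ _ → nil)

 flatMap-unary : ∀ (L : List (Fin n)) → flatMap (λ _ _ → cons nil nil) (encodeList encodeFin L) ≡ unary L
 flatMap-unary [] = refl
 flatMap-unary (x ∷ L) = cong (cons nil) (flatMap-unary L)

 eqᵈ-unary : ∀ (A B : List (Fin n)) → eqᵈ (unary A) (unary B) ≡ (length A ≡ᵇ length B)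
 eqᵈ-unary [] [] = refl
 eqᵈ-unary [] (_ ∷ _) = refl
 eqᵈ-unary (_ ∷ _) [] = refl
 eqᵈ-unary (_ ∷ A) (_ ∷ B) = eqᵈ-unary A B

module _ {M : Model n} {D : Slot → Datum} (enc : Encodes M D) where
 open Encodes enc

 private
  pair-loop : ∀ {x y s} {l : Datum} {u v : Fin n} {R : Fin n → Fin n → Bool} → x ≡ encodeFin u → y ≡ encodeFin v → l ≡ D s →
   (∀ u v → contains (encodePair u v) (D s) ≡ R u v) →
   truth (flatMap (λ z _ → encodeBool (eqᵈ (cons x y) z)) l) ≡ R u v
  pair-loop {s = s} {u = u} {v} refl refl refl h = trans (contains-loop (encodePair u v) (D s)) (h u v)

  some-vert : ∀ {N : Names i j m} {γ} {xs : Vec (Fin n) i} {Ls} → Fits D xs Ls N γ → ∀ e {p} →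
   (∀ v r → truth (run e (encodeFin v ∷ r ∷ γ)) ≡ p v) →
   truth (run (forᵉ (ref (slot N vertsˢ)) e) γ) ≡ any p (List.allFin n)
  some-vert {γ = γ} f e h = trans (cong (λ l → truth (flatMap (λ x r → run e (x ∷ r ∷ γ)) l)) (trans (slot-fits f vertsˢ) verts))
   (truth-flatMap encodeFin h (List.allFin n))

  some-list : ∀ {N : Names i j m} {γ} {xs : Vec (Fin n) i} {Ls} → Fits D xs Ls N γ → ∀ k e {p} →
   (∀ L r → truth (run e (encodeList encodeFin L ∷ r ∷ γ)) ≡ p L) →
   truth (run (forᵉ (upToᵉ (slot N vertsˢ) k) e) γ) ≡ any p (upTo {n} k)
  some-list {N = N} {γ} f k e h = trans (cong (λ l → truth (flatMap (λ x r → run e (x ∷ r ∷ γ)) l))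
   (run-upToᵉ {n = n} (slot N vertsˢ) γ (trans (slot-fits f vertsˢ) verts) k))
   (truth-flatMap (encodeList encodeFin) h (upTo {n} k))

 run-toEx : ∀ {N : Names i j m} {γ xs Ls} → Fits D xs Ls N γ → ∀ φ → truth (run (toEx N φ) γ) ≡ eval M φ xs Ls
 run-toEx f (leᶠ x y) = pair-loop {s = orderˢ} (vert-fits f x) (vert-fits f y) (slot-fits f orderˢ) order
 run-toEx f (adᶠ x y) = pair-loop {s = edgesˢ} (vert-fits f x) (vert-fits f y) (slot-fits f edgesˢ) edges
 run-toEx f (rqᶠ x y) = pair-loop {s = pairsˢ} (vert-fits f x) (vert-fits f y) (slot-fits f pairsˢ) pairs
 run-toEx {xs = xs} f (eqᶠ x y) = trans (truth-encodeBool _) (trans (cong₂ eqᵈ (vert-fits f x) (vert-fits f y)) (eqᵈ-encodeFin (lookup xs x) (lookup xs y)))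
 run-toEx {xs = xs} f (alᶠ x) rewrite vert-fits f x | slot-fits f aliveˢ =
  trans (contains-loop (encodeFin (lookup xs x)) (D aliveˢ)) (alive (lookup xs x))
 run-toEx {xs = xs} {Ls} f (inᶠ x y) rewrite vert-fits f x | list-fits f y =
  trans (contains-loop (encodeFin (lookup xs x)) (encodeList encodeFin (lookup Ls y))) (contains-member (lookup xs x) (lookup Ls y))
 run-toEx {Ls = Ls} f (longᶠ x y) rewrite list-fits f x | list-fits f y =
  trans (truth-encodeBool _) (trans (cong₂ eqᵈ (flatMap-unary (lookup Ls x)) (flatMap-unary (lookup Ls y))) (eqᵈ-unary (lookup Ls x) (lookup Ls y)))
 run-toEx {N = N} {γ} f (¬ᶠ φ) = trans (run-notᵉ (toEx N φ) γ) (cong not (run-toEx f φ))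
 run-toEx {N = N} {γ} {xs} {Ls} f (φ ∧ᶠ ψ) = trans (run-case (notᵉ (toEx N φ)) (toEx N ψ) nilᵉ γ
  (trans (run-notᵉ (toEx N φ) γ) (cong not (run-toEx f φ))) (run-toEx f ψ) (λ _ _ → refl)) (if-and (eval M φ xs Ls))
 run-toEx {N = N} {γ} {xs} {Ls} f (φ ∨ᶠ ψ) = trans (run-case (toEx N φ) (toEx N ψ) trueᵉ γ
  (run-toEx f φ) (run-toEx f ψ) (λ _ _ → refl)) (if-or (eval M φ xs Ls))
 run-toEx {N = N} {γ} {xs} {Ls} f (φ →ᶠ ψ) = trans (run-case (notᵉ (toEx N φ)) (toEx N ψ) trueᵉ γ
  (trans (run-notᵉ (toEx N φ) γ) (cong not (run-toEx f φ))) (run-toEx f ψ) (λ _ _ → refl)) (if-or (not (eval M φ xs Ls)))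
 run-toEx {N = N} f (∃ᶠ φ) = some-vert f (toEx (addVert N) φ) λ v r → run-toEx (fits-vert {v = v} f) φ
 run-toEx {N = N} {γ} f (∀ᶠ φ) = trans (run-notᵉ (forᵉ (ref (slot N vertsˢ)) (notᵉ (toEx (addVert N) φ))) γ)
  (cong not (some-vert f (notᵉ (toEx (addVert N) φ)) λ v r →
  trans (run-notᵉ (toEx (addVert N) φ) (encodeFin v ∷ r ∷ γ)) (cong not (run-toEx (fits-vert {v = v} f) φ))))
 run-toEx {N = N} f (∃ˡ φ) = some-list f window (toEx (addList N) φ) λ L r → run-toEx (fits-list {L = L} f) φ
 run-toEx {N = N} {γ} f (∀ˡ φ) = trans (run-notᵉ (forᵉ (upToᵉ (slot N vertsˢ) window) (notᵉ (toEx (addList N) φ))) γ)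
  (cong not (some-list f window (notᵉ (toEx (addList N) φ)) λ L r →
  trans (run-notᵉ (toEx (addList N) φ) (encodeList encodeFin L ∷ r ∷ γ)) (cong not (run-toEx (fits-list {L = L} f) φ))))

-- Rules

data Range : Set where
 short fresh : ℕ → Range

range : Range → List (List (Fin n))
range (short k) = upTo k
range (fresh k) = distinct k

-- In the formulas for a new binary relation, 1 is its first argument and 0 its
-- second one; nothing stands for an unchanged relation.
record Move (i j : ℕ) : Set where
 field
  order : Maybe (Form (2 + i) j)
  alive : Maybe (Form (1 + i) j)
  pairs : Maybe (Form (2 + i) j)
  price : ℕ

data Rule (i j : ℕ) : Set where
 someVertex : Rule (1 + i) j → Rule i j
 someList : Range → Rule i (1 + j) → Rule i j
 guard : Form i j → Rule i j → Rule i j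
 moves : List (Move i j) → Rule i j

moveTo : Model n → Move i j → Vec (Fin n) i → Vec (List (Fin n)) j → Model n
moveTo M μ xs Ls = record { ad = ad ; inst = record
 { le = maybe′ (λ φ u v → eval M φ (v ∷ u ∷ xs) Ls) le (Move.order μ)
 ; al = maybe′ (λ φ u → eval M φ (u ∷ xs) Ls) al (Move.alive μ)
 ; rq = maybe′ (λ φ u v → eval M φ (v ∷ u ∷ xs) Ls) rq (Move.pairs μ) } }
 where open Model M

module _ (M : Model n) where
 Fires : Rule i j → Vec (Fin n) i → Vec (List (Fin n)) j → Set
 Fires (someVertex R) xs Ls = ∃ λ v → Fires R (v ∷ xs) Ls
 Fires (someList r R) xs Ls = ∃ λ L → L ∈ range r × Fires R xs (L ∷ Ls)
 Fires (guard φ R) xs Ls = holds M φ xs Ls × Fires R xs Ls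
 Fires (moves μs) xs Ls = ⊤

 results : (R : Rule i j) {xs : Vec (Fin n) i} {Ls : Vec (List (Fin n)) j} → Fires R xs Ls → List (Model n × ℕ)
 results (someVertex R) (v , w) = results R w
 results (someList r R) (L , _ , w) = results R w
 results (guard φ R) (_ , w) = results R w
 results (moves μs) {xs} {Ls} _ = List.map (λ μ → moveTo M μ xs Ls , Move.price μ) μs

vertBound pairBound : ℕ → ℕ
vertBound s = 1 + s * (2 + s)
pairBound s = 1 + s * (1 + s * (3 + (s + s)))

-- A new relation is computed from the list of vertices, so its size is bounded in terms of this
-- list, which never changes, and not in terms of the relation before. Hence a single `B` holds
-- throughout the search.
record Room (B : ℕ) (D : Slot → Datum) : Set where
 field
  slots : ∀ s → size (D s) ≤ B
  vert-room : vertBound (size (D vertsˢ)) ≤ B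
  pair-room : pairBound (size (D vertsˢ)) ≤ B

record IsState (B : ℕ) (M : Model n) (k : ℕ) (s : Datum) : Set where
 field
  datum : Slot → Datum
  packed : s ≡ pack datum
  encodes : Encodes M datum
  budget : len (datum budgetˢ) ≡ k
  room : Room B datum

data AreStates {n} (B k : ℕ) : List (Model n × ℕ) → Datum → Set where
 [] : AreStates B k [] nil
 take : ∀ {J c Js s d} → c ≤ k → IsState B J (k ∸ c) s → AreStates B k Js d → AreStates B k ((J , c) ∷ Js) (cons s d)
 drop : ∀ {J c Js d} → ¬ c ≤ k → AreStates B k Js d → AreStates B k ((J , c) ∷ Js) d

newPairsᵉ : Names i j m → Form (2 + i) j → Ex m
newPairsᵉ N φ = forᵉ (ref (slot N vertsˢ)) (forᵉ (ref (later (slot N vertsˢ)))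
 (caseᵉ (notᵉ (toEx (addVert (addVert N)) φ)) (consᵉ (consᵉ (ref v2) (ref v0)) nilᵉ) nilᵉ))

newVertsᵉ : Names i j m → Form (1 + i) j → Ex m
newVertsᵉ N φ = forᵉ (ref (slot N vertsˢ)) (caseᵉ (notᵉ (toEx (addVert N) φ)) (consᵉ (ref v0) nilᵉ) nilᵉ)

dropᵉ : ℕ → Ex m → Ex m
dropᵉ zero e = e
dropᵉ (suc c) e = caseᵉ (dropᵉ c e) nilᵉ (ref v1)

-- The budget is a list in unary: a price `suc c` can be paid if something is left after `c` has
-- been dropped.
tooPoorᵉ : Fin m → ℕ → Ex m
tooPoorᵉ x zero = nilᵉ
tooPoorᵉ x (suc c) = notᵉ (dropᵉ c (ref x))

moveᵉ : Names i j m → Move i j → Ex m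
moveᵉ N μ = consᵉ (ref (slot N vertsˢ)) (consᵉ (ref (slot N edgesˢ)) (consᵉ (maybe′ (newPairsᵉ N) (ref (slot N orderˢ)) (Move.order μ))
 (consᵉ (maybe′ (newVertsᵉ N) (ref (slot N aliveˢ)) (Move.alive μ)) (consᵉ (maybe′ (newPairsᵉ N) (ref (slot N pairsˢ)) (Move.pairs μ))
 (dropᵉ (Move.price μ) (ref (slot N budgetˢ)))))))

movesᵉ : Names i j m → List (Move i j) → Ex m
movesᵉ N [] = nilᵉ
movesᵉ N (μ ∷ μs) = caseᵉ (tooPoorᵉ (slot N budgetˢ) (Move.price μ)) (consᵉ (moveᵉ N μ) (movesᵉ N μs)) (movesᵉ (shift N) μs)

rangeᵉ : Fin m → Range → Ex m
rangeᵉ V (short k) = upToᵉ V k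
rangeᵉ V (fresh k) = distinctᵉ V k

ruleᵉ : Names i j m → Rule i j → Ex m
ruleᵉ N (someVertex R) = forᵉ (ref (slot N vertsˢ)) (ruleᵉ (addVert N) R)
ruleᵉ N (someList r R) = forᵉ (rangeᵉ (slot N vertsˢ) r) (ruleᵉ (addList N) R)
ruleᵉ N (guard φ R) = caseᵉ (notᵉ (toEx N φ)) (ruleᵉ N R) nilᵉ
ruleᵉ N (moves μs) = consᵉ (movesᵉ N μs) nilᵉ

run-rangeᵉ : ∀ (V : Fin m) γ → lookup γ V ≡ encodeList encodeFin (List.allFin n) → ∀ r → run (rangeᵉ V r) γ ≡ encodeLists (range {n} r)
run-rangeᵉ V γ e (short k) = run-upToᵉ V γ e k
run-rangeᵉ V γ e (fresh k) = run-distinctᵉ V γ e k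

run-if : ∀ (a b : Ex m) γ {x} → truth (run a γ) ≡ x → run (caseᵉ (notᵉ a) b nilᵉ) γ ≡ (if x then run b γ else nil)
run-if a b γ e with run a γ
run-if a b γ refl | nil = refl
run-if a b γ refl | cons _ _ = refl

run-dropᵉ : ∀ c (e : Ex m) γ → len (run (dropᵉ c e) γ) ≡ len (run e γ) ∸ c × size (run (dropᵉ c e) γ) ≤ size (run e γ)
run-dropᵉ zero e γ = refl , ≤-refl
run-dropᵉ (suc c) e γ with run (dropᵉ c e) γ | run-dropᵉ c e γ
... | nil | p , q = trans (cong (_∸ 1) p) (trans (∸-+-assoc (len (run e γ)) c 1) (cong (len (run e γ) ∸_) (+-comm c 1))) , q
... | cons a b | p , q = trans (cong (_∸ 1) p) (trans (∸-+-assoc (len (run e γ)) c 1) (cong (len (run e γ) ∸_) (+-comm c 1))) ,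
 ≤-trans (≤-trans (m≤n+m (size b) (size a)) (n≤1+n _)) q

run-tooPoorᵉ : ∀ (x : Fin m) c γ → Reflects (¬ c ≤ len (lookup γ x)) (truth (run (tooPoorᵉ x c) γ))
run-tooPoorᵉ x zero γ = ofⁿ λ ¬le → ¬le z≤n
run-tooPoorᵉ x (suc c) γ with run (dropᵉ c (ref x)) γ | proj₁ (run-dropᵉ c (ref x) γ)
... | nil | e = ofʸ λ c<k → <⇒≢ (m<n⇒0<n∸m c<k) e
... | cons _ d | e = ofⁿ λ c≮k → contradiction (trans e (m≤n⇒m∸n≡0 (≮⇒≥ c≮k))) λ ()

private
 some-one : ∀ (x : Fin n) {p : Fin n → Bool} xs → (∀ y → y ≢ x → p y ≡ false) → x ∈ xs → any p xs ≡ p x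
 some-one x {p} xs other x∈ = iff⇒≡ (λ t → only (any⁻ p xs t)) λ t → any⁺ p (Any.map (λ { refl → t }) x∈)
  where
  only : ∀ {xs} → Any (T ∘ p) xs → T (p x)
  only (here {y} t) with y ≟ᶠ x
  ... | yes refl = t
  ... | no y≢x = ⊥-elim (subst T (other y y≢x) t)
  only (there q) = only q

 contains-for : ∀ (V : Fin m) γ (e : Ex (2 + m)) x {p : Fin n → Bool} → lookup γ V ≡ encodeList encodeFin (List.allFin n) →
  (∀ y r → contains x (run e (encodeFin y ∷ r ∷ γ)) ≡ p y) →
  contains x (run (forᵉ (ref V) e) γ) ≡ any p (List.allFin n)
 contains-for {n = n} V γ e x eq h = trans (cong (λ l → contains x (flatMap (λ y r → run e (y ∷ r ∷ γ)) l)) eq)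
  (contains-flatMap encodeFin x h (List.allFin n))

 contains-if : ∀ x y b → contains x (if b then cons y nil else nil) ≡ b ∧ eqᵈ x y
 contains-if x y true = trans (∨-identityʳ _) refl
 contains-if x y false = refl

 does-refl : ∀ (u : Fin n) → does (u ≟ᶠ u) ≡ true
 does-refl u with u ≟ᶠ u
 ... | yes _ = refl
 ... | no u≢u = ⊥-elim (u≢u refl)

 does-≢ : ∀ {u v : Fin n} → v ≢ u → does (u ≟ᶠ v) ≡ false
 does-≢ {u = u} {v} v≢u with u ≟ᶠ v
 ... | yes e = ⊥-elim (v≢u (sym e))
 ... | no _ = refl

module _ {M : Model n} {D : Slot → Datum} (enc : Encodes M D) {N : Names i j m} {γ : Vec Datum m}
 {xs : Vec (Fin n) i} {Ls : Vec (List (Fin n)) j} (f : Fits D xs Ls N γ) where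
 open Encodes enc

 private
  all-verts : lookup γ (slot N vertsˢ) ≡ encodeList encodeFin (List.allFin n)
  all-verts = trans (slot-fits f vertsˢ) verts

 contains-newVertsᵉ : ∀ φ u → contains (encodeFin u) (run (newVertsᵉ N φ) γ) ≡ eval M φ (u ∷ xs) Ls
 contains-newVertsᵉ φ u = trans (contains-for (slot N vertsˢ) γ (caseᵉ (notᵉ (toEx (addVert N) φ)) (consᵉ (ref v0) nilᵉ) nilᵉ)
  (encodeFin u) {p = λ y → eval M φ (y ∷ xs) Ls ∧ does (u ≟ᶠ y)} all-verts step)
  (trans (some-one u (List.allFin n) (λ y y≢u → trans (cong (eval M φ (y ∷ xs) Ls ∧_) (does-≢ y≢u)) (∧-zeroʳ _)) (∈-allFin u))
  (trans (cong (eval M φ (u ∷ xs) Ls ∧_) (does-refl u)) (∧-identityʳ _)))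
  where
  step : ∀ y r → contains (encodeFin u) (run (caseᵉ (notᵉ (toEx (addVert N) φ)) (consᵉ (ref v0) nilᵉ) nilᵉ) (encodeFin y ∷ r ∷ γ))
   ≡ eval M φ (y ∷ xs) Ls ∧ does (u ≟ᶠ y)
  step y r = trans (cong (contains (encodeFin u)) (run-if (toEx (addVert N) φ) (consᵉ (ref v0) nilᵉ) (encodeFin y ∷ r ∷ γ) (run-toEx enc (fits-vert {v = y} f) φ)))
   (trans (contains-if (encodeFin u) (encodeFin y) (eval M φ (y ∷ xs) Ls)) (cong (eval M φ (y ∷ xs) Ls ∧_) (eqᵈ-encodeFin u y)))

 contains-newPairsᵉ : ∀ φ u v → contains (encodePair u v) (run (newPairsᵉ N φ) γ) ≡ eval M φ (v ∷ u ∷ xs) Ls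
 contains-newPairsᵉ φ u v = trans (contains-for (slot N vertsˢ) γ (forᵉ (ref (later (slot N vertsˢ))) entryᵉ) (encodePair u v)
  {p = λ y → does (u ≟ᶠ y) ∧ E v y} all-verts outer)
  (trans (some-one u (List.allFin n) (λ y y≢u → cong (_∧ E v y) (does-≢ y≢u)) (∈-allFin u))
  (cong (_∧ E v u) (does-refl u)))
  where
  entryᵉ = caseᵉ (notᵉ (toEx (addVert (addVert N)) φ)) (consᵉ (consᵉ (ref v2) (ref v0)) nilᵉ) nilᵉ
  E : Fin n → Fin n → Bool
  E z y = eval M φ (z ∷ y ∷ xs) Ls
  inner : ∀ y r z r′ → contains (encodePair u v) (run entryᵉ (encodeFin z ∷ r′ ∷ encodeFin y ∷ r ∷ γ)) ≡ E z y ∧ (does (u ≟ᶠ y) ∧ does (v ≟ᶠ z))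
  inner y r z r′ = trans (cong (contains (encodePair u v)) (run-if (toEx (addVert (addVert N)) φ) (consᵉ (consᵉ (ref v2) (ref v0)) nilᵉ)
   (encodeFin z ∷ r′ ∷ encodeFin y ∷ r ∷ γ) (run-toEx enc (fits-vert {v = z} (fits-vert {v = y} f)) φ)))
   (trans (contains-if (encodePair u v) (encodePair y z) (E z y)) (cong (E z y ∧_) (cong₂ _∧_ (eqᵈ-encodeFin u y) (eqᵈ-encodeFin v z))))
  outer : ∀ y r → contains (encodePair u v) (run (forᵉ (ref (later (slot N vertsˢ))) entryᵉ) (encodeFin y ∷ r ∷ γ)) ≡ does (u ≟ᶠ y) ∧ E v y
  outer y r = trans (contains-for (later (slot N vertsˢ)) (encodeFin y ∷ r ∷ γ) entryᵉ (encodePair u v)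
   {p = λ z → E z y ∧ (does (u ≟ᶠ y) ∧ does (v ≟ᶠ z))} all-verts (inner y r))
   (trans (some-one v (List.allFin n) (λ z z≢v → trans (cong (λ b → E z y ∧ (does (u ≟ᶠ y) ∧ b)) (does-≢ z≢v)) (trans (cong (E z y ∧_) (∧-zeroʳ _)) (∧-zeroʳ _))) (∈-allFin v))
   (trans (cong (λ b → E v y ∧ (does (u ≟ᶠ y) ∧ b)) (does-refl v)) (trans (cong (E v y ∧_) (∧-identityʳ _)) (∧-comm (E v y) _))))

 private
  size-if : ∀ b {d s} → 1 ≤ s → size d ≤ s → size (if b then d else nil) ≤ s
  size-if true _ p = p
  size-if false p _ = p

  in-verts : ∀ {x r} → cons x r ⊑ lookup γ (slot N vertsˢ) → size x ≤ size (D vertsˢ)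
  in-verts {x} {r} p = ≤-trans (≤-trans (m≤m+n (size x) (size r)) (n≤1+n _)) (≤-trans (⊑-size p) (≤-reflexive (cong size (slot-fits f vertsˢ))))

 size-newVertsᵉ : ∀ φ → size (run (newVertsᵉ N φ) γ) ≤ vertBound (size (D vertsˢ))
 size-newVertsᵉ φ = ≤-trans (size-flatMap (λ x r → run entryᵉ (x ∷ r ∷ γ)) (lookup γ (slot N vertsˢ)) entry-≤)
  (≤-reflexive (cong (λ d → 1 + size d * (2 + size (D vertsˢ))) (slot-fits f vertsˢ)))
  where
  entryᵉ = caseᵉ (notᵉ (toEx (addVert N) φ)) (consᵉ (ref v0) nilᵉ) nilᵉ
  entry-≤ : ∀ x r → cons x r ⊑ lookup γ (slot N vertsˢ) → size (run entryᵉ (x ∷ r ∷ γ)) ≤ 2 + size (D vertsˢ)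
  entry-≤ x r p = ≤-trans (≤-reflexive (cong size (run-if (toEx (addVert N) φ) (consᵉ (ref v0) nilᵉ) (x ∷ r ∷ γ) refl)))
   (size-if (truth (run (toEx (addVert N) φ) (x ∷ r ∷ γ))) {cons x nil} (s≤s z≤n) (s≤s (≤-trans (≤-reflexive (+-comm (size x) 1)) (s≤s (in-verts p)))))

 size-newPairsᵉ : ∀ φ → size (run (newPairsᵉ N φ) γ) ≤ pairBound (size (D vertsˢ))
 size-newPairsᵉ φ = ≤-trans (size-flatMap (λ x r → run innerᵉ (x ∷ r ∷ γ)) (lookup γ (slot N vertsˢ)) inner-≤)
  (≤-reflexive (cong (λ d → 1 + size d * (1 + S * (3 + (S + S)))) (slot-fits f vertsˢ)))
  where
  S = size (D vertsˢ)
  entryᵉ = caseᵉ (notᵉ (toEx (addVert (addVert N)) φ)) (consᵉ (consᵉ (ref v2) (ref v0)) nilᵉ) nilᵉ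
  innerᵉ = forᵉ (ref (later (slot N vertsˢ))) entryᵉ
  entry-≤ : ∀ x r y s → cons x r ⊑ lookup γ (slot N vertsˢ) → cons y s ⊑ lookup γ (slot N vertsˢ) →
   size (run entryᵉ (y ∷ s ∷ x ∷ r ∷ γ)) ≤ 3 + (S + S)
  entry-≤ x r y s p q = ≤-trans (≤-reflexive (cong size (run-if (toEx (addVert (addVert N)) φ) (consᵉ (consᵉ (ref v2) (ref v0)) nilᵉ) (y ∷ s ∷ x ∷ r ∷ γ) refl)))
   (size-if (truth (run (toEx (addVert (addVert N)) φ) (y ∷ s ∷ x ∷ r ∷ γ))) {cons (cons x y) nil} (s≤s z≤n) (s≤s (s≤s (≤-trans (≤-reflexive (+-comm _ 1)) (s≤s (+-mono-≤ (in-verts p) (in-verts q)))))))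
  inner-≤ : ∀ x r → cons x r ⊑ lookup γ (slot N vertsˢ) → size (run innerᵉ (x ∷ r ∷ γ)) ≤ 1 + S * (3 + (S + S))
  inner-≤ x r p = ≤-trans (size-flatMap (λ y s → run entryᵉ (y ∷ s ∷ x ∷ r ∷ γ)) (lookup γ (slot N vertsˢ)) (λ y s q → entry-≤ x r y s p q))
   (≤-reflexive (cong (λ d → 1 + size d * (3 + (S + S))) (slot-fits f vertsˢ)))

 module _ {B : ℕ} (room : Room B D) where
  open Room room

  move-isState : ∀ μ → IsState B (moveTo M μ xs Ls) (len (D budgetˢ) ∸ Move.price μ) (run (moveᵉ N μ) γ)
  move-isState μ = record
   { datum = new
   ; packed = refl
   ; encodes = record
   { verts = all-verts
   ; edges = λ u v → trans (cong (contains (encodePair u v)) (slot-fits f edgesˢ)) (edges u v)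
   ; order = new-pairs orderˢ (Move.order μ) order
   ; alive = new-alive (Move.alive μ)
   ; pairs = new-pairs pairsˢ (Move.pairs μ) pairs
   }
   ; budget = trans (proj₁ dropped) (cong (λ d → len d ∸ Move.price μ) (slot-fits f budgetˢ))
   ; room = record { slots = small
   ; vert-room = subst (λ d → vertBound (size d) ≤ B) (sym (slot-fits f vertsˢ)) vert-room
   ; pair-room = subst (λ d → pairBound (size d) ≤ B) (sym (slot-fits f vertsˢ)) pair-room }
   }
   where
   new : Slot → Datum
   new vertsˢ = lookup γ (slot N vertsˢ)
   new edgesˢ = lookup γ (slot N edgesˢ)
   new orderˢ = run (maybe′ (newPairsᵉ N) (ref (slot N orderˢ)) (Move.order μ)) γ
   new aliveˢ = run (maybe′ (newVertsᵉ N) (ref (slot N aliveˢ)) (Move.alive μ)) γ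
   new pairsˢ = run (maybe′ (newPairsᵉ N) (ref (slot N pairsˢ)) (Move.pairs μ)) γ
   new budgetˢ = run (dropᵉ (Move.price μ) (ref (slot N budgetˢ))) γ

   dropped = run-dropᵉ (Move.price μ) (ref (slot N budgetˢ)) γ

   new-pairs : ∀ s o {R} → (∀ u v → contains (encodePair u v) (D s) ≡ R u v) → ∀ u v →
    contains (encodePair u v) (run (maybe′ (newPairsᵉ N) (ref (slot N s)) o) γ) ≡
    maybe′ (λ φ u v → eval M φ (v ∷ u ∷ xs) Ls) R o u v
   new-pairs s (just φ) h u v = contains-newPairsᵉ φ u v
   new-pairs s nothing h u v = trans (cong (contains (encodePair u v)) (slot-fits f s)) (h u v)

   new-alive : ∀ o u → contains (encodeFin u) (run (maybe′ (newVertsᵉ N) (ref (slot N aliveˢ)) o) γ) ≡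
    maybe′ (λ φ u → eval M φ (u ∷ xs) Ls) (Model.al M) o u
   new-alive (just φ) u = contains-newVertsᵉ φ u
   new-alive nothing u = trans (cong (contains (encodeFin u)) (slot-fits f aliveˢ)) (alive u)

   old-≤ : ∀ s → size (lookup γ (slot N s)) ≤ B
   old-≤ s = subst (λ d → size d ≤ B) (sym (slot-fits f s)) (slots s)

   pairs-≤ : ∀ s o → size (run (maybe′ (newPairsᵉ N) (ref (slot N s)) o) γ) ≤ B
   pairs-≤ s (just φ) = ≤-trans (size-newPairsᵉ φ) pair-room
   pairs-≤ s nothing = old-≤ s

   alive-≤ : ∀ o → size (run (maybe′ (newVertsᵉ N) (ref (slot N aliveˢ)) o) γ) ≤ B
   alive-≤ (just φ) = ≤-trans (size-newVertsᵉ φ) vert-room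
   alive-≤ nothing = old-≤ aliveˢ

   small : ∀ s → size (new s) ≤ B
   small vertsˢ = old-≤ vertsˢ
   small edgesˢ = old-≤ edgesˢ
   small orderˢ = pairs-≤ orderˢ (Move.order μ)
   small aliveˢ = alive-≤ (Move.alive μ)
   small pairsˢ = pairs-≤ pairsˢ (Move.pairs μ)
   small budgetˢ = ≤-trans (proj₂ dropped) (old-≤ budgetˢ)

-- A comprehension produces one entry for each witness, but only the first entry is used, so the
-- remaining ones are left unspecified.
data Outcome (W : Set) (P : W → Datum → Set) : Datum → Set where
 nowhere : ¬ W → Outcome W P nil
 at-once : ∀ {d ds} (w : W) → P w d → Outcome W P (cons d ds)

map-outcome : ∀ {W W′ : Set} {P : W → Datum → Set} {P′ : W′ → Datum → Set} (g : W → W′) → (W′ → W) → (∀ {w d} → P w d → P′ (g w) d) →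
 ∀ {d} → Outcome W P d → Outcome W′ P′ d
map-outcome g back h (nowhere ¬w) = nowhere (¬w ∘ back)
map-outcome g back h (at-once w p) = at-once (g w) (h p)

flatMap-outcome : {A : Set} (f : A → Datum) {F : Datum → Datum → Datum} {W : A → Set} {P : ∀ x → W x → Datum → Set} →
 (∀ x r → Outcome (W x) (P x) (F (f x) r)) → ∀ xs →
 Outcome (∃ λ x → x ∈ xs × W x) (λ (x , _ , w) → P x w) (flatMap F (encodeList f xs))
flatMap-outcome f h [] = nowhere λ ()
flatMap-outcome f {F} {W} {P} h (x ∷ xs) = by (F (f x) (encodeList f xs)) (h x _)
 where
 by : ∀ d → Outcome (W x) (P x) d →
  Outcome (∃ λ y → y ∈ x ∷ xs × W y) (λ (y , _ , w) → P y w) (append d (flatMap F (encodeList f xs)))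
 by nil (nowhere ¬w) = map-outcome (λ (y , y∈ , w) → y , there y∈ , w)
  (λ { (_ , ∈₀ , w) → ⊥-elim (¬w w) ; (y , there y∈ , w) → y , y∈ , w }) id (flatMap-outcome f h xs)
 by (cons d ds) (at-once w p) = at-once (x , ∈₀ , w) p

module _ {M : Model n} {D : Slot → Datum} (enc : Encodes M D) {B : ℕ} (room : Room B D) where
 moves-states : ∀ {N : Names i j m} {γ} {xs : Vec (Fin n) i} {Ls} → Fits D xs Ls N γ → ∀ μs →
  AreStates B (len (D budgetˢ)) (List.map (λ μ → moveTo M μ xs Ls , Move.price μ) μs) (run (movesᵉ N μs) γ)
 moves-states f [] = []
 moves-states {N = N} {γ} f (μ ∷ μs)
  with run (tooPoorᵉ (slot N budgetˢ) (Move.price μ)) γ | run-tooPoorᵉ (slot N budgetˢ) (Move.price μ) γ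
 ... | nil | ofⁿ rich = take (decidable-stable (_ ≤? _) (subst (λ d → ¬ ¬ (Move.price μ ≤ len d)) (slot-fits f budgetˢ) rich))
  (move-isState enc f room μ) (moves-states f μs)
 ... | cons _ _ | ofʸ poor = drop (subst (λ d → ¬ (Move.price μ ≤ len d)) (slot-fits f budgetˢ) poor) (moves-states (fits-shift f) μs)

 rule-outcome : ∀ {N : Names i j m} {γ} {xs : Vec (Fin n) i} {Ls} → Fits D xs Ls N γ → ∀ R →
  Outcome (Fires M R xs Ls) (λ w → AreStates B (len (D budgetˢ)) (results M R w)) (run (ruleᵉ N R) γ)
 rule-outcome {N = N} {γ} {xs} {Ls} f (someVertex R) = map-outcome {W = ∃ λ v → v ∈ List.allFin n × Fires M R (v ∷ xs) Ls}
  {P = λ (_ , _ , w) → AreStates B (len (D budgetˢ)) (results M R w)} (λ (v , _ , w) → v , w) (λ (v , w) → v , ∈-allFin v , w) id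
  (subst (Outcome _ _ ∘ flatMap (λ x r → run (ruleᵉ (addVert N) R) (x ∷ r ∷ γ))) (sym (trans (slot-fits f vertsˢ) (Encodes.verts enc)))
  (flatMap-outcome encodeFin (λ v r → rule-outcome (fits-vert {v = v} f) R) (List.allFin n)))
 rule-outcome {N = N} {γ} f (someList r R) =
  subst (Outcome _ _ ∘ flatMap (λ x r → run (ruleᵉ (addList N) R) (x ∷ r ∷ γ)))
  (sym (run-rangeᵉ (slot N vertsˢ) γ (trans (slot-fits f vertsˢ) (Encodes.verts enc)) r))
  (flatMap-outcome (encodeList encodeFin) (λ L r′ → rule-outcome (fits-list {L = L} f) R) (range r))
 rule-outcome {N = N} {γ} {xs} {Ls} f (guard φ R) = subst (Outcome _ _) (sym (run-if (toEx N φ) (ruleᵉ N R) γ (run-toEx enc f φ)))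
  (by (eval-reflects M φ xs Ls))
  where
  by : ∀ {b} → Reflects (holds M φ xs Ls) b → Outcome (holds M φ xs Ls × Fires M R xs Ls)
   (λ w → AreStates B (len (D budgetˢ)) (results M R (proj₂ w))) (if b then run (ruleᵉ N R) γ else nil)
  by (ofʸ h) = map-outcome (h ,_) proj₂ id (rule-outcome f R)
  by (ofⁿ ¬h) = nowhere (¬h ∘ proj₁)
 rule-outcome f (moves μs) = at-once tt (moves-states f μs)

-- The rules of the algorithm

private
 v4 : Fin (5 + m)
 v4 = suc v3
 v6 : Fin (7 + m)
 v6 = suc v5

sepᶠ : Fin i → Fin i → Fin i → Form i j
sepᶠ e u v = alᶠ e ∧ᶠ ((leᶠ u e ∧ᶠ ¬ᶠ leᶠ v e) ∨ᶠ (leᶠ v e ∧ᶠ ¬ᶠ leᶠ u e))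

reqᶠ : Fin i → Fin i → Form i j
reqᶠ u v = rqᶠ u v ∨ᶠ rqᶠ v u

pairᶠ : Fin i → Fin i → Form i j
pairᶠ a b = ∃ᶠ ∃ᶠ (reqᶠ v1 v0 ∧ᶠ ∀ᶠ (sepᶠ v0 v2 v1 →ᶠ (eqᶠ v0 (suc (suc (suc a))) ∨ᶠ eqᶠ v0 (suc (suc (suc b))))))

belowRootᶠ : Fin i → Form i j
belowRootᶠ f = ∃ᶠ ¬ᶠ leᶠ v0 (suc f)

killed : Fin i → Form (1 + i) j
killed f = alᶠ v0 ∧ᶠ ¬ᶠ eqᶠ v0 (suc f)

-- A vertex u next to a vertex p of the tree built so far becomes its child.
growRule : Rule 0 0
growRule = someVertex (someVertex (guard (leᶠ p p ∧ᶠ (¬ᶠ leᶠ u u) ∧ᶠ (adᶠ u p ∨ᶠ adᶠ p u)) (moves (record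
 { order = just (leᶠ v1 v0 ∨ᶠ (eqᶠ v1 v3 ∧ᶠ (eqᶠ v0 v3 ∨ᶠ leᶠ v2 v0)))
 ; alive = nothing ; pairs = nothing ; price = 0 } ∷ []))))
 where
 p u : Fin 2
 p = v0
 u = v1

deleteRule : Rule 0 0
deleteRule = someVertex (someVertex (guard
 (alᶠ v1 ∧ᶠ belowRootᶠ v1 ∧ᶠ (¬ᶠ eqᶠ v1 v0) ∧ᶠ
 ∀ᶠ ∀ᶠ (reqᶠ v1 v0 →ᶠ sepᶠ v3 v1 v0 →ᶠ (sepᶠ v2 v1 v0 ∨ᶠ
 ∃ᶠ (sepᶠ v0 v2 v1 ∧ᶠ (¬ᶠ eqᶠ v0 v4) ∧ᶠ
 ∃ᶠ ((¬ᶠ eqᶠ v0 v1) ∧ᶠ (¬ᶠ eqᶠ v0 v5) ∧ᶠ pairᶠ v1 v0 ∧ᶠ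
 ∀ᶠ ∀ᶠ (reqᶠ v1 v0 →ᶠ sepᶠ v2 v1 v0 →ᶠ (sepᶠ v3 v1 v0 ∨ᶠ (sepᶠ v7 v1 v0 ∧ᶠ sepᶠ v6 v1 v0))))))))
 (moves (record { order = nothing ; alive = just (killed v1) ; pairs = nothing ; price = 0 } ∷ []))))

selfishᶠ : (u v f a b : Fin i) → Form i j
selfishᶠ u v f a b = leᶠ u f ∧ᶠ (¬ᶠ leᶠ v f) ∧ᶠ (¬ᶠ leᶠ u a) ∧ᶠ (¬ᶠ leᶠ u b)

splitRule : Rule 0 0
splitRule = someVertex (someVertex (someVertex (guard
 (alᶠ v2 ∧ᶠ belowRootᶠ v2 ∧ᶠ alᶠ v1 ∧ᶠ alᶠ v0 ∧ᶠ leᶠ v1 v2 ∧ᶠ leᶠ v0 v2 ∧ᶠ (¬ᶠ eqᶠ v1 v2) ∧ᶠ (¬ᶠ eqᶠ v0 v2) ∧ᶠ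
 (¬ᶠ leᶠ v1 v0) ∧ᶠ (¬ᶠ leᶠ v0 v1) ∧ᶠ
 (∀ᶠ (alᶠ v0 →ᶠ leᶠ v0 v3 →ᶠ (eqᶠ v0 v3 ∨ᶠ eqᶠ v0 v2 ∨ᶠ eqᶠ v0 v1))) ∧ᶠ pairᶠ v1 v0 ∧ᶠ
 (∀ᶠ ∀ᶠ (reqᶠ v1 v0 →ᶠ sepᶠ v3 v1 v0 →ᶠ (sepᶠ v2 v1 v0 ∨ᶠ sepᶠ v4 v1 v0))) ∧ᶠ
 (∀ᶠ ∀ᶠ (reqᶠ v1 v0 →ᶠ sepᶠ v2 v1 v0 →ᶠ (sepᶠ v3 v1 v0 ∨ᶠ sepᶠ v4 v1 v0))))
 (moves (record
 { order = nothing
 ; alive = just (killed v2)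
 ; pairs = just ((reqᶠ v1 v0 ∧ᶠ (¬ᶠ selfishᶠ v1 v0 v4 v3 v2) ∧ᶠ (¬ᶠ selfishᶠ v0 v1 v4 v3 v2)) ∨ᶠ
 ((eqᶠ v1 v3 ∨ᶠ eqᶠ v1 v2) ∧ᶠ ∃ᶠ (reqᶠ v0 v1 ∧ᶠ selfishᶠ v0 v1 v5 v4 v3)))
 ; price = 0 } ∷ [])))))

listHitᶠ : Fin j → Fin i → Fin i → Form i j
listHitᶠ A u v = ∃ᶠ (sepᶠ v0 (suc u) (suc v) ∧ᶠ inᶠ v0 A)

someSetᶠ : List (Fin j) → Form 0 (1 + j)
-- The empty disjunction: no list differs in length from itself.
someSetᶠ [] = ¬ᶠ longᶠ v0 v0
someSetᶠ (b ∷ bs) = (∀ᶠ (inᶠ v0 (suc b) →ᶠ inᶠ v0 v0)) ∨ᶠ someSetᶠ bs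

validᶠ : Fin j → List (Fin j) → Form 0 j
validᶠ X bs = ∀ˡ ((∀ᶠ (inᶠ v0 v0 →ᶠ inᶠ v0 (suc X))) →ᶠ
 (∀ᶠ ∀ᶠ (reqᶠ v1 v0 →ᶠ (∀ᶠ (sepᶠ v0 v2 v1 →ᶠ inᶠ v0 (suc X))) →ᶠ listHitᶠ v0 v1 v0)) →ᶠ
 ∃ˡ (longᶠ v0 v1 ∧ᶠ (∀ᶠ ∀ᶠ (reqᶠ v1 v0 →ᶠ listHitᶠ v1 v1 v0 →ᶠ listHitᶠ v0 v1 v0)) ∧ᶠ someSetᶠ (List.map suc bs)))

cutMove : Fin j × ℕ → Move 0 j
cutMove (b , c) = record
 { order = nothing ; alive = nothing
 ; pairs = just (rqᶠ v1 v0 ∧ᶠ ∀ᶠ (inᶠ v0 b →ᶠ ¬ᶠ sepᶠ v0 v2 v1))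
 ; price = c }

-- The sets chosen so far are pushed onto a stack, so they end up in the order opposite to that of
-- the sizes. Therefore `Progress` speaks of `List.reverse`.
chooseRule : List ℕ → Fin j → List (Fin j × ℕ) → Rule 0 j
chooseRule [] X bs = guard (validᶠ X (List.map proj₁ bs)) (moves (List.map cutMove bs))
chooseRule (c ∷ cs) X bs = someList (fresh c) (chooseRule cs (suc X) ((v0 , c) ∷ List.map (λ (b , c) → suc b , c) bs))

branchRule : List ℕ → Rule 0 0
branchRule cs = someList (short window) (chooseRule cs v0 [])

mainRules : List (Rule 0 0)
mainRules = deleteRule ∷ splitRule ∷ List.map branchRule sizes

module _ (M : Model n) where
 open Model M

 private
  module S = Solve inst

 data Progress (root : Fin n) : List (Model n × ℕ) → Set where
  smaller : ∀ {J} → Model.le J ≡ le → Model.Alive J root → count (Model.al J) < count al →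
   (∀ {k} → Solutions.Solvable inst k ⇔ Solutions.Solvable (Model.inst J) k) →
   Progress root [ (J , 0) ]
  branches : ∀ {Js cs} → cs ∈ sizes → List.map proj₂ Js ≡ List.reverse cs →
   All (λ (J , _) → Model.le J ≡ le × Model.al J ≡ al) Js →
   (∀ {k} → Solutions.Solvable inst k ⇔ Any (λ (J , c) → c ≤ k × Solutions.Solvable (Model.inst J) (k ∸ c)) Js) →
   Progress root Js

 eval⁺ : ∀ (φ : Form i j) xs Ls → holds M φ xs Ls → T (eval M φ xs Ls)
 eval⁺ φ xs Ls h with eval M φ xs Ls | eval-reflects M φ xs Ls
 ... | true | _ = tt
 ... | false | ofⁿ ¬h = ¬h h

 eval⁻ : ∀ (φ : Form i j) xs Ls → T (eval M φ xs Ls) → holds M φ xs Ls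
 eval⁻ φ xs Ls t with eval M φ xs Ls | eval-reflects M φ xs Ls
 ... | true | ofʸ h = h

 private
  fewer-alive : ∀ f (al′ : Fin n → Bool) → Alive f → (∀ e → T (al′ e) → Alive e × e ≢ f) → count al′ < count al
  fewer-alive f al′ af h = count-strict f (λ e t → proj₁ (h e t)) (λ t → proj₂ (h f t) refl) af

 module _ {root : Fin n} (tree : IsRooted le root) (alive-root : Alive root) where
  open Rules inst root
  not-root : ∀ {f} → (∃ λ y → ¬ y ≼ f) → f ≢ root
  not-root (y , y⋠f) refl = y⋠f (IsRooted.≼-root tree y)

  delete-progress : (w : Fires M deleteRule [] []) → Progress root (results M deleteRule {[]} {[]} w)
  delete-progress (f , g , (af , below , f≢g , replaced) , tt) = smaller refl
   (alive⁺ root alive-root (λ e → not-root below (sym e))) (fewer-alive f (λ e → eval M (killed v1) (e ∷ g ∷ [ f ]) []) af alive⁻)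
   (mk⇔ D.forth D.back)
   where
   J = moveTo M (record { order = nothing ; alive = just (killed v1) ; pairs = nothing ; price = 0 }) (g ∷ [ f ]) []
   alive⁺ : ∀ e → Alive e → e ≢ f → Model.Alive J e
   alive⁺ e ae e≢f = eval⁺ (killed v1) (e ∷ g ∷ [ f ]) [] (ae , e≢f)
   alive⁻ : ∀ e → Model.Alive J e → Alive e × e ≢ f
   alive⁻ e = eval⁻ (killed v1) (e ∷ g ∷ [ f ]) []
   deletable : Deletable f g
   deletable = record { alive = af ; ≢root = not-root below ; ≢g = f≢g ; replaced = replaced }
   module D = S.Deletion {f} {g} {root} deletable (Model.inst J) refl alive⁺ (λ e a → proj₁ (alive⁻ e a)) (λ u v r → r) (λ u v r → r)

  split-progress : (w : Fires M splitRule [] []) → Progress root (results M splitRule {[]} {[]} w)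
  split-progress (f , a , b , (af , below , aa , ab , a≼f , b≼f , a≢f , b≢f , a⋠b , b⋠a , only , pair , via-a , via-b) , tt) =
   smaller refl (alive⁺ root alive-root (λ e → not-root below (sym e))) (fewer-alive f (λ e → eval M (killed v2) (e ∷ b ∷ a ∷ [ f ]) []) af alive⁻)
   (mk⇔ (P.forth new⁺ new⁻) (P.back new⁺ new⁻))
   where
   newᶠ : Form 5 0
   newᶠ = (reqᶠ v1 v0 ∧ᶠ (¬ᶠ selfishᶠ v1 v0 v4 v3 v2) ∧ᶠ (¬ᶠ selfishᶠ v0 v1 v4 v3 v2)) ∨ᶠ
    ((eqᶠ v1 v3 ∨ᶠ eqᶠ v1 v2) ∧ᶠ ∃ᶠ (reqᶠ v0 v1 ∧ᶠ selfishᶠ v0 v1 v5 v4 v3))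
   J = moveTo M (record { order = nothing ; alive = just (killed v2) ; pairs = just newᶠ ; price = 0 }) (b ∷ a ∷ [ f ]) []
   alive⁺ : ∀ e → Alive e → e ≢ f → Model.Alive J e
   alive⁺ e ae e≢f = eval⁺ (killed v2) (e ∷ b ∷ a ∷ [ f ]) [] (ae , e≢f)
   alive⁻ : ∀ e → Model.Alive J e → Alive e × e ≢ f
   alive⁻ e = eval⁻ (killed v2) (e ∷ b ∷ a ∷ [ f ]) []
   splittable : Splittable f a b
   splittable = record
    { alive-f = af ; ≢root = not-root below ; alive-a = aa ; alive-b = ab ; a≼f = a≼f ; b≼f = b≼f ; a≢f = a≢f ; b≢f = b≢f
    ; a⋠b = a⋠b ; b⋠a = b⋠a ; only = only ; pair = pair ; via-a = via-a ; via-b = via-b }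
   module P = S.Splitting {f} {a} {b} {root} tree splittable (Model.inst J) refl alive⁺ alive⁻
   new⁺ : ∀ u v → P.New u v → T (Model.rq J u v)
   new⁺ u v = eval⁺ newᶠ (v ∷ u ∷ b ∷ a ∷ [ f ]) []
   new⁻ : ∀ u v → T (Model.rq J u v) → P.New u v
   new⁻ u v = eval⁻ newᶠ (v ∷ u ∷ b ∷ a ∷ [ f ]) []

 private
  sets : Vec (List (Fin n)) j → List (Fin j × ℕ) → List (List (Fin n))
  sets Ls = List.map (λ (b , _) → lookup Ls b)

  someSet⁺ : ∀ (Y : List (Fin n)) (Ls : Vec (List (Fin n)) j) bs → Any (All (_∈ Y)) (List.map (lookup Ls) bs) → holds M (someSetᶠ bs) [] (Y ∷ Ls)
  someSet⁺ Y Ls (b ∷ bs) (here p) = inj₁ λ e → All.lookup p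
  someSet⁺ Y Ls (b ∷ bs) (there p) = inj₂ (someSet⁺ Y Ls bs p)

  someSet⁻ : ∀ (Y : List (Fin n)) (Ls : Vec (List (Fin n)) j) bs → holds M (someSetᶠ bs) [] (Y ∷ Ls) → Any (All (_∈ Y)) (List.map (lookup Ls) bs)
  someSet⁻ Y Ls [] p = ⊥-elim (p refl)
  someSet⁻ Y Ls (b ∷ bs) (inj₁ p) = here (All.tabulate λ {e} → p e)
  someSet⁻ Y Ls (b ∷ bs) (inj₂ p) = there (someSet⁻ Y Ls bs p)

  valid⁺ : ∀ (Ls : Vec (List (Fin n)) j) X bs → S.ListValid (lookup Ls X) (List.map (lookup Ls) bs) → holds M (validᶠ X bs) [] Ls
  valid⁺ Ls X bs valid A A≤ A⊆X local with valid A A≤ A⊆X local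
  ... | Y , len≡ , hits , goal = Y , ≤-trans (≤-reflexive len≡) A≤ , len≡ , hits ,
   someSet⁺ Y (A ∷ Ls) (List.map suc bs) (subst (Any (All (_∈ Y))) (map-∘ bs) goal)

  valid⁻ : ∀ (Ls : Vec (List (Fin n)) j) X bs → holds M (validᶠ X bs) [] Ls → S.ListValid (lookup Ls X) (List.map (lookup Ls) bs)
  valid⁻ Ls X bs valid A A≤ A⊆X local with valid A A≤ A⊆X local
  ... | Y , _ , len≡ , hits , goal = Y , len≡ , hits , subst (Any (All (_∈ Y))) (sym (map-∘ bs)) (someSet⁻ Y (A ∷ Ls) (List.map suc bs) goal)

  sets-suc : ∀ (L : List (Fin n)) (Ls : Vec (List (Fin n)) j) bs → sets (L ∷ Ls) (List.map (λ (b , c) → suc b , c) bs) ≡ sets Ls bs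
  sets-suc L Ls bs = sym (map-∘ bs)

  list-valid-⊆ : ∀ {X Bs Cs} → (∀ {B} → B ∈ Bs → B ∈ Cs) → S.ListValid X Bs → S.ListValid X Cs
  list-valid-⊆ {X} {Bs} {Cs} sub valid A A≤ A⊆X local with valid A A≤ A⊆X local
  ... | Y , len≡ , hits , goal = Y , len≡ , hits , (let (B , B∈ , p) = find goal in lose (sub B∈) p)

  choose⁺ : ∀ cs (Ls : Vec (List (Fin n)) j) X bs (Bs : List (List (Fin n))) → List.map length Bs ≡ cs → All Unique Bs →
   S.ListValid (lookup Ls X) (Bs ++ sets Ls bs) → Fires M (chooseRule cs X bs) [] Ls
  choose⁺ [] Ls X bs [] _ _ valid = valid⁺ Ls X (List.map proj₁ bs) (subst (S.ListValid (lookup Ls X)) (map-∘ bs) valid) , tt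
  choose⁺ (c ∷ cs) Ls X bs (B ∷ Bs) refl (u ∷ us) valid = B , ∈-distinct⁺ B u ,
   choose⁺ cs (B ∷ Ls) (suc X) ((v0 , c) ∷ List.map (λ (b , c) → suc b , c) bs) Bs refl us
   (subst (λ Cs → S.ListValid (lookup Ls X) (Bs ++ B ∷ Cs)) (sym (sets-suc B Ls bs)) (list-valid-⊆ move valid))
   where
   move : ∀ {C} → C ∈ B ∷ Bs ++ sets Ls bs → C ∈ Bs ++ B ∷ sets Ls bs
   move (here p) = ∈-++⁺ʳ Bs (here p)
   move (there p) with ∈-++⁻ Bs p
   ... | inj₁ q = ∈-++⁺ˡ q
   ... | inj₂ q = ∈-++⁺ʳ Bs (there q)

  data Cuts : List (List (Fin n)) → List (Model n × ℕ) → Set where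
   [] : Cuts [] []
   cut : ∀ {B Bs J Js} → Unique B → Model.le J ≡ le → Model.al J ≡ al → S.Cut B (Model.inst J) → Cuts Bs Js → Cuts (B ∷ Bs) ((J , length B) ∷ Js)

  cuts : ∀ (Ls : Vec (List (Fin n)) j) bs → All (λ (b , c) → length (lookup Ls b) ≡ c × Unique (lookup Ls b)) bs →
   Cuts (sets Ls bs) (List.map (λ μ → moveTo M μ [] Ls , Move.price μ) (List.map cutMove bs))
  cuts Ls [] [] = []
  cuts Ls ((b , c) ∷ bs) ((refl , u) ∷ us) = cut u refl refl (record { same-le = refl ; same-al = refl
   ; req⁺ = λ u v r away → eval⁺ keptᶠ (v ∷ [ u ]) Ls (r , away)
   ; req⁻ = λ u v t → eval⁻ keptᶠ (v ∷ [ u ]) Ls t }) (cuts Ls bs us)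
   where
   keptᶠ : Form 2 _
   keptᶠ = rqᶠ v1 v0 ∧ᶠ ∀ᶠ (inᶠ v0 b →ᶠ ¬ᶠ sepᶠ v0 v2 v1)

  choose⁻ : ∀ cs (Ls : Vec (List (Fin n)) j) X bs (w : Fires M (chooseRule cs X bs) [] Ls) →
   All (λ (b , c) → length (lookup Ls b) ≡ c × Unique (lookup Ls b)) bs →
   ∃ λ Bs → S.ListValid (lookup Ls X) Bs × Cuts Bs (results M (chooseRule cs X bs) w) ×
   List.map length Bs ≡ List.foldl (flip _∷_) (List.map proj₂ bs) cs
  choose⁻ [] Ls X bs (valid , tt) good = sets Ls bs , subst (S.ListValid (lookup Ls X)) (sym (map-∘ bs)) (valid⁻ Ls X (List.map proj₁ bs) valid) ,
   cuts Ls bs good , lengths good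
   where
   lengths : ∀ {bs} → All (λ (b , c) → length (lookup Ls b) ≡ c × Unique (lookup Ls b)) bs → List.map length (sets Ls bs) ≡ List.map proj₂ bs
   lengths [] = refl
   lengths ((e , _) ∷ good) = cong₂ _∷_ e (lengths good)
  choose⁻ (c ∷ cs) Ls X bs (B , B∈ , w) good
   with choose⁻ cs (B ∷ Ls) (suc X) ((v0 , c) ∷ List.map (λ (b , c) → suc b , c) bs) w (∈-distinct⁻ c B∈ ∷ later-good good)
   where
   later-good : ∀ {bs} → All (λ (b , c) → length (lookup Ls b) ≡ c × Unique (lookup Ls b)) bs →
    All (λ (b , c) → length (lookup (B ∷ Ls) b) ≡ c × Unique (lookup (B ∷ Ls) b)) (List.map (λ (b , c) → suc b , c) bs)
   later-good [] = []
   later-good (g ∷ good) = g ∷ later-good good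
  ... | Bs , valid , cs-ok , lengths = Bs , valid , cs-ok ,
   trans lengths (cong (λ l → List.foldl (flip _∷_) (c ∷ l) cs) (sym (map-∘ bs)))

  branch-progress : ∀ {root cs} → cs ∈ sizes → (w : Fires M (branchRule cs) [] []) → Progress root (results M (branchRule cs) {[]} {[]} w)
  branch-progress {cs = cs} cs∈ (X , X∈ , w) with choose⁻ cs [ X ] v0 [] w []
  ... | Bs , valid , cuts , lengths = branches cs∈ (trans (prices cuts) lengths) (same cuts) (mk⇔ forth (back cuts))
   where
   module C = S.Cutting (∈-upTo⁻ window X∈) valid
   prices : ∀ {Bs Js} → Cuts Bs Js → List.map proj₂ Js ≡ List.map length Bs
   prices [] = refl
   prices (cut _ _ _ _ cs) = cong (_ ∷_) (prices cs)
   same : ∀ {Bs Js} → Cuts Bs Js → All (λ (J , _) → Model.le J ≡ le × Model.al J ≡ al) Js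
   same [] = []
   same (cut _ l a _ cs) = (l , a) ∷ same cs
   hit : ∀ {Bs Js D k} → Cuts Bs Js → Solutions.Solution inst k D → Any (All (T ∘ D)) Bs →
    Any (λ (J , c) → c ≤ k × Solutions.Solvable (Model.inst J) (k ∸ c)) Js
   hit (cut u _ _ c cs) sol (here p) = here (S.Cut.cut-forth c sol u p)
   hit (cut u _ _ c cs) sol (there p) = there (hit cs sol p)
   forth : ∀ {k} → Solutions.Solvable inst k → Any (λ (J , c) → c ≤ k × Solutions.Solvable (Model.inst J) (k ∸ c)) _
   forth (C , sol) with C.choose C sol
   ... | D , sol′ , p = hit cuts sol′ p
   back : ∀ {Bs Js k} → Cuts Bs Js → Any (λ (J , c) → c ≤ k × Solutions.Solvable (Model.inst J) (k ∸ c)) Js → Solutions.Solvable inst k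
   back (cut _ _ _ c cs) (here (c≤k , s)) = S.Cut.cut-back c c≤k s
   back (cut _ _ _ c cs) (there p) = back cs p

 main-progress : ∀ {root} (tree : IsRooted le root) → Alive root → ∀ {R} → R ∈ mainRules → (w : Fires M R [] []) →
  Progress root (results M R {[]} {[]} w)
 main-progress tree ar ∈₀ w = delete-progress tree ar w
 main-progress tree ar ∈₁ w = split-progress tree ar w
 main-progress tree ar (there (there p)) w with ∈-map⁻ branchRule p
 ... | cs , cs∈ , refl = branch-progress cs∈ w

 step-fires : ∀ {root} (tree : IsRooted le root) → Rules.Step inst root → ∃ λ R → R ∈ mainRules × Fires M R [] []
 step-fires {root} tree (Rules.delete f g del) = deleteRule , ∈₀ ,
  f , g , (alive , (root , λ r≼f → ≢root (IsRooted.≼-antisym tree (IsRooted.≼-root tree f) r≼f)) , ≢g , replaced) , tt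
  where open Rules.Deletable del
 step-fires {root} tree (Rules.split f a b sp) = splitRule , ∈₁ ,
  f , a , b , (alive-f , (root , λ r≼f → ≢root (IsRooted.≼-antisym tree (IsRooted.≼-root tree f) r≼f)) , alive-a , alive-b ,
  a≼f , b≼f , a≢f , b≢f , a⋠b , b⋠a , only , pair , via-a , via-b) , tt
  where open Rules.Splittable sp
 step-fires {root} tree (Rules.branch br) = branchRule (List.map length Bs) , there (there (∈-map⁺ branchRule size-∈)) ,
  X , ∈-upTo⁺ window X small , choose⁺ (List.map length Bs) [ X ] v0 [] Bs refl unique
  (subst (S.ListValid X) (sym (++-identityʳ Bs)) (S.valid-list root {X} {Bs} valid))
  where open Rules.Branching br

-- These are the positions in the environment that results from the five nested cases of `next` on a
-- packed state.
stateNames : Names 0 0 11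
stateNames = record { vert = λ () ; list = λ () ; slot = λ
 { pairsˢ → v0 ; budgetˢ → v1 ; aliveˢ → v2 ; orderˢ → v4 ; edgesˢ → v6 ; vertsˢ → suc v7 } }

someRequestᶠ : Form 0 0
someRequestᶠ = ∃ᶠ ∃ᶠ rqᶠ v1 v0

firstᵉ : List (Rule 0 0) → Ex 11
firstᵉ [] = nilᵉ
firstᵉ (R ∷ Rs) = caseᵉ (ruleᵉ stateNames R) (firstᵉ Rs) (ref v0)

-- The result is a list of states. `trueᵉ` is the list whose only member is the accepting state
-- `nil`, and the empty list, when no rule fires, rejects.
bodyᵉ : Ex 11
bodyᵉ = caseᵉ (ruleᵉ stateNames growRule) (caseᵉ (notᵉ (toEx stateNames someRequestᶠ)) (firstᵉ mainRules) trueᵉ) (ref v0)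

next : Ex 1
next = caseᵉ (ref v0) nilᵉ (caseᵉ (ref v1) nilᵉ (caseᵉ (ref v1) nilᵉ (caseᵉ (ref v1) nilᵉ (caseᵉ (ref v1) nilᵉ bodyᵉ))))

module _ (B : ℕ) (M : Model n) (k : ℕ) where
 open Model M

 data FirstSpec (Rs : List (Rule 0 0)) : Datum → Set where
  fires : ∀ {R d} → R ∈ Rs → (w : Fires M R [] []) → AreStates B k (results M R {[]} {[]} w) d → FirstSpec Rs d
  stuck : (∀ {R} → R ∈ Rs → ¬ Fires M R [] []) → FirstSpec Rs nil

 data NextSpec : Datum → Set where
  grows : ∀ {d} (w : Fires M growRule [] []) → AreStates B k (results M growRule {[]} {[]} w) d → NextSpec d
  accepts : ¬ Fires M growRule [] [] → (∀ u v → ¬ T (rq u v)) → NextSpec (cons nil nil)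
  goes-on : ∀ {d} → ¬ Fires M growRule [] [] → (∃₂ λ u v → T (rq u v)) → FirstSpec mainRules d → NextSpec d

private
 pick : ∀ (a b : Ex m) γ {W P} {Q : Datum → Set} → Outcome W P (run a γ) → (¬ W → Q (run b γ)) → (∀ {d} (w : W) → P w d → Q d) →
  Q (run (caseᵉ a b (ref v0)) γ)
 pick a b γ o none some with run a γ
 pick a b γ (nowhere ¬w) none some | nil = none ¬w
 pick a b γ (at-once w p) none some | cons _ _ = some w p

 run-reject : ∀ (a b : Ex m) c γ {x} {Q : Datum → Set} → truth (run a γ) ≡ x → (x ≡ true → Q (run b γ)) →
  (x ≡ false → ∀ l r → Q (run c (l ∷ r ∷ γ))) → Q (run (caseᵉ (notᵉ a) b c) γ)
 run-reject a b c γ e p q with run a γ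
 run-reject a b c γ e p q | nil = q (sym e) nil nil
 run-reject a b c γ e p q | cons _ _ = p (sym e)

module _ {B : ℕ} {M : Model n} where
 next-spec : ∀ {s k} → IsState B M k s → NextSpec B M k (run next [ s ])
 next-spec {s} {k} st = subst (λ s → NextSpec B M k (run next [ s ])) (sym packed)
  (subst (λ k → NextSpec B M k (run bodyᵉ γ)) budget spec)
  where
  open IsState st renaming (datum to D)
  γ : Vec Datum 11
  γ = D pairsˢ ∷ D budgetˢ ∷ D aliveˢ ∷ r₄ ∷ D orderˢ ∷ r₃ ∷ D edgesˢ ∷ r₂ ∷ D vertsˢ ∷ r₁ ∷ pack D ∷ []
   where
   r₄ r₃ r₂ r₁ : Datum
   r₄ = cons (D pairsˢ) (D budgetˢ)
   r₃ = cons (D aliveˢ) r₄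
   r₂ = cons (D orderˢ) r₃
   r₁ = cons (D edgesˢ) r₂
  fits : Fits {n = n} D [] [] stateNames γ
  fits = record { vert-fits = λ () ; list-fits = λ () ; slot-fits = λ
   { pairsˢ → refl ; budgetˢ → refl ; aliveˢ → refl ; orderˢ → refl ; edgesˢ → refl ; vertsˢ → refl } }
  K = len (D budgetˢ)

  first : ∀ Rs → FirstSpec B M K Rs (run (firstᵉ Rs) γ)
  first [] = stuck λ ()
  first (R ∷ Rs) = pick (ruleᵉ stateNames R) (firstᵉ Rs) γ {Q = FirstSpec B M K (R ∷ Rs)} (rule-outcome encodes room fits R)
   (λ ¬w → others ¬w (first Rs)) (λ w → fires ∈₀ w)
   where
   others : ∀ {d} → ¬ Fires M R [] [] → FirstSpec B M K Rs d → FirstSpec B M K (R ∷ Rs) d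
   others ¬w (fires R∈ w p) = fires (there R∈) w p
   others ¬w (stuck ¬ws) = stuck λ { ∈₀ → ¬w ; (there R∈) → ¬ws R∈ }

  spec : NextSpec B M K (run bodyᵉ γ)
  spec = pick (ruleᵉ stateNames growRule) (caseᵉ (notᵉ (toEx stateNames someRequestᶠ)) (firstᵉ mainRules) trueᵉ) γ {Q = NextSpec B M K} (rule-outcome encodes room fits growRule)
   (λ ¬grow → run-reject (toEx stateNames someRequestᶠ) (firstᵉ mainRules) trueᵉ γ {Q = NextSpec B M K} (run-toEx encodes fits someRequestᶠ)
   (λ e → goes-on ¬grow (eval⁻ M someRequestᶠ [] [] (≡⇒T e)) (first mainRules))
   (λ e _ _ → accepts ¬grow λ u v r → subst T e (eval⁺ M someRequestᶠ [] [] (u , v , r))))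
   (λ w p → grows w p)

-- The number of nodes

-- A bound for the number of leaves, with L k ~ c ρ^k since ρ⁴ = 2ρ² + 1.
L : ℕ → ℕ
L 0 = 1
L 1 = 1
L 2 = 3
L 3 = 5
L (suc (suc (suc (suc k)))) = 2 * L (suc (suc k)) + L k

L-pos : ∀ k → 1 ≤ L k
L-pos 0 = s≤s z≤n
L-pos 1 = s≤s z≤n
L-pos 2 = s≤s z≤n
L-pos 3 = s≤s z≤n
L-pos (suc (suc (suc (suc k)))) = ≤-trans (L-pos k) (m≤n+m _ _)

leaves : List ℕ → ℕ → ℕ
leaves [] k = 0
leaves (c ∷ cs) k = (if c ≤ᵇ k then L (k ∸ c) else 0) + leaves cs k

private
 -- This is `leaves` at `j + 4`: there no size up to 4 exceeds the budget, so neither the case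
 -- distinction nor a truncation is left.
 shifted : List ℕ → ℕ → ℕ
 shifted [] j = 0
 shifted (c ∷ cs) j = L (j + (4 ∸ c)) + shifted cs j

 shifted-rec : ∀ cs j → shifted cs (4 + j) ≡ 2 * shifted cs (2 + j) + shifted cs j
 shifted-rec [] j = refl
 shifted-rec (c ∷ cs) j = trans (cong (L (4 + j + (4 ∸ c)) +_) (shifted-rec cs j))
  (solve 4 (λ a b x y → (con 2 :* a :+ b) :+ (con 2 :* x :+ y) := con 2 :* (a :+ x) :+ (b :+ y)) refl
  (L (2 + (j + (4 ∸ c)))) (L (j + (4 ∸ c))) (shifted cs (2 + j)) (shifted cs j))

 -- Both sides satisfy the linear recurrence of `L`, whose coefficients are not negative, so four
 -- initial values decide. These are compared by evaluation.
 shifted-≤ : ∀ cs → (∀ j → j < 4 → shifted cs j ≤ L (j + 4)) → ∀ j → shifted cs j ≤ L (j + 4)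
 shifted-≤ cs base 0 = base 0 (s≤s z≤n)
 shifted-≤ cs base 1 = base 1 (s≤s (s≤s z≤n))
 shifted-≤ cs base 2 = base 2 (s≤s (s≤s (s≤s z≤n)))
 shifted-≤ cs base 3 = base 3 (s≤s (s≤s (s≤s (s≤s z≤n))))
 shifted-≤ cs base (suc (suc (suc (suc j)))) = ≤-trans (≤-reflexive (shifted-rec cs j))
  (+-mono-≤ (*-monoʳ-≤ 2 (shifted-≤ cs base (suc (suc j)))) (shifted-≤ cs base j))

 leaves-shifted : ∀ cs → All (_≤ 4) cs → ∀ j → leaves cs (j + 4) ≡ shifted cs j
 leaves-shifted [] [] j = refl
 leaves-shifted (c ∷ cs) (p ∷ ps) j with c ≤ᵇ j + 4 | ≤⇒≤ᵇ (≤-trans p (m≤n+m 4 j))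
 ... | true | _ = cong₂ _+_ (cong L (+-∸-assoc j p)) (leaves-shifted cs ps j)

 checkable : List ℕ → Bool
 checkable cs = all (λ c → (1 ≤ᵇ c) ∧ (c ≤ᵇ 4)) cs ∧
  (all (λ k → leaves cs k ≤ᵇ L k) (0 ∷ 1 ∷ 2 ∷ [ 3 ]) ∧ all (λ j → shifted cs j ≤ᵇ L (j + 4)) (0 ∷ 1 ∷ 2 ∷ [ 3 ]))

 small-∈ : ∀ {j} → j < 4 → j ∈ 0 ∷ 1 ∷ 2 ∷ [ 3 ]
 small-∈ {0} _ = ∈₀
 small-∈ {1} _ = ∈₁
 small-∈ {2} _ = ∈₂
 small-∈ {3} _ = ∈₃
 small-∈ {suc (suc (suc (suc _)))} (s≤s (s≤s (s≤s (s≤s ()))))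

leaves-≤ : ∀ cs → T (checkable cs) → All (1 ≤_) cs × (∀ k → leaves cs k ≤ L k)
leaves-≤ cs t = All.map (λ {c} p → ≤ᵇ⇒≤ 1 c (proj₁ (∧⁻ {1 ≤ᵇ c} p))) sized , bound
 where
 parts = ∧⁻ {all (λ c → (1 ≤ᵇ c) ∧ (c ≤ᵇ 4)) cs} t
 parts′ = ∧⁻ {all (λ k → leaves cs k ≤ᵇ L k) (0 ∷ 1 ∷ 2 ∷ [ 3 ])} (proj₂ parts)
 sized : All (λ c → T ((1 ≤ᵇ c) ∧ (c ≤ᵇ 4))) cs
 sized = all⁺ (λ c → (1 ≤ᵇ c) ∧ (c ≤ᵇ 4)) cs (proj₁ parts)
 few : ∀ k → k < 4 → leaves cs k ≤ L k
 few k k<4 = ≤ᵇ⇒≤ _ _ (All.lookup (all⁺ (λ k → leaves cs k ≤ᵇ L k) (0 ∷ 1 ∷ 2 ∷ [ 3 ]) (proj₁ parts′)) (small-∈ k<4))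
 base : ∀ j → j < 4 → shifted cs j ≤ L (j + 4)
 base j j<4 = ≤ᵇ⇒≤ _ _ (All.lookup (all⁺ (λ j → shifted cs j ≤ᵇ L (j + 4)) (0 ∷ 1 ∷ 2 ∷ [ 3 ]) (proj₂ parts′)) (small-∈ j<4))
 bound : ∀ k → leaves cs k ≤ L k
 bound k with k <? 4
 ... | yes k<4 = few k k<4
 ... | no k≮4 = subst (λ k → leaves cs k ≤ L k) (m∸n+n≡m (≮⇒≥ k≮4)) (≤-trans
  (≤-reflexive (leaves-shifted cs (All.map (λ {c} p → ≤ᵇ⇒≤ c 4 (proj₂ (∧⁻ {1 ≤ᵇ c} p))) sized) (k ∸ 4)))
  (shifted-≤ cs base (k ∸ 4)))

abstract
 sizes-leaves : ∀ {cs} → cs ∈ sizes → All (1 ≤_) (List.reverse cs) × (∀ k → leaves (List.reverse cs) k ≤ L k)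
 sizes-leaves {cs} cs∈ = leaves-≤ (List.reverse cs) (All.lookup (all⁺ (checkable ∘ List.reverse) sizes tt) cs∈)

open Search next using (Explores; ExploresAny; accepted; expand; exhausted; succeeds; fails)

stateBound : ℕ → ℕ
stateBound B = 5 + 6 * B

enter : ∀ {B} {M : Model n} {k s b N} → IsState B M k s → ExploresAny (stateBound B) (run next [ s ]) b N → Explores (stateBound B) s b (suc N)
enter {B = B} {s = s} st e = by s (IsState.packed st) e
 where
 open IsState st renaming (datum to D)
 open Room room
 by : ∀ s {b N} → s ≡ pack D → ExploresAny (stateBound B) (run next [ s ]) b N → Explores (stateBound B) s b (suc N)
 by _ refl e = expand fits e
  where
  fits : size (pack D) ≤ stateBound B
  fits = begin
   size (pack D)
   ≡⟨ solve 6 (λ a b c d e f → con 1 :+ (a :+ (con 1 :+ (b :+ (con 1 :+ (c :+ (con 1 :+ (d :+ (con 1 :+ (e :+ f)))))))))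
   := con 5 :+ (a :+ (b :+ (c :+ (d :+ (e :+ (f :+ con 0))))))) refl
   (size (D vertsˢ)) (size (D edgesˢ)) (size (D orderˢ)) (size (D aliveˢ)) (size (D pairsˢ)) (size (D budgetˢ)) ⟩
   5 + (size (D vertsˢ) + (size (D edgesˢ) + (size (D orderˢ) + (size (D aliveˢ) + (size (D pairsˢ) + (size (D budgetˢ) + 0))))))
   ≤⟨ +-monoʳ-≤ 5 (+-mono-≤ (slots vertsˢ) (+-mono-≤ (slots edgesˢ) (+-mono-≤ (slots orderˢ) (+-mono-≤ (slots aliveˢ)
   (+-mono-≤ (slots pairsˢ) (+-mono-≤ (slots budgetˢ) z≤n)))))) ⟩
   stateBound B ∎
   where open ≤-Reasoning

record Explored (B : ℕ) (s : Datum) (P : Set) (m : ℕ) : Set where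
 field
  answer : Bool
  nodes : ℕ
  run-of : Explores (stateBound B) s answer nodes
  correct : answer ≡ true ⇔ P
  few : nodes ≤ m

record ExploredAny (B : ℕ) (d : Datum) (P : Set) (m : ℕ) : Set where
 field
  answer : Bool
  nodes : ℕ
  run-of : ExploresAny (stateBound B) d answer nodes
  correct : answer ≡ true ⇔ P
  few : nodes ≤ m

Solvableᵐ : Model n → ℕ → Set
Solvableᵐ M = Solutions.Solvable (Model.inst M)

Won : ℕ → Model n × ℕ → Set
Won k (J , c) = c ≤ k × Solvableᵐ J (k ∸ c)

one-less : ∀ {m k} x → m ≤ x * L k → suc m ≤ suc x * L k
one-less {k = k} x le = +-mono-≤ (L-pos k) le

explore-any : ∀ {B k x} {Js : List (Model n × ℕ)} {d} → All (1 ≤_) (List.map proj₂ Js) →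
 (∀ {J c s} → (J , c) ∈ Js → 1 ≤ c → c ≤ k → IsState B J (k ∸ c) s → Explored B s (Solvableᵐ J (k ∸ c)) (x * L (k ∸ c))) →
 AreStates B k Js d → ExploredAny B d (Any (Won k) Js) (x * leaves (List.map proj₂ Js) k)
explore-any _ ih [] = record { answer = false ; nodes = 0 ; run-of = exhausted ; correct = mk⇔ (λ ()) (λ ()) ; few = z≤n }
explore-any {B = B} {k} {x} {(J , c) ∷ Js} (p ∷ ps) ih (take {d = d} c≤k st sts) =
 both (ih ∈₀ p c≤k st) (explore-any {x = x} ps (λ J∈ → ih (there J∈)) sts)
 where
 total-leaves : leaves (c ∷ List.map proj₂ Js) k ≡ L (k ∸ c) + leaves (List.map proj₂ Js) k
 total-leaves = cong (λ b → (if b then L (k ∸ c) else 0) + leaves (List.map proj₂ Js) k) (T⇒≡ (≤⇒≤ᵇ c≤k))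
 both : ∀ {s} → Explored B s (Solvableᵐ J (k ∸ c)) (x * L (k ∸ c)) → ExploredAny B d (Any (Won k) Js) (x * leaves (List.map proj₂ Js) k) →
  ExploredAny B (cons s d) (Any (Won k) ((J , c) ∷ Js)) (x * leaves (c ∷ List.map proj₂ Js) k)
 both record { answer = true ; run-of = r ; correct = ok ; few = f } _ = record
  { run-of = succeeds r ; correct = mk⇔ (λ _ → here (c≤k , Equivalence.to ok refl)) (λ _ → refl)
  ; few = ≤-trans f (*-monoʳ-≤ x (≤-trans (m≤m+n _ _) (≤-reflexive (sym total-leaves)))) }
 both record { answer = false ; run-of = r ; correct = ok ; few = f } record { run-of = rs ; correct = oks ; few = fs } = record
  { run-of = fails r rs
  ; correct = mk⇔ (λ e → there (Equivalence.to oks e)) λ { (here (_ , s)) → contradiction (Equivalence.from ok s) λ () ; (there q) → Equivalence.from oks q }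
  ; few = ≤-trans (+-mono-≤ f fs) (≤-reflexive (trans (sym (*-distribˡ-+ x _ _)) (cong (x *_) (sym total-leaves)))) }
explore-any {B = B} {k} {x} {(J , c) ∷ Js} (p ∷ ps) ih (drop {d = d} c≰k sts) = skip (explore-any {x = x} ps (λ J∈ → ih (there J∈)) sts)
 where
 skip : ExploredAny B d (Any (Won k) Js) (x * leaves (List.map proj₂ Js) k) →
  ExploredAny B d (Any (Won k) ((J , c) ∷ Js)) (x * leaves (c ∷ List.map proj₂ Js) k)
 skip record { run-of = rs ; correct = oks ; few = fs } = record
  { run-of = rs ; correct = mk⇔ (there ∘ Equivalence.to oks) λ { (here (c≤k , _)) → ⊥-elim (c≰k c≤k) ; (there q) → Equivalence.from oks q }
  ; few = ≤-trans fs (*-monoʳ-≤ x (m≤n+m _ _)) }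

no-grow : ∀ {M : Model n} {root} → IsRooted (Model.le M) root → ¬ Fires M growRule [] []
no-grow tree (u , _ , (_ , u⋠u , _) , _) = u⋠u (IsRooted.≼-refl tree u)

-- The nodes are bounded by depth times leaves. The depth is at most `2 + count al + k`, because
-- contracting kills a vertex and every set of a branching costs at least one.
explore-rooted : ∀ {B} m {M : Model n} {root k s} → count (Model.al M) + k < m → IsRooted (Model.le M) root → Model.Alive M root →
 IsState B M k s → Explored B s (Solvableᵐ M k) ((2 + count (Model.al M) + k) * L k)
explore-rooted {n = n} {B} (suc m) {M} {root} {k} {s} (s≤s lt) tree alive-root st = go (next-spec st)
 where
 open Model M
 goal = (2 + count al + k) * L k

 use : ∀ {M₀ : Model n} {x} → ExploredAny B (run next [ s ]) (Solvableᵐ M₀ k) (x * L k) →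
  Explored B s (Solvableᵐ M₀ k) (suc x * L k)
 use {x = x} record { run-of = r ; correct = ok ; few = f } = record
  { run-of = enter st r ; correct = ok ; few = one-less {k = k} x f }

 lone : ∀ {d s′ m′} {J : Model n} → d ≡ cons s′ nil → (∀ {k} → Solvableᵐ M k ⇔ Solvableᵐ J k) → m′ ≤ (1 + count al + k) * L k →
  Explored B s′ (Solvableᵐ J k) m′ → ExploredAny B d (Solvableᵐ M k) ((1 + count al + k) * L k)
 lone refl same le record { answer = true ; run-of = r ; correct = ok ; few = f } = record
  { run-of = succeeds r ; correct = mk⇔ (Equivalence.from same ∘ Equivalence.to ok) (Equivalence.from ok ∘ Equivalence.to same)
  ; few = ≤-trans f le }
 lone refl same le record { answer = false ; nodes = N ; run-of = r ; correct = ok ; few = f } = record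
  { run-of = fails r exhausted ; correct = mk⇔ (Equivalence.from same ∘ Equivalence.to ok) (Equivalence.from ok ∘ Equivalence.to same)
  ; few = ≤-trans (≤-reflexive (+-identityʳ N)) (≤-trans f le) }

 many : ∀ {d} {P : Set} {Js : List (Model n × ℕ)} → (Solvableᵐ M k ⇔ P) → leaves (List.map proj₂ Js) k ≤ L k →
  ExploredAny B d P ((1 + count al + k) * leaves (List.map proj₂ Js) k) →
  ExploredAny B d (Solvableᵐ M k) ((1 + count al + k) * L k)
 many same le record { run-of = r ; correct = ok ; few = f } = record
  { run-of = r ; correct = mk⇔ (Equivalence.from same ∘ Equivalence.to ok) (Equivalence.from ok ∘ Equivalence.to same)
  ; few = ≤-trans f (*-monoʳ-≤ (1 + count al + k) le) }

 deeper : ∀ {d} {Js : List (Model n × ℕ)} → Progress M root Js → AreStates B k Js d → ExploredAny B d (Solvableᵐ M k) ((1 + count al + k) * L k)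
 deeper (smaller {J} le≡ alive fewer same) (drop 0≰k _) = ⊥-elim (0≰k z≤n)
 deeper (smaller {J} le≡ alive fewer same) (take _ st′ []) = lone {J = J} refl same (*-monoˡ-≤ (L k) (s≤s (+-monoˡ-≤ k fewer)))
  (explore-rooted m {J} (<-≤-trans (+-monoˡ-< k fewer) lt) (subst (λ le → IsRooted le root) (sym le≡) tree) alive st′)
 deeper (branches {Js} {cs} cs∈ prices alike same) sts = many {Js = Js} same
  (subst (λ ps → leaves ps k ≤ L k) (sym prices) (proj₂ (sizes-leaves cs∈) k))
  (explore-any {x = 1 + count al + k} (subst (All (1 ≤_)) (sym prices) (proj₁ (sizes-leaves cs∈))) below sts)
  where
  cheaper : ∀ {J c} → Model.al J ≡ al → 1 ≤ c → c ≤ k → suc (count (Model.al J) + (k ∸ c)) ≤ count al + k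
  cheaper {J} {c} al≡ 1≤c c≤k = begin
   suc (count (Model.al J) + (k ∸ c)) ≡⟨ cong (λ al → suc (count al + (k ∸ c))) al≡ ⟩
   suc (count al + (k ∸ c)) ≡⟨ +-suc (count al) (k ∸ c) ⟨
   count al + suc (k ∸ c) ≤⟨ +-monoʳ-≤ (count al) (≤-trans (+-monoˡ-≤ (k ∸ c) 1≤c) (≤-reflexive (m+[n∸m]≡n c≤k))) ⟩
   count al + k ∎
   where open ≤-Reasoning
  weaken : ∀ {s P m m′} → m ≤ m′ → Explored B s P m → Explored B s P m′
  weaken le record { run-of = r ; correct = ok ; few = f } = record { run-of = r ; correct = ok ; few = ≤-trans f le }
  below : ∀ {J c s} → (J , c) ∈ Js → 1 ≤ c → c ≤ k → IsState B J (k ∸ c) s →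
   Explored B s (Solvableᵐ J (k ∸ c)) ((1 + count al + k) * L (k ∸ c))
  below {J} {c} J∈ 1≤c c≤k st′ = weaken (*-monoˡ-≤ (L (k ∸ c)) (s≤s shrink))
   (explore-rooted m {J} (≤-trans shrink lt) (subst (λ le → IsRooted le root) (sym (proj₁ alike′)) tree)
   (subst (λ al → T (al root)) (sym (proj₂ alike′)) alive-root) st′)
   where
   alike′ = All.lookup alike J∈
   shrink = cheaper {J} (proj₂ alike′) 1≤c c≤k

 go : NextSpec B M k (run next [ s ]) → Explored B s (Solvableᵐ M k) goal
 go spec = use {M} {1 + count al + k} (by spec)
  where
  by : ∀ {d} → NextSpec B M k d → ExploredAny B d (Solvableᵐ M k) ((1 + count al + k) * L k)
  by (grows w _) = ⊥-elim (no-grow {M = M} tree w)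
  by (accepts _ none-left) = record { run-of = succeeds accepted
   ; correct = mk⇔ (λ _ → char [] , ≤-trans (count-char-≤ {n} []) z≤n , λ { u v (inj₁ r) → ⊥-elim (none-left u v r) ; u v (inj₂ r) → ⊥-elim (none-left v u r) }) (λ _ → refl)
   ; few = *-mono-≤ {1} {1 + count al + k} (s≤s z≤n) (L-pos k) }
  by (goes-on _ _ (fires R∈ w sts)) = deeper (main-progress M tree alive-root R∈ w) sts
  -- Without a step this request is passed by no living vertex at all, by `contradict`. Nothing can
  -- hit it, so rejecting is right.
  by (goes-on _ (u , v , r) (stuck ¬fires)) = record { run-of = exhausted ; correct = mk⇔ (λ ()) (λ sol → ⊥-elim (unsolvable sol)) ; few = z≤n }
   where
   unsolvable : ¬ Solvableᵐ M k
   unsolvable (C , _ , hit) with hit u v (inj₁ r)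
   ... | e , s , _ = Completeness.contradict inst tree alive-root
    (λ step → let (R , R∈ , w) = step-fires M tree step in ¬fires R∈ w) {u} {v} (inj₁ r) s

-- Counting along an injection

count-≤ : (C : Fin n → Bool) → count C ≤ n
count-≤ {zero} C = z≤n
count-≤ {suc n} C with C zero
... | true = s≤s (count-≤ (C ∘ suc))
... | false = ≤-trans (count-≤ (C ∘ suc)) (n≤1+n n)

zero∉suc : (xs : List (Fin n)) → Fin.zero ∉ List.map Fin.suc xs
zero∉suc (x ∷ xs) (there p) = zero∉suc xs p

elements-unique : (C : Fin n → Bool) → Unique (elements C)
elements-unique {zero} C = []
elements-unique {suc n} C with C zero
... | true = All.tabulate (λ p e → zero∉suc (elements (C ∘ suc)) (subst (_∈ List.map Fin.suc (elements (C ∘ suc))) (sym e) p)) ∷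
 map⁺ suc-injective (elements-unique (C ∘ suc))
... | false = map⁺ suc-injective (elements-unique (C ∘ suc))

-- A relation takes the place of a function because the correspondence of vertices and edges,
-- `edgeAt u ≡ just ε`, is partial and is used in both directions.
count-injection : {C : Fin n → Bool} {D : Fin m → Bool} (R : Fin n → Fin m → Set) → (∀ x → T (C x) → ∃ λ y → R x y × T (D y)) →
 (∀ {x x′ y} → R x y → R x′ y → x ≡ x′) → count C ≤ count D
count-injection {n} {m} {C} {D} R total injective with images (elements C) (elements-unique C) (All.tabulate (∈-elements⁻ C))
 where
 images : ∀ xs → Unique xs → All (T ∘ C) xs → ∃ λ ys → length ys ≡ length xs × Unique ys × All (T ∘ D) ys × (∀ {y} → y ∈ ys → ∃ λ x → x ∈ xs × R x y)
 images [] [] [] = [] , refl , [] , [] , λ ()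
 images (x ∷ xs) (x∉ ∷ u) (c ∷ cs) with images xs u cs | total x c
 ... | ys , len , u′ , ds , pre | y , r , d = y ∷ ys , cong suc len ,
  All.tabulate (λ y∈ → λ { refl → let (x′ , x′∈ , r′) = pre y∈ in All.lookup x∉ x′∈ (injective r r′) }) ∷ u′ , d ∷ ds ,
  λ { ∈₀ → x , ∈₀ , r ; (there y∈) → let (x′ , x′∈ , r′) = pre y∈ in x′ , there x′∈ , r′ }
... | ys , len , u , ds , _ = begin
 count C ≡⟨ length-elements C ⟨
 length (elements C) ≡⟨ len ⟨
 length ys ≤⟨ m≤n+m _ _ ⟩
 count (λ e → D e ∧ not (char ys e)) + length ys ≤⟨ count-remove D ys u ds ⟩
 count D ∎
 where open ≤-Reasoning

count-lookup : (S : Subset n) → ∣ S ∣ ≡ count (lookup S)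
count-lookup [] = refl
count-lookup (true ∷ S) = cong suc (count-lookup S)
count-lookup (false ∷ S) = count-lookup S

-- Walks

module _ (G : Graph) where
 open Graph G

 module _ {A : Subset #E} where
  suffix : ∀ {u v w} (p : Walk A v w) → Unique (vertices p) → u ∈ vertices p → Path A u w
  suffix [] un ∈₀ = [] , un
  suffix (step e a j p) un ∈₀ = step e a j p , un
  suffix (step e a j p) (_ ∷ un) (there u∈) = suffix p un u∈

  to-path : ∀ {u v} → Walk A u v → Path A u v
  to-path [] = [] , ([] ∷ [])
  to-path {u} (step e a j p) with to-path p
  ... | q , un with Any.any? (u ≟ᶠ_) (vertices q)
  ... | yes u∈ = suffix q un u∈
  ... | no u∉ = step e a j q , All.tabulate (λ { {w} w∈ refl → u∉ w∈ }) ∷ un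

  end-∈ : ∀ {u v} (p : Walk A u v) → u ∈ vertices p
  end-∈ [] = ∈₀
  end-∈ (step _ _ _ _) = ∈₀

  same-ends : ∀ {e u v x y} → Joins e u v → Joins e x y → (x ≡ u × y ≡ v) ⊎ (x ≡ v × y ≡ u)
  same-ends (inj₁ p) (inj₁ q) with trans (sym p) q
  ... | refl = inj₁ (refl , refl)
  same-ends (inj₁ p) (inj₂ q) with trans (sym p) q
  ... | refl = inj₂ (refl , refl)
  same-ends (inj₂ p) (inj₁ q) with trans (sym p) q
  ... | refl = inj₂ (refl , refl)
  same-ends (inj₂ p) (inj₂ q) with trans (sym p) q
  ... | refl = inj₁ (refl , refl)

  edge-vertex : ∀ {e u v x y} (p : Walk A u v) → e ∈ edges p → Joins e x y → x ∈ vertices p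
  edge-vertex (step e a j p) ∈₀ j′ with same-ends j j′
  ... | inj₁ (refl , refl) = ∈₀
  ... | inj₂ (refl , refl) = there (end-∈ p)
  edge-vertex (step e a j p) (there e∈) j′ = there (edge-vertex p e∈ j′)

  unique-edges : ∀ {u v} (p : Walk A u v) → Unique (vertices p) → Unique (edges p)
  unique-edges [] _ = []
  unique-edges (step e a j p) (u∉ ∷ un) = All.tabulate (λ { e∈ refl → All.lookup u∉ (edge-vertex p e∈ j) refl }) ∷ unique-edges p un

  edges-⊆ : ∀ {e u v} (p : Walk A u v) → e ∈ edges p → e ∈ˢ A
  edges-⊆ (step e a j p) ∈₀ = a
  edges-⊆ (step e a j p) (there e∈) = edges-⊆ p e∈

  walk-∷ʳ : ∀ {u v w} (e : E) → e ∈ˢ A → Joins e v w → Walk A u v → Walk A u w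
  walk-∷ʳ e a j [] = step e a j []
  walk-∷ʳ e a j (step e′ a′ j′ p) = step e′ a′ j′ (walk-∷ʳ e a j p)

 module _ {A B : Subset #E} (A⊆B : ∀ {e} → e ∈ˢ A → e ∈ˢ B) where
  widen : ∀ {u v} → Walk A u v → Walk B u v
  widen [] = []
  widen (step e a j p) = step e (A⊆B a) j (widen p)

  edges-widen : ∀ {u v} (p : Walk A u v) → edges (widen p) ≡ edges p
  edges-widen [] = refl
  edges-widen (step e a j p) = cong (e ∷_) (edges-widen p)

  vertices-widen : ∀ {u v} (p : Walk A u v) → vertices (widen p) ≡ vertices p
  vertices-widen [] = refl
  vertices-widen {u} (step e a j p) = cong (u ∷_) (vertices-widen p)

-- Trees grown from a root

 -- The part of the tree built so far, with u ≼ e if e is on the path from u to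
 -- the root; the vertices in it are those with u ≼ u.
 record Grown (_≼_ : V → V → Set) (root : V) : Set where
  field
   root-in : root ≼ root
   in-left : ∀ {u e} → u ≼ e → u ≼ u
   in-right : ∀ {u e} → u ≼ e → e ≼ e
   top : ∀ {u} → u ≼ u → u ≼ root
   trans≼ : ∀ {u v w} → u ≼ v → v ≼ w → u ≼ w
   antisym : ∀ {u v} → u ≼ v → v ≼ u → u ≡ v
   chain : ∀ {u v w} → u ≼ v → u ≼ w → v ≼ w ⊎ w ≼ v
   parent : ∀ {u} → u ≼ u → u ≢ root → ∃₂ λ p ε → Joins ε u p × ¬ p ≼ u × (∀ e → u ≼ e ⇔ (e ≡ u ⊎ p ≼ e))

 -- The vertex `u` is attached as a leaf below `p`. The new order is described through `to` and
 -- `from` since the algorithm obtains it by evaluating a formula.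
 module _ {_≼_ _≼′_ : V → V → Set} {root p u : V} {ε : E} (g : Grown _≼_ root) (p-in : p ≼ p) (u-out : ¬ u ≼ u) (joins : Joins ε u p)
  (to : ∀ {x y} → x ≼′ y → x ≼ y ⊎ (x ≡ u × (y ≡ u ⊎ p ≼ y)))
  (from : ∀ {x y} → x ≼ y ⊎ (x ≡ u × (y ≡ u ⊎ p ≼ y)) → x ≼′ y) where
  open Grown g

  private
   New : V → V → Set
   New x y = x ≼ y ⊎ (x ≡ u × (y ≡ u ⊎ p ≼ y))

   not-from : ∀ {y} → ¬ u ≼ y
   not-from r = u-out (in-left r)
   not-to : ∀ {x} → ¬ x ≼ u
   not-to r = u-out (in-right r)

   in-left′ : ∀ {x y} → New x y → New x x
   in-left′ (inj₁ r) = inj₁ (in-left r)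
   in-left′ (inj₂ (refl , _)) = inj₂ (refl , inj₁ refl)

   in-right′ : ∀ {x y} → New x y → New y y
   in-right′ (inj₁ r) = inj₁ (in-right r)
   in-right′ (inj₂ (_ , inj₁ refl)) = inj₂ (refl , inj₁ refl)
   in-right′ (inj₂ (_ , inj₂ r)) = inj₁ (in-right r)

   top′ : ∀ {x} → New x x → New x root
   top′ (inj₁ r) = inj₁ (top r)
   top′ (inj₂ (refl , _)) = inj₂ (refl , inj₂ (top p-in))

   trans′ : ∀ {x y z} → New x y → New y z → New x z
   trans′ (inj₁ r) (inj₁ s) = inj₁ (trans≼ r s)
   trans′ (inj₁ r) (inj₂ (refl , _)) = ⊥-elim (not-to r)
   trans′ (inj₂ (refl , inj₁ refl)) s = s
   trans′ (inj₂ (refl , inj₂ r)) (inj₁ s) = inj₂ (refl , inj₂ (trans≼ r s))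
   trans′ (inj₂ (refl , inj₂ r)) (inj₂ (refl , _)) = ⊥-elim (not-to r)

   antisym′ : ∀ {x y} → New x y → New y x → x ≡ y
   antisym′ (inj₁ r) (inj₁ s) = antisym r s
   antisym′ (inj₁ r) (inj₂ (refl , _)) = ⊥-elim (not-to r)
   antisym′ (inj₂ (refl , inj₁ refl)) s = refl
   antisym′ (inj₂ (refl , inj₂ r)) (inj₁ s) = ⊥-elim (not-to s)
   antisym′ (inj₂ (refl , inj₂ r)) (inj₂ (refl , _)) = refl

   chain′ : ∀ {x y z} → New x y → New x z → New y z ⊎ New z y
   chain′ (inj₁ r) (inj₁ s) = Sum.map inj₁ inj₁ (chain r s)
   chain′ (inj₁ r) (inj₂ (refl , _)) = ⊥-elim (not-from r)
   chain′ (inj₂ (refl , _)) (inj₁ s) = ⊥-elim (not-from s)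
   chain′ (inj₂ (refl , inj₁ refl)) s = inj₁ s
   chain′ r (inj₂ (refl , inj₁ refl)) = inj₂ r
   chain′ (inj₂ (refl , inj₂ r)) (inj₂ (refl , inj₂ s)) = Sum.map inj₁ inj₁ (chain r s)

   parent′ : ∀ {x} → New x x → x ≢ root → ∃₂ λ q ε → Joins ε x q × ¬ New q x × (∀ e → New x e ⇔ (e ≡ x ⊎ New q e))
   parent′ (inj₂ (refl , _)) _ = p , ε , joins ,
    (λ { (inj₁ r) → not-to r ; (inj₂ (refl , _)) → u-out p-in }) ,
    λ e → mk⇔ (λ { (inj₁ r) → ⊥-elim (not-from r) ; (inj₂ (_ , inj₁ q)) → inj₁ q ; (inj₂ (_ , inj₂ r)) → inj₂ (inj₁ r) })
    (λ { (inj₁ q) → inj₂ (refl , inj₁ q) ; (inj₂ (inj₁ r)) → inj₂ (refl , inj₂ r) ; (inj₂ (inj₂ (refl , _))) → ⊥-elim (u-out p-in) })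
   parent′ {x} (inj₁ r) x≢root with parent r x≢root
   ... | q , ε , j , q⋠x , iff = q , ε , j ,
    (λ { (inj₁ s) → q⋠x s ; (inj₂ (refl , _)) → not-from q-in }) ,
    λ e → mk⇔ (λ { (inj₁ s) → Sum.map₂ inj₁ (Equivalence.to (iff e) s) ; (inj₂ (refl , _)) → ⊥-elim (u-out r) })
    (λ { (inj₁ refl) → inj₁ r ; (inj₂ (inj₁ s)) → inj₁ (Equivalence.from (iff e) (inj₂ s)) ; (inj₂ (inj₂ (refl , _))) → ⊥-elim (not-from q-in) })
    where
    q-in : q ≼ root
    q-in with Equivalence.to (iff root) (top r)
    ... | inj₁ e = ⊥-elim (x≢root (sym e))
    ... | inj₂ s = s

  grow : Grown _≼′_ root
  grow = record
   { root-in = from (inj₁ root-in)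
   ; in-left = from ∘ in-left′ ∘ to
   ; in-right = from ∘ in-right′ ∘ to
   ; top = from ∘ top′ ∘ to
   ; trans≼ = λ r s → from (trans′ (to r) (to s))
   ; antisym = λ r s → antisym′ (to r) (to s)
   ; chain = λ r s → Sum.map from from (chain′ (to r) (to s))
   ; parent = λ r x≢root → let (q , ε , j , ¬r , iff) = parent′ (to r) x≢root in
   q , ε , j , ¬r ∘ to , λ e → mk⇔ (Sum.map₂ from ∘ Equivalence.to (iff e) ∘ to) (from ∘ Equivalence.from (iff e) ∘ Sum.map₂ to)
   }

-- Cuts of the tree as hitting sets

module Rooted (G : Graph) (isTree : Graph.IsTree G) {le : Graph.V G → Graph.V G → Bool} {root : Graph.V G}
 (grown : Grown G (λ u e → T (le u e)) root) (all-in : ∀ u → T (le u u)) where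
 open Graph G
 open Grown grown
 private
  _≼_ : V → V → Set
  u ≼ e = T (le u e)

 is-rooted : IsRooted le root
 is-rooted = record { ≼-refl = all-in ; ≼-trans = trans≼ ; ≼-antisym = antisym ; ≼-chain = chain ; ≼-root = λ u → top (all-in u) }

 IsParent : E → V → V → Set
 IsParent ε u p = Joins ε u p × ¬ p ≼ u × (∀ e → u ≼ e ⇔ (e ≡ u ⊎ p ≼ e))

 edgeAt : V → Maybe E
 edgeAt u with u ≟ᶠ root
 ... | yes _ = nothing
 ... | no u≢root = just (proj₁ (proj₂ (parent (all-in u) u≢root)))

 parent-at : ∀ {u ε} → edgeAt u ≡ just ε → ∃ (IsParent ε u)
 parent-at {u} eq with u ≟ᶠ root
 parent-at {u} refl | no u≢root = proj₁ (parent (all-in u) u≢root) , proj₂ (proj₂ (parent (all-in u) u≢root))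

 edge-exists : ∀ {u} → u ≢ root → ∃ λ ε → edgeAt u ≡ just ε
 edge-exists {u} u≢root with u ≟ᶠ root
 ... | yes e = ⊥-elim (u≢root e)
 ... | no _ = _ , refl

 edgeAt-injective : ∀ {u w ε} → edgeAt u ≡ just ε → edgeAt w ≡ just ε → u ≡ w
 edgeAt-injective {u} {w} a b with parent-at a | parent-at b
 ... | p , j , p⋠u , iff | q , j′ , q⋠w , iff′ with same-ends G {allEdges} j j′
 ... | inj₁ (refl , _) = refl
 ... | inj₂ (refl , refl) = ⊥-elim (p⋠u (Equivalence.from (iff′ u) (inj₂ (all-in u))))

 private
  ancestors : V → ℕ
  ancestors u = count (le u)

  higher : ∀ {u p ε} → IsParent ε u p → ancestors p < ancestors u
  higher {u} (_ , p⋠u , iff) = count-strict u (λ e r → Equivalence.from (iff e) (inj₂ r)) p⋠u (all-in u)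

 Separates : V → V → V → Set
 Separates e u v = (u ≼ e × ¬ v ≼ e) ⊎ (v ≼ e × ¬ u ≼ e)

 module _ {A : Subset #E} where
  -- The walk goes from `u` to its parent unless `v` is below `u`; in this case it ends with the
  -- edge above `v`, taken downwards. The remaining part is separated by vertices that separated `u`
  -- and `v` before, and it has fewer ancestors.
  climb : ∀ m u v → ancestors u + ancestors v < m → (∀ e ε → Separates e u v → edgeAt e ≡ just ε → ε ∈ˢ A) → Walk A u v
  climb (suc m) u v (s≤s lt) intact with u ≟ᶠ v
  ... | yes refl = []
  ... | no u≢v with T? (le v u)
  ... | no v⋠u = up (edge-exists λ { refl → v⋠u (top (all-in v)) })
   where
   up : (∃ λ ε → edgeAt u ≡ just ε) → Walk A u v
   up (ε , at) with parent-at at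
   ... | p , par@(j , p⋠u , iff) = step ε (intact u ε (inj₁ (all-in u , v⋠u)) at) j
    (climb m p v (<-≤-trans (+-monoˡ-< (ancestors v) (higher par)) lt) below)
    where
    below : ∀ e ε′ → Separates e p v → edgeAt e ≡ just ε′ → ε′ ∈ˢ A
    below e ε′ (inj₁ (p≼e , v⋠e)) = intact e ε′ (inj₁ (Equivalence.from (iff e) (inj₂ p≼e) , v⋠e))
    below e ε′ (inj₂ (v≼e , p⋠e)) = intact e ε′ (inj₂ (v≼e , not-below ∘ Equivalence.to (iff e)))
     where
     not-below : e ≡ u ⊎ p ≼ e → ⊥
     not-below (inj₁ refl) = v⋠u v≼e
     not-below (inj₂ p≼e) = p⋠e p≼e
  ... | yes v≼u = up (edge-exists λ { refl → u≢v (antisym (top (all-in u)) v≼u) })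
   where
   u⋠v : ¬ u ≼ v
   u⋠v u≼v = u≢v (antisym u≼v v≼u)
   up : (∃ λ ε → edgeAt v ≡ just ε) → Walk A u v
   up (ε , at) with parent-at at
   ... | p , par@(j , p⋠v , iff) = walk-∷ʳ G ε (intact v ε (inj₂ (all-in v , u⋠v)) at) (Sum.swap j)
    (climb m u p (<-≤-trans (+-monoʳ-< (ancestors u) (higher par)) lt) below)
    where
    below : ∀ e ε′ → Separates e u p → edgeAt e ≡ just ε′ → ε′ ∈ˢ A
    below e ε′ (inj₂ (p≼e , u⋠e)) = intact e ε′ (inj₂ (Equivalence.from (iff e) (inj₂ p≼e) , u⋠e))
    below e ε′ (inj₁ (u≼e , p⋠e)) = intact e ε′ (inj₁ (u≼e , not-below ∘ Equivalence.to (iff e)))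
     where
     not-below : e ≡ v ⊎ p ≼ e → ⊥
     not-below (inj₁ refl) = u⋠v u≼e
     not-below (inj₂ p≼e) = p⋠e p≼e

  connect : ∀ {u v} → (∀ e ε → Separates e u v → edgeAt e ≡ just ε → ε ∈ˢ A) → Path A u v
  connect {u} {v} intact = to-path G (climb _ u v ≤-refl intact)

 edgeAt≟ : ∀ u ε → Dec (edgeAt u ≡ just ε)
 edgeAt≟ u ε = ≡-dec _≟ᶠ_ (edgeAt u) (just ε)

 -- The edges from vertices to their parents connect everything already, so any further edge would
 -- close a cycle together with a path between its ends.
 tree-edge : ∀ ε → ∃ λ u → edgeAt u ≡ just ε
 tree-edge ε with any? (λ u → edgeAt≟ u ε)
 ... | yes found = found
 ... | no none = ⊥-elim (proj₂ isTree (a , step ε ∈⊤ (inj₁ refl) (widen G (λ _ → ∈⊤) p) , (λ ()) ,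
  subst (λ es → Unique (ε ∷ es)) (sym (edges-widen G (λ _ → ∈⊤) p)) (All.tabulate off ∷ unique-edges G p un) ,
  subst Unique (sym (vertices-widen G (λ _ → ∈⊤) p)) un))
  where
  a = proj₁ (lookup ends ε)
  b = proj₂ (lookup ends ε)
  used : E → Bool
  used ε′ = does (any? λ u → edgeAt≟ u ε′)
  A : Subset #E
  A = Vec.tabulate used
  used⁺ : ∀ {u ε′} → edgeAt u ≡ just ε′ → used ε′ ≡ true
  used⁺ {u} {ε′} at with any? (λ u → edgeAt≟ u ε′)
  ... | yes _ = refl
  ... | no ¬∃ = ⊥-elim (¬∃ (u , at))
  used-ε : used ε ≡ false
  used-ε with any? (λ u → edgeAt≟ u ε)
  ... | yes found = ⊥-elim (none found)
  ... | no _ = refl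
  path : Path A b a
  path = connect λ e ε′ _ at → lookup⇒[]= ε′ A (trans (lookup∘tabulate used ε′) (used⁺ at))
  p = proj₁ path
  un = proj₂ path
  off : ∀ {ε′} → ε′ ∈ edges p → ε ≢ ε′
  off ε′∈ refl with trans (sym used-ε) (trans (sym (lookup∘tabulate used ε)) ([]=⇒lookup (edges-⊆ G p ε′∈)))
  ... | ()

 across : ∀ {e ε x y} → Joins ε x y → x ≼ e → ¬ y ≼ e → edgeAt e ≡ just ε
 across {e} {ε} j x≼e y⋠e with tree-edge ε
 ... | t , at with parent-at at
 ... | q , j′ , q⋠t , iff with same-ends G {allEdges} j′ j
 ... | inj₂ (refl , refl) = ⊥-elim (y⋠e (Equivalence.from (iff e) (inj₂ x≼e)))
 ... | inj₁ (refl , refl) with Equivalence.to (iff e) x≼e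
 ... | inj₁ refl = at
 ... | inj₂ q≼e = ⊥-elim (y⋠e q≼e)

 -- Some edge of the walk leads from below `e` to a vertex not below `e` or back, and by `across`
 -- only the edge above `e` does so.
 crossing : ∀ {A u v e} → Walk A u v → Separates e u v → ∃ λ ε → edgeAt e ≡ just ε × ε ∈ˢ A
 crossing [] (inj₁ (p , q)) = ⊥-elim (q p)
 crossing [] (inj₂ (p , q)) = ⊥-elim (q p)
 crossing {A} {u} {v} {e} (step {v = w} ε a j p) sep with T? (le u e) | T? (le w e)
 ... | yes u≼e | yes w≼e = crossing p (Sum.map (λ (_ , q) → w≼e , q) (λ (_ , q) → ⊥-elim (q u≼e)) sep)
 ... | no u⋠e | no w⋠e = crossing p (Sum.map (λ (q , _) → ⊥-elim (u⋠e q)) (λ (q , _) → q , w⋠e) sep)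
 ... | yes u≼e | no w⋠e = ε , across j u≼e w⋠e , a
 ... | no u⋠e | yes w≼e = ε , across (Sum.swap j) w≼e u⋠e , a

module Correspondence (I : GMWCT) where
 open GMWCT I
 Asked : V → V → Set
 Asked u v = u ≢ v × Any (λ S → u ∈ˢ S × v ∈ˢ S) terminals

 module _ (M : Model #V) {root : V} (grown : Grown graph (λ u e → T (Model.le M u e)) root) (all-in : ∀ u → T (Model.le M u u))
  (all-alive : ∀ u → Model.Alive M u) (asked : ∀ u v → T (Model.rq M u v) ⇔ Asked u v) where
  open Model M
  open Rooted graph isTree {le} grown all-in

  private
   maybe-T : ∀ (o : Maybe E) (f : E → Bool) → T (maybe′ f false o) → ∃ λ ε → o ≡ just ε × T (f ε)
   maybe-T (just ε) f t = ε , refl , t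

   -- No solution has more than `#V` elements, so the budget can be capped. This is needed because
   -- `k` is given in binary, whereas the budget in a state is unary and has to stay polynomial in
   -- the size of the input.
   yes⇒solvable : YesInstance I → Solvableᵐ M (#V ⊓ k)
   yes⇒solvable (E′ , small , cut) = C , ⊓-glb (count-≤ C) (≤-trans few small) , hit
    where
    C : V → Bool
    C u = maybe′ (lookup E′) false (edgeAt u)
    few : count C ≤ ∣ E′ ∣
    few = ≤-trans (count-injection (λ u ε → edgeAt u ≡ just ε) (λ u → maybe-T (edgeAt u) (lookup E′)) edgeAt-injective)
     (≤-reflexive (sym (count-lookup E′)))
    hit₁ : ∀ u v → T (rq u v) → Hit C u v
    hit₁ u v r with any? (λ e → sep? e u v ×-dec T? (C e))
    ... | yes found = found
    ... | no none with Equivalence.to (asked u v) r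
    ... | u≢v , among = let (S , S∈ , u∈ , v∈) = find among in
     ⊥-elim (All.lookup cut S∈ u v u∈ v∈ u≢v (connect λ e ε s at → x∉p⇒x∈∁p λ ε∈ →
     none (e , (all-alive e , s) , subst (λ o → T (maybe′ (lookup E′) false o)) (sym at) (≡⇒T ([]=⇒lookup ε∈)))))
    hit : ∀ u v → Req u v → Hit C u v
    hit u v (inj₁ r) = hit₁ u v r
    hit u v (inj₂ r) = hit-sym {C} {v} {u} (hit₁ v u r)

   solvable⇒yes : Solvableᵐ M (#V ⊓ k) → YesInstance I
   solvable⇒yes (C , small , hit) = E′ , ≤-trans few (≤-trans small (m⊓n≤n #V k)) , All.tabulate λ {S} S∈ u v u∈ v∈ u≢v (p , _) →
    conflict p (hit u v (inj₁ (Equivalence.from (asked u v) (u≢v , lose S∈ (u∈ , v∈)))))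
    where
    chosen? : ∀ ε → Dec (∃ λ u → edgeAt u ≡ just ε × T (C u))
    chosen? ε = any? λ u → edgeAt≟ u ε ×-dec T? (C u)
    chosen : E → Bool
    chosen ε = does (chosen? ε)
    E′ : Subset #E
    E′ = Vec.tabulate chosen
    chosen⁻ : ∀ ε → T (lookup E′ ε) → ∃ λ u → edgeAt u ≡ just ε × T (C u)
    chosen⁻ ε t with chosen? ε | subst T (lookup∘tabulate chosen ε) t
    ... | yes found | _ = found
    chosen⁺ : ∀ {u ε} → edgeAt u ≡ just ε → T (C u) → ε ∈ˢ E′
    chosen⁺ {u} {ε} at c = lookup⇒[]= ε E′ (trans (lookup∘tabulate chosen ε) (by (chosen? ε)))
     where
     by : ∀ (d : Dec (∃ λ u → edgeAt u ≡ just ε × T (C u))) → does d ≡ true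
     by (yes _) = refl
     by (no ¬∃) = ⊥-elim (¬∃ (u , at , c))
    few : ∣ E′ ∣ ≤ count C
    few = ≤-trans (≤-reflexive (count-lookup E′)) (count-injection (λ ε u → edgeAt u ≡ just ε) chosen⁻
     (λ a b → just-injective (trans (sym a) b)))
    conflict : ∀ {u v} → Walk (∁ E′) u v → ¬ Hit C u v
    conflict p (e , (_ , s) , c) with crossing p s
    ... | ε , at , ε∈ = x∈∁p⇒x∉p ε∈ (chosen⁺ at c)

  yes⇔solvable : Solvableᵐ M (#V ⊓ k) ⇔ YesInstance I
  yes⇔solvable = mk⇔ solvable⇒yes yes⇒solvable

 outside : Model #V → ℕ
 outside M = count λ u → not (Model.le M u u)

 Joined : V → V → Set
 Joined u v = ∃ λ ε → lookup ends ε ≡ (u , v)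

 module _ {M : Model #V} {root : V} (grown : Grown graph (λ u e → T (Model.le M u e)) root) (joined : ∀ u v → T (Model.ad M u v) ⇔ Joined u v) where
  open Model M
  open Grown grown

  private
   -- The first vertex outside of the part built so far, on a walk that starts inside, would let the
   -- rule fire.
   reach : ¬ Fires M growRule [] [] → ∀ {A u v} → Walk A u v → T (le u u) → T (le v v)
   reach ¬grow [] u-in = u-in
   reach ¬grow (step {u} {w} ε a j p) u-in with T? (le w w)
   ... | yes w-in = reach ¬grow p w-in
   ... | no w-out = ⊥-elim (¬grow (w , u , (u-in , w-out , Sum.map
    (λ eq → Equivalence.from (joined w u) (ε , eq)) (λ eq → Equivalence.from (joined u w) (ε , eq)) (Sum.swap j)) , tt))

  grown-all : ¬ Fires M growRule [] [] → ∀ u → T (le u u)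
  grown-all ¬grow u = reach ¬grow (proj₁ (proj₁ isTree root u)) root-in

  module _ {p u : V} (guard-ok : T (le p p) × ¬ T (le u u) × (T (ad u p) ⊎ T (ad p u))) where
   private
    orderᶠ : Form 4 0
    orderᶠ = leᶠ v1 v0 ∨ᶠ (eqᶠ v1 v3 ∧ᶠ (eqᶠ v0 v3 ∨ᶠ leᶠ v2 v0))

    le′ : V → V → Bool
    le′ x y = eval M orderᶠ (y ∷ x ∷ p ∷ [ u ]) []

    edge : ∃ λ ε → Joins ε u p
    edge with proj₂ (proj₂ guard-ok)
    ... | inj₁ a = let (ε , eq) = Equivalence.to (joined u p) a in ε , inj₁ eq
    ... | inj₂ a = let (ε , eq) = Equivalence.to (joined p u) a in ε , inj₂ eq

    to : ∀ {x y} → T (le′ x y) → T (le x y) ⊎ (x ≡ u × (y ≡ u ⊎ T (le p y)))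
    to {x} {y} = eval⁻ M orderᶠ (y ∷ x ∷ p ∷ [ u ]) []
    from : ∀ {x y} → T (le x y) ⊎ (x ≡ u × (y ≡ u ⊎ T (le p y))) → T (le′ x y)
    from {x} {y} = eval⁺ M orderᶠ (y ∷ x ∷ p ∷ [ u ]) []

   grow-once : Grown graph (λ x y → T (le′ x y)) root
   grow-once = grow graph grown (proj₁ guard-ok) (proj₁ (proj₂ guard-ok)) (proj₂ edge) to from

   grow-fewer : count (λ x → not (le′ x x)) < outside M
   grow-fewer = count-strict u (λ x t → T-not⁺ {le x x} λ r → T-not⁻ {le′ x x} t (from (inj₁ r)))
    (λ t → T-not⁻ {le′ u u} t (from (inj₂ (refl , inj₁ refl)))) (T-not⁺ {le u u} (proj₁ (proj₂ guard-ok)))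

 -- While the order grows there are no alternatives, so each missing vertex adds a single node in
 -- front of the search proper.
 explore-growing : ∀ {B} m {M : Model #V} {root s} → outside M < m → Grown graph (λ u e → T (Model.le M u e)) root →
  (∀ u v → T (Model.ad M u v) ⇔ Joined u v) → (∀ u → Model.Alive M u) → (∀ u v → T (Model.rq M u v) ⇔ Asked u v) →
  IsState B M (#V ⊓ k) s → Explored B s (YesInstance I) ((outside M + (2 + #V + (#V ⊓ k))) * L (#V ⊓ k))
 explore-growing {B} (suc m) {M} {root} {s} (s≤s lt) grown joined all-alive asked st = by (next-spec st) refl
  where
  k′ = #V ⊓ k
  rest = 2 + #V + k′

  one : ∀ {d s′ m′} → run next [ s ] ≡ d → d ≡ cons s′ nil → suc m′ ≤ (outside M + rest) * L k′ → Explored B s′ (YesInstance I) m′ →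
   Explored B s (YesInstance I) ((outside M + rest) * L k′)
  one {s′ = s′} eq refl le record { answer = true ; run-of = r ; correct = ok ; few = f } = record
   { run-of = enter st (subst (λ d → ExploresAny (stateBound B) d true _) (sym eq) (succeeds r)) ; correct = ok ; few = ≤-trans (s≤s f) le }
  one {s′ = s′} eq refl le record { answer = false ; nodes = N ; run-of = r ; correct = ok ; few = f } = record
   { run-of = enter st (subst (λ d → ExploresAny (stateBound B) d false _) (sym eq) (fails r exhausted)) ; correct = ok
   ; few = ≤-trans (s≤s (≤-trans (≤-reflexive (+-identityʳ N)) f)) le }

  finished : ¬ Fires M growRule [] [] → Explored B s (YesInstance I) ((outside M + rest) * L k′)
  finished ¬grow = convert (explore-rooted _ ≤-refl (Rooted.is-rooted graph isTree {Model.le M} grown all-in) (all-alive root) st)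
   where
   all-in = grown-all {M} grown joined ¬grow
   convert : Explored B s (Solvableᵐ M k′) ((2 + count (Model.al M) + k′) * L k′) → Explored B s (YesInstance I) ((outside M + rest) * L k′)
   convert record { run-of = r ; correct = ok ; few = f } = record
    { run-of = r
    ; correct = mk⇔ (Equivalence.to eqv ∘ Equivalence.to ok) (Equivalence.from ok ∘ Equivalence.from eqv)
    ; few = ≤-trans f (*-monoˡ-≤ (L k′) (≤-trans (s≤s (s≤s (+-monoˡ-≤ k′ (count-≤ (Model.al M))))) (m≤n+m rest (outside M)))) }
    where
    eqv = yes⇔solvable M grown all-in all-alive asked

  by : ∀ {d} → NextSpec B M k′ d → run next [ s ] ≡ d → Explored B s (YesInstance I) ((outside M + rest) * L k′)
  by (accepts ¬grow _) _ = finished ¬grow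
  by (goes-on ¬grow _ _) _ = finished ¬grow
  by (grows (u , p , ok , tt) (drop 0≰k _)) _ = ⊥-elim (0≰k z≤n)
  by (grows (u , p , ok , tt) (take {J = J} _ st′ [])) eq = one eq refl
   (≤-trans (one-less {k = k′} (outside J + rest) ≤-refl) (*-monoˡ-≤ (L k′) (+-monoˡ-≤ rest (grow-fewer {M} grown joined ok))))
   (explore-growing m {J} (<-≤-trans (grow-fewer {M} grown joined ok) lt) (grow-once {M} grown joined ok) joined all-alive asked st′)

-- The initial state

v4′ : ∀ {m} → Fin (5 + m)
v4′ = suc v3
v6′ : ∀ {m} → Fin (7 + m)
v6′ = suc v5

-- Each suffix of the list of the vertices with k in its tail counts one; if k
-- is no vertex then all of them count.
budgetᵉ : Fin m → Fin m → Ex m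
budgetᵉ V k = caseᵉ (forᵉ (ref V) (eqᵉ (ref (later k)) (ref v0))) (ref V)
 (forᵉ (ref (later V)) (caseᵉ (forᵉ (ref v1) (eqᵉ (ref (later (later (later k)))) (ref v0))) nilᵉ trueᵉ))

pairsᵉ : Fin m → Ex m
pairsᵉ Ts = forᵉ (ref Ts) (forᵉ (ref v0) (forᵉ (ref v2) (caseᵉ (eqᵉ (ref v2) (ref v0)) (consᵉ (consᵉ (ref v2) (ref v0)) nilᵉ) nilᵉ)))

-- With no vertex at all, the initial state is the accepting one.
init : Ex 1
init = caseᵉ (ref v0) nilᵉ (caseᵉ (ref v1) nilᵉ (caseᵉ (ref v1) nilᵉ (caseᵉ (ref v4′) nilᵉ
 (consᵉ (ref v6′) (consᵉ (ref v4′) (consᵉ (consᵉ (consᵉ (ref v0) (ref v0)) nilᵉ) (consᵉ (ref v6′) (consᵉ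
 (pairsᵉ v2) (budgetᵉ v6′ v3)))))))))

-- The list of the vertices with a variable start, for an induction over its suffixes.
upFrom : ℕ → ℕ → List ℕ
upFrom a zero = []
upFrom a (suc m) = a ∷ upFrom (suc a) m

encode-upFrom : ∀ (f : Fin m → Fin n) a → (∀ i → toℕ (f i) ≡ a + toℕ i) →
 encodeList encodeFin (List.tabulate f) ≡ encodeList encodeℕ (upFrom a m)
encode-upFrom {zero} f a h = refl
encode-upFrom {suc m} f a h = cong₂ cons (cong encodeℕ (trans (h zero) (+-identityʳ a)))
 (encode-upFrom (f ∘ suc) (suc a) λ i → trans (h (suc i)) (+-suc a (toℕ i)))

contains⁻ : {A : Set} (f : A → Datum) {x : Datum} (ys : List A) → T (contains x (encodeList f ys)) → ∃ λ y → y ∈ ys × x ≡ f y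
contains⁻ f {x} (y ∷ ys) t with ∨⁻ {eqᵈ x (f y)} t
... | inj₁ e = y , ∈₀ , eqᵈ-sound x (f y) e
... | inj₂ q = let (y′ , y∈ , e) = contains⁻ f ys q in y′ , there y∈ , e

contains⁺ : {A : Set} (f : A → Datum) {y : A} {ys : List A} → y ∈ ys → T (contains (f y) (encodeList f ys))
contains⁺ f {y} ∈₀ = ∨⁺ {eqᵈ (f y) (f y)} (inj₁ (≡⇒T (eqᵈ-refl (f y))))
contains⁺ f {y} (there {y′} y∈) = ∨⁺ {eqᵈ (f y) (f y′)} (inj₂ (contains⁺ f y∈))

∈-upFrom⁺ : ∀ a m {k} → a ≤ k → k < a + m → k ∈ upFrom a m
∈-upFrom⁺ a zero {k} a≤k k< = ⊥-elim (<⇒≱ (<-≤-trans k< (≤-reflexive (+-identityʳ a))) a≤k)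
∈-upFrom⁺ a (suc m) {k} a≤k k< with k ≟ⁿ a
... | yes refl = ∈₀
... | no k≢a = there (∈-upFrom⁺ (suc a) m (≤∧≢⇒< a≤k (k≢a ∘ sym)) (<-≤-trans k< (≤-reflexive (+-suc a m))))

∈-upFrom⁻ : ∀ a m {k} → k ∈ upFrom a m → a ≤ k × k < a + m
∈-upFrom⁻ a (suc m) ∈₀ = ≤-refl , m<m+n a (s≤s z≤n)
∈-upFrom⁻ a (suc m) (there k∈) with ∈-upFrom⁻ (suc a) m k∈
... | a<k , k< = <⇒≤ a<k , <-≤-trans k< (≤-reflexive (sym (+-suc a m)))

private
 loop : ℕ → Datum → Datum
 loop k = flatMap λ y _ → encodeBool (eqᵈ (encodeℕ k) y)

 keep : Datum → Datum
 keep nil = nil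
 keep (cons _ _) = cons nil nil

 len-keep : ∀ k a m → len (flatMap (λ _ rest → keep (loop k rest)) (encodeList encodeℕ (upFrom a m))) ≡ (if k <ᵇ a + m then k ∸ a else 0)
 len-keep k a zero with k <ᵇ a + 0 in eq
 ... | false = refl
 ... | true = sym (m≤n⇒m∸n≡0 (<⇒≤ (subst (k <_) (+-identityʳ a) (<ᵇ⇒< k (a + 0) (subst T (sym eq) tt)))))
 len-keep k a (suc m) = by (loop k rest) (trans (contains-loop (encodeℕ k) rest) refl)
  where
  rest = encodeList encodeℕ (upFrom (suc a) m)
  shape : a + suc m ≡ suc a + m
  shape = +-suc a m
  by : ∀ d → truth d ≡ contains (encodeℕ k) rest →
   len (append (keep d) (flatMap (λ _ rest → keep (loop k rest)) rest)) ≡ (if k <ᵇ a + suc m then k ∸ a else 0)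
  by nil e rewrite len-keep k (suc a) m | shape with k <ᵇ suc a + m in eq
  ... | false = refl
  ... | true = trans (m≤n⇒m∸n≡0 (≤-trans k≤a (n≤1+n a))) (sym (m≤n⇒m∸n≡0 k≤a))
   where
   k≤a : k ≤ a
   k≤a = ≮⇒≥ λ a<k → subst T (sym e) (contains⁺ encodeℕ (∈-upFrom⁺ (suc a) m a<k (<ᵇ⇒< k (suc a + m) (subst T (sym eq) tt))))
  by (cons _ _) e rewrite len-keep k (suc a) m | shape = trans (cong (λ b → suc (if b then k ∸ suc a else 0)) k<) (trans 1+ (cong (λ b → if b then k ∸ a else 0) (sym k<)))
   where
   inside : suc a ≤ k × k < suc a + m
   inside with contains⁻ encodeℕ (upFrom (suc a) m) (subst T e tt)
   ... | y , y∈ , eq with encodeℕ-injective {k} {y} eq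
   ... | refl = ∈-upFrom⁻ (suc a) m y∈
   k< : (k <ᵇ suc a + m) ≡ true
   k< = T⇒≡ (<⇒<ᵇ (proj₂ inside))
   1+ : suc (k ∸ suc a) ≡ k ∸ a
   1+ = sym (+-∸-assoc 1 (proj₁ inside))

 flatMap-cong : ∀ {F G : Datum → Datum → Datum} → (∀ x r → F x r ≡ G x r) → ∀ l → flatMap F l ≡ flatMap G l
 flatMap-cong e nil = refl
 flatMap-cong e (cons x l) = cong₂ append (e x l) (flatMap-cong e l)

len-encodeList : {A : Set} (f : A → Datum) (xs : List A) → len (encodeList f xs) ≡ length xs
len-encodeList f [] = refl
len-encodeList f (x ∷ xs) = cong suc (len-encodeList f xs)

len-budgetᵉ : ∀ (V κ : Fin m) γ {n k} → lookup γ V ≡ encodeList encodeFin (List.allFin n) → lookup γ κ ≡ encodeℕ k →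
 len (run (budgetᵉ V κ) γ) ≡ n ⊓ k
len-budgetᵉ {m} V κ γ {n} {k} V≡ κ≡ = by _ refl (trans (cong truth as-loop) (contains-loop (encodeℕ k) (encodeList encodeℕ (upFrom 0 n))))
 where
 codes : encodeList encodeFin (List.allFin n) ≡ encodeList encodeℕ (upFrom 0 n)
 codes = encode-upFrom {n} id 0 λ _ → refl
 V≡′ = trans V≡ codes
 as-loop : run (forᵉ (ref V) (eqᵉ (ref (later κ)) (ref v0))) γ ≡ loop k (encodeList encodeℕ (upFrom 0 n))
 as-loop = cong₂ (λ c l → flatMap (λ y _ → encodeBool (eqᵈ c y)) l) κ≡ V≡′
 entry-keep : ∀ x rest (γ′ : Vec Datum (2 + m)) → lookup γ′ (later κ) ≡ encodeℕ k →
  run (caseᵉ (forᵉ (ref v1) (eqᵉ (ref (later (later (later κ)))) (ref v0))) nilᵉ trueᵉ) (x ∷ rest ∷ γ′) ≡ keep (loop k rest)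
 entry-keep x rest γ′ e = trans (shape (flatMap (λ y _ → encodeBool (eqᵈ (lookup γ′ (later κ)) y)) rest) refl) (cong (λ c → keep (flatMap (λ y _ → encodeBool (eqᵈ c y)) rest)) e)
  where
  shape : ∀ d → flatMap (λ y _ → encodeBool (eqᵈ (lookup γ′ (later κ)) y)) rest ≡ d →
   run (caseᵉ (forᵉ (ref v1) (eqᵉ (ref (later (later (later κ)))) (ref v0))) nilᵉ trueᵉ) (x ∷ rest ∷ γ′) ≡ keep d
  shape nil eq rewrite eq = refl
  shape (cons _ _) eq rewrite eq = refl
 by : ∀ d → run (forᵉ (ref V) (eqᵉ (ref (later κ)) (ref v0))) γ ≡ d → truth d ≡ contains (encodeℕ k) (encodeList encodeℕ (upFrom 0 n)) →
  len (run (budgetᵉ V κ) γ) ≡ n ⊓ k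
 by nil eq t rewrite eq = trans (cong len V≡) (trans (len-encodeList encodeFin (List.allFin n)) (trans (length-tabulate id)
  (sym (m≤n⇒m⊓n≡m (≮⇒≥ λ k<n → subst T (sym t) (contains⁺ encodeℕ (∈-upFrom⁺ 0 n z≤n k<n)))))))
 by (cons l r) eq t rewrite eq = trans (cong len (trans (flatMap-cong (λ x rest → entry-keep x rest (l ∷ r ∷ γ) κ≡) (lookup γ V))
  (cong (flatMap (λ _ rest → keep (loop k rest))) V≡′)))
  (trans (len-keep k 0 n) (trans (cong (λ b → if b then k else 0) (T⇒≡ (<⇒<ᵇ k<n))) (sym (m≥n⇒m⊓n≡n (<⇒≤ k<n)))))
  where
  k<n : k < n
  k<n with contains⁻ encodeℕ (upFrom 0 n) (subst T t tt)
  ... | y , y∈ , e with encodeℕ-injective {k} {y} e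
  ... | refl = proj₂ (∈-upFrom⁻ 0 n y∈)

contains-flatMap-⇔ : {A : Set} (f : A → Datum) {F : Datum → Datum → Datum} {P : A → Set} → ∀ x →
 (∀ y r → T (contains x (F (f y) r)) ⇔ P y) → ∀ ys → T (contains x (flatMap F (encodeList f ys))) ⇔ (∃ λ y → y ∈ ys × P y)
contains-flatMap-⇔ f x h [] = mk⇔ (λ ()) (λ ())
contains-flatMap-⇔ f {F} {P} x h (y ∷ ys) = mk⇔
 (λ t → by (∨⁻ {contains x (F (f y) _)} (subst T (contains-append x (F (f y) _) _) t)))
 (λ found → subst T (sym (contains-append x (F (f y) _) _)) (∨⁺ {contains x (F (f y) _)} (back found)))
 where
 by : T (contains x (F (f y) (encodeList f ys))) ⊎ T (contains x (flatMap F (encodeList f ys))) → ∃ λ z → z ∈ y ∷ ys × P z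
 by (inj₁ t) = y , ∈₀ , Equivalence.to (h y _) t
 by (inj₂ t) = let (z , z∈ , p) = Equivalence.to (contains-flatMap-⇔ f x h ys) t in z , there z∈ , p
 back : (∃ λ z → z ∈ y ∷ ys × P z) → T (contains x (F (f y) (encodeList f ys))) ⊎ T (contains x (flatMap F (encodeList f ys)))
 back (z , ∈₀ , p) = inj₁ (Equivalence.from (h y _) p)
 back (z , there z∈ , p) = inj₂ (Equivalence.from (contains-flatMap-⇔ f x h ys) (z , z∈ , p))

encodePair-injective : ∀ {u v u′ v′ : Fin n} → encodePair u v ≡ encodePair u′ v′ → u ≡ u′ × v ≡ v′
encodePair-injective {u = u} {v} {u′} {v′} e = toℕ-injective (encodeℕ-injective {toℕ u} {toℕ u′} (proj₁ (parts e))) , toℕ-injective (encodeℕ-injective {toℕ v} {toℕ v′} (proj₂ (parts e)))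
 where
 parts : ∀ {a b c d} → Datum.cons a b ≡ cons c d → a ≡ c × b ≡ d
 parts refl = refl , refl

module _ (Ts : Fin m) (γ : Vec Datum m) (terminals : List (Subset n)) (Ts≡ : lookup γ Ts ≡ encodeList encodeSubset terminals) (u v : Fin n) where
 private
  pair : ∀ x r y r′ (S r″ : Datum) → T (contains (encodePair u v) (run (caseᵉ (eqᵉ (ref v2) (ref v0)) (consᵉ (consᵉ (ref v2) (ref v0)) nilᵉ) nilᵉ)
   (encodeFin y ∷ r′ ∷ encodeFin x ∷ r ∷ S ∷ r″ ∷ γ))) ⇔ (x ≢ y × u ≡ x × v ≡ y)
  pair x r y r′ S r″ = by (eqᵈ (encodeFin x) (encodeFin y)) refl (eqᵈ-encodeFin x y)
   where
   by : ∀ b → eqᵈ (encodeFin x) (encodeFin y) ≡ b → b ≡ does (x ≟ᶠ y) → T (contains (encodePair u v) (run (caseᵉ (eqᵉ (ref v2) (ref v0)) (consᵉ (consᵉ (ref v2) (ref v0)) nilᵉ) nilᵉ)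
    (encodeFin y ∷ r′ ∷ encodeFin x ∷ r ∷ S ∷ r″ ∷ γ))) ⇔ (x ≢ y × u ≡ x × v ≡ y)
   by true eq e rewrite eq with x ≟ᶠ y
   ... | yes x≡y = mk⇔ (λ ()) (λ (x≢y , _) → x≢y x≡y)
   by false eq e rewrite eq with x ≟ᶠ y
   ... | no x≢y = mk⇔ (λ t → x≢y , encodePair-injective (eqᵈ-sound _ _ (subst T (∨-identityʳ _) t)))
    λ { (_ , refl , refl) → subst T (sym (trans (∨-identityʳ _) (eqᵈ-refl (encodePair u v)))) tt }

 contains-pairsᵉ : T (contains (encodePair u v) (run (pairsᵉ Ts) γ)) ⇔ (u ≢ v × Any (λ S → u ∈ˢ S × v ∈ˢ S) terminals)
 contains-pairsᵉ = mk⇔ (to ∘ Equivalence.to found ∘ subst (λ l → T (contains (encodePair u v) (outer l))) Ts≡)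
  (subst (λ l → T (contains (encodePair u v) (outer l))) (sym Ts≡) ∘ Equivalence.from found ∘ from)
  where
  outer : Datum → Datum
  outer = flatMap (λ S r → run (forᵉ (ref v0) (forᵉ (ref v2) (caseᵉ (eqᵉ (ref v2) (ref v0)) (consᵉ (consᵉ (ref v2) (ref v0)) nilᵉ) nilᵉ))) (S ∷ r ∷ γ))
  members : Subset n → List (Fin n)
  members S = List.filter (_∈? S) (List.allFin n)
  Found : Subset n → Set
  Found S = ∃ λ x → x ∈ members S × ∃ λ y → y ∈ members S × (x ≢ y × u ≡ x × v ≡ y)
  found : T (contains (encodePair u v) (outer (encodeList encodeSubset terminals))) ⇔ (∃ λ S → S ∈ terminals × Found S)
  found = contains-flatMap-⇔ encodeSubset (encodePair u v) (λ S r →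
   contains-flatMap-⇔ encodeFin (encodePair u v) (λ x r′ →
   contains-flatMap-⇔ encodeFin (encodePair u v) (λ y r″ → pair x r′ y r″ (encodeSubset S) r) (members S)) (members S)) terminals
  to : (∃ λ S → S ∈ terminals × Found S) → u ≢ v × Any (λ S → u ∈ˢ S × v ∈ˢ S) terminals
  to (S , S∈ , x , x∈ , y , y∈ , x≢y , refl , refl) = x≢y , lose S∈ (proj₂ (∈-filter⁻ (_∈? S) {xs = List.allFin n} x∈) , proj₂ (∈-filter⁻ (_∈? S) {xs = List.allFin n} y∈))
  from : u ≢ v × Any (λ S → u ∈ˢ S × v ∈ˢ S) terminals → ∃ λ S → S ∈ terminals × Found S
  from (u≢v , some) = let (S , S∈ , u∈ , v∈) = find some in
   S , S∈ , u , ∈-filter⁺ (_∈? S) (∈-allFin u) u∈ , v , ∈-filter⁺ (_∈? S) (∈-allFin v) v∈ , u≢v , refl , refl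

-- Bounds in terms of the size of the input

L-mono-suc : ∀ k → L k ≤ L (suc k)
L-mono-suc 0 = ≤-refl
L-mono-suc 1 = ≤ᵇ⇒≤ 1 3 tt
L-mono-suc 2 = ≤ᵇ⇒≤ 3 5 tt
L-mono-suc 3 = ≤ᵇ⇒≤ 5 7 tt
L-mono-suc (suc (suc (suc (suc k)))) = +-mono-≤ (*-monoʳ-≤ 2 (L-mono-suc (suc (suc k)))) (L-mono-suc k)

L-mono : ∀ {j k} → j ≤ k → L j ≤ L k
L-mono {j} {k} j≤k = subst (λ x → L j ≤ L x) (m∸n+n≡m j≤k) (up (k ∸ j))
 where
 up : ∀ d → L j ≤ L (d + j)
 up zero = ≤-refl
 up (suc d) = ≤-trans (up d) (L-mono-suc (d + j))

len-≤-size : ∀ d → len d ≤ size d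
len-≤-size nil = z≤n
len-≤-size (cons a d) = s≤s (≤-trans (len-≤-size d) (m≤n+m (size d) (size a)))

data _PartOf_ (x : Datum) : Datum → Set where
 whole : x PartOf x
 inLeft : ∀ {a b} → x PartOf a → x PartOf cons a b
 inRight : ∀ {a b} → x PartOf b → x PartOf cons a b

part-≤ : ∀ {x d} → x PartOf d → size x ≤ size d
part-≤ whole = ≤-refl
part-≤ (inLeft {a} {b} p) = ≤-trans (part-≤ p) (≤-trans (m≤m+n (size a) (size b)) (n≤1+n _))
part-≤ (inRight {a} {b} p) = ≤-trans (part-≤ p) (≤-trans (m≤n+m (size b) (size a)) (n≤1+n _))

slot-part : ∀ D s → D s PartOf pack D
slot-part D vertsˢ = inLeft whole
slot-part D edgesˢ = inRight (inLeft whole)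
slot-part D orderˢ = inRight (inRight (inLeft whole))
slot-part D aliveˢ = inRight (inRight (inRight (inLeft whole)))
slot-part D pairsˢ = inRight (inRight (inRight (inRight (inLeft whole))))
slot-part D budgetˢ = inRight (inRight (inRight (inRight (inRight whole))))

toList-lookup : {A : Set} (xs : Vec A n) {x : A} → x ∈ Vec.toList xs → ∃ λ i → lookup xs i ≡ x
toList-lookup (y ∷ xs) ∈₀ = zero , refl
toList-lookup (y ∷ xs) (there x∈) = let (i , e) = toList-lookup xs x∈ in suc i , e

lookup-toList : {A : Set} (xs : Vec A n) (i : Fin n) → lookup xs i ∈ Vec.toList xs
lookup-toList (y ∷ xs) zero = ∈₀
lookup-toList (y ∷ xs) (suc i) = there (lookup-toList xs i)

module _ (G : Graph) {_≼_ : Graph.V G → Graph.V G → Set} {root : Graph.V G} (root-in : root ≼ root)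
 (only : ∀ u e → u ≼ e → u ≡ root × e ≡ root) where
 open Graph G
 private
  at-root : ∀ {u e} → u ≡ root → e ≡ root → u ≼ e
  at-root refl refl = root-in

 single-grown : Grown G _≼_ root
 single-grown = record
  { root-in = root-in
  ; in-left = λ t → at-root (proj₁ (only _ _ t)) (proj₁ (only _ _ t))
  ; in-right = λ t → at-root (proj₂ (only _ _ t)) (proj₂ (only _ _ t))
  ; top = λ t → at-root (proj₁ (only _ _ t)) refl
  ; trans≼ = λ t t′ → at-root (proj₁ (only _ _ t)) (proj₂ (only _ _ t′))
  ; antisym = λ t t′ → trans (proj₁ (only _ _ t)) (sym (proj₁ (only _ _ t′)))
  ; chain = λ t t′ → inj₁ (at-root (proj₂ (only _ _ t)) (proj₂ (only _ _ t′)))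
  ; parent = λ t u≢root → ⊥-elim (u≢root (proj₁ (only _ _ t)))
  }

abstract
 algorithm : Algorithm
 algorithm = Search.search next init

 startᵇ initᵇ stepᵇ : Bound
 startᵇ = outᵇ init
 initᵇ = costᵇ init
 stepᵇ = Search.nodeᵇ next

 start-size : ∀ x → size (run init [ x ]) ≤ at startᵇ (size x)
 start-size x = out-bound init [ x ] (≤-reflexive (+-identityʳ (size x)))

 algorithm-search : ∀ x {M b N} → Explores M (run init [ x ]) b N →
  ∃ λ t → (algorithm On x Outputs b InTime t) × t ≤ 2 + at initᵇ (size x) + N * at stepᵇ M
 algorithm-search x e = Search.search-runs next init x e

-- In `nodesᵇ` the first summand is for the growing of the order and the others are for the depth
-- `2 + #V + (#V ⊓ k)`; the number of vertices is at most the size of the input. The argument of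
-- `stepᵇ` is `stateBound` at `roomᵇ`.
vertᵇ pairᵇ roomᵇ nodesᵇ timeᵇ : Bound
vertᵇ = 𝕂 1 ⊕ 𝕏 ⊗ (𝕂 2 ⊕ 𝕏)
pairᵇ = 𝕂 1 ⊕ 𝕏 ⊗ (𝕂 1 ⊕ 𝕏 ⊗ (𝕂 3 ⊕ (𝕏 ⊕ 𝕏)))
roomᵇ = startᵇ ⊕ (vertᵇ ⊕ pairᵇ)
nodesᵇ = 𝕏 ⊕ (𝕂 2 ⊕ 𝕏 ⊕ 𝕏)
timeᵇ = 𝕂 2 ⊕ initᵇ ⊕ nodesᵇ ⊗ stepᵇ ⊙ (𝕂 5 ⊕ 𝕂 6 ⊗ roomᵇ)

module _ (I : GMWCT) where
 open GMWCT I
 open Correspondence I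

 private
  X B : ℕ
  X = size (encode I)
  B = at roomᵇ X

  Vs Es Ts κ : Datum
  Vs = encodeList encodeFin (List.allFin #V)
  Es = encodeList (λ e → cons (encodeFin (proj₁ e)) (encodeFin (proj₂ e))) (Vec.toList ends)
  Ts = encodeList encodeSubset terminals
  κ = encodeℕ k

  #V-≤ : #V ≤ X
  #V-≤ = begin
   #V ≡⟨ length-tabulate id ⟨
   length (List.allFin #V) ≡⟨ len-encodeList encodeFin (List.allFin #V) ⟨
   len Vs ≤⟨ len-≤-size Vs ⟩
   size Vs ≤⟨ part-≤ {Vs} {encode I} (inLeft whole) ⟩
   X ∎
   where open ≤-Reasoning

  Goal : Datum → Set
  Goal s = Explored B s (YesInstance I) (at nodesᵇ X * L k)

  empty-goal : (∀ (v : V) → ⊥) → Goal nil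
  empty-goal ¬V = record { answer = true ; nodes = 1 ; run-of = accepted
   ; correct = mk⇔ (λ _ → noEdges , ≤-trans (≤-reflexive (∣⊥∣≡0 #E)) z≤n , All.tabulate λ _ u → ⊥-elim (¬V u)) (λ _ → refl)
   ; few = *-mono-≤ {1} {at nodesᵇ X} (≤-trans (s≤s z≤n) (m≤n+m (2 + X + X) X)) (L-pos k) }

  module Start (root : V) (rs : List V) (all≡ : List.allFin #V ≡ root ∷ rs) where
   c r₁ r₂ : Datum
   c = encodeFin root
   r₁ = cons Es r₂
   r₂ = cons Ts κ
   Vs′ : Datum
   Vs′ = cons c (encodeList encodeFin rs)
   γ : Vec Datum 9
   γ = c ∷ encodeList encodeFin rs ∷ Ts ∷ κ ∷ Es ∷ r₂ ∷ Vs′ ∷ r₁ ∷ cons Vs′ r₁ ∷ []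
   Vs≡ : Vs′ ≡ Vs
   Vs≡ = cong (encodeList encodeFin) (sym all≡)

   D : Slot → Datum
   D vertsˢ = Vs′
   D edgesˢ = Es
   D orderˢ = cons (cons c c) nil
   D aliveˢ = Vs′
   D pairsˢ = run (pairsᵉ v2) γ
   D budgetˢ = run (budgetᵉ v6′ v3) γ

   M : Model #V
   M = record { ad = λ u v → contains (encodePair u v) (D edgesˢ) ; inst = record
    { le = λ u v → contains (encodePair u v) (D orderˢ)
    ; al = λ u → contains (encodeFin u) (D aliveˢ)
    ; rq = λ u v → contains (encodePair u v) (D pairsˢ) } }

   state : IsState B M (#V ⊓ k) (pack D)
   state = record { datum = D ; packed = refl
    ; encodes = record { verts = Vs≡ ; edges = λ _ _ → refl ; order = λ _ _ → refl ; alive = λ _ → refl ; pairs = λ _ _ → refl }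
    ; budget = len-budgetᵉ v6′ v3 γ Vs≡ refl
    ; room = record
    { slots = λ s → ≤-trans (part-≤ (slot-part D s)) (≤-trans
    (subst (λ V → size (pack D) ≤ at startᵇ (size (cons V r₁))) Vs≡ (start-size (cons Vs′ r₁)))
    (m≤m+n (at startᵇ X) _))
    ; vert-room = ≤-trans (at-mono vertᵇ Vs-≤) (≤-trans (m≤m+n (at vertᵇ X) _) (m≤n+m _ (at startᵇ X)))
    ; pair-room = ≤-trans (at-mono pairᵇ Vs-≤) (≤-trans (m≤n+m _ (at vertᵇ X)) (m≤n+m _ (at startᵇ X))) } }
    where
    Vs-≤ : size Vs′ ≤ X
    Vs-≤ = ≤-trans (≤-reflexive (cong size Vs≡)) (part-≤ {Vs} {cons Vs r₁} (inLeft whole))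

   grown : Grown graph (λ u e → T (Model.le M u e)) root
   grown = single-grown graph (contains⁺ {A = ⊤} (λ _ → cons c c) {tt} {[ tt ]} ∈₀)
    λ u e t → encodePair-injective {u = u} {e} {root} {root} (eqᵈ-sound (encodePair u e) (cons c c) (subst T (∨-identityʳ _) t))

   joined : ∀ u v → T (Model.ad M u v) ⇔ Joined u v
   joined u v = mk⇔ to from
    where
    code : V × V → Datum
    code e = cons (encodeFin (proj₁ e)) (encodeFin (proj₂ e))
    to : T (contains (encodePair u v) Es) → Joined u v
    to t with contains⁻ code (Vec.toList ends) t
    ... | (x , y) , e∈ , eq with encodePair-injective {u = u} {v} {x} {y} eq
    ... | refl , refl = toList-lookup ends e∈
    from : Joined u v → T (contains (encodePair u v) Es)
    from (ε , eq) = contains⁺ code (subst (_∈ Vec.toList ends) eq (lookup-toList ends ε))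

   goal : Goal (pack D)
   goal = convert (explore-growing _ ≤-refl grown joined all-alive (λ u v → contains-pairsᵉ v2 γ terminals refl u v) state)
    where
    all-alive : ∀ u → Model.Alive M u
    all-alive u = subst (λ d → T (contains (encodeFin u) d)) (sym Vs≡) (contains⁺ encodeFin (∈-allFin u))
    convert : Explored B (pack D) (YesInstance I) ((outside M + (2 + #V + (#V ⊓ k))) * L (#V ⊓ k)) → Goal (pack D)
    convert record { run-of = r ; correct = ok ; few = f } = record { run-of = r ; correct = ok ; few = ≤-trans f
     (*-mono-≤ (+-mono-≤ (≤-trans (count-≤ (λ u → not (Model.le M u u))) #V-≤)
     (+-mono-≤ (+-monoʳ-≤ 2 #V-≤) (≤-trans (m⊓n≤m #V k) #V-≤)))
     (L-mono (m⊓n≤n #V k))) }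

  from-list : ∀ vs → List.allFin #V ≡ vs → ∀ Vd → Vd ≡ encodeList encodeFin vs → Goal (run init (cons Vd (cons Es (cons Ts κ)) ∷ []))
  from-list [] eq _ refl = empty-goal λ v → absurd (subst (v ∈_) eq (∈-allFin v))
   where
   absurd : ∀ {v : V} → v ∈ [] → ⊥
   absurd ()
  from-list (r ∷ rs) eq _ refl = Start.goal r rs eq

 explore-input : Explored B (run init (encode I ∷ [])) (YesInstance I) (at nodesᵇ X * L k)
 explore-input = from-list (List.allFin #V) refl Vs refl

search-total : ∀ C K n l {N t} → 1 ≤ l → N ≤ n * l → t ≤ 2 + C + N * K → t ≤ l * (2 + C + n * K)
search-total C K n l {N} {t} pos few t≤ = begin
 t ≤⟨ t≤ ⟩
 2 + C + N * K ≤⟨ +-monoʳ-≤ (2 + C) (*-monoˡ-≤ K few) ⟩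
 2 + C + n * l * K ≤⟨ +-monoˡ-≤ (n * l * K) (≤-trans (≤-reflexive (sym (*-identityˡ (2 + C)))) (*-monoˡ-≤ (2 + C) pos)) ⟩
 l * (2 + C) + n * l * K ≡⟨ solve 4 (λ l c n k → l :* c :+ n :* l :* k := l :* (c :+ n :* k)) refl l (2 + C) n K ⟩
 l * (2 + C + n * K) ∎
 where open ≤-Reasoning

module _ (I : GMWCT) where
 open GMWCT I
 record Run : Set where
  field
   answer : Bool
   time : ℕ
   run-of : algorithm On encode I Outputs answer InTime time
   correct : answer ≡ true ⇔ YesInstance I
   fast : time ≤ L k * at timeᵇ (size (encode I))

 algorithm-runs : Run
 algorithm-runs = convert (explore-input I)
  where
  X = size (encode I)
  convert : Explored (at roomᵇ X) (run init (encode I ∷ [])) (YesInstance I) (at nodesᵇ X * L k) → Run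
  convert record { answer = b ; nodes = N ; run-of = r ; correct = ok ; few = f } =
   let (t , p , t≤) = algorithm-search (encode I) r in record
   { answer = b ; time = t ; run-of = p ; correct = ok
   ; fast = search-total (at initᵇ X) (at stepᵇ (stateBound (at roomᵇ X))) (at nodesᵇ X) (L k) (L-pos k) f t≤ }

-- Comparison with the real number ρ

module Reals where
 import Data.Integer.Base as ℤ
 import Data.Integer.Properties as ℤₚ
 open import Data.Rational.Base as ℚ using (ℚ; 0ℚ; 1ℚ) renaming (_+_ to _+q_; _*_ to _*q_; _≤_ to _≤q_; _<_ to _<q_)
 import Data.Rational.Properties as ℚₚ
 open import Data.Rational.Unnormalised.Base as ℚᵘ using (mkℚᵘ; *≡*; *≤*)
 import Data.Rational.Unnormalised.Properties as ℚᵘₚ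
 import Data.Rational.Solver as QSolver
 open QSolver.+-*-Solver using () renaming (solve to solveq; _:+_ to _:+q_; _:*_ to _:*q_; _:=_ to _:=q_; con to conq)

 ι : ℕ → ℚ
 ι n = ℤ.+ n ℚ./ 1

 private
  ιᵘ : ℕ → ℚᵘ.ℚᵘ
  ιᵘ n = mkℚᵘ (ℤ.+ n) 0

  ι-ιᵘ : ∀ n → ℚ.toℚᵘ (ι n) ℚᵘ.≃ ιᵘ n
  ι-ιᵘ n = ℚₚ.toℚᵘ-fromℚᵘ (ιᵘ n)

 ι-+ : ∀ a b → ι (a + b) ≡ ι a +q ι b
 ι-+ a b = ℚₚ.toℚᵘ-injective (begin
  ℚ.toℚᵘ (ι (a + b)) ≈⟨ ι-ιᵘ (a + b) ⟩
  ιᵘ (a + b) ≈⟨ *≡* (cong (λ x → x ℤ.* ℤ.+ 1) (sym (cong₂ ℤ._+_ (ℤₚ.*-identityʳ (ℤ.+ a)) (ℤₚ.*-identityʳ (ℤ.+ b))))) ⟩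
  ιᵘ a ℚᵘ.+ ιᵘ b ≈⟨ ℚᵘₚ.+-cong (ι-ιᵘ a) (ι-ιᵘ b) ⟨
  ℚ.toℚᵘ (ι a) ℚᵘ.+ ℚ.toℚᵘ (ι b) ≈⟨ ℚₚ.toℚᵘ-homo-+ (ι a) (ι b) ⟨
  ℚ.toℚᵘ (ι a +q ι b) ∎)
  where open ℚᵘₚ.≃-Reasoning

 ι-* : ∀ a b → ι (a * b) ≡ ι a *q ι b
 ι-* a b = ℚₚ.toℚᵘ-injective (begin
  ℚ.toℚᵘ (ι (a * b)) ≈⟨ ι-ιᵘ (a * b) ⟩
  ιᵘ (a * b) ≈⟨ *≡* (cong (λ x → x ℤ.* ℤ.+ 1) (ℤₚ.pos-* a b)) ⟩
  ιᵘ a ℚᵘ.* ιᵘ b ≈⟨ ℚᵘₚ.*-cong (ι-ιᵘ a) (ι-ιᵘ b) ⟨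
  ℚ.toℚᵘ (ι a) ℚᵘ.* ℚ.toℚᵘ (ι b) ≈⟨ ℚₚ.toℚᵘ-homo-* (ι a) (ι b) ⟨
  ℚ.toℚᵘ (ι a *q ι b) ∎)
  where open ℚᵘₚ.≃-Reasoning

 ι-mono : ∀ {a b} → a ≤ b → ι a ≤q ι b
 ι-mono {a} {b} a≤b = ℚₚ.toℚᵘ-cancel-≤ (begin
  ℚ.toℚᵘ (ι a) ≃⟨ ι-ιᵘ a ⟩
  ιᵘ a ≤⟨ *≤* (ℤₚ.*-monoʳ-≤-nonNeg (ℤ.+ 1) (ℤ.+≤+ a≤b)) ⟩
  ιᵘ b ≃⟨ ι-ιᵘ b ⟨
  ℚ.toℚᵘ (ι b) ∎)
  where open ℚᵘₚ.≤-Reasoning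

 private
  mulˡ : ∀ r {p q} → 0ℚ ≤q r → p ≤q q → r *q p ≤q r *q q
  mulˡ r 0≤r = ℚₚ.*-monoˡ-≤-nonNeg r {{ℚ.nonNegative 0≤r}}

  mulʳ : ∀ r {p q} → 0ℚ ≤q r → p ≤q q → p *q r ≤q q *q r
  mulʳ r 0≤r = ℚₚ.*-monoʳ-≤-nonNeg r {{ℚ.nonNegative 0≤r}}

  mul-mono : ∀ {p q r s} → 0ℚ ≤q p → 0ℚ ≤q s → p ≤q q → r ≤q s → p *q r ≤q q *q s
  mul-mono {p} {q} {r} {s} 0≤p 0≤s p≤q r≤s = ℚₚ.≤-trans (mulˡ p 0≤p r≤s) (mulʳ s 0≤s p≤q)

  mul-pos : ∀ {p q} → 0ℚ <q p → 0ℚ <q q → 0ℚ <q p *q q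
  mul-pos {p} {q} 0<p 0<q = ℚₚ.positive⁻¹ (p *q q) {{ℚₚ.pos*pos⇒pos p {{ℚ.positive 0<p}} q {{ℚ.positive 0<q}}}}

  0≤ι : ∀ n → 0ℚ ≤q ι n
  0≤ι n = ι-mono {0} {n} z≤n

  0<1 : 0ℚ <q 1ℚ
  0<1 = ℚₚ.positive⁻¹ 1ℚ

 pow : ℚ → ℕ → ℚ
 pow r zero = 1ℚ
 pow r (suc k) = r *q pow r k

 -- The form in which the lower bound ρ for `r` is used: the quartic inequality is the one that
 -- carries powers of `r` through the recurrence of `L`.
 record AtLeastρ (r : ℚ) : Set where
  field
   1≤ : 1ℚ ≤q r
   quartic : ι 2 *q (r *q r) +q 1ℚ ≤q (r *q r) *q (r *q r)

 open AtLeastρ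

 private
  0≤r : ∀ {r} → AtLeastρ r → 0ℚ ≤q r
  0≤r a = ℚₚ.≤-trans (ℚₚ.<⇒≤ 0<1) (1≤ a)

  1≤pow : ∀ {r} → 1ℚ ≤q r → ∀ k → 1ℚ ≤q pow r k
  1≤pow {r} 1≤r zero = ℚₚ.≤-refl
  1≤pow {r} 1≤r (suc k) = ℚₚ.≤-trans (ℚₚ.≤-reflexive (sym (ℚₚ.*-identityˡ 1ℚ)))
   (mul-mono (ℚₚ.<⇒≤ 0<1) (ℚₚ.≤-trans (ℚₚ.<⇒≤ 0<1) (1≤pow 1≤r k)) 1≤r (1≤pow 1≤r k))

  0≤pow : ∀ {r} → AtLeastρ r → ∀ k → 0ℚ ≤q pow r k
  0≤pow a k = ℚₚ.≤-trans (ℚₚ.<⇒≤ 0<1) (1≤pow (1≤ a) k)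

  pow-mono : ∀ {r s} → AtLeastρ r → r ≤q s → AtLeastρ s → ∀ k → pow r k ≤q pow s k
  pow-mono a r≤s b zero = ℚₚ.≤-refl
  pow-mono a r≤s b (suc k) = mul-mono (0≤r a) (0≤pow b k) r≤s (pow-mono a r≤s b k)

 -- From s = r² = x + y with x² > 2 and y > 1 follows (s − 1)² ≥ x² ≥ 2.
 ρ-at-least : ∀ {r} → ρ r → AtLeastρ r
 ρ-at-least {r} (0<r , x , y , (0<x , 2<xx) , 1<y , rr≡) = record { 1≤ = 1≤r ; quartic = quartic′ }
  where
  open ℚₚ.≤-Reasoning
  w = r *q r ℚ.- 1ℚ
  s≡ : r *q r ≡ w +q 1ℚ
  s≡ = solveq 1 (λ s → s :=q (s :+q conq (ℚ.- 1ℚ)) :+q conq 1ℚ) refl (r *q r)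
  x≤w : x ≤q w
  x≤w = begin
   x ≡⟨ solveq 1 (λ x → x :=q (x :+q conq 1ℚ) :+q conq (ℚ.- 1ℚ)) refl x ⟩
   (x +q 1ℚ) ℚ.- 1ℚ ≤⟨ ℚₚ.+-monoˡ-≤ (ℚ.- 1ℚ) (ℚₚ.+-monoʳ-≤ x (ℚₚ.<⇒≤ 1<y)) ⟩
   (x +q y) ℚ.- 1ℚ ≡⟨ cong (ℚ._- 1ℚ) rr≡ ⟨
   w ∎
  0≤x = ℚₚ.<⇒≤ 0<x
  0≤w = ℚₚ.≤-trans 0≤x x≤w
  quartic′ : ι 2 *q (r *q r) +q 1ℚ ≤q (r *q r) *q (r *q r)
  quartic′ = begin
   ι 2 *q (r *q r) +q 1ℚ ≡⟨ cong (λ s → ι 2 *q s +q 1ℚ) s≡ ⟩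
   ι 2 *q (w +q 1ℚ) +q 1ℚ ≡⟨ solveq 1 (λ w → conq (ι 2) :*q (w :+q conq 1ℚ) :+q conq 1ℚ :=q conq (ι 2) :+q (conq (ι 2) :*q w :+q conq 1ℚ)) refl w ⟩
   ι 2 +q (ι 2 *q w +q 1ℚ) ≤⟨ ℚₚ.+-monoˡ-≤ _ (ℚₚ.≤-trans (ℚₚ.<⇒≤ 2<xx) (mul-mono 0≤x 0≤w x≤w x≤w)) ⟩
   w *q w +q (ι 2 *q w +q 1ℚ) ≡⟨ solveq 1 (λ w → w :*q w :+q (conq (ι 2) :*q w :+q conq 1ℚ) :=q (w :+q conq 1ℚ) :*q (w :+q conq 1ℚ)) refl w ⟩
   (w +q 1ℚ) *q (w +q 1ℚ) ≡⟨ cong₂ _*q_ s≡ s≡ ⟨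
   (r *q r) *q (r *q r) ∎
  1≤rr : 1ℚ ≤q r *q r
  1≤rr = begin
   1ℚ ≡⟨ ℚₚ.+-identityˡ 1ℚ ⟨
   0ℚ +q 1ℚ ≤⟨ ℚₚ.+-monoˡ-≤ 1ℚ 0≤w ⟩
   w +q 1ℚ ≡⟨ s≡ ⟨
   r *q r ∎
  1≤r : 1ℚ ≤q r
  1≤r with ℚₚ.≤-total 1ℚ r
  ... | inj₁ p = p
  ... | inj₂ r≤1 = begin
   1ℚ ≤⟨ 1≤rr ⟩
   r *q r ≤⟨ mulˡ r (ℚₚ.<⇒≤ 0<r) r≤1 ⟩
   r *q 1ℚ ≡⟨ ℚₚ.*-identityʳ r ⟩
   r ∎

 -- The least of the k factors of a member of the cut ρ^k.
 ρ^-at-least : ∀ k {a} → (ρ ^ʳ k) a → ∃ λ r → AtLeastρ r × pow r k ≤q a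
 -- There are no factors to choose from, and 2 will do: 2 · 4 + 1 = 9 is at most 16.
 ρ^-at-least zero 1<a = ι 2 , record
  { 1≤ = ι-mono {1} {2} (s≤s z≤n) ; quartic = ι-mono {9} {16} (≤ᵇ⇒≤ 9 16 tt) } , ℚₚ.<⇒≤ 1<a
 ρ^-at-least (suc k) (p , q , ρp , ρq , refl) with ρ^-at-least k ρq
 ... | r , ar , rk≤q with ℚₚ.≤-total p r
 ... | inj₁ p≤r = p , ap , mulˡ p (0≤r ap) (ℚₚ.≤-trans (pow-mono ap p≤r ar k) rk≤q)
  where ap = ρ-at-least ρp
 ... | inj₂ r≤p = r , ar , mul-mono (0≤r ar) (ℚₚ.≤-trans (0≤pow ar k) rk≤q) r≤p rk≤q

 -- Induction along the recurrence of `L`. The factor 5 is `L 3`, the largest of the four initial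
 -- values.
 L-≤-pow : ∀ {r} → AtLeastρ r → ∀ k → ι (L k) ≤q ι 5 *q pow r k
 L-≤-pow {r} a = go
  where
  open ℚₚ.≤-Reasoning
  base : ∀ k → L k ≤ 5 → ι (L k) ≤q ι 5 *q pow r k
  base k le = begin
   ι (L k) ≤⟨ ι-mono le ⟩
   ι 5 ≡⟨ ℚₚ.*-identityʳ (ι 5) ⟨
   ι 5 *q 1ℚ ≤⟨ mulˡ (ι 5) (0≤ι 5) (1≤pow (1≤ a) k) ⟩
   ι 5 *q pow r k ∎
  go : ∀ k → ι (L k) ≤q ι 5 *q pow r k
  go 0 = base 0 (s≤s z≤n)
  go 1 = base 1 (s≤s z≤n)
  go 2 = base 2 (s≤s (s≤s (s≤s z≤n)))
  go 3 = base 3 ≤-refl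
  go (suc (suc (suc (suc k)))) = begin
   ι (2 * L (2 + k) + L k) ≡⟨ trans (ι-+ (2 * L (2 + k)) (L k)) (cong (_+q ι (L k)) (ι-* 2 (L (2 + k)))) ⟩
   ι 2 *q ι (L (2 + k)) +q ι (L k) ≤⟨ ℚₚ.+-mono-≤ (mulˡ (ι 2) (0≤ι 2) (go (suc (suc k)))) (go k) ⟩
   ι 2 *q (ι 5 *q (r *q (r *q P))) +q ι 5 *q P
   ≡⟨ solveq 2 (λ r p → conq (ι 2) :*q (conq (ι 5) :*q (r :*q (r :*q p))) :+q conq (ι 5) :*q p
   :=q (conq (ι 5) :*q p) :*q (conq (ι 2) :*q (r :*q r) :+q conq 1ℚ)) refl r P ⟩
   (ι 5 *q P) *q (ι 2 *q (r *q r) +q 1ℚ)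
   ≤⟨ mulˡ (ι 5 *q P) (ℚₚ.≤-trans (ℚₚ.≤-reflexive (sym (ℚₚ.*-zeroʳ (ι 5)))) (mulˡ (ι 5) (0≤ι 5) (0≤pow a k))) (quartic a) ⟩
   (ι 5 *q P) *q ((r *q r) *q (r *q r))
   ≡⟨ solveq 2 (λ r p → (conq (ι 5) :*q p) :*q ((r :*q r) :*q (r :*q r)) :=q conq (ι 5) :*q (r :*q (r :*q (r :*q (r :*q p))))) refl r P ⟩
   ι 5 *q (r *q (r *q (r *q (r *q P)))) ∎
   where P = pow r k

 time-≤ʳ : ∀ k p {t} → t ≤ L k * p → ℕ→ℝ⁺ t ≤ʳ ℕ→ℝ⁺ 5 *ʳ ρ ^ʳ k *ʳ ℕ→ℝ⁺ p
 -- As cuts consist of upper bounds, the claim is that `t` lies below each product of rationals from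
 -- the three cuts; the one from the power of ρ is at least `pow r k` for some `r` above ρ.
 time-≤ʳ k p {t} t≤ (_ , b , (a , a′ , 5<a , ρa′ , refl) , p<b , refl) with ρ^-at-least k ρa′
 ... | r , ar , pow≤a′ = begin-strict
  ι t ≤⟨ ι-mono t≤ ⟩
  ι (L k * p) ≡⟨ ι-* (L k) p ⟩
  ι (L k) *q ι p ≤⟨ mulʳ (ι p) (0≤ι p) (L-≤-pow ar k) ⟩
  (ι 5 *q pow r k) *q ι p ≤⟨ mulʳ (ι p) (0≤ι p) (mul-mono (0≤ι 5) (ℚₚ.<⇒≤ 0<a′) (ℚₚ.<⇒≤ 5<a) pow≤a′) ⟩
  (a *q a′) *q ι p <⟨ ℚₚ.*-monoʳ-<-pos (a *q a′) {{ℚ.positive (mul-pos (ℚₚ.≤-<-trans (0≤ι 5) 5<a) 0<a′)}} p<b ⟩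
  (a *q a′) *q b ∎
  where
  open ℚₚ.≤-Reasoning
  0<a′ : 0ℚ <q a′
  0<a′ = ℚₚ.<-≤-trans 0<1 (ℚₚ.≤-trans (1≤pow (1≤ ar) k) pow≤a′)

theorem5p1 : Σ Algorithm λ A → Σ ℕ λ c → Σ Polynomial λ p →
  (I : GMWCT) → Σ Bool λ b → Σ ℕ λ t →
   (A On encode I Outputs b InTime t)
   × (b ≡ true ⇔ YesInstance I)
   × (ℕ→ℝ⁺ t ≤ʳ ℕ→ℝ⁺ c *ʳ ρ ^ʳ GMWCT.k I *ʳ ℕ→ℝ⁺ (⟦ p ⟧ (size (encode I))))
theorem5p1 = algorithm , 5 , polynomial timeᵇ , λ I →
 let open Run (algorithm-runs I) in
 answer , time , run-of , correct ,
 subst (λ p → ℕ→ℝ⁺ time ≤ʳ ℕ→ℝ⁺ 5 *ʳ ρ ^ʳ GMWCT.k I *ʳ ℕ→ℝ⁺ p) (sym (⟦polynomial⟧ timeᵇ (size (encode I))))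
  (Reals.time-≤ʳ (GMWCT.k I) (at timeᵇ (size (encode I))) fast)
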